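{- There is an algorithm which, given a tournament with vertex set $X$, computes its umodular (bijoin) decomposition tree in $O(|X|^2)$ time.
   Context: For a tournament with finite vertex set $X$, let $N^+(x)$, $N^-(x)$ be the out- and in-neighbourhoods. Its standard homogeneous relation is: for $x\in X$, $u,v\in X\setminus\{x\}$, $H(x|uv)$ holds iff $u,v$ both lie in $N^+(x)$ or both lie in $N^-(x)$. A umodule (bijoin) of the tournament is a subset $U\subseteq X$ such that for all $u,u'\in U$ and $x,x'\in X\setminus U$: $H(u|xx')\Leftrightarrow H(u'|xx')$. The complement of a umodule of a tournament is again a umodule. Umodular decomposition tree. Let $\mathcal{B}=\{\{U,X\setminus U\}: U \text{ a umodule},\ \emptyset\neq U\neq X\}$. Two bipartitions $\{A^1,A^2\}$, $\{B^1,B^2\}$ of $X$ overlap if all four intersections $A^i\cap B^j$ are nonempty; a bipartition in $\mathcal{B}$ is strong if it overlaps no other member of $\mathcal{B}$. The umodular decomposition tree is the unique unrooted tree $T$ whose leaves are labelled bijectively by $X$ and whose edges $e$ correspond bijectively to the strong bipartitions of $\mathcal{B}$ (the leaf labels of the two components of $T-e$ being the two parts). For an internal node $N$ of degree $k$, the leaf labels of the components of $T-N$ form a partition $X_1,\dots,X_k$ of $X$; for $I\subseteq\{1,\dots,k\}$, $1\le|I|<k$, let $B_N(I)=\{\bigcup_{i\in I}X_i, X\setminus\bigcup_{i\in I}X_i\}$. Internal nodes are labelled complete, circular or prime, and the neighbouring subtrees of circular nodes are ordered, so that $\mathcal{B}$ consists exactly of: all $B_N(I)$ for $N$ complete; all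 $B_N(I)$ with $I$ an interval of $\{1,\dots,k\}$ for $N$ circular; all $B_N(\{a\})$ for $N$ prime. -}

module Defs where

open import Data.Bool.Base using (Bool; true; false; not; if_then_else_)
open import Data.Nat.Base using (ℕ; suc; _+_; _*_; _∸_; _≤_; _<_; _≡ᵇ_; _<ᵇ_)
import Data.Nat.Properties as ℕ
open import Data.Fin.Base as Fin using (Fin; toℕ; fromℕ<; remQuot)
open import Data.Fin.Subset using (Subset; _∈_; _∉_; _∩_; ∁; ⁅_⁆; ∣_∣; Nonempty)
open import Data.List.Base using (List; []; _∷_; _∷ʳ_; length; lookup)
import Data.List.Membership.Propositional as List
open import Data.List.Relation.Unary.Linked using (Linked)
open import Data.List.Relation.Unary.Unique.Propositional using (Unique)
open import Data.Product.Base using (Σ-syntax; ∃-syntax; _×_; _,_)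
open import Data.Sum.Base using (_⊎_)
open import Data.Empty using (⊥)
open import Data.Unit.Base using (⊤)
import Data.Vec.Base as Vec
open import Function.Bundles using (_⇔_)
open import Relation.Binary.Construct.Closure.ReflexiveTransitive using (Star)
open import Relation.Binary.PropositionalEquality.Core using (_≡_; _≢_)
open import Relation.Nullary using (¬_; yes; no)

------------------------------------------------------------------------
-- Tournaments and umodules

record Tournament (n : ℕ) : Set where
  field
    arc    : Fin n → Fin n → Bool
    irrefl : ∀ x → arc x x ≡ false
    orient : ∀ x y → x ≢ y → arc y x ≡ not (arc x y)

module _ {n : ℕ} (T : Tournament n) where
  open Tournament T

  N⁺ N⁻ : Fin n → Subset n
  N⁺ x = Vec.tabulate (λ y → arc x y)
  N⁻ x = Vec.tabulate (λ y → arc y x)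

  -- H x u v is H(x|uv); it is only meaningful for u and v distinct from x,
  -- which always holds where it is used in Umodule.
  H : Fin n → Fin n → Fin n → Set
  H x u v = (u ∈ N⁺ x × v ∈ N⁺ x) ⊎ (u ∈ N⁻ x × v ∈ N⁻ x)

  Umodule : Subset n → Set
  Umodule U = ∀ {u u′ x x′} → u ∈ U → u′ ∈ U → x ∉ U → x′ ∉ U →
              H u x x′ ⇔ H u′ x x′

  -- A bipartition {A , ∁ A} is given by either one of its parts.
  InB : Subset n → Set
  InB A = Nonempty A × Nonempty (∁ A) × (Umodule A ⊎ Umodule (∁ A))

Overlap : ∀ {n} → Subset n → Subset n → Set
Overlap A B = Nonempty (A ∩ B) × Nonempty (A ∩ ∁ B) ×
              Nonempty (∁ A ∩ B) × Nonempty (∁ A ∩ ∁ B)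

Strong : ∀ {n} → Tournament n → Subset n → Set
Strong T A = InB T A × (∀ B → InB T B → ¬ Overlap A B)

------------------------------------------------------------------------
-- Leaf-labelled trees

data Label : Set where
  complete circular prime : Label

data Kind (n : ℕ) : Set where
  leaf     : Fin n → Kind n
  internal : Label → Kind n

-- A finite graph with ordered adjacency lists; the order of the list at a
-- circular node is the order of its neighbouring subtrees.
record LabelledGraph (n : ℕ) : Set where
  field
    size : ℕ
    kind : Fin size → Kind n
    nbrs : Fin size → List (Fin size)

  Node : Set
  Node = Fin size

  degree : Node → ℕ
  degree v = length (nbrs v)

  Adj : Node → Node → Set
  Adj u v = v List.∈ nbrs u

  SameEdge : Node → Node → Node → Node → Set
  SameEdge u v a b = (a ≡ u × b ≡ v) ⊎ (a ≡ v × b ≡ u)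

  -- Adjacency after deleting the edge uv, respectively the node N.
  AdjWithoutEdge : Node → Node → Node → Node → Set
  AdjWithoutEdge u v a b = Adj a b × ¬ SameEdge u v a b

  AdjWithoutNode : Node → Node → Node → Set
  AdjWithoutNode N a b = Adj a b × a ≢ N × b ≢ N

  Cycle : List Node → Set
  Cycle []       = ⊥
  Cycle (v ∷ vs) = 2 ≤ length vs × Unique (v ∷ vs) × Linked Adj (v ∷ vs ∷ʳ v)

  record IsSimple : Set where
    field
      unique    : ∀ v → Unique (nbrs v)
      loopless  : ∀ v → ¬ Adj v v
      symmetric : ∀ {u v} → Adj u v → Adj v u

  record IsTree : Set where
    field
      nonempty  : 0 < size
      isSimple  : IsSimple
      connected : ∀ u v → Star Adj u v
      acyclic   : ∀ vs → ¬ Cycle vs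

  IsLeaf : Node → Set
  IsLeaf v = ∃[ x ] kind v ≡ leaf x

  -- The bound degree ≤ 1, rather than degree ≡ 1, accounts for the tree with
  -- a single node.
  record LeavesLabelledBijectively : Set where
    field
      leaves     : ∀ v → IsLeaf v ⇔ degree v ≤ 1
      injective  : ∀ {v w x} → kind v ≡ leaf x → kind w ≡ leaf x → v ≡ w
      surjective : ∀ x → ∃[ v ] kind v ≡ leaf x

  -- x labels a leaf of the component of T - uv that contains u.
  Side : Node → Node → Fin n → Set
  Side u v x = ∃[ w ] kind w ≡ leaf x × Star (AdjWithoutEdge u v) u w

  -- x labels a leaf of the component of T - N that contains the i-th
  -- neighbour of N.
  Part : (N : Node) → Fin (degree N) → Fin n → Set
  Part N i x = ∃[ w ] kind w ≡ leaf x ×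
                      Star (AdjWithoutNode N) (lookup (nbrs N) i) w

  Parts : (N : Node) → Subset (degree N) → Fin n → Set
  Parts N I x = ∃[ i ] i ∈ I × Part N i x

infix 4 _≐_

_≐_ : ∀ {n} → Subset n → (Fin n → Set) → Set
A ≐ P = ∀ x → x ∈ A ⇔ P x

Interval : ∀ {k} → Subset k → Set
Interval I = ∀ {i j l} → i ∈ I → l ∈ I → i Fin.≤ j → j Fin.≤ l → j ∈ I

Allowed : ∀ {k} → Label → Subset k → Set
Allowed complete I = ⊤
Allowed circular I = Interval I
Allowed prime    I = ∃[ a ] I ≡ ⁅ a ⁆

module _ {n : ℕ} (D : LabelledGraph n) where
  open LabelledGraph D

  -- {A , ∁ A} is the bipartition of the labels induced by the edge uv.
  EdgeBipartition : Node → Node → Subset n → Set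
  EdgeBipartition u v A = (A ≐ Side u v × ∁ A ≐ Side v u) ⊎
                          (A ≐ Side v u × ∁ A ≐ Side u v)

  -- {A , ∁ A} is B_N(I).
  NodeBipartition : (N : Node) → Subset (degree N) → Subset n → Set
  NodeBipartition N I A = A ≐ Parts N I ⊎ ∁ A ≐ Parts N I

  Represented : Subset n → Set
  Represented A =
    ∃[ N ] Σ[ l ∈ Label ] kind N ≡ internal l ×
    Σ[ I ∈ Subset (degree N) ]
      1 ≤ ∣ I ∣ × ∣ I ∣ < degree N × Allowed l I × NodeBipartition N I A

record IsDecompositionTree {n : ℕ} (T : Tournament n) (D : LabelledGraph n) : Set where
  open LabelledGraph D
  field
    isTree      : IsTree
    leafLabels  : LeavesLabelledBijectively
    edge⇒strong : ∀ {u v} → Adj u v → ∃[ A ] Strong T A × EdgeBipartition D u v A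
    strong⇒edge : ∀ A → Strong T A →
                  ∃[ u ] ∃[ v ] Adj u v × EdgeBipartition D u v A
    edge-unique : ∀ {u v a b} A → Adj u v → Adj a b →
                  EdgeBipartition D u v A → EdgeBipartition D a b A →
                  SameEdge u v a b
    -- For n ≤ 2 the tree has no internal node, and for n ≡ 2 its only edge
    -- carries the only member of the family.
    represents  : 3 ≤ n → ∀ A → InB T A ⇔ Represented D A

------------------------------------------------------------------------
-- A unit-cost word RAM, programmed by structured commands

data Op : Set where
  add sub mul eq lt : Op

-- reg x is the register named x; load e is the memory cell with address e.
data Expr : Set where
  lit  : ℕ → Expr
  reg  : ℕ → Expr
  load : Expr → Expr
  bin  : Op → Expr → Expr → Expr

infixr 4 _︔_

data Cmd : Set where
  skip  : Cmd
  _︔_  : Cmd → Cmd → Cmd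
  set   : ℕ → Expr → Cmd
  store : Expr → Expr → Cmd
  cond  : Expr → Cmd → Cmd → Cmd
  while : Expr → Cmd → Cmd

record State : Set where
  constructor state
  field
    regs : ℕ → ℕ
    mem  : ℕ → ℕ

open State public

_[_≔_] : (ℕ → ℕ) → ℕ → ℕ → (ℕ → ℕ)
(f [ a ≔ v ]) b with a ℕ.≟ b
... | yes _ = v
... | no  _ = f b

bit : Bool → ℕ
bit b = if b then 1 else 0

⟦_⟧ₒ : Op → ℕ → ℕ → ℕ
⟦ add ⟧ₒ a b = a + b
⟦ sub ⟧ₒ a b = a ∸ b
⟦ mul ⟧ₒ a b = a * b
⟦ eq  ⟧ₒ a b = bit (a ≡ᵇ b)
⟦ lt  ⟧ₒ a b = bit (a <ᵇ b)

⟦_⟧ : Expr → State → ℕ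
⟦ lit k ⟧     σ = k
⟦ reg x ⟧     σ = regs σ x
⟦ load e ⟧    σ = mem σ (⟦ e ⟧ σ)
⟦ bin o e f ⟧ σ = ⟦ o ⟧ₒ (⟦ e ⟧ σ) (⟦ f ⟧ σ)

cost : Expr → ℕ
cost (lit k)     = 1
cost (reg x)     = 1
cost (load e)    = 1 + cost e
cost (bin o e f) = 1 + cost e + cost f

-- Every value arising in the evaluation of the expression, addresses
-- included, is at most W.
Fits : ℕ → State → Expr → Set
Fits W σ e@(lit _)     = ⟦ e ⟧ σ ≤ W
Fits W σ e@(reg _)     = ⟦ e ⟧ σ ≤ W
Fits W σ e@(load f)    = Fits W σ f × ⟦ e ⟧ σ ≤ W
Fits W σ e@(bin _ f g) = Fits W σ f × Fits W σ g × ⟦ e ⟧ σ ≤ W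

-- Run W c σ t σ′: started in σ, the command c halts in σ′ after t units of
-- time.  There is no rule for an expression with a value above W, so a run
-- that exceeds the word size never halts.
data Run (W : ℕ) : Cmd → State → ℕ → State → Set where
  run-skip  : ∀ {σ} → Run W skip σ 1 σ
  run-seq   : ∀ {c d σ σ′ σ″ s t} →
              Run W c σ s σ′ → Run W d σ′ t σ″ → Run W (c ︔ d) σ (s + t) σ″
  run-set   : ∀ {x e σ} → Fits W σ e →
              Run W (set x e) σ (1 + cost e)
                  (state (regs σ [ x ≔ ⟦ e ⟧ σ ]) (mem σ))
  run-store : ∀ {e f σ} → Fits W σ e → Fits W σ f →
              Run W (store e f) σ (1 + cost e + cost f)
                  (state (regs σ) (mem σ [ ⟦ e ⟧ σ ≔ ⟦ f ⟧ σ ]))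
  run-then  : ∀ {e c d σ σ′ t} → Fits W σ e → ⟦ e ⟧ σ ≢ 0 →
              Run W c σ t σ′ → Run W (cond e c d) σ (1 + cost e + t) σ′
  run-else  : ∀ {e c d σ σ′ t} → Fits W σ e → ⟦ e ⟧ σ ≡ 0 →
              Run W d σ t σ′ → Run W (cond e c d) σ (1 + cost e + t) σ′
  run-exit  : ∀ {e c σ} → Fits W σ e → ⟦ e ⟧ σ ≡ 0 →
              Run W (while e c) σ (1 + cost e) σ
  run-loop  : ∀ {e c σ σ′ σ″ s t} → Fits W σ e → ⟦ e ⟧ σ ≢ 0 →
              Run W c σ s σ′ → Run W (while e c) σ′ t σ″ →
              Run W (while e c) σ (1 + cost e + s + t) σ″

------------------------------------------------------------------------
-- Input and output conventions

-- Register 0 holds n and cell n * i + j holds the adjacency bit of (i , j);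
-- every other register and cell holds 0.
input : ∀ {n} → Tournament n → State
input {n} T = state regs₀ mem₀
  where
  regs₀ : ℕ → ℕ
  regs₀ 0       = n
  regs₀ (suc _) = 0

  mem₀ : ℕ → ℕ
  mem₀ a with a ℕ.<? n * n
  ... | no  _    = 0
  ... | yes a<n² = let (i , j) = remQuot n (fromℕ< a<n²)
                   in bit (Tournament.arc T i j)

encodeKind : ∀ {n} → Kind n → ℕ
encodeKind (internal complete) = 0
encodeKind (internal circular) = 1
encodeKind (internal prime)    = 2
encodeKind (leaf x)            = 3 + toℕ x

-- Register 0 holds the number of nodes, and register 1 the address of a table
-- of pointers, one for each node, to records (kind, degree, neighbours...).
record Outputs {n : ℕ} (σ : State) (D : LabelledGraph n) : Set where
  open LabelledGraph D

  record-at : Node → ℕ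
  record-at v = mem σ (regs σ 1 + toℕ v)

  field
    size-ok   : regs σ 0 ≡ size
    kind-ok   : ∀ v → mem σ (record-at v) ≡ encodeKind (kind v)
    degree-ok : ∀ v → mem σ (record-at v + 1) ≡ degree v
    nbrs-ok   : ∀ v i → mem σ (record-at v + 2 + toℕ i) ≡ toℕ (lookup (nbrs v) i)

{-# OPTIONS --safe #-}
module Submission where

-- Switching the tournament at the vertex 0 turns the bipartitions of the family into
-- the modules, not containing 0, of the tournament G u v = arc u v xor arc u 0 xor arc v 0
-- on the other m vertices.  Its modular decomposition tree, with the leaf 0 hung above
-- the root, is the tree sought; a node whose interval is a module followed by a module
-- is circular, and every other internal node is prime.
--
-- Partition refinement sorts the m vertices, in quadratic time, into a path of G in which
-- every module is an interval: the classes of a pivot outside of the current segment are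
-- sorted recursively and merged along G, and in a segment without outer pivots the in- and
-- out-neighbours of a vertex are sorted recursively and concatenated.  Among the m² intervals
-- the modules are those not cut by a vertex outside, and the strong ones those overlapped by
-- no module; both can be read off from extremal cutters and extremal ends.  A last double
-- loop, by increasing left end and decreasing right end, meets every strong interval after
-- those containing it, so the parent is the newest node so far whose interval contains it.
--
-- Running times are established for an execution without word-size conditions.  All values
-- that such an execution produces grow by a bounded amount per unit of time, so the time
-- bound also shows that they fit into the words.

open import Defs
open import Data.Bool.Base using (Bool; true; false; not; _∧_; if_then_else_; T; _∨_; _xor_)
import Data.Bool.Properties as Bool
open import Data.Empty using (⊥; ⊥-elim)
open import Data.Fin.Base as Fin using (Fin; toℕ; zero; suc; fromℕ<)
import Data.Fin.Properties as Fin
import Data.Fin.Subset as Sub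
open import Data.Fin.Subset using (Subset; _∈_; _∉_; _∩_; ∁; Nonempty; ⁅_⁆; ∣_∣)
open import Data.Fin.Subset.Properties using (_∈?_; x∈∁p⇒x∉p; x∉p⇒x∈∁p; x∉∁p⇒x∈p; x∈p∩q⁺; x∈p∩q⁻; ∣⁅x⁆∣≡1; x∈⁅x⁆; x∈⁅y⁆⇒x≡y; p⊆q⇒∣p∣≤∣q∣; ∣p∣≤n; nonempty?; Empty-unique; ∣⊥∣≡0; ∣⊤∣≡n)
open import Data.List.Base using (List; []; _∷_; _++_; _∷ʳ_; length; map; filter; allFin; tabulate; lookup)
open import Data.List.Membership.Propositional using () renaming (_∈_ to _∈ˡ_)
open import Data.List.Membership.Propositional.Properties using (∈-++⁺ˡ; ∈-++⁺ʳ; ∈-++⁻; ∈-map⁺; ∈-map⁻; ∈-filter⁺; ∈-filter⁻; ∈-allFin; ∈-lookup)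
open import Data.List.Properties using (++-assoc; length-++; ++-identityʳ; filter-++; map-++; filter-accept; filter-reject; filter-none; length-map; ∷-injective)
open import Data.List.Relation.Binary.Permutation.Propositional using (_↭_; ↭-refl; ↭-sym; ↭-trans; prep; ↭-reflexive; ↭⇒↭ₛ)
open import Data.List.Relation.Binary.Permutation.Propositional.Properties using (∈-resp-↭; ++⁺; ++-comm; shift; ++⁺ʳ; All-resp-↭)
import Data.List.Relation.Binary.Permutation.Setoid.Properties as Setoid
open import Data.List.Relation.Unary.All as All using (All; []; _∷_)
import Data.List.Relation.Unary.All.Properties as All
open import Data.List.Relation.Unary.AllPairs using ([]; _∷_; AllPairs)
import Data.List.Relation.Unary.AllPairs.Properties as AllPairs
open import Data.List.Relation.Unary.Any as Any using (here; there)
import Data.List.Relation.Unary.Any.Properties as Any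
open import Data.List.Relation.Unary.Linked as Linked using (Linked; []; [-]; _∷_)
open import Data.List.Relation.Unary.Unique.Propositional using (Unique)
import Data.List.Relation.Unary.Unique.Propositional.Properties as Unique
open import Data.Nat.Base using (ℕ; zero; suc; _+_; _*_; _∸_; _^_; _≤_; _<_; _≡ᵇ_; _<ᵇ_; z≤n; s≤s; >-nonZero; _⊓_; _⊔_; _≤ᵇ_; NonZero; ≢-nonZero⁻¹)
open import Data.Nat.DivMod using (_%_; [m+kn]%n≡m%n; m<n⇒m%n≡m)
import Data.Nat.Properties as ℕ
open import Data.Nat.Tactic.RingSolver using (solve-∀)
open import Data.Product.Base using (Σ-syntax; ∃-syntax; _×_; _,_; proj₁; proj₂)
open import Data.Sum.Base using (_⊎_; inj₁; inj₂)
open import Data.Unit.Base using (⊤; tt)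
import Data.Vec.Base as Vec
import Data.Vec.Properties as Vec
open import Function.Base using (_∘_; id; case_of_)
open import Function.Bundles using (_⇔_; mk⇔; Equivalence)
open import Relation.Binary.Construct.Closure.ReflexiveTransitive using (Star; ε; _◅_; _◅◅_; reverse)
open import Relation.Binary.Definitions using (tri<; tri≈; tri>)
open import Relation.Binary.PropositionalEquality using (_≡_; _≢_; refl; sym; trans; cong; cong₂; subst; subst₂; module ≡-Reasoning; setoid)
open import Relation.Nullary using (¬_; Dec; yes; no; map′; _→-dec_; _⊎-dec_; _×-dec_)
open import Relation.Nullary.Decidable using (toWitness; does; dec-true)

-- A set is a umodule exactly when the four arcs between `u , u′` inside and `x , x′` outside always
-- have even parity. With the vertex 0 as one corner this becomes homogeneity in the switched
-- tournament, so a single fixed vertex suffices. The refinement is quadratic by a potential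
-- argument. A segment of length `len` that shares a window of length `h` with its outer pivots is
-- charged `len * h`. Spending a pivot, or fixing one vertex of a segment without pivots, lowers the
-- total charge by exactly the length of the segment, which pays for one partition and one merge.
-- Extremal cutters, starts and ends are not specified as minima and maxima but by the thresholds
-- that they meet; the same equivalences then serve as loop invariants and as the final criteria.
-- The number of strong intervals is never estimated.

∧-true : ∀ {a b} → a ∧ b ≡ true → a ≡ true × b ≡ true
∧-true {true} {true} _ = refl , refl

≡ᵇ-true : ∀ {a b} → (a ≡ᵇ b) ≡ true → a ≡ b
≡ᵇ-true {a} {b} p = ℕ.≡ᵇ⇒≡ a b (subst T (sym p) tt)

<ᵇ-true : ∀ {a b} → (a <ᵇ b) ≡ true → a < b
<ᵇ-true {a} {b} p = ℕ.<ᵇ⇒< a b (subst T (sym p) tt)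

T-true : ∀ {b} → T b → b ≡ true
T-true {true} _ = refl

<-true : ∀ {a b} → a < b → (a <ᵇ b) ≡ true
<-true p = T-true (ℕ.<⇒<ᵇ p)

≡-true : ∀ {a b} → a ≡ b → (a ≡ᵇ b) ≡ true
≡-true {a} {b} p = T-true (ℕ.≡⇒≡ᵇ a b p)

¬true : ∀ {b} → b ≢ true → b ≡ false
¬true {true}  p = ⊥-elim (p refl)
¬true {false} p = refl

<-false : ∀ {a b} → ¬ (a < b) → (a <ᵇ b) ≡ false
<-false p = ¬true (λ q → p (<ᵇ-true q))

upd-same : ∀ (f : ℕ → ℕ) {a b} v → a ≡ b → (f [ a ≔ v ]) b ≡ v
upd-same f {a} {b} v p with a ℕ.≟ b
... | yes _ = refl
... | no  q = ⊥-elim (q p)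

upd-diff : ∀ (f : ℕ → ℕ) {a b} v → a ≢ b → (f [ a ≔ v ]) b ≡ f b
upd-diff f {a} {b} v p with a ℕ.≟ b
... | yes q = ⊥-elim (p q)
... | no  _ = refl

-- Executions without word size, and weakest preconditions for them

data Exec : Cmd → State → ℕ → State → Set where
  ex-skip  : ∀ {σ} → Exec skip σ 1 σ
  ex-seq   : ∀ {c d σ σ′ σ″ s t} →
             Exec c σ s σ′ → Exec d σ′ t σ″ → Exec (c ︔ d) σ (s + t) σ″
  ex-set   : ∀ {x e σ} → Exec (set x e) σ (1 + cost e) (state (regs σ [ x ≔ ⟦ e ⟧ σ ]) (mem σ))
  ex-store : ∀ {e f σ} → Exec (store e f) σ (1 + cost e + cost f)
                              (state (regs σ) (mem σ [ ⟦ e ⟧ σ ≔ ⟦ f ⟧ σ ]))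
  ex-then  : ∀ {e c d σ σ′ t} → ⟦ e ⟧ σ ≢ 0 → Exec c σ t σ′ → Exec (cond e c d) σ (1 + cost e + t) σ′
  ex-else  : ∀ {e c d σ σ′ t} → ⟦ e ⟧ σ ≡ 0 → Exec d σ t σ′ → Exec (cond e c d) σ (1 + cost e + t) σ′
  ex-exit  : ∀ {e c σ} → ⟦ e ⟧ σ ≡ 0 → Exec (while e c) σ (1 + cost e) σ
  ex-loop  : ∀ {e c σ σ′ σ″ s t} → ⟦ e ⟧ σ ≢ 0 → Exec c σ s σ′ → Exec (while e c) σ′ t σ″ →
             Exec (while e c) σ (1 + cost e + s + t) σ″

Post : Set₁
Post = ℕ → State → Set

-- Total correctness. On straight-line code `wp` unfolds by evaluation; at a loop it asks for a
-- terminating execution, which is supplied by `loop-rule` or by explicit iteration.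
wp : Cmd → Post → State → Set
wp skip         Q σ = Q 1 σ
wp (c ︔ d)      Q σ = wp c (λ s σ₁ → wp d (λ t → Q (s + t)) σ₁) σ
wp (set x e)    Q σ = Q (1 + cost e) (state (regs σ [ x ≔ ⟦ e ⟧ σ ]) (mem σ))
wp (store e f)  Q σ = Q (1 + cost e + cost f) (state (regs σ) (mem σ [ ⟦ e ⟧ σ ≔ ⟦ f ⟧ σ ]))
wp (cond e c d) Q σ = (⟦ e ⟧ σ ≢ 0 → wp c (λ t → Q (1 + cost e + t)) σ) ×
                      (⟦ e ⟧ σ ≡ 0 → wp d (λ t → Q (1 + cost e + t)) σ)
wp (while e c)  Q σ = ∃[ t ] ∃[ σ′ ] Exec (while e c) σ t σ′ × Q t σ′

wp-sound : ∀ c {Q σ} → wp c Q σ → ∃[ t ] ∃[ σ′ ] Exec c σ t σ′ × Q t σ′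
wp-sound skip p = _ , _ , ex-skip , p
wp-sound (c ︔ d) p with wp-sound c p
... | s , σ₁ , x , q with wp-sound d q
... | t , σ₂ , y , r = _ , _ , ex-seq x y , r
wp-sound (set x e) p = _ , _ , ex-set , p
wp-sound (store e f) p = _ , _ , ex-store , p
wp-sound (cond e c d) {σ = σ} (p , q) with ⟦ e ⟧ σ ℕ.≟ 0
... | yes z = let (_ , _ , x , r) = wp-sound d (q z) in _ , _ , ex-else z x , r
... | no nz = let (_ , _ , x , r) = wp-sound c (p nz) in _ , _ , ex-then nz x , r
wp-sound (while e c) p = p

wp-complete : ∀ {c Q σ t σ′} → Exec c σ t σ′ → Q t σ′ → wp c Q σ
wp-complete ex-skip q = q
wp-complete (ex-seq x y) q = wp-complete x (wp-complete y q)
wp-complete ex-set q = q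
wp-complete ex-store q = q
wp-complete (ex-then nz x) q = (λ _ → wp-complete x q) , (λ z → ⊥-elim (nz z))
wp-complete (ex-else z x) q = (λ nz → ⊥-elim (nz z)) , (λ _ → wp-complete x q)
wp-complete x@(ex-exit _) q = _ , _ , x , q
wp-complete x@(ex-loop _ _ _) q = _ , _ , x , q

wp-mono : ∀ c {Q R : Post} {σ} → (∀ t σ′ → Q t σ′ → R t σ′) → wp c Q σ → wp c R σ
wp-mono c f p = let (_ , _ , x , q) = wp-sound c p in wp-complete x (f _ _ q)

-- A syntactic check: for a concrete command it is settled by evaluation and can be passed as an
-- implicit argument of type `T`.
keeps : ℕ → Cmd → Bool
keeps r skip         = true
keeps r (c ︔ d)      = keeps r c ∧ keeps r d
keeps r (set x e)    = not (x ≡ᵇ r)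
keeps r (store e f)  = true
keeps r (cond e c d) = keeps r c ∧ keeps r d
keeps r (while e c)  = keeps r c

keeps-sound : ∀ r {c σ t σ′} → Exec c σ t σ′ → keeps r c ≡ true → regs σ′ r ≡ regs σ r
keeps-sound r ex-skip k = refl
keeps-sound r (ex-seq x y) k = let (p , q) = ∧-true k in
  trans (keeps-sound r y q) (keeps-sound r x p)
keeps-sound r (ex-set {x} {e} {σ}) k =
  upd-diff (regs σ) {x} (⟦ e ⟧ σ) (λ p → case trans (sym (cong not (≡-true {x} {r} p))) k of λ ())
keeps-sound r ex-store k = refl
keeps-sound r (ex-then _ x) k = keeps-sound r x (proj₁ (∧-true k))
keeps-sound r (ex-else {c = c} _ x) k = keeps-sound r x (proj₂ (∧-true {keeps r c} k))
keeps-sound r (ex-exit _) k = refl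
keeps-sound r (ex-loop _ x y) k = trans (keeps-sound r y k) (keeps-sound r x k)

-- Work arrays: cell i of array k < 16 has the address AB + (i * 16 + k)

rN rM rS rTB rAB : ℕ
rN  = 2
rM  = 3
rS  = 4
rTB = 5
rAB = 6

infixl 6 _⊕_ _⊖_
infixl 7 _⊗_
infix 5 _≺_ _≈_

_⊕_ _⊖_ _⊗_ _≺_ _≈_ : Expr → Expr → Expr
_⊕_ = bin add
_⊖_ = bin sub
_⊗_ = bin mul
_≺_ = bin lt
_≈_ = bin eq

cell : ℕ → Expr → Expr
cell k i = reg rAB ⊕ (i ⊗ lit 16 ⊕ lit k)

ld : ℕ → Expr → Expr
ld k i = load (cell k i)

put : ℕ → Expr → Expr → Cmd
put k i e = store (cell k i) e

inc : ℕ → Cmd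
inc r = set r (reg r ⊕ lit 1)

arr : State → ℕ → ℕ → ℕ
arr σ k i = mem σ (regs σ rAB + (i * 16 + k))

-- The residue modulo 16 recovers the array. Interleaving leaves every array unbounded, so no
-- capacities have to be fixed and disjointness needs no bounds on indices.
16-inj : ∀ {i j k l} → k < 16 → l < 16 → i * 16 + k ≡ j * 16 + l → i ≡ j × k ≡ l
16-inj {i} {j} {k} {l} k< l< p = i≡j , k≡l
  where
  k≡l : k ≡ l
  k≡l = begin
    k                 ≡⟨ m<n⇒m%n≡m k< ⟨
    k % 16            ≡⟨ [m+kn]%n≡m%n k i 16 ⟨
    (k + i * 16) % 16 ≡⟨ cong (_% 16) (trans (ℕ.+-comm k (i * 16)) (trans p (ℕ.+-comm (j * 16) l))) ⟩
    (l + j * 16) % 16 ≡⟨ [m+kn]%n≡m%n l j 16 ⟩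
    l % 16            ≡⟨ m<n⇒m%n≡m l< ⟩
    l                 ∎
    where open ≡-Reasoning
  i≡j : i ≡ j
  i≡j = ℕ.*-cancelʳ-≡ i j 16 (ℕ.+-cancelʳ-≡ k (i * 16) (j * 16) (trans p (cong (j * 16 +_) (sym k≡l))))

arr-same : ∀ (f : ℕ → ℕ) A k {i v j} → i ≡ j → (f [ A + (i * 16 + k) ≔ v ]) (A + (j * 16 + k)) ≡ v
arr-same f A k {v = v} p = upd-same f v (cong (λ i → A + (i * 16 + k)) p)

arr-other : ∀ (f : ℕ → ℕ) A k l i j {v} → {_ : T (k <ᵇ 16)} → {_ : T (l <ᵇ 16)} → {_ : T (not (k ≡ᵇ l))} →
            (f [ A + (i * 16 + k) ≔ v ]) (A + (j * 16 + l)) ≡ f (A + (j * 16 + l))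
arr-other f A k l i j {v} {k<} {l<} {ne} =
  upd-diff f v (λ p → subst T (cong not (≡-true {k} {l}
    (proj₂ (16-inj {i} {j} (ℕ.<ᵇ⇒< k 16 k<) (ℕ.<ᵇ⇒< l 16 l<) (ℕ.+-cancelˡ-≡ A _ _ p))))) ne)

arr-idx : ∀ (f : ℕ → ℕ) A k {i j v} → {_ : T (k <ᵇ 16)} → i ≢ j →
          (f [ A + (i * 16 + k) ≔ v ]) (A + (j * 16 + k)) ≡ f (A + (j * 16 + k))
arr-idx f A k {i} {j} {v} {k<} ne =
  upd-diff f v (λ p → ne (proj₁ (16-inj {i} {j} (ℕ.<ᵇ⇒< k 16 k<) (ℕ.<ᵇ⇒< k 16 k<) (ℕ.+-cancelˡ-≡ A _ _ p))))

-- All stores of the command go to arrays selected by p, and AB is not assigned.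
puts : (ℕ → Bool) → Cmd → Bool
puts p skip         = true
puts p (c ︔ d)      = puts p c ∧ puts p d
puts p (set x e)    = not (x ≡ᵇ rAB)
puts p (store (bin add (reg 6) (bin add (bin mul i (lit 16)) (lit k))) f) = (k <ᵇ 16) ∧ p k
puts p (store e f)  = false
puts p (cond e c d) = puts p c ∧ puts p d
puts p (while e c)  = puts p c

-- The address `a` belongs to no selected array. This covers the cells below the base address as
-- well as the cells of the other arrays.
Low : (ℕ → Bool) → ℕ → ℕ → Set
Low p A a = ∀ k i → k < 16 → p k ≡ true → A + (i * 16 + k) ≢ a

puts-AB : ∀ p c → puts p c ≡ true → keeps rAB c ≡ true
puts-AB p skip k = refl
puts-AB p (c ︔ d) k with ∧-true {puts p c} k
... | a , b rewrite puts-AB p c a = puts-AB p d b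
puts-AB p (set x e) k = k
puts-AB p (store e f) k = refl
puts-AB p (cond e c d) k with ∧-true {puts p c} k
... | a , b rewrite puts-AB p c a = puts-AB p d b
puts-AB p (while e c) k = puts-AB p c k

store-form : ∀ p {e f} → puts p (store e f) ≡ true →
             ∃[ i ] ∃[ k ] e ≡ cell k i × k < 16 × p k ≡ true
store-form p {bin add (reg 6) (bin add (bin mul i (lit 16)) (lit k))} h =
  let (a , b) = ∧-true {k <ᵇ 16} h in i , k , refl , <ᵇ-true a , b

puts-sound : ∀ p {c σ t σ′} → Exec c σ t σ′ → puts p c ≡ true →
             ∀ a → Low p (regs σ rAB) a → mem σ′ a ≡ mem σ a
puts-sound p ex-skip k a l = refl
puts-sound p (ex-seq {c} {d} {σ} x y) k a l = let (h , h′) = ∧-true {puts p c} k in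
  trans (puts-sound p y h′ a (subst (λ A → Low p A a) (sym (keeps-sound rAB x (puts-AB p c h))) l))
        (puts-sound p x h a l)
puts-sound p ex-set k a l = refl
puts-sound p (ex-store {e} {f} {σ}) k a l with store-form p {e} {f} k
... | i , j , refl , j< , pj = upd-diff (mem σ) _ (l j (⟦ i ⟧ σ) j< pj)
puts-sound p (ex-then {c = c} _ x) k a l = puts-sound p x (proj₁ (∧-true {puts p c} k)) a l
puts-sound p (ex-else {c = c} _ x) k a l = puts-sound p x (proj₂ (∧-true {puts p c} k)) a l
puts-sound p (ex-exit _) k a l = refl
puts-sound p (ex-loop {c = c} _ x y) k a l =
  trans (puts-sound p y k a (subst (λ A → Low p A a) (sym (keeps-sound rAB x (puts-AB p c k))) l))
        (puts-sound p x k a l)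

low-below : ∀ p {A a} → a < A → Low p A a
low-below p {A} a<A k i _ _ q = ℕ.<⇒≢ (ℕ.<-≤-trans a<A (ℕ.m≤m+n A (i * 16 + k))) (sym q)

low-arr : ∀ p {A} l j → l < 16 → p l ≡ false → Low p A (A + (j * 16 + l))
low-arr p {A} l j l< pl k i k< pk q with 16-inj {i} {j} k< l< (ℕ.+-cancelˡ-≡ A _ _ q)
... | _ , refl = case trans (sym pk) pl of λ ()

-- What the syntax of a command alone says about its effect. The implicit arguments are checks
-- evaluated on the concrete command, so postconditions can be confined to what changes.
record Frame (c : Cmd) (σ σ′ : State) : Set where
  field
    reg-same : ∀ r → {_ : T (keeps r c)} → regs σ′ r ≡ regs σ r
    arr-keep : ∀ p k → {_ : T (puts p c)} → {_ : T (k <ᵇ 16)} → {_ : T (not (p k))} → ∀ i → arr σ′ k i ≡ arr σ k i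
    low-same : {_ : T (puts (λ _ → true) c)} → ∀ a → a < regs σ rAB → mem σ′ a ≡ mem σ a
open Frame public

T-not : ∀ {b} → T (not b) → b ≡ false
T-not {false} _ = refl

frame : ∀ {c σ t σ′} → Exec c σ t σ′ → Frame c σ σ′
frame {c} {σ} {σ′ = σ′} x = record
  { reg-same = λ r {h} → keeps-sound r x (T-true h)
  ; arr-keep = λ p k {h} {k<} {nk} i →
      trans (cong (λ A → mem σ′ (A + (i * 16 + k))) (keeps-sound rAB x (puts-AB p c (T-true h))))
            (puts-sound p x (T-true h) _ (low-arr p {regs σ rAB} k i (ℕ.<ᵇ⇒< k 16 k<) (T-not nk)))
  ; low-same = λ {h} a a< → puts-sound (λ _ → true) x (T-true h) a (low-below _ a<)
  }

-- From Exec to Run: in a safe program a stored value exceeds the values already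
-- present by at most G per unit of cost, so the running time bounds all values.

-- Registers 2 to 7 are reserved for sizes and base addresses. They may be added to other values, so
-- their bound `G` is kept apart from the growing bound `M`.
isConst : ℕ → Bool
isConst r = (1 <ᵇ r) ∧ (r <ᵇ 8)

smallStep : Expr → Bool
smallStep (lit k) = k <ᵇ 17
smallStep (reg r) = isConst r
smallStep _       = false

-- Products are excluded because repeated multiplication could outgrow every fixed power. A `load`
-- or a comparison is safe with arbitrary operands: its value is a present cell or a bit. Products
-- may therefore still occur in addresses.
safeExpr : Expr → Bool
safeExpr (lit k)       = k <ᵇ 17
safeExpr (reg r)       = true
safeExpr (load e)      = true
safeExpr (bin add e f) = safeExpr e ∧ smallStep f
safeExpr (bin sub e f) = safeExpr e
safeExpr (bin mul e f) = false
safeExpr (bin eq e f)  = true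
safeExpr (bin lt e f)  = true

safe : Cmd → Bool
safe skip         = true
safe (c ︔ d)      = safe c ∧ safe d
safe (set x e)    = not (isConst x) ∧ safeExpr e
safe (store e f)  = safeExpr f
safe (cond e c d) = safe c ∧ safe d
safe (while e c)  = safe c

record Bounded (M G : ℕ) (σ : State) : Set where
  field
    regs≤  : ∀ r → regs σ r ≤ M
    mem≤   : ∀ a → mem σ a ≤ M
    const≤ : ∀ r → isConst r ≡ true → regs σ r ≤ G
open Bounded public

bit≤1 : ∀ b → bit b ≤ 1
bit≤1 true  = s≤s z≤n
bit≤1 false = z≤n

smallStep-bound : ∀ {M G σ} f → Bounded M G σ → 16 ≤ G → smallStep f ≡ true → ⟦ f ⟧ σ ≤ G
smallStep-bound (lit k) b g h = ℕ.≤-trans (ℕ.≤-pred (<ᵇ-true h)) g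
smallStep-bound (reg r) b g h = const≤ b r h

G≤ : ∀ M G c → G ≤ M + G * suc c
G≤ M G c = ℕ.≤-trans (ℕ.≤-trans (ℕ.m≤m+n G (G * c)) (ℕ.≤-reflexive (sym (ℕ.*-suc G c)))) (ℕ.m≤n+m (G * suc c) M)

safeExpr-bound : ∀ {M G σ} e → Bounded M G σ → 16 ≤ G → safeExpr e ≡ true → ⟦ e ⟧ σ ≤ M + G * cost e
safeExpr-bound {M} {G} (lit k) b g h = ℕ.≤-trans (smallStep-bound (lit k) b g h) (G≤ M G 0)
safeExpr-bound (reg x) b g h = ℕ.≤-trans (regs≤ b x) (ℕ.m≤m+n _ _)
safeExpr-bound (load e) b g h = ℕ.≤-trans (mem≤ b _) (ℕ.m≤m+n _ _)
safeExpr-bound {M} {G} (bin add e f) b g h = let (p , q) = ∧-true {safeExpr e} h in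
  ℕ.≤-trans (ℕ.+-mono-≤ (safeExpr-bound e b g p) (smallStep-bound f b g q))
  (ℕ.≤-trans (ℕ.≤-reflexive (ℕ.+-assoc M (G * cost e) G))
  (ℕ.+-monoʳ-≤ M (ℕ.≤-trans (ℕ.≤-reflexive (trans (ℕ.+-comm (G * cost e) G) (sym (ℕ.*-suc G (cost e)))))
    (ℕ.*-monoʳ-≤ G (ℕ.m≤m+n (suc (cost e)) (cost f))))))
safeExpr-bound {M} {G} {σ} (bin sub e f) b g h =
  ℕ.≤-trans (ℕ.m∸n≤m _ (⟦ f ⟧ σ)) (ℕ.≤-trans (safeExpr-bound e b g h)
  (ℕ.+-monoʳ-≤ M (ℕ.*-monoʳ-≤ G (ℕ.≤-trans (ℕ.n≤1+n _) (ℕ.m≤m+n (suc (cost e)) (cost f))))))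
safeExpr-bound {M} {G} {σ} (bin eq e f) b g h =
  ℕ.≤-trans (bit≤1 (⟦ e ⟧ σ ≡ᵇ ⟦ f ⟧ σ)) (ℕ.≤-trans (ℕ.≤-trans (s≤s z≤n) g) (G≤ M G _))
safeExpr-bound {M} {G} {σ} (bin lt e f) b g h =
  ℕ.≤-trans (bit≤1 (⟦ e ⟧ σ <ᵇ ⟦ f ⟧ σ)) (ℕ.≤-trans (ℕ.≤-trans (s≤s z≤n) g) (G≤ M G _))

upd-≤ : ∀ (f : ℕ → ℕ) {K} a v → (∀ b → f b ≤ K) → v ≤ K → ∀ b → (f [ a ≔ v ]) b ≤ K
upd-≤ f a v h k b with a ℕ.≟ b
... | yes _ = k
... | no  _ = h b

Bounded-mono : ∀ {M M′ G σ} → M ≤ M′ → Bounded M G σ → Bounded M′ G σ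
Bounded-mono l b = record { regs≤ = λ r → ℕ.≤-trans (regs≤ b r) l ; mem≤ = λ a → ℕ.≤-trans (mem≤ b a) l ; const≤ = const≤ b }

exec-bounded : ∀ {G c σ t σ′} → 16 ≤ G → Exec c σ t σ′ → safe c ≡ true → ∀ {M} → Bounded M G σ →
               Bounded (M + G * t) G σ′
seq-bounded : ∀ {G c d σ s σ₁ t σ₂} → 16 ≤ G → Exec c σ s σ₁ → Exec d σ₁ t σ₂ → safe c ≡ true → safe d ≡ true →
              ∀ {M} k → Bounded M G σ → Bounded (M + G * (k + s + t)) G σ₂
seq-bounded {G} {s = s} {t = t} g x y p q {M} k b =
  Bounded-mono (ℕ.≤-trans (ℕ.≤-reflexive (trans (ℕ.+-assoc M (G * s) (G * t)) (cong (M +_) (sym (ℕ.*-distribˡ-+ G s t)))))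
      (ℕ.+-monoʳ-≤ M (ℕ.*-monoʳ-≤ G (ℕ.+-monoˡ-≤ t (ℕ.m≤n+m s k)))))
    (exec-bounded g y q (exec-bounded g x p b))
exec-bounded g ex-skip h b = Bounded-mono (ℕ.m≤m+n _ _) b
exec-bounded g (ex-seq {c} x y) h b = let (p , q) = ∧-true {safe c} h in seq-bounded g x y p q 0 b
exec-bounded {G} g (ex-set {x} {e} {σ}) h {M} b = let (p , q) = ∧-true {not (isConst x)} h in record
  { regs≤ = upd-≤ (regs σ) x _ (λ r → ℕ.≤-trans (regs≤ b r) (ℕ.m≤m+n _ _)) (ℕ.≤-trans (safeExpr-bound e b g q)
      (ℕ.+-monoʳ-≤ M (ℕ.*-monoʳ-≤ G (ℕ.n≤1+n (cost e)))))
  ; mem≤ = λ a → ℕ.≤-trans (mem≤ b a) (ℕ.m≤m+n _ _)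
  ; const≤ = λ r c → subst (_≤ G) (sym (upd-diff (regs σ) {x} {r} (⟦ e ⟧ σ)
      (λ { refl → case trans (sym (cong not c)) p of λ () }))) (const≤ b r c) }
exec-bounded {G} g (ex-store {e} {f} {σ}) h {M} b = record
  { regs≤ = λ r → ℕ.≤-trans (regs≤ b r) (ℕ.m≤m+n _ _)
  ; mem≤ = upd-≤ (mem σ) (⟦ e ⟧ σ) _ (λ r → ℕ.≤-trans (mem≤ b r) (ℕ.m≤m+n _ _)) (ℕ.≤-trans (safeExpr-bound f b g h)
      (ℕ.+-monoʳ-≤ M (ℕ.*-monoʳ-≤ G (ℕ.m≤n+m (cost f) (1 + cost e)))))
  ; const≤ = const≤ b }
exec-bounded {G} g (ex-then {e} {c} {t = t} _ x) h {M} b =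
  Bounded-mono (ℕ.+-monoʳ-≤ M (ℕ.*-monoʳ-≤ G (ℕ.m≤n+m t (1 + cost e)))) (exec-bounded g x (proj₁ (∧-true {safe c} h)) b)
exec-bounded {G} g (ex-else {e} {c} {t = t} _ x) h {M} b =
  Bounded-mono (ℕ.+-monoʳ-≤ M (ℕ.*-monoʳ-≤ G (ℕ.m≤n+m t (1 + cost e)))) (exec-bounded g x (proj₂ (∧-true {safe c} h)) b)
exec-bounded g (ex-exit _) h b = Bounded-mono (ℕ.m≤m+n _ _) b
exec-bounded g (ex-loop {e} _ x y) h b = seq-bounded g x y h h (1 + cost e) b

-- When registers and cells are at most `s ^ κ`, the value of `e` is at most `s ^ exponent κ e`. The
-- two extra units at an operation come from the factors of `suc x * suc y`.
exponent : ℕ → Expr → ℕ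
exponent κ (lit k)     = k
exponent κ (reg x)     = κ
exponent κ (load e)    = exponent κ e + κ
exponent κ (bin o e f) = suc (exponent κ e) + suc (exponent κ f)

exponentᶜ : ℕ → Cmd → ℕ
exponentᶜ κ skip         = 0
exponentᶜ κ (c ︔ d)      = exponentᶜ κ c + exponentᶜ κ d
exponentᶜ κ (set x e)    = exponent κ e
exponentᶜ κ (store e f)  = exponent κ e + exponent κ f
exponentᶜ κ (cond e c d) = exponent κ e + (exponentᶜ κ c + exponentᶜ κ d)
exponentᶜ κ (while e c)  = exponent κ e + exponentᶜ κ c

module _ {s : ℕ} (2≤s : 2 ≤ s) where

  ^-mono : ∀ {a b} → a ≤ b → s ^ a ≤ s ^ b
  ^-mono {zero} {zero} z≤n = ℕ.≤-refl
  ^-mono {zero} {suc b} z≤n = ℕ.*-mono-≤ (ℕ.≤-trans (s≤s z≤n) 2≤s) (^-mono {zero} {b} z≤n)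
  ^-mono (s≤s p) = ℕ.*-monoʳ-≤ s (^-mono p)

  1≤^ : ∀ a → 1 ≤ s ^ a
  1≤^ a = ^-mono {0} {a} z≤n

  suc≤^ : ∀ {x} a → x ≤ s ^ a → suc x ≤ s ^ suc a
  suc≤^ a p = ℕ.≤-trans (ℕ.+-mono-≤ (1≤^ a) p)
    (ℕ.≤-trans (ℕ.≤-reflexive (cong (s ^ a +_) (sym (ℕ.+-identityʳ (s ^ a))))) (ℕ.*-monoˡ-≤ (s ^ a) 2≤s))

  lit≤^ : ∀ k → k ≤ s ^ k
  lit≤^ zero = z≤n
  lit≤^ (suc k) = suc≤^ k (lit≤^ k)

  *≤^ : ∀ {x y} a b → x ≤ s ^ a → y ≤ s ^ b → x * y ≤ s ^ (a + b)
  *≤^ a b p q = ℕ.≤-trans (ℕ.*-mono-≤ p q) (ℕ.≤-reflexive (sym (ℕ.^-distribˡ-+-* s a b)))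

  suc*≤^ : ∀ {x y z} a b → z ≤ suc x * suc y → x ≤ s ^ a → y ≤ s ^ b → z ≤ s ^ (suc a + suc b)
  suc*≤^ a b l p q = ℕ.≤-trans l (*≤^ (suc a) (suc b) (suc≤^ a p) (suc≤^ b q))

  -- One bound for all operations, multiplicative so that exponents add.
  op≤ : ∀ o x y → ⟦ o ⟧ₒ x y ≤ suc x * suc y
  op≤ add x y = ℕ.≤-trans (ℕ.+-monoʳ-≤ x (ℕ.m≤m*n y (suc x)))
    (ℕ.≤-trans (ℕ.n≤1+n _) (ℕ.≤-reflexive (trans (cong (λ z → suc x + z) (ℕ.*-comm y (suc x))) (sym (ℕ.*-suc (suc x) y)))))
  op≤ sub x y = ℕ.≤-trans (ℕ.m∸n≤m x y) (ℕ.≤-trans (ℕ.n≤1+n x) (ℕ.m≤m*n (suc x) (suc y)))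
  op≤ mul x y = ℕ.*-mono-≤ (ℕ.n≤1+n x) (ℕ.n≤1+n y)
  op≤ eq x y = ℕ.≤-trans (bit≤1 (x ≡ᵇ y)) (s≤s z≤n)
  op≤ lt x y = ℕ.≤-trans (bit≤1 (x <ᵇ y)) (s≤s z≤n)

  module _ (κ w : ℕ) where

    value-bound : ∀ {σ G} e → Bounded (s ^ κ) G σ → ⟦ e ⟧ σ ≤ s ^ exponent κ e
    value-bound (lit k) b = lit≤^ k
    value-bound (reg x) b = regs≤ b x
    value-bound (load e) b = ℕ.≤-trans (mem≤ b _) (^-mono (ℕ.m≤n+m κ (exponent κ e)))
    value-bound {σ} (bin o e f) b =
      suc*≤^ (exponent κ e) (exponent κ f) (op≤ o (⟦ e ⟧ σ) (⟦ f ⟧ σ)) (value-bound e b) (value-bound f b)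

    fits : ∀ {σ G} e → Bounded (s ^ κ) G σ → exponent κ e ≤ w → Fits (s ^ w) σ e
    fits e@(lit k) b l = ℕ.≤-trans (value-bound e b) (^-mono l)
    fits e@(reg x) b l = ℕ.≤-trans (value-bound e b) (^-mono l)
    fits e@(load f) b l = fits f b (ℕ.≤-trans (ℕ.m≤m+n _ κ) l) , ℕ.≤-trans (value-bound e b) (^-mono l)
    fits e@(bin o f g) b l =
      fits f b (ℕ.≤-trans (ℕ.≤-trans (ℕ.n≤1+n _) (ℕ.m≤m+n _ _)) l) ,
      fits g b (ℕ.≤-trans (ℕ.≤-trans (ℕ.n≤1+n _) (ℕ.m≤n+m (suc (exponent κ g)) (suc (exponent κ f)))) l) ,
      ℕ.≤-trans (value-bound e b) (^-mono l)

    -- The bound `M + G * t` at the end dominates the bound at every intermediate moment, so a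
    -- single `κ` serves for the whole execution.
    lift : ∀ {G c σ t σ′ M} → 16 ≤ G → Exec c σ t σ′ → safe c ≡ true → Bounded M G σ →
           M + G * t ≤ s ^ κ → exponentᶜ κ c ≤ w → Run (s ^ w) c σ t σ′
    lift-seq : ∀ {G c d σ r σ₁ t σ₂ M} → 16 ≤ G → ∀ k → Exec c σ r σ₁ → Exec d σ₁ t σ₂ → safe c ≡ true → safe d ≡ true →
               Bounded M G σ → M + G * (k + r + t) ≤ s ^ κ → exponentᶜ κ c ≤ w → exponentᶜ κ d ≤ w →
               Run (s ^ w) c σ r σ₁ × Run (s ^ w) d σ₁ t σ₂
    lift-seq {G} {r = r} {t = t} {M = M} g k x y p q b l wc wd =
      lift g x p b (ℕ.≤-trans (ℕ.+-monoʳ-≤ M (ℕ.*-monoʳ-≤ G (ℕ.≤-trans (ℕ.m≤n+m r k) (ℕ.m≤m+n (k + r) t)))) l) wc ,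
      lift g y q (exec-bounded g x p b) (ℕ.≤-trans (ℕ.≤-trans (ℕ.≤-reflexive
        (trans (ℕ.+-assoc M (G * r) (G * t)) (cong (M +_) (sym (ℕ.*-distribˡ-+ G r t)))))
        (ℕ.+-monoʳ-≤ M (ℕ.*-monoʳ-≤ G (ℕ.+-monoˡ-≤ t (ℕ.m≤n+m r k))))) l) wd

    lift g ex-skip h b l v = run-skip
    lift g (ex-seq {c} {d} x y) h b l v =
      let (p , q) = ∧-true {safe c} h
          (x′ , y′) = lift-seq g 0 x y p q b l (ℕ.≤-trans (ℕ.m≤m+n _ _) v) (ℕ.≤-trans (ℕ.m≤n+m _ _) v)
      in run-seq x′ y′
    lift {M = M} g (ex-set {x} {e}) h b l v = run-set (fits e (Bounded-mono (ℕ.≤-trans (ℕ.m≤m+n M _) l) b) v)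
    lift {M = M} g (ex-store {e} {f}) h b l v =
      let b′ = Bounded-mono (ℕ.≤-trans (ℕ.m≤m+n M _) l) b in
      run-store (fits e b′ (ℕ.≤-trans (ℕ.m≤m+n _ _) v)) (fits f b′ (ℕ.≤-trans (ℕ.m≤n+m _ _) v))
    lift {G} {M = M} g (ex-then {e} {c} {d} {t = t} nz x) h b l v =
      run-then (fits e (Bounded-mono (ℕ.≤-trans (ℕ.m≤m+n M _) l) b) (ℕ.≤-trans (ℕ.m≤m+n _ _) v)) nz
        (lift g x (proj₁ (∧-true {safe c} h)) b (ℕ.≤-trans (ℕ.+-monoʳ-≤ M (ℕ.*-monoʳ-≤ G (ℕ.m≤n+m t (1 + cost e)))) l)
          (ℕ.≤-trans (ℕ.≤-trans (ℕ.m≤m+n _ _) (ℕ.m≤n+m _ (exponent κ e))) v))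
    lift {G} {M = M} g (ex-else {e} {c} {d} {t = t} z x) h b l v =
      run-else (fits e (Bounded-mono (ℕ.≤-trans (ℕ.m≤m+n M _) l) b) (ℕ.≤-trans (ℕ.m≤m+n _ _) v)) z
        (lift g x (proj₂ (∧-true {safe c} h)) b (ℕ.≤-trans (ℕ.+-monoʳ-≤ M (ℕ.*-monoʳ-≤ G (ℕ.m≤n+m t (1 + cost e)))) l)
          (ℕ.≤-trans (ℕ.≤-trans (ℕ.m≤n+m _ (exponentᶜ κ c)) (ℕ.m≤n+m _ (exponent κ e))) v))
    lift {M = M} g (ex-exit {e} z) h b l v =
      run-exit (fits e (Bounded-mono (ℕ.≤-trans (ℕ.m≤m+n M _) l) b) (ℕ.≤-trans (ℕ.m≤m+n _ _) v)) z
    lift {G} {M = M} g (ex-loop {e} {c} {s = r} {t} nz x y) h b l v =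
      let (x′ , y′) = lift-seq g (1 + cost e) x y h h b l (ℕ.≤-trans (ℕ.m≤n+m _ (exponent κ e)) v) v
      in run-loop (fits e (Bounded-mono (ℕ.≤-trans (ℕ.m≤m+n M _) l) b) (ℕ.≤-trans (ℕ.m≤m+n _ _) v)) nz x′ y′

-- Loops and linear time bounds

frame-refl : ∀ {c σ} → Frame c σ σ
frame-refl = record { reg-same = λ _ → refl ; arr-keep = λ _ _ _ → refl ; low-same = λ _ _ → refl }

frame-trans : ∀ {c σ₁ σ₂ σ₃} → Frame c σ₁ σ₂ → Frame c σ₂ σ₃ → Frame c σ₁ σ₃
frame-trans {c} f g = record
  { reg-same = λ r {h} → trans (reg-same g r {h}) (reg-same f r {h})
  ; arr-keep = λ p k {h} {h′} {h″} i → trans (arr-keep g p k {h} {h′} {h″} i) (arr-keep f p k {h} {h′} {h″} i)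
  ; low-same = λ {h} a l → trans (low-same g {h} a (subst (a <_) (sym (reg-same f rAB {keep h})) l)) (low-same f {h} a l)
  }
  where
  keep : T (puts (λ _ → true) c) → T (keeps rAB c)
  keep h = subst T (sym (puts-AB _ c (T-true h))) tt

infixr 5 _+ˡ_

-- A record rather than a bare inequality, so that the coefficients can be inferred when the bounds
-- of consecutive commands are added.
record Lin (a b l t : ℕ) : Set where
  constructor lin
  field bound : t ≤ a + b * l
open Lin public

_+ˡ_ : ∀ {s t a a′ b b′ l} → Lin a b l s → Lin a′ b′ l t → Lin (a + a′) (b + b′) l (s + t)
_+ˡ_ {a = a} {a′} {b} {b′} {l} (lin p) (lin q) = lin (ℕ.≤-trans (ℕ.+-mono-≤ p q) (ℕ.≤-reflexive (begin
  a + b * l + (a′ + b′ * l)   ≡⟨ ℕ.+-assoc a (b * l) _ ⟩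
  a + (b * l + (a′ + b′ * l)) ≡⟨ cong (a +_) (trans (sym (ℕ.+-assoc (b * l) a′ _))
                                   (trans (cong (_+ b′ * l) (ℕ.+-comm (b * l) a′)) (ℕ.+-assoc a′ (b * l) _))) ⟩
  a + (a′ + (b * l + b′ * l)) ≡⟨ cong (λ z → a + (a′ + z)) (sym (ℕ.*-distribʳ-+ l b b′)) ⟩
  a + (a′ + (b + b′) * l)     ≡⟨ ℕ.+-assoc a a′ _ ⟨
  a + a′ + (b + b′) * l       ∎)))
  where open ≡-Reasoning

const-≤ : ∀ c {l} → Lin c 0 l c
const-≤ c = lin (ℕ.m≤m+n c 0)

upto : ∀ {t l} c → t ≤ c → Lin c 0 l t
upto c p = lin (ℕ.≤-trans p (ℕ.m≤m+n c 0))

weaken : ∀ {t a b a′ b′ l} → Lin a b l t → {_ : T (a <ᵇ suc a′)} → {_ : T (b <ᵇ suc b′)} → Lin a′ b′ l t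
weaken {a = a} {b} {a′} {b′} {l} (lin p) {h} {h′} = lin (ℕ.≤-trans p
  (ℕ.+-mono-≤ (ℕ.≤-pred (ℕ.<ᵇ⇒< a (suc a′) h)) (ℕ.*-monoˡ-≤ l (ℕ.≤-pred (ℕ.<ᵇ⇒< b (suc b′) h′)))))

shorter : ∀ {t a b l l′} → Lin a b l t → l ≤ l′ → Lin a b l′ t
shorter {a = a} {b} (lin p) q = lin (ℕ.≤-trans p (ℕ.+-monoʳ-≤ a (ℕ.*-monoʳ-≤ b q)))

frame-while : ∀ {e c σ σ′} → Frame c σ σ′ → Frame (while e c) σ σ′
frame-while f = record
  { reg-same = λ r {h} → reg-same f r {h}
  ; arr-keep = λ p k {h} {h′} {h″} → arr-keep f p k {h} {h′} {h″}
  ; low-same = λ {h} → low-same f {h} }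

-- The index of the invariant bounds the iterations still to come; the guard may fail earlier, as
-- happens in `weave`. The step receives the frame from the initial state, so an invariant mentions
-- only what the body changes.
loop-rule : ∀ {e c} T (Inv : ℕ → State → Set) (Done : State → Set) {σ₀} →
  (∀ k σ → Frame c σ₀ σ → Inv k σ →
     (⟦ e ⟧ σ ≡ 0 × Done σ) ⊎
     (∃[ k′ ] k ≡ suc k′ × ⟦ e ⟧ σ ≢ 0 × wp c (λ t σ′ → t ≤ T × Inv k′ σ′) σ)) →
  ∀ N {Q : Post} → Inv N σ₀ →
  (∀ t σ′ → Lin (1 + cost e) (1 + cost e + T) N t → Frame (while e c) σ₀ σ′ → Done σ′ → Q t σ′) → wp (while e c) Q σ₀
loop-rule {e} {c} T Inv Done {σ₀} step N {Q} i k =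
  let (t , σ′ , x , le , fr , j) = go N _ frame-refl i in
  t , σ′ , x , k t σ′ (lin (subst (t ≤_) (trans (ℕ.+-comm _ (1 + cost e)) (cong (1 + cost e +_) (ℕ.*-comm N _))) le)) (frame-while fr) j
  where
  go : ∀ N σ → Frame c σ₀ σ → Inv N σ →
       ∃[ t ] ∃[ σ′ ] Exec (while e c) σ t σ′ × t ≤ N * (1 + cost e + T) + (1 + cost e) × Frame c σ₀ σ′ × Done σ′
  go N σ f i with step N σ f i
  ... | inj₁ (z , d) = _ , _ , ex-exit z , ℕ.m≤n+m _ _ , f , d
  ... | inj₂ (N′ , refl , nz , w) with wp-sound c w
  ... | s , σ₁ , x , s≤T , i₁ with go N′ σ₁ (frame-trans f (frame x)) i₁
  ... | t , σ₂ , y , le , f′ , j = _ , _ , ex-loop nz x y ,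
      ℕ.≤-trans (ℕ.+-mono-≤ (ℕ.+-monoʳ-≤ (1 + cost e) s≤T) le)
                (ℕ.≤-reflexive (sym (ℕ.+-assoc (1 + cost e + T) (N′ * (1 + cost e + T)) (1 + cost e)))) , f′ , j

-- A stretch of iterations without the final failing test. Treating one pending segment takes many
-- iterations of the main loop but does not end it.
data Iter (e : Expr) (c : Cmd) : State → ℕ → State → Set where
  nil  : ∀ {σ} → Iter e c σ 0 σ
  cons : ∀ {σ s σ₁ t σ₂} → ⟦ e ⟧ σ ≢ 0 → Exec c σ s σ₁ → Iter e c σ₁ t σ₂ → Iter e c σ (1 + cost e + s + t) σ₂

iter-++ : ∀ {e c σ₁ s σ₂ t σ₃} → Iter e c σ₁ s σ₂ → Iter e c σ₂ t σ₃ → Iter e c σ₁ (s + t) σ₃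
iter-++ nil y = y
iter-++ {e} {c} {σ₁} {σ₃ = σ₃} (cons {s = s} {t = t′} nz x xs) y =
  subst (λ z → Iter e c σ₁ z σ₃) (sym (ℕ.+-assoc (1 + cost e + s) t′ _)) (cons nz x (iter-++ xs y))

iter-while : ∀ {e c σ t σ′} → Iter e c σ t σ′ → ⟦ e ⟧ σ′ ≡ 0 → Exec (while e c) σ (t + (1 + cost e)) σ′
iter-while nil z = ex-exit z
iter-while {e} {c} {σ} {σ′ = σ′} (cons {s = s} {t = t′} nz x xs) z =
  subst (λ w → Exec (while e c) σ w σ′) (sym (ℕ.+-assoc (1 + cost e + s) t′ (1 + cost e))) (ex-loop nz x (iter-while xs z))

iter-frame : ∀ {e c σ t σ′} → Iter e c σ t σ′ → Frame c σ σ′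
iter-frame nil = frame-refl
iter-frame (cons _ x xs) = frame-trans (frame x) (iter-frame xs)

-- The form of wp in which the command and the postcondition can be inferred.
record Spec (c : Cmd) (σ : State) (Q : Post) : Set where
  constructor spec
  field runs : ∃[ t ] ∃[ σ′ ] Exec c σ t σ′ × Q t σ′
open Spec public

byWp : ∀ {c σ Q} → wp c Q σ → Spec c σ Q
byWp {c} p = spec (wp-sound c p)

mapS : ∀ {c σ Q R} → Spec c σ Q → (∀ t σ′ → Frame c σ σ′ → Q t σ′ → R t σ′) → Spec c σ R
mapS (spec (t , σ′ , x , q)) k = spec (t , σ′ , x , k t σ′ (frame x) q)

seqS : ∀ {c d σ R} → Spec c σ (λ t σ′ → Spec d σ′ (λ t′ → R (t + t′))) → Spec (c ︔ d) σ R
seqS (spec (t , σ′ , x , spec (t′ , σ″ , y , r))) = spec (t + t′ , σ″ , ex-seq x y , r)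

setS : ∀ {r e d σ R} → Spec d (state (regs σ [ r ≔ ⟦ e ⟧ σ ]) (mem σ)) (λ t → R (1 + cost e + t)) → Spec (set r e ︔ d) σ R
setS (spec (t , σ′ , x , q)) = spec (_ , σ′ , ex-seq ex-set x , q)

storeS : ∀ {e f a v d σ R} → ⟦ e ⟧ σ ≡ a → ⟦ f ⟧ σ ≡ v → Spec d (state (regs σ) (mem σ [ a ≔ v ])) (λ t → R (1 + cost e + cost f + t)) →
         Spec (store e f ︔ d) σ R
storeS refl refl (spec (t , σ′ , x , q)) = spec (_ , σ′ , ex-seq ex-store x , q)

thenS : ∀ {e c d σ R} → ⟦ e ⟧ σ ≢ 0 → Spec c σ (λ t → R (1 + cost e + t)) → Spec (cond e c d) σ R
thenS nz (spec (t , σ′ , x , q)) = spec (_ , σ′ , ex-then nz x , q)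

elseS : ∀ {e c d σ R} → ⟦ e ⟧ σ ≡ 0 → Spec d σ (λ t → R (1 + cost e + t)) → Spec (cond e c d) σ R
elseS z (spec (t , σ′ , x , q)) = spec (_ , σ′ , ex-else z x , q)

seg : (ℕ → ℕ) → ℕ → ℕ → List ℕ
seg f a zero    = []
seg f a (suc l) = f a ∷ seg f (suc a) l

seg-cong : ∀ {f g} a b l → (∀ j → j < l → f (a + j) ≡ g (b + j)) → seg f a l ≡ seg g b l
seg-cong a b zero h = refl
seg-cong {f} {g} a b (suc l) h = cong₂ _∷_
  (subst₂ (λ x y → f x ≡ g y) (ℕ.+-identityʳ a) (ℕ.+-identityʳ b) (h 0 (s≤s z≤n)))
  (seg-cong (suc a) (suc b) l λ j j< → subst₂ (λ x y → f x ≡ g y) (ℕ.+-suc a j) (ℕ.+-suc b j) (h (suc j) (s≤s j<)))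

seg-++ : ∀ f a k l → seg f a (k + l) ≡ seg f a k ++ seg f (a + k) l
seg-++ f a zero l = cong (λ b → seg f b l) (sym (ℕ.+-identityʳ a))
seg-++ f a (suc k) l = cong (f a ∷_) (trans (seg-++ f (suc a) k l)
  (cong (λ b → seg f (suc a) k ++ seg f b l) (sym (ℕ.+-suc a k))))

seg-snoc : ∀ f a l → seg f a (suc l) ≡ seg f a l ++ f (a + l) ∷ []
seg-snoc f a l = trans (cong (seg f a) (ℕ.+-comm 1 l)) (seg-++ f a l 1)

seg-∈ : ∀ f a {l} j → j < l → f (a + j) ∈ˡ seg f a l
seg-∈ f a zero (s≤s _) = here (cong f (ℕ.+-identityʳ a))
seg-∈ f a {suc l} (suc j) (s≤s p) = there (subst (λ b → f b ∈ˡ seg f (suc a) l) (sym (ℕ.+-suc a j)) (seg-∈ f (suc a) j p))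

∈-seg : ∀ f a l {y} → y ∈ˡ seg f a l → ∃[ j ] j < l × y ≡ f (a + j)
∈-seg f a (suc l) (here p) = 0 , s≤s z≤n , trans p (cong f (sym (ℕ.+-identityʳ a)))
∈-seg f a (suc l) (there i) = let (j , j< , p) = ∈-seg f (suc a) l i in
  suc j , s≤s j< , trans p (cong f (sym (ℕ.+-suc a j)))

-- Orders of the vertices in which the modules are contiguous

record IsTournament (G : ℕ → ℕ → Bool) : Set where
  field
    irr  : ∀ u → G u u ≡ false
    tour : ∀ u v → u ≢ v → G v u ≡ not (G u v)

module Order {G : ℕ → ℕ → Bool} (tournament : IsTournament G) where
  open IsTournament tournament

  asym : ∀ {u v} → G u v ≡ true → G v u ≡ false
  asym {u} {v} p with u ℕ.≟ v
  ... | yes refl = irr u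
  ... | no  ne   = trans (tour u v ne) (cong not p)

  total : ∀ {u v} → u ≢ v → G u v ≡ false → G v u ≡ true
  total {u} {v} ne p = trans (tour u v ne) (cong not p)

  Forward : ℕ → ℕ → Set
  Forward x y = G y x ≡ false

  data Run⁺ (M : ℕ → Bool) : List ℕ → Set where
    done : ∀ {xs} → All (λ x → M x ≡ false) xs → Run⁺ M xs
    more : ∀ {x xs} → M x ≡ true → Run⁺ M xs → Run⁺ M (x ∷ xs)

  data Contig (M : ℕ → Bool) : List ℕ → Set where
    skip  : ∀ {x xs} → M x ≡ false → Contig M xs → Contig M (x ∷ xs)
    start : ∀ {xs} → Run⁺ M xs → Contig M xs

  Module : (ℕ → Bool) → List ℕ → List ℕ → Set
  Module M C W = ∀ {z y y′} → z ∈ˡ C ⊎ z ∈ˡ W → M z ≡ false → y ∈ˡ C → y′ ∈ˡ C →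
                 M y ≡ true → M y′ ≡ true → G z y ≡ G z y′

  -- `C` is the segment and `W` its outer pivots. Enlarging `W` weakens the claim, since fewer sets
  -- avoid `W` and are homogeneous for it; with `W` empty, every module of the subtournament on `C`
  -- is contiguous.
  record Good (C W ℓ : List ℕ) : Set where
    field
      perm   : ℓ ↭ C
      path   : Linked Forward ℓ
      contig : ∀ M → (∀ {z} → z ∈ˡ W → M z ≡ false) → Module M C W → Contig M ℓ
  open Good public

  -- Traces of merging that keep the comparison behind every choice; contiguity rests on these
  -- comparisons.
  data Merge : List ℕ → List ℕ → List ℕ → Set where
    nilˡ  : ∀ {ys} → Merge [] ys ys
    nilʳ  : ∀ {xs} → Merge xs [] xs
    left  : ∀ {x y xs ys zs} → Forward x y → Merge xs (y ∷ ys) zs → Merge (x ∷ xs) (y ∷ ys) (x ∷ zs)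
    right : ∀ {x y xs ys zs} → Forward y x → Merge (x ∷ xs) ys zs → Merge (x ∷ xs) (y ∷ ys) (y ∷ zs)

  merge-swap : ∀ {xs ys zs} → Merge xs ys zs → Merge ys xs zs
  merge-swap nilˡ = nilʳ
  merge-swap nilʳ = nilˡ
  merge-swap (left p m) = right p (merge-swap m)
  merge-swap (right p m) = left p (merge-swap m)

  merge-↭ : ∀ {xs ys zs} → Merge xs ys zs → zs ↭ xs ++ ys
  merge-↭ nilˡ = ↭-refl
  merge-↭ (nilʳ {xs}) = ++-comm [] xs
  merge-↭ (left {x} _ m) = prep x (merge-↭ m)
  merge-↭ (right {x} {y} {xs} {ys} _ m) = ↭-trans (prep y (merge-↭ m)) (↭-sym (shift y (x ∷ xs) ys))

  merge-path-from : ∀ {z xs ys zs} → Merge xs ys zs → Linked Forward (z ∷ xs) → Linked Forward (z ∷ ys) →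
                    Linked Forward (z ∷ zs)
  merge-path-from nilˡ p q = q
  merge-path-from nilʳ p q = p
  merge-path-from (left f m) (a ∷ p) (b ∷ q) = a ∷ merge-path-from m p (f ∷ q)
  merge-path-from (right f m) (a ∷ p) (b ∷ q) = b ∷ merge-path-from m (f ∷ p) q

  merge-path : ∀ {xs ys zs} → Merge xs ys zs → Linked Forward xs → Linked Forward ys → Linked Forward zs
  merge-path nilˡ p q = q
  merge-path nilʳ p q = p
  merge-path (left f m) p q = merge-path-from m p (f ∷ q)
  merge-path (right f m) p q = merge-path-from m (f ∷ p) q

  merge-All : ∀ {P : ℕ → Set} {xs ys zs} → Merge xs ys zs → All P xs → All P ys → All P zs
  merge-All nilˡ p q = q
  merge-All nilʳ p q = p
  merge-All (left f m) (a ∷ p) q = a ∷ merge-All m p q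
  merge-All (right f m) p (b ∷ q) = b ∷ merge-All m p q

  -- While members of `M` remain, the pending `y` cannot be chosen: it would have to beat the next
  -- member, against the hypothesis.
  merge-run : ∀ {M xs y ys zs} → Merge xs (y ∷ ys) zs → Run⁺ M xs → All (λ z → M z ≡ false) (y ∷ ys) →
              (∀ {m} → m ∈ˡ xs → M m ≡ true → G y m ≡ false) → Run⁺ M zs
  merge-run m (done a) q h = done (merge-All m a q)
  merge-run (left f m) (more p r) q h = more p (merge-run m r q (h ∘ there))
  merge-run {M} (right {x} {y} f m) (more p r) (n ∷ q) h =
    case trans (sym (total (λ { refl → case trans (sym p) n of λ () }) f)) (h (here refl) p) of λ ()

  -- A module inside one of the two lists is not interrupted, because every element
  -- of the other list compares in the same way with all its members.
  merge-contig : ∀ {M xs ys zs} → Merge xs ys zs → Contig M xs → All (λ z → M z ≡ false) ys →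
                 (∀ {z y y′} → z ∈ˡ ys → y ∈ˡ xs → y′ ∈ˡ xs → M y ≡ true → M y′ ≡ true → G z y ≡ G z y′) →
                 Contig M zs
  merge-contig nilˡ c q h = start (done q)
  merge-contig nilʳ c q h = c
  merge-contig (left f m) (skip n c) q h = skip n (merge-contig m c q (λ a b b′ → h a (there b) (there b′)))
  merge-contig m@(left _ _) (start (done a)) q h = start (done (merge-All m a q))
  merge-contig (left f m) (start (more p r)) q h =
    start (more p (merge-run m r q (λ i k → trans (h (here refl) (there i) (here refl) k p) f)))
  merge-contig (right f m) c (n ∷ q) h = skip n (merge-contig m c q (h ∘ there))

  search : ∀ (M : ℕ → Bool) xs → All (λ x → M x ≡ false) xs ⊎ (∃[ x ] x ∈ˡ xs × M x ≡ true)
  search M [] = inj₁ []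
  search M (x ∷ xs) with M x in eq | search M xs
  ... | true  | _ = inj₂ (x , here refl , eq)
  ... | false | inj₁ a = inj₁ (eq ∷ a)
  ... | false | inj₂ (y , i , p) = inj₂ (y , there i , p)

  good-empty : ∀ {W} → Good [] W []
  good-empty = record { perm = ↭-refl ; path = [] ; contig = λ M _ _ → start (done []) }

  good-single : ∀ {x W} → Good (x ∷ []) W (x ∷ [])
  good-single {x} = record { perm = ↭-refl ; path = [-] ; contig = λ M _ _ → one M }
    where
    one : ∀ M → Contig M (x ∷ [])
    one M with M x in eq
    ... | true  = start (more eq (done []))
    ... | false = start (done (eq ∷ []))

  -- A pivot outside of `M` sees all members alike, so they cannot occur on both sides of its
  -- partition.
  one-side : ∀ {M C W x C₁ C₂} → Module M C W → x ∈ˡ C ⊎ x ∈ˡ W → M x ≡ false →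
             (∀ {y} → y ∈ˡ C₁ → y ∈ˡ C) → (∀ {y} → y ∈ˡ C₂ → y ∈ˡ C) →
             All (λ y → G x y ≡ false) C₁ → All (λ y → G x y ≡ true) C₂ →
             All (λ y → M y ≡ false) C₁ ⊎ All (λ y → M y ≡ false) C₂
  one-side {M} {C₁ = C₁} md x∈ mx s₁ s₂ a₁ a₂ with search M C₁
  ... | inj₁ a = inj₁ a
  ... | inj₂ (y , i , p) = inj₂ (All.tabulate λ {z} j → ¬true λ q →
          case trans (sym (All.lookup a₂ j)) (trans (md x∈ mx (s₂ j) (s₁ i) q p) (All.lookup a₁ i)) of λ ())

  module _ {C W C₁ C₂ W₁ W₂ ℓ₁ ℓ₂ ℓ : List ℕ} {x : ℕ} (split : C₁ ++ C₂ ↭ C)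
           (out : All (λ y → G x y ≡ false) C₁) (inn : All (λ y → G x y ≡ true) C₂)
           (W₁⊆ : ∀ {z} → z ∈ˡ W₁ → z ∈ˡ C₂ ⊎ z ∈ˡ W) (W₂⊆ : ∀ {z} → z ∈ˡ W₂ → z ∈ˡ C₁ ⊎ z ∈ˡ W)
           (good₁ : Good C₁ W₁ ℓ₁) (good₂ : Good C₂ W₂ ℓ₂) where

    private
      s₁ : ∀ {y} → y ∈ˡ C₁ → y ∈ˡ C
      s₁ = ∈-resp-↭ split ∘ ∈-++⁺ˡ
      s₂ : ∀ {y} → y ∈ˡ C₂ → y ∈ˡ C
      s₂ = ∈-resp-↭ split ∘ ∈-++⁺ʳ C₁

    -- By `one-side` a module misses one half. That half is then outside of the module, so it is a
    -- legitimate set of pivots for the other half and cannot interrupt the module in the merge.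
    good-pivot : x ∈ˡ W → Merge ℓ₁ ℓ₂ ℓ → Good C W ℓ
    good-pivot x∈W m = record
      { perm = ↭-trans (merge-↭ m) (↭-trans (++⁺ (perm good₁) (perm good₂)) split)
      ; path = merge-path m (path good₁) (path good₂)
      ; contig = con }
      where
      con : ∀ M → (∀ {z} → z ∈ˡ W → M z ≡ false) → Module M C W → Contig M ℓ
      con M wf md with one-side md (inj₂ x∈W) (wf x∈W) s₁ s₂ out inn
      ... | inj₁ n = merge-contig (merge-swap m)
            (contig good₂ M (λ i → case W₂⊆ i of λ { (inj₁ j) → All.lookup n j ; (inj₂ j) → wf j })
              (λ { (inj₁ i) mz a b → md (inj₁ (s₂ i)) mz (s₂ a) (s₂ b)
                 ; (inj₂ i) mz a b → md (case W₂⊆ i of λ { (inj₁ j) → inj₁ (s₁ j) ; (inj₂ j) → inj₂ j }) mz (s₂ a) (s₂ b) }))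
            (All.tabulate (All.lookup n ∘ ∈-resp-↭ (perm good₁)))
            (λ i a b → md (inj₁ (s₁ (∈-resp-↭ (perm good₁) i))) (All.lookup n (∈-resp-↭ (perm good₁) i))
                          (s₂ (∈-resp-↭ (perm good₂) a)) (s₂ (∈-resp-↭ (perm good₂) b)))
      ... | inj₂ n = merge-contig m
            (contig good₁ M (λ i → case W₁⊆ i of λ { (inj₁ j) → All.lookup n j ; (inj₂ j) → wf j })
              (λ { (inj₁ i) mz a b → md (inj₁ (s₁ i)) mz (s₁ a) (s₁ b)
                 ; (inj₂ i) mz a b → md (case W₁⊆ i of λ { (inj₁ j) → inj₁ (s₂ j) ; (inj₂ j) → inj₂ j }) mz (s₁ a) (s₁ b) }))
            (All.tabulate (All.lookup n ∘ ∈-resp-↭ (perm good₂)))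
            (λ i a b → md (inj₁ (s₂ (∈-resp-↭ (perm good₂) i))) (All.lookup n (∈-resp-↭ (perm good₂) i))
                          (s₁ (∈-resp-↭ (perm good₁) a)) (s₁ (∈-resp-↭ (perm good₁) b)))

  ++-path : ∀ {xs v ys} → Linked Forward xs → Linked Forward ys → All (λ y → Forward y v) xs → All (Forward v) ys →
            Linked Forward (xs ++ v ∷ ys)
  ++-path [] [] _ _ = [-]
  ++-path [] [-] _ (b ∷ _) = b ∷ [-]
  ++-path [] q@(_ ∷ _) _ (b ∷ _) = b ∷ q
  ++-path [-] q (a ∷ _) bs = a ∷ ++-path [] q [] bs
  ++-path (r ∷ p) q (a ∷ as) bs = r ∷ ++-path p q as bs

  contig-pad : ∀ {M xs ys} → Contig M xs → All (λ y → M y ≡ false) ys → Contig M (xs ++ ys)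
  contig-pad (skip n c) a = skip n (contig-pad c a)
  contig-pad {M} {ys = ys} (start r) a = start (run r)
    where
    all : ∀ {xs} → All (λ y → M y ≡ false) xs → All (λ y → M y ≡ false) (xs ++ ys)
    all [] = a
    all (b ∷ bs) = b ∷ all bs
    run : ∀ {xs} → Run⁺ M xs → Run⁺ M (xs ++ ys)
    run (done b) = done (all b)
    run (more p r) = more p (run r)

  skip-all : ∀ {M xs ys} → All (λ y → M y ≡ false) xs → Contig M ys → Contig M (xs ++ ys)
  skip-all [] c = c
  skip-all (a ∷ as) c = skip a (skip-all as c)

  -- Along a forward path one cannot return from R to M if R is dominated by M.
  rest-out : ∀ {M : ℕ → Bool} {x xs} → M x ≡ false → Linked Forward (x ∷ xs) →
             (∀ {z y} → z ∈ˡ (x ∷ xs) → y ∈ˡ (x ∷ xs) → M z ≡ false → M y ≡ true → G y z ≡ true) →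
             All (λ y → M y ≡ false) (x ∷ xs)
  rest-out n [-] h = n ∷ []
  rest-out {M} n (f ∷ p) h = n ∷ rest-out {M}
    (¬true λ q → case trans (sym f) (h (here refl) (there (here refl)) n q) of λ ()) p
    (λ a b → h (there a) (there b))

  run-after : ∀ {M xs} → Linked Forward xs →
              (∀ {z y} → z ∈ˡ xs → y ∈ˡ xs → M z ≡ false → M y ≡ true → G y z ≡ true) → Run⁺ M xs
  run-after [] h = done []
  run-after {M} {x ∷ xs} p h with M x in eq
  ... | false = done (rest-out {M} eq p h)
  ... | true  = more eq (run-after (Linked.tail p) (λ a b → h (there a) (there b)))

  run-into : ∀ {M x xs ys} → M x ≡ true → Linked Forward (x ∷ xs) →
             (∀ {z y} → z ∈ˡ (x ∷ xs) → y ∈ˡ (x ∷ xs) → M z ≡ false → M y ≡ true → G z y ≡ true) →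
             Run⁺ M ys → Run⁺ M (x ∷ xs ++ ys)
  run-into p [-] h r = more p r
  run-into {M} {x} {y ∷ xs} p (f ∷ q) h r with M y in eq
  ... | false = case trans (sym f) (h (there (here refl)) (here refl) eq p) of λ ()
  ... | true  = more p (run-into eq q (λ a b → h (there a) (there b)) r)

  contig-into : ∀ {M xs ys} → Linked Forward xs →
                (∀ {z y} → z ∈ˡ xs → y ∈ˡ xs → M z ≡ false → M y ≡ true → G z y ≡ true) →
                Run⁺ M ys → Contig M (xs ++ ys)
  contig-into [] h r = start r
  contig-into {M} {x ∷ xs} p h r with M x in eq
  ... | true  = start (run-into eq p h r)
  ... | false = skip eq (contig-into (Linked.tail p) (λ a b → h (there a) (there b)) r)

  -- If `v` lies in `M`, the rest of `L` beats all of `M` and the rest of `R` loses to all of `M`;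
  -- along forward paths this makes `M` a suffix of `ℓ₁` and a prefix of `ℓ₂`, joined by `v`. If
  -- not, `v` itself acts as a pivot and `M` misses `L` or `R`.
  good-level : ∀ {C W L R W₁ W₂ ℓ₁ ℓ₂ v} → L ++ v ∷ R ↭ C →
               All (λ y → G v y ≡ false) L → All (λ y → G v y ≡ true) R →
               (∀ {z} → z ∈ˡ W₁ → z ∈ˡ (v ∷ R)) → (∀ {z} → z ∈ˡ W₂ → z ∈ˡ L ⊎ z ≡ v) →
               Good L W₁ ℓ₁ → Good R W₂ ℓ₂ → Good C W (ℓ₁ ++ v ∷ ℓ₂)
  good-level {C} {W} {L} {R} {W₁} {W₂} {ℓ₁} {ℓ₂} {v} split aL aR W₁⊆ W₂⊆ g₁ g₂ = record
    { perm = ↭-trans (++⁺ (perm g₁) (prep v (perm g₂))) split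
    ; path = ++-path (path g₁) (path g₂) (All.tabulate (All.lookup aL ∘ p₁)) (All.tabulate (asym ∘ All.lookup aR ∘ p₂))
    ; contig = con }
    where
    p₁ : ∀ {y} → y ∈ˡ ℓ₁ → y ∈ˡ L
    p₁ = ∈-resp-↭ (perm g₁)
    p₂ : ∀ {y} → y ∈ˡ ℓ₂ → y ∈ˡ R
    p₂ = ∈-resp-↭ (perm g₂)
    s₁ : ∀ {y} → y ∈ˡ L → y ∈ˡ C
    s₁ = ∈-resp-↭ split ∘ ∈-++⁺ˡ
    s₂ : ∀ {y} → y ∈ˡ (v ∷ R) → y ∈ˡ C
    s₂ = ∈-resp-↭ split ∘ ∈-++⁺ʳ L
    v∈ : v ∈ˡ C
    v∈ = s₂ (here refl)
    diff : ∀ {M y z} → M z ≡ false → M y ≡ true → z ≢ y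
    diff n p refl = case trans (sym n) p of λ ()
    con : ∀ M → (∀ {z} → z ∈ˡ W → M z ≡ false) → Module M C W → Contig M (ℓ₁ ++ v ∷ ℓ₂)
    con M wf md with M v in mv
    ... | true = contig-into (path g₁)
            (λ {z} {y} a b n p → trans (md (inj₁ (s₁ (p₁ a))) n (s₁ (p₁ b)) v∈ p mv)
                                 (total (λ e → diff {M} n mv (sym e)) (All.lookup aL (p₁ a))))
            (more mv (run-after (path g₂) (λ {z} {y} a b n p → total (diff {M} n p)
              (trans (md (inj₁ (s₂ (there (p₂ a)))) n (s₂ (there (p₂ b))) v∈ p mv) (asym (All.lookup aR (p₂ a)))))))
    ... | false with one-side md (inj₁ v∈) mv s₁ (s₂ ∘ there) aL aR
    ... | inj₁ n = skip-all (All.tabulate (All.lookup n ∘ p₁)) (skip mv (contig g₂ M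
            (λ i → case W₂⊆ i of λ { (inj₁ j) → All.lookup n j ; (inj₂ refl) → mv })
            (λ i mz a b → md (inj₁ (case i of λ { (inj₁ j) → s₂ (there j)
                                                ; (inj₂ j) → case W₂⊆ j of λ { (inj₁ k) → s₁ k ; (inj₂ refl) → v∈ } }))
                             mz (s₂ (there a)) (s₂ (there b)))))
    ... | inj₂ n = contig-pad (contig g₁ M
            (λ i → case W₁⊆ i of λ { (here refl) → mv ; (there j) → All.lookup n j })
            (λ i mz a b → md (inj₁ (case i of λ { (inj₁ j) → s₁ j ; (inj₂ j) → s₂ (W₁⊆ j) })) mz (s₁ a) (s₁ b)))
          (mv ∷ All.tabulate (All.lookup n ∘ p₂))

-- Machine access to the switched tournament

inp : Expr → Expr → Expr
inp u v = load (reg rN ⊗ u ⊕ v)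

-- On bits, `≈` is the negated exclusive or. The two negations cancel, so the nested tests give the
-- exclusive or of the three input bits.
arcᴱ : Expr → Expr → Expr
arcᴱ u v = (inp u v ≈ inp u (lit 0)) ≈ inp v (lit 0)

switched : (ℕ → ℕ) → ℕ → ℕ → ℕ → ℕ
switched f n u v = bit (bit (f (n * u + v) ≡ᵇ f (n * u + 0)) ≡ᵇ f (n * v + 0))

-- The memory consists of the input, of output rows of length `s` from `tb` on, and of the
-- interleaved work arrays from `ab` on.
record Layout : Set where
  field
    n m s tb ab : ℕ
    n²≤ab : n * n ≤ ab
    m<n   : m < n

module Machine (L : Layout) (G : ℕ → ℕ → Bool) where
  open Layout L public

  record Env (σ : State) : Set where
    field
      N≡   : regs σ rN ≡ n
      M≡   : regs σ rM ≡ m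
      S≡   : regs σ rS ≡ s
      TB≡  : regs σ rTB ≡ tb
      AB≡  : regs σ rAB ≡ ab
      arcs : ∀ {u v} → u < n → v < n → switched (mem σ) n u v ≡ bit (G u v)
  open Env public

  index< : ∀ {u v} → u < n → v < n → n * u + v < n * n
  index< {u} {v} u< v< = ℕ.<-≤-trans (ℕ.+-monoʳ-< (n * u) v<)
    (ℕ.≤-trans (ℕ.≤-reflexive (trans (ℕ.+-comm (n * u) n) (sym (ℕ.*-suc n u)))) (ℕ.*-monoʳ-≤ n u<))

  Pure : Cmd → Set
  Pure c = T (puts (λ _ → true) c ∧ (keeps rN c ∧ (keeps rM c ∧ (keeps rS c ∧ keeps rTB c))))

  env-frame : ∀ {c σ σ′} → Frame c σ σ′ → {_ : Pure c} → Env σ → Env σ′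
  env-frame {c} {σ} {σ′} f {h} e = record
    { N≡ = trans (reg-same f rN {k k1}) (N≡ e) ; M≡ = trans (reg-same f rM {k k2}) (M≡ e)
    ; S≡ = trans (reg-same f rS {k k3}) (S≡ e) ; TB≡ = trans (reg-same f rTB {k k4}) (TB≡ e)
    ; AB≡ = trans (reg-same f rAB {k (puts-AB _ c p0)}) (AB≡ e)
    ; arcs = λ u< v< → trans (cong₂ (λ x y → bit (x ≡ᵇ y)) (cong₂ (λ x y → bit (x ≡ᵇ y)) (low u< v<) (low u< 0<)) (low v< 0<)) (arcs e u< v<)
    }
    where
    k : ∀ {b} → b ≡ true → T b
    k q = subst T (sym q) tt
    p0 = proj₁ (∧-true {puts (λ _ → true) c} (T-true h))
    r1 = proj₂ (∧-true {puts (λ _ → true) c} (T-true h))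
    k1 = proj₁ (∧-true {keeps rN c} r1)
    r2 = proj₂ (∧-true {keeps rN c} r1)
    k2 = proj₁ (∧-true {keeps rM c} r2)
    r3 = proj₂ (∧-true {keeps rM c} r2)
    k3 = proj₁ (∧-true {keeps rS c} r3)
    k4 = proj₂ (∧-true {keeps rS c} r3)
    0< : 0 < n
    0< = ℕ.≤-<-trans z≤n m<n
    low : ∀ {u v} → u < n → v < n → mem σ′ (n * u + v) ≡ mem σ (n * u + v)
    low u< v< = low-same f {k p0} _ (ℕ.<-≤-trans (index< u< v<) (subst (n * n ≤_) (sym (AB≡ e)) n²≤ab))

  arcᴱ-value : ∀ {σ} u v {x y} → Env σ → ⟦ u ⟧ σ ≡ x → ⟦ v ⟧ σ ≡ y → x < n → y < n → ⟦ arcᴱ u v ⟧ σ ≡ bit (G x y)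
  arcᴱ-value {σ} u v {x} {y} e p q x< y< =
    trans (cong₂ (λ N z → switched (mem σ) N z (⟦ v ⟧ σ)) (N≡ e) p)
          (trans (cong (switched (mem σ) n x) q) (arcs e x< y<))

  -- Partition and merge

  rSP rT rLO rA rB rHI rX rI rW rZ rY rLV rK rE : ℕ
  rSP = 8
  rT  = 9
  rLO = 10
  rA  = 11
  rB  = 12
  rHI = 13
  rX  = 14
  rI  = 15
  rW  = 16
  rZ  = 17
  rY  = 18
  rLV = 19
  rK  = 25
  rE  = 26

  copy : ℕ → ℕ → Cmd
  copy ks kd = while (reg rI ≺ reg rE) (put kd (reg rW) (ld ks (reg rI)) ︔ inc rW ︔ inc rI)

  bit-true : ∀ {b} → bit b ≢ 0 → b ≡ true
  bit-true {true}  _ = refl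
  bit-true {false} h = ⊥-elim (h refl)

  bit-false : ∀ {b} → bit b ≡ 0 → b ≡ false
  bit-false {false} _ = refl

  bit≢0 : ∀ {b x} → x ≡ bit b → b ≡ true → x ≢ 0
  bit≢0 refl refl ()

  record Copied (ks kd i w len : ℕ) (σ σ′ : State) : Set where
    field
      rI≡   : regs σ′ rI ≡ i + len
      rW≡   : regs σ′ rW ≡ w + len
      moved : seg (arr σ′ kd) w len ≡ seg (arr σ ks) i len
      rest  : ∀ j → j < w ⊎ w + len ≤ j → arr σ′ kd j ≡ arr σ kd j

  copy-spec : ∀ ks kd → {_ : T (puts (_≡ᵇ kd) (copy ks kd))} → {_ : T (not (ks ≡ᵇ kd))} → {_ : T (ks <ᵇ 16)} → {_ : T (kd <ᵇ 16)} →
              ∀ {σ} i w len → regs σ rI ≡ i → regs σ rW ≡ w → regs σ rE ≡ i + len →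
              wp (copy ks kd) (λ t σ′ → Lin 4 40 len t × Frame (copy ks kd) σ σ′ × Copied ks kd i w len σ σ′) σ
  copy-spec ks kd {h} {h′} {h″} {kd<} {σ₀} i w len pI pW pE =
    loop-rule {e = reg rI ≺ reg rE} 36 Inv (Copied ks kd i w len σ₀) step len init
      (λ t σ′ l f d → l , f , d)
    where
    c = put kd (reg rW) (ld ks (reg rI)) ︔ inc rW ︔ inc rI
    record Inv (k : ℕ) (σ : State) : Set where
      pattern
      constructor inv
      field
        d     : ℕ
        d+k   : d + k ≡ len
        rI≡   : regs σ rI ≡ i + d
        rW≡   : regs σ rW ≡ w + d
        moved : seg (arr σ kd) w d ≡ seg (arr σ₀ ks) i d
        rest  : ∀ j → j < w ⊎ w + d ≤ j → arr σ kd j ≡ arr σ₀ kd j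
    init : Inv len σ₀
    init = inv 0 refl (trans pI (sym (ℕ.+-identityʳ i))) (trans pW (sym (ℕ.+-identityʳ w))) refl (λ _ _ → refl)
    step : ∀ k σ → Frame c σ₀ σ → Inv k σ → _
    step zero σ f (inv d d+k pI′ pW′ mv rs) = inj₁ (cong bit (<-false (λ l → ℕ.<-irrefl refl (subst₂ _<_ pI″ (trans (reg-same f rE) pE) l))) ,
      record { rI≡ = pI″ ; rW≡ = trans pW′ (cong (w +_) d≡)
             ; moved = subst (λ z → seg (arr σ kd) w z ≡ seg (arr σ₀ ks) i z) d≡ mv
             ; rest = λ j q → rs j (subst (λ z → j < w ⊎ w + z ≤ j) (sym d≡) q) })
      where
      d≡ : d ≡ len
      d≡ = trans (sym (ℕ.+-identityʳ d)) d+k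
      pI″ : regs σ rI ≡ i + len
      pI″ = trans pI′ (cong (i +_) d≡)
    step (suc k) σ f (inv d d+k pI′ pW′ mv rs) = inj₂ (k , refl ,
      bit≢0 refl (<-true (subst₂ _<_ (sym pI′) (sym (trans (reg-same f rE) pE)) (ℕ.+-monoʳ-< i d<))) ,
      ℕ.≤ᵇ⇒≤ _ _ tt , inv (suc d) (trans (sym (ℕ.+-suc d k)) d+k)
        (trans (cong (_+ 1) pI′) (trans (ℕ.+-assoc i d 1) (cong (i +_) (ℕ.+-comm d 1))))
        (trans (cong (_+ 1) pW′) (trans (ℕ.+-assoc w d 1) (cong (w +_) (ℕ.+-comm d 1))))
        (trans (seg-snoc _ w d) (trans (cong₂ (λ x y → x ++ y ∷ [])
           (trans (seg-cong w w d (λ j j< → arr-idx (mem σ) (regs σ rAB) kd {regs σ rW} {w + j} {_} {kd<} (λ q → ℕ.<-irrefl (trans (sym q) pW′) (ℕ.+-monoʳ-< w j<)))) mv)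
           (trans (arr-same (mem σ) (regs σ rAB) kd pW′) (trans (arr-keep f (_≡ᵇ kd) ks {h} {h″} {h′} (regs σ rI)) (cong (arr σ₀ ks) pI′))))
         (sym (seg-snoc _ i d))))
        (λ j q → trans (arr-idx (mem σ) (regs σ rAB) kd {regs σ rW} {j} {_} {kd<} (λ r → ne j q (trans (sym pW′) r)))
                       (rs j (case q of λ { (inj₁ a) → inj₁ a ; (inj₂ b) → inj₂ (ℕ.≤-trans (ℕ.+-monoʳ-≤ w (ℕ.n≤1+n d)) b) }))))
      where
      d< : d < len
      d< = subst (d <_) d+k (ℕ.m<m+n d (s≤s z≤n))
      ne : ∀ j → j < w ⊎ w + suc d ≤ j → w + d ≢ j
      ne j (inj₁ a) refl = ℕ.<⇒≱ a (ℕ.m≤m+n w d)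
      ne j (inj₂ b) refl = ℕ.<⇒≱ (ℕ.+-monoʳ-< w (ℕ.n<1+n d)) b

  succ-idx : ∀ {r} i d → r ≡ i + d → r + 1 ≡ i + suc d
  succ-idx i d p = trans (cong (_+ 1) p) (trans (ℕ.+-assoc i d 1) (cong (i +_) (ℕ.+-comm d 1)))

  succ-idx₀ : ∀ {r} d → r ≡ d → r + 1 ≡ suc d
  succ-idx₀ d p = succ-idx 0 d p

  -- The vertices not dominated by the pivot are compacted in place, the write position never
  -- passing the read position; the others wait in array 1.
  scan : Cmd
  scan = while (reg rI ≺ reg rB)
           (set rY (ld 0 (reg rI)) ︔
            cond (arcᴱ (reg rX) (reg rY)) (put 1 (reg rZ) (reg rY) ︔ inc rZ) (put 0 (reg rW) (reg rY) ︔ inc rW) ︔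
            inc rI)

  partition : Cmd
  partition = set rW (reg rI) ︔ set rZ (lit 0) ︔ scan ︔ set rK (reg rW) ︔ set rE (reg rZ) ︔ set rI (lit 0) ︔ copy 1 0

  Outs Ins : ℕ → List ℕ → Set
  Outs x = All (λ y → G x y ≡ false)
  Ins  x = All (λ y → G x y ≡ true)

  snoc-↭ : ∀ (xs ys zs : List ℕ) {y} → xs ++ ys ↭ zs → (xs ++ y ∷ []) ++ ys ↭ zs ++ y ∷ []
  snoc-↭ xs ys zs {y} p = ↭-trans (↭-reflexive (++-assoc xs (y ∷ []) ys))
    (↭-trans (shift y xs ys) (↭-trans (prep y p) (++-comm (y ∷ []) zs)))

  Outside : State → State → ℕ → ℕ → Set
  Outside σ σ′ a l = ∀ j → j < a ⊎ a + l ≤ j → arr σ′ 0 j ≡ arr σ 0 j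

  record Scanned (x i len : ℕ) (σ₀ σ : State) : Set where
    pattern
    constructor scanned
    field
      k z  : ℕ
      k+z  : k + z ≡ len
      rI≡  : regs σ rI ≡ i + len
      rW≡  : regs σ rW ≡ i + k
      rZ≡  : regs σ rZ ≡ z
      outs : Outs x (seg (arr σ 0) i k)
      ins  : Ins x (seg (arr σ 1) 0 z)
      perm : seg (arr σ 0) i k ++ seg (arr σ 1) 0 z ↭ seg (arr σ₀ 0) i len
      rest : Outside σ₀ σ i len

  scan-spec : ∀ {σ₀} x i len → Env σ₀ → x < n → (∀ j → j < len → arr σ₀ 0 (i + j) < n) →
              regs σ₀ rI ≡ i → regs σ₀ rB ≡ i + len → regs σ₀ rX ≡ x → regs σ₀ rW ≡ i → regs σ₀ rZ ≡ 0 →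
              wp scan (λ t σ → Lin 4 90 len t × Frame scan σ₀ σ × Scanned x i len σ₀ σ) σ₀
  scan-spec {σ₀} x i len env x< P< pI pB pX pW pZ =
    loop-rule 86 Inv (Scanned x i len σ₀) step len init (λ t σ l f d → l , f , d)
    where
    body = set rY (ld 0 (reg rI)) ︔
            cond (arcᴱ (reg rX) (reg rY)) (put 1 (reg rZ) (reg rY) ︔ inc rZ) (put 0 (reg rW) (reg rY) ︔ inc rW) ︔
            inc rI
    Inv : ℕ → State → Set
    Inv r σ = ∃[ d ] d + r ≡ len × Scanned x i d σ₀ σ
    init : Inv len σ₀
    init = 0 , refl , scanned 0 0 refl (trans pI (sym (ℕ.+-identityʳ i))) (trans pW (sym (ℕ.+-identityʳ i))) pZ [] [] ↭-refl (λ _ _ → refl)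
    step : ∀ r σ → Frame body σ₀ σ → Inv r σ → _
    step zero σ f (d , d+ , sc) with trans (sym (ℕ.+-identityʳ d)) d+
    ... | refl = inj₁ (cong bit (<-false (λ l → ℕ.<-irrefl refl (subst₂ _<_ (Scanned.rI≡ sc) (trans (reg-same f rB) pB) l))) , sc)
    step (suc r) σ f (d , d+ , sc@(scanned k z k+z pI′ pW′ pZ′ os is pm rs)) = inj₂ (r , refl ,
      bit≢0 refl (<-true (subst₂ _<_ (sym pI′) (sym (trans (reg-same f rB) pB)) (ℕ.+-monoʳ-< i d<))) ,
      (λ nz → ℕ.≤ᵇ⇒≤ _ _ tt , suc d , d+′ ,
         let gt : G x (P (i + d)) ≡ true
             gt = bit-true (λ q → nz (trans val q)) in
         scanned k (suc z) (trans (ℕ.+-suc k z) (cong suc k+z)) (succ-idx i d pI′) pW′ (succ-idx₀ z pZ′)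
           (subst (Outs x) (sym segI) os)
           (subst (Ins x) (sym segI′) (All.++⁺ is (gt ∷ [])))
           (subst₂ _↭_ (sym (trans (cong₂ _++_ segI segI′) (sym (++-assoc (seg P i k) _ _)))) (sym (goal≡))
             (++⁺ʳ (P (i + d) ∷ []) pm))
           (λ j q → trans (arr-other (mem σ) (regs σ rAB) 1 0 (regs σ rZ) j) (rs j (weak j q)))) ,
      (λ z0 → ℕ.≤ᵇ⇒≤ _ _ tt , suc d , d+′ ,
         let gf : G x (P (i + d)) ≡ false
             gf = bit-false (trans (sym val) z0) in
         scanned (suc k) z (cong suc k+z) (succ-idx i d pI′) (succ-idx i k pW′) pZ′
           (subst (Outs x) (sym segO) (All.++⁺ os (gf ∷ [])))
           (subst (Ins x) (sym segO′) is)
           (subst₂ _↭_ (sym (cong₂ _++_ segO segO′)) (sym goal≡) (snoc-↭ (seg P i k) (seg Q 0 z) _ pm))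
           (λ j q → trans (arr-idx (mem σ) (regs σ rAB) 0 {regs σ rW} {j} (λ e → ne j q (trans (sym pW′) e))) (rs j (weak j q)))))
      where
      P = arr σ 0
      Q = arr σ 1
      d< : d < len
      d< = subst (d <_) d+ (ℕ.m<m+n d (s≤s z≤n))
      d+′ = trans (sym (ℕ.+-suc d r)) d+
      k≤d : k ≤ d
      k≤d = subst (k ≤_) k+z (ℕ.m≤m+n k z)
      val : ⟦ arcᴱ (reg rX) (reg rY) ⟧ (state (regs σ [ rY ≔ P (regs σ rI) ]) (mem σ)) ≡ bit (G x (P (i + d)))
      P≡ : P (i + d) ≡ arr σ₀ 0 (i + d)
      P≡ = rs (i + d) (inj₂ ℕ.≤-refl)
      val = arcᴱ-value (reg rX) (reg rY) {x} {P (i + d)}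
              (env-frame (frame (ex-set {rY} {ld 0 (reg rI)} {σ})) (env-frame f env))
              (trans (reg-same f rX) pX) (cong P pI′) x< (subst (_< n) (sym P≡) (P< d d<))
      goal≡ : seg (arr σ₀ 0) i (suc d) ≡ seg (arr σ₀ 0) i d ++ P (i + d) ∷ []
      goal≡ = trans (seg-snoc _ i d) (cong (λ y → seg (arr σ₀ 0) i d ++ y ∷ []) (sym P≡))
      weak : ∀ j → j < i ⊎ i + suc d ≤ j → j < i ⊎ i + d ≤ j
      weak j (inj₁ q) = inj₁ q
      weak j (inj₂ q) = inj₂ (ℕ.≤-trans (ℕ.+-monoʳ-≤ i (ℕ.n≤1+n d)) q)
      ne : ∀ j → j < i ⊎ i + suc d ≤ j → i + k ≢ j
      ne j (inj₁ q) refl = ℕ.<⇒≱ q (ℕ.m≤m+n i k)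
      ne j (inj₂ q) refl = ℕ.<⇒≱ (ℕ.+-monoʳ-< i (s≤s k≤d)) q
      y = P (regs σ rI)
      mI = mem σ [ regs σ rAB + (regs σ rZ * 16 + 1) ≔ y ]
      mO = mem σ [ regs σ rAB + (regs σ rW * 16 + 0) ≔ y ]
      at : (ℕ → ℕ) → ℕ → ℕ → ℕ
      at f k j = f (regs σ rAB + (j * 16 + k))
      segI : seg (at mI 0) i k ≡ seg P i k
      segI = seg-cong i i k (λ j j< → arr-other (mem σ) (regs σ rAB) 1 0 (regs σ rZ) (i + j))
      segI′ : seg (at mI 1) 0 (suc z) ≡ seg Q 0 z ++ P (i + d) ∷ []
      segI′ = trans (seg-snoc _ 0 z) (cong₂ (λ a b → a ++ b ∷ [])
        (seg-cong 0 0 z (λ j j< → arr-idx (mem σ) (regs σ rAB) 1 {regs σ rZ} {j} (λ e → ℕ.<-irrefl (trans (sym e) pZ′) j<)))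
        (trans (arr-same (mem σ) (regs σ rAB) 1 pZ′) (cong P pI′)))
      segO : seg (at mO 0) i (suc k) ≡ seg P i k ++ P (i + d) ∷ []
      segO = trans (seg-snoc _ i k) (cong₂ (λ a b → a ++ b ∷ [])
        (seg-cong i i k (λ j j< → arr-idx (mem σ) (regs σ rAB) 0 {regs σ rW} {i + j} (λ e → ℕ.<-irrefl (trans (sym e) pW′) (ℕ.+-monoʳ-< i j<))))
        (trans (arr-same (mem σ) (regs σ rAB) 0 pW′) (cong P pI′)))
      segO′ : seg (at mO 1) 0 z ≡ seg Q 0 z
      segO′ = seg-cong 0 0 z (λ j j< → arr-other (mem σ) (regs σ rAB) 0 1 (regs σ rW) j)

  record Partitioned (x i len : ℕ) (σ₀ σ : State) : Set where
    pattern
    constructor partitioned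
    field
      k z  : ℕ
      k+z  : k + z ≡ len
      rK≡  : regs σ rK ≡ i + k
      outs : Outs x (seg (arr σ 0) i k)
      ins  : Ins x (seg (arr σ 0) (i + k) z)
      perm : seg (arr σ 0) i k ++ seg (arr σ 0) (i + k) z ↭ seg (arr σ₀ 0) i len
      rest : Outside σ₀ σ i len

  partition-spec : ∀ {σ₀} x i len → Env σ₀ → x < n → (∀ j → j < len → arr σ₀ 0 (i + j) < n) →
                   regs σ₀ rI ≡ i → regs σ₀ rB ≡ i + len → regs σ₀ rX ≡ x →
                   Spec partition σ₀ (λ t σ → Lin 30 140 len t × Partitioned x i len σ₀ σ)
  partition-spec {σ₀} x i len env x< P< pI pB pX = byWp (
    wp-mono scan (λ t₁ σ₁ (l₁ , f₁ , scanned k z k+z pI₁ pW₁ pZ₁ os is pm rs) →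
      let σ₂ = state (((regs σ₁ [ rK ≔ regs σ₁ rW ]) [ rE ≔ regs σ₁ rZ ]) [ rI ≔ 0 ]) (mem σ₁)
          z≤ : z ≤ len
          z≤ = subst (z ≤_) k+z (ℕ.m≤n+m z k)
      in wp-mono (copy 1 0) (λ t₂ σ₃ (l₂ , f₂ , cp) →
        let open Copied cp
            out : seg (arr σ₃ 0) i k ≡ seg (arr σ₁ 0) i k
            out = seg-cong i i k (λ j j< → rest (i + j) (inj₁ (ℕ.+-monoʳ-< i j<)))
        in weaken (const-≤ 2 +ˡ const-≤ 2 +ˡ l₁ +ˡ const-≤ 2 +ˡ const-≤ 2 +ˡ const-≤ 2 +ˡ shorter l₂ z≤) ,
          partitioned k z k+z (trans (reg-same f₂ rK) pW₁)
          (subst (Outs x) (sym out) os) (subst (Ins x) (sym moved) is)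
          (subst (_↭ seg (arr σ₀ 0) i len) (sym (cong₂ _++_ out moved)) pm)
          (λ j q → trans (rest j (case q of λ { (inj₁ a) → inj₁ (ℕ.<-≤-trans a (ℕ.m≤m+n i k))
                                              ; (inj₂ b) → inj₂ (subst (_≤ j) (trans (cong (i +_) (sym k+z)) (sym (ℕ.+-assoc i k z))) b) }))
                         (rs j q)))
        (copy-spec 1 0 {σ = σ₂} 0 (i + k) z refl pW₁ pZ₁))
    (scan-spec x i len (env-frame (frame (ex-seq (ex-set {rW} {reg rI}) (ex-set {rZ} {lit 0}))) env) x< P< pI pB pX pI refl))

  -- The left list waits in array 1 and the right list is read in place. The write position trails
  -- the read position by the number of buffered vertices, so nothing unread is overwritten, and
  -- once the buffer is empty the rest is already in place. When the right list is exhausted, the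
  -- first factor of the guard annihilates an arc test on meaningless data.
  weave : Cmd
  weave = while (reg rY ≺ reg rZ)
            (cond ((reg rI ≺ reg rB) ⊗ arcᴱ (ld 0 (reg rI)) (ld 1 (reg rY)))
                  (put 0 (reg rW) (ld 0 (reg rI)) ︔ inc rI)
                  (put 0 (reg rW) (ld 1 (reg rY)) ︔ inc rY) ︔
             inc rW)

  merge : Cmd
  merge = set rI (reg rA) ︔ set rW (lit 0) ︔ set rE (reg rLO) ︔ copy 0 1 ︔
          set rZ (reg rW) ︔ set rW (reg rA) ︔ set rY (lit 0) ︔ weave

  module _ (tournament : IsTournament G) where
    open Order tournament

    merge-[] : ∀ {xs zs} → Merge xs [] zs → zs ≡ xs
    merge-[] nilˡ = refl
    merge-[] nilʳ = refl

    record Woven (a l₁ l₂ : ℕ) (σ₀ σ : State) : Set where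
      field
        merged : Merge (seg (arr σ₀ 1) 0 l₁) (seg (arr σ₀ 0) (a + l₁) l₂) (seg (arr σ 0) a (l₁ + l₂))
        rest   : Outside σ₀ σ a (l₁ + l₂)

    weave-spec : ∀ {σ₀} a l₁ l₂ → Env σ₀ → (∀ j → j < l₁ → arr σ₀ 1 j < n) → (∀ j → j < l₂ → arr σ₀ 0 (a + l₁ + j) < n) →
                 regs σ₀ rY ≡ 0 → regs σ₀ rZ ≡ l₁ → regs σ₀ rW ≡ a → regs σ₀ rI ≡ a + l₁ → regs σ₀ rB ≡ a + l₁ + l₂ →
                 wp weave (λ t σ → Lin 4 120 (l₁ + l₂) t × Woven a l₁ l₂ σ₀ σ) σ₀
    weave-spec {σ₀} a l₁ l₂ env Q< P< pY pZ pW pI pB =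
      loop-rule 116 Inv (Woven a l₁ l₂ σ₀) step (l₁ + l₂) init (λ t σ l f d → l , d)
      where
      body = cond ((reg rI ≺ reg rB) ⊗ arcᴱ (ld 0 (reg rI)) (ld 1 (reg rY)))
                  (put 0 (reg rW) (ld 0 (reg rI)) ︔ inc rI)
                  (put 0 (reg rW) (ld 1 (reg rY)) ︔ inc rY) ︔
             inc rW
      record Inv (k : ℕ) (σ : State) : Set where
        pattern
        constructor inv
        field
          d y p i q : ℕ
          p+q   : p + q ≡ k
          y+p   : y + p ≡ l₁
          i+q   : i + q ≡ a + l₁ + l₂
          w+p   : a + d + p ≡ i
          rY≡   : regs σ rY ≡ y
          rI≡   : regs σ rI ≡ i
          rW≡   : regs σ rW ≡ a + d
          same  : ∀ j → i ≤ j ⊎ j < a → arr σ 0 j ≡ arr σ₀ 0 j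
          -- A merge is derived from its front, whereas the loop knows the front first; the
          -- invariant therefore turns any merge of the remainders into one of the whole lists.
          cont  : ∀ {zs} → Merge (seg (arr σ₀ 1) y p) (seg (arr σ₀ 0) i q) zs →
                  Merge (seg (arr σ₀ 1) 0 l₁) (seg (arr σ₀ 0) (a + l₁) l₂) (seg (arr σ 0) a d ++ zs)
          d+    : d + (p + q) ≡ l₁ + l₂
          al₁≤i : a + l₁ ≤ i
      init : Inv (l₁ + l₂) σ₀
      init = inv 0 0 l₁ (a + l₁) l₂ refl refl refl (cong (_+ l₁) (ℕ.+-identityʳ a)) pY pI (trans pW (sym (ℕ.+-identityʳ a)))
               (λ _ _ → refl) id refl ℕ.≤-refl
      step : ∀ k σ → Frame body σ₀ σ → Inv k σ → _
      step k σ f (inv d y zero i q p+q y+p i+q w+p pY′ pI′ pW′ sm ct d+ al) = inj₁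
        (cong bit (<-false (λ l → ℕ.<-irrefl (trans (sym (ℕ.+-identityʳ y)) y+p) (subst₂ _<_ pY′ (trans (reg-same f rZ) pZ) l))) , record
         { merged = subst (Merge _ _) (trans (cong (seg (arr σ 0) a d ++_) (trans (seg-cong i i q (λ j _ → sym (sm (i + j) (inj₁ (ℕ.m≤m+n i j)))))
                                                                       (cong (λ b → seg (arr σ 0) b q) (sym i≡))))
                                        (trans (sym (seg-++ (arr σ 0) a d q)) (cong (seg (arr σ 0) a) d+)))
                          (ct nilˡ)
         ; rest = λ { j (inj₁ b) → sm j (inj₂ b)
                    ; j (inj₂ b) → sm j (inj₁ (ℕ.≤-trans (ℕ.m≤m+n i q) (ℕ.≤-trans (ℕ.≤-reflexive (trans i+q (ℕ.+-assoc a l₁ l₂))) b))) } })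
        where
        i≡ : a + d ≡ i
        i≡ = trans (sym (ℕ.+-identityʳ (a + d))) w+p
      step k σ f (inv d y (suc p) i q p+q y+p i+q w+p pY′ pI′ pW′ sm ct d+ al) = inj₂ (p + q , sym p+q ,
        bit≢0 refl (<-true (subst₂ _<_ (sym pY′) (sym (trans (reg-same f rZ) pZ)) y<)) ,
        takeP q i+q ct p+q d+ , takeQ q i+q ct p+q d+)
        where
        P = arr σ 0
        P₀ = arr σ₀ 0
        Q = arr σ₀ 1
        envσ = env-frame f env
        y< : y < l₁
        y< = subst (y <_) y+p (ℕ.m<m+n y (s≤s z≤n))
        w<i : a + d < i
        w<i = subst (a + d <_) w+p (ℕ.m<m+n (a + d) (s≤s z≤n))
        Q≡ : ∀ j → arr σ 1 j ≡ Q j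
        Q≡ = arr-keep f (_≡ᵇ 0) 1
        Pi : P i ≡ P₀ i
        Pi = sm i (inj₁ ℕ.≤-refl)
        guard = (reg rI ≺ reg rB) ⊗ arcᴱ (ld 0 (reg rI)) (ld 1 (reg rY))
        rB≡ : regs σ rB ≡ a + l₁ + l₂
        rB≡ = trans (reg-same f rB) pB
        gval : ∀ {q} → i + suc q ≡ a + l₁ + l₂ → ⟦ guard ⟧ σ ≡ bit (G (P₀ i) (Q y))
        gval {q} e = trans (cong₂ _*_
            (cong bit (<-true (subst₂ _<_ (sym pI′) (sym rB≡) (subst (i <_) e (ℕ.m<m+n i (s≤s z≤n))))))
            (arcᴱ-value (ld 0 (reg rI)) (ld 1 (reg rY)) envσ (trans (cong P pI′) Pi) (trans (cong (arr σ 1) pY′) (Q≡ y))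
              (subst (λ z → P₀ z < n) (ℕ.m+[n∸m]≡n al) (P< (i ∸ (a + l₁)) (ℕ.+-cancelˡ-< (a + l₁) _ _
                 (subst₂ _<_ (sym (ℕ.m+[n∸m]≡n al)) e (ℕ.m<m+n i (s≤s z≤n)))))) (Q< y y<)))
          (ℕ.*-identityˡ _)
        gzero : i + 0 ≡ a + l₁ + l₂ → ⟦ guard ⟧ σ ≡ 0
        gzero e = cong (_* ⟦ arcᴱ (ld 0 (reg rI)) (ld 1 (reg rY)) ⟧ σ)
          (cong bit (<-false (λ l → ℕ.<-irrefl (trans (sym (ℕ.+-identityʳ i)) e) (subst₂ _<_ pI′ rB≡ l))))
        at : (ℕ → ℕ) → ℕ → ℕ
        at g j = g (regs σ rAB + (j * 16 + 0))
        extend : ∀ {v x} → v ≡ x → seg (at (mem σ [ regs σ rAB + (regs σ rW * 16 + 0) ≔ v ])) a (suc d) ≡ seg P a d ++ x ∷ []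
        extend v≡ = trans (seg-snoc _ a d) (cong₂ (λ u z → u ++ z ∷ [])
          (seg-cong a a d (λ j j< → arr-idx (mem σ) (regs σ rAB) 0 {regs σ rW} {a + j} (λ e → ℕ.<-irrefl (trans (sym e) pW′) (ℕ.+-monoʳ-< a j<))))
          (trans (arr-same (mem σ) (regs σ rAB) 0 pW′) v≡))
        keepP : ∀ {v i′} → i ≤ i′ → ∀ j → i′ ≤ j ⊎ j < a → at (mem σ [ regs σ rAB + (regs σ rW * 16 + 0) ≔ v ]) j ≡ P₀ j
        keepP le j s = trans (arr-idx (mem σ) (regs σ rAB) 0 {regs σ rW} {j} (λ e → bad s (trans (sym pW′) e)))
                          (sm j (case s of λ { (inj₁ b) → inj₁ (ℕ.≤-trans le b) ; (inj₂ b) → inj₂ b }))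
          where
          bad : ∀ {j} → _ ≤ j ⊎ j < a → a + d ≢ j
          bad (inj₁ b) refl = ℕ.<⇒≱ w<i (ℕ.≤-trans le b)
          bad (inj₂ b) refl = ℕ.<⇒≱ b (ℕ.m≤m+n a d)
        takeP : ∀ q → i + q ≡ a + l₁ + l₂ →
                (∀ {zs} → Merge (seg Q y (suc p)) (seg P₀ i q) zs → Merge (seg Q 0 l₁) (seg P₀ (a + l₁) l₂) (seg P a d ++ zs)) →
                suc p + q ≡ k → d + (suc p + q) ≡ l₁ + l₂ → ⟦ guard ⟧ σ ≢ 0 → _ × Inv (p + q) _
        takeP zero e _ _ _ nz = ⊥-elim (nz (gzero e))
        takeP (suc q) e ct _ d+ nz = ℕ.≤ᵇ⇒≤ _ _ tt , inv (suc d) y (suc p) (suc i) q (sym (ℕ.+-suc p q)) y+p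
          (trans (sym (ℕ.+-suc i q)) e) (trans (cong (_+ suc p) (ℕ.+-suc a d)) (cong suc w+p))
          pY′ (trans (cong (_+ 1) pI′) (ℕ.+-comm i 1)) (succ-idx a d pW′)
          (keepP (ℕ.n≤1+n i))
          (λ {zs} mg → subst (Merge _ _) (sym (trans (cong (_++ zs) (extend (trans (cong P pI′) Pi))) (++-assoc (seg P a d) _ zs)))
             (ct (right (asym (bit-true (λ z → nz (trans (gval e) z)))) mg)))
          (trans (trans (sym (ℕ.+-suc d (suc p + q))) (cong (d +_) (cong suc (sym (ℕ.+-suc p q))))) d+)
          (ℕ.m≤n⇒m≤1+n al)
        takeQ : ∀ q → i + q ≡ a + l₁ + l₂ →
                (∀ {zs} → Merge (seg Q y (suc p)) (seg P₀ i q) zs → Merge (seg Q 0 l₁) (seg P₀ (a + l₁) l₂) (seg P a d ++ zs)) →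
                suc p + q ≡ k → d + (suc p + q) ≡ l₁ + l₂ → ⟦ guard ⟧ σ ≡ 0 → _ × Inv (p + q) _
        takeQ q e ct _ d+ z0 = ℕ.≤ᵇ⇒≤ _ _ tt , inv (suc d) (suc y) p i q refl (trans (sym (ℕ.+-suc y p)) y+p) e
          (trans (trans (cong (_+ p) (ℕ.+-suc a d)) (sym (ℕ.+-suc (a + d) p))) w+p)
          (succ-idx₀ y pY′) pI′ (succ-idx a d pW′)
          (keepP ℕ.≤-refl)
          (λ {zs} mg → subst (Merge _ _) (sym (trans (cong (_++ zs) (extend (trans (cong (arr σ 1) pY′) (Q≡ y)))) (++-assoc (seg P a d) _ zs)))
             (ct (takeLeft q e mg)))
          (trans (sym (ℕ.+-suc d (p + q))) d+) al
          where
          takeLeft : ∀ {zs} q → i + q ≡ a + l₁ + l₂ → Merge (seg Q (suc y) p) (seg P₀ i q) zs → Merge (seg Q y (suc p)) (seg P₀ i q) (Q y ∷ zs)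
          takeLeft zero e mg = subst (Merge _ []) (cong (Q y ∷_) (sym (merge-[] mg))) nilʳ
          takeLeft (suc q) e mg = left (bit-false (trans (sym (gval e)) z0)) mg

    record Merged (a l₁ l₂ : ℕ) (σ₀ σ : State) : Set where
      field
        merged : Merge (seg (arr σ₀ 0) a l₁) (seg (arr σ₀ 0) (a + l₁) l₂) (seg (arr σ 0) a (l₁ + l₂))
        rest   : Outside σ₀ σ a (l₁ + l₂)

    merge-spec : ∀ {σ₀} a l₁ l₂ → Env σ₀ → (∀ j → j < l₁ + l₂ → arr σ₀ 0 (a + j) < n) →
                 regs σ₀ rA ≡ a → regs σ₀ rLO ≡ a + l₁ → regs σ₀ rB ≡ a + l₁ + l₂ →
                 Spec merge σ₀ (λ t σ → Lin 30 170 (l₁ + l₂) t × Merged a l₁ l₂ σ₀ σ)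
    merge-spec {σ₀} a l₁ l₂ env P< pA pL pB = byWp (
      wp-mono (copy 0 1) (λ t₁ σ₁ (lt₁ , f₁ , cp) →
        let open Copied cp
            same : ∀ j → arr σ₁ 0 j ≡ arr σ₀ 0 j
            same = arr-keep f₁ (_≡ᵇ 1) 0
            σ₂ = state (((regs σ₁ [ rZ ≔ regs σ₁ rW ]) [ rW ≔ regs σ₁ rA ]) [ rY ≔ 0 ]) (mem σ₁)
            Q≡ : ∀ j → j < l₁ → arr σ₁ 1 j ≡ arr σ₀ 0 (a + j)
            Q≡ = seg-inj l₁ moved
        in wp-mono weave (λ t₂ σ₃ (lt₂ , wv) →
             weaken (const-≤ 2 +ˡ const-≤ 2 +ˡ const-≤ 2 +ˡ shorter lt₁ (ℕ.m≤m+n l₁ l₂) +ˡ const-≤ 2 +ˡ const-≤ 2 +ˡ const-≤ 2 +ˡ lt₂) ,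
             record { merged = subst₂ (λ u v → Merge u v (seg (arr σ₃ 0) a (l₁ + l₂))) moved
                                 (seg-cong (a + l₁) (a + l₁) l₂ (λ j _ → same (a + l₁ + j))) (Woven.merged wv)
                    ; rest = λ j q → trans (Woven.rest wv j q) (same j) })
           (weave-spec {σ₂} a l₁ l₂ (env-frame (frame (ex-seq (ex-set {rZ} {reg rW}) (ex-seq (ex-set {rW} {reg rA}) (ex-set {rY} {lit 0})))) (env-frame f₁ env₁))
             (λ j j< → subst (_< n) (sym (Q≡ j j<)) (P< j (ℕ.<-≤-trans j< (ℕ.m≤m+n l₁ l₂))))
             (λ j j< → subst (_< n) (sym (trans (same (a + l₁ + j)) (cong (arr σ₀ 0) (ℕ.+-assoc a l₁ j)))) (P< (l₁ + j) (ℕ.+-monoʳ-< l₁ j<)))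
             refl rW≡ (trans (reg-same f₁ rA) pA) rI≡ (trans (reg-same f₁ rB) pB)))
      (copy-spec 0 1 a 0 l₁ pA refl pL))
      where
      env₁ = env-frame (frame (ex-seq (ex-set {rI} {reg rA}) (ex-seq (ex-set {rW} {lit 0}) (ex-set {rE} {reg rLO})))) env
      seg-inj : ∀ {f g : ℕ → ℕ} {i} l → seg f 0 l ≡ seg g i l → ∀ j → j < l → f j ≡ g (i + j)
      seg-inj {f} {g} {i} l p j j< = go 0 i l p j j<
        where
        open import Data.List.Properties using (∷-injective)
        go : ∀ a b l → seg f a l ≡ seg g b l → ∀ j → j < l → f (a + j) ≡ g (b + j)
        go a b (suc l) p zero _ = subst₂ (λ x y → f x ≡ g y) (sym (ℕ.+-identityʳ a)) (sym (ℕ.+-identityʳ b)) (proj₁ (∷-injective p))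
        go a b (suc l) p (suc j) (s≤s q) = subst₂ (λ x y → f x ≡ g y) (sym (ℕ.+-suc a j)) (sym (ℕ.+-suc b j)) (go (suc a) (suc b) l (proj₂ (∷-injective p)) j q)

  -- The stack of pending segments

  pop push choose close finish split body sortLoop : Cmd
  pop = set rSP (reg rSP ⊖ lit 1) ︔ set rT (ld 2 (reg rSP)) ︔ set rLO (ld 3 (reg rSP)) ︔ set rA (ld 4 (reg rSP)) ︔
        set rB (ld 5 (reg rSP)) ︔ set rHI (ld 6 (reg rSP))
  push = put 2 (reg rSP) (reg 20) ︔ put 3 (reg rSP) (reg 21) ︔ put 4 (reg rSP) (reg 22) ︔ put 5 (reg rSP) (reg 23) ︔
         put 6 (reg rSP) (reg 24) ︔ inc rSP
  choose = cond (reg rLO ≺ reg rA) (set rX (ld 0 (reg rLO)) ︔ inc rLO)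
             (cond (reg rB ≺ reg rHI) (set rHI (reg rHI ⊖ lit 1) ︔ set rX (ld 0 (reg rHI)))
                                      (set rX (ld 0 (reg rA)) ︔ inc rI ︔ set rLV (lit 1)))
  -- Without a pivot, the vertex taken from `a` changes places with the cell at `rK ⊖ lit 1` and so
  -- lands between the two parts. With a pivot, the merge is pushed below both parts and is popped
  -- after them.
  close = cond (reg rLV) (put 0 (reg rA) (ld 0 (reg rK ⊖ lit 1)) ︔ put 0 (reg rK ⊖ lit 1) (reg rX))
                         (set 20 (lit 1) ︔ set 21 (reg rK) ︔ set 22 (reg rA) ︔ set 23 (reg rB) ︔ push)
  -- Each part gets all the rest of the current window as outer pivots: the other part, the
  -- remaining old pivots and, without a pivot, the vertex placed in between.
  finish = close ︔
           (set 20 (lit 0) ︔ set 21 (reg rLO) ︔ set 22 (reg rK) ︔ set 23 (reg rB) ︔ set 24 (reg rHI) ︔ push) ︔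
           (set 22 (reg rA) ︔ set 23 (reg rK ⊖ reg rLV) ︔ push)
  split = set rLV (lit 0) ︔ set rI (reg rA) ︔ choose ︔ partition ︔ finish
  body = pop ︔ cond (reg rT) merge (cond (reg rA ⊕ lit 1 ≺ reg rB) split skip)
  sortLoop = while (reg rSP) body

  -- The components are a tag and `lo , a , b , hi`. Tag 0: sort the cells from `a` up to `b`, with
  -- outer pivots from `lo` up to `a` and from `b` up to `hi`. Tag 1: merge the sorted cells from
  -- `a` up to `lo` with those from `lo` up to `b`.
  Item : Set
  Item = ℕ × ℕ × ℕ × ℕ × ℕ

  item : State → ℕ → Item
  item σ i = arr σ 2 i , arr σ 3 i , arr σ 4 i , arr σ 5 i , arr σ 6 i

  tuple : ∀ {a a′ b b′ c c′ d d′ e e′ : ℕ} → a ≡ a′ → b ≡ b′ → c ≡ c′ → d ≡ d′ → e ≡ e′ →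
          (a , b , c , d , e) ≡ (a′ , b′ , c′ , d′ , e′)
  tuple refl refl refl refl refl = refl

  push-spec : ∀ {σ} → Spec push σ (λ t σ′ → t ≤ 60 × regs σ′ rSP ≡ regs σ rSP + 1 ×
                item σ′ (regs σ rSP) ≡ (regs σ 20 , regs σ 21 , regs σ 22 , regs σ 23 , regs σ 24) ×
                (∀ i → regs σ rSP ≢ i → item σ′ i ≡ item σ i))
  push-spec {σ} = byWp
    ( ℕ.≤ᵇ⇒≤ _ _ tt , refl , tuple
        (trans (o f4 6 2) (trans (o f3 5 2) (trans (o f2 4 2) (trans (o f1 3 2) (sm (mem σ) 2)))))
        (trans (o f4 6 3) (trans (o f3 5 3) (trans (o f2 4 3) (sm f1 3))))
        (trans (o f4 6 4) (trans (o f3 5 4) (sm f2 4)))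
        (trans (o f4 6 5) (sm f3 5))
        (sm f4 6)
    , λ i ne → tuple
        (trans (o′ i f4 6 2) (trans (o′ i f3 5 2) (trans (o′ i f2 4 2) (trans (o′ i f1 3 2) (ix i (mem σ) 2 ne)))))
        (trans (o′ i f4 6 3) (trans (o′ i f3 5 3) (trans (o′ i f2 4 3) (trans (ix i f1 3 ne) (o′ i (mem σ) 2 3)))))
        (trans (o′ i f4 6 4) (trans (o′ i f3 5 4) (trans (ix i f2 4 ne) (trans (o′ i f1 3 4) (o′ i (mem σ) 2 4)))))
        (trans (o′ i f4 6 5) (trans (ix i f3 5 ne) (trans (o′ i f2 4 5) (trans (o′ i f1 3 5) (o′ i (mem σ) 2 5)))))
        (trans (ix i f4 6 ne) (trans (o′ i f3 5 6) (trans (o′ i f2 4 6) (trans (o′ i f1 3 6) (o′ i (mem σ) 2 6))))))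
    where
    A = regs σ rAB
    s′ = regs σ rSP
    f1 = mem σ [ A + (s′ * 16 + 2) ≔ regs σ 20 ]
    f2 = f1 [ A + (s′ * 16 + 3) ≔ regs σ 21 ]
    f3 = f2 [ A + (s′ * 16 + 4) ≔ regs σ 22 ]
    f4 = f3 [ A + (s′ * 16 + 5) ≔ regs σ 23 ]
    sm : ∀ f k {v} → (f [ A + (s′ * 16 + k) ≔ v ]) (A + (s′ * 16 + k)) ≡ v
    sm f k {v} = arr-same f A k {s′} {v} {s′} refl
    ix : ∀ i f k {v} {h : T (k <ᵇ 16)} → s′ ≢ i → (f [ A + (s′ * 16 + k) ≔ v ]) (A + (i * 16 + k)) ≡ f (A + (i * 16 + k))
    ix i f k {v} {h} = arr-idx f A k {s′} {i} {v} {h}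
    o′ : ∀ i f k l {v} {h : T (k <ᵇ 16)} {h′ : T (l <ᵇ 16)} {h″ : T (not (k ≡ᵇ l))} →
         (f [ A + (s′ * 16 + k) ≔ v ]) (A + (i * 16 + l)) ≡ f (A + (i * 16 + l))
    o′ i f k l {v} {h} {h′} {h″} = arr-other f A k l s′ i {v} {h} {h′} {h″}
    o : ∀ f k l {v} {h : T (k <ᵇ 16)} {h′ : T (l <ᵇ 16)} {h″ : T (not (k ≡ᵇ l))} →
        (f [ A + (s′ * 16 + k) ≔ v ]) (A + (s′ * 16 + l)) ≡ f (A + (s′ * 16 + l))
    o f k l {v} {h} {h′} {h″} = o′ s′ f k l {v} {h} {h′} {h″}

  record Popped (s′ t lo a b hi : ℕ) (σ₀ σ : State) : Set where
    field
      rSP≡ : regs σ rSP ≡ s′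
      rT≡  : regs σ rT ≡ t
      rLO≡ : regs σ rLO ≡ lo
      rA≡  : regs σ rA ≡ a
      rB≡  : regs σ rB ≡ b
      rHI≡ : regs σ rHI ≡ hi
      same : ∀ k i → arr σ k i ≡ arr σ₀ k i

  pop-spec : ∀ {σ s′ t lo a b hi} → regs σ rSP ≡ suc s′ → item σ s′ ≡ (t , lo , a , b , hi) →
             Spec pop σ (λ τ σ′ → τ ≤ 60 × Popped s′ t lo a b hi σ σ′)
  pop-spec {σ} {s′} {t} {lo} {a} {b} {hi} p q = byWp
    ( ℕ.≤ᵇ⇒≤ _ _ tt , record
      { rSP≡ = top ; rT≡ = get 2 proj₁ refl ; rLO≡ = get 3 (proj₁ ∘ proj₂) refl ; rA≡ = get 4 (proj₁ ∘ proj₂ ∘ proj₂) refl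
      ; rB≡ = get 5 (proj₁ ∘ proj₂ ∘ proj₂ ∘ proj₂) refl ; rHI≡ = get 6 (proj₂ ∘ proj₂ ∘ proj₂ ∘ proj₂) refl ; same = λ _ _ → refl })
    where
    top : regs σ rSP ∸ 1 ≡ s′
    top = cong (_∸ 1) p
    get : ∀ k (π : Item → ℕ) → π (item σ s′) ≡ arr σ k s′ → arr σ k (regs σ rSP ∸ 1) ≡ π (t , lo , a , b , hi)
    get k π h = trans (cong (arr σ k) top) (trans (sym h) (cong π q))

  record Pivoted (x lo a len hi s′ : ℕ) (σ₀ σ : State) : Set where
    field
      k z   : ℕ
      k+z   : k + z ≡ len
      outs  : Outs x (seg (arr σ 0) a k)
      ins   : Ins x (seg (arr σ 0) (a + k) z)
      perm  : seg (arr σ 0) a k ++ seg (arr σ 0) (a + k) z ↭ seg (arr σ₀ 0) a len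
      rest  : Outside σ₀ σ a len
      rSP≡  : regs σ rSP ≡ 3 + s′
      item₀ : ∃[ h ] item σ s′ ≡ (1 , a + k , a , a + len , h)
      item₁ : item σ (1 + s′) ≡ (0 , lo , a + k , a + len , hi)
      item₂ : item σ (2 + s′) ≡ (0 , lo , a , a + k , hi)
      below : ∀ i → i < s′ → item σ i ≡ item σ₀ i

  record Chosen (lv i lo a b hi x s′ : ℕ) (σ₀ σ : State) : Set where
    field
      rLV≡ : regs σ rLV ≡ lv
      rI≡  : regs σ rI ≡ i
      rLO≡ : regs σ rLO ≡ lo
      rA≡  : regs σ rA ≡ a
      rB≡  : regs σ rB ≡ b
      rHI≡ : regs σ rHI ≡ hi
      rX≡  : regs σ rX ≡ x
      rSP≡ : regs σ rSP ≡ s′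
      same : ∀ k i → arr σ k i ≡ arr σ₀ k i

  pivot-spec : ∀ {σ₀ σ lo a len hi x s′} → Chosen 0 a lo a (a + len) hi x s′ σ₀ σ → Env σ → x < n →
               (∀ j → j < len → arr σ₀ 0 (a + j) < n) →
               Spec (partition ︔ finish) σ (λ t σ′ → Lin 300 140 len t × Pivoted x lo a len hi s′ σ₀ σ′)
  pivot-spec {σ₀} {σ} {lo} {a} {len} {hi} {x} {s′} ch env x< P< =
    seqS (mapS (partition-spec x a len env x< (λ j j< → subst (_< n) (sym (same 0 (a + j))) (P< j j<)) rI≡ rB≡ rX≡)
      λ { t₁ σ₁ f₁ (l₁ , partitioned k z k+z pK os is pm rs) →
      let r1 : ∀ r → {_ : T (keeps r partition)} → regs σ₁ r ≡ regs σ r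
          r1 r {h} = reg-same f₁ r {h}
      in
         seqS (elseS (trans (r1 rLV) rLV≡) (setS (setS (setS (setS (mapS push-spec λ { t₂ σ₂ f₂ (l₂ , sp₂ , it₂ , bl₂) →
         seqS (setS (setS (setS (setS (setS (mapS push-spec λ { t₃ σ₃ f₃ (l₃ , sp₃ , it₃ , bl₃) →
         setS (setS (mapS push-spec λ { t₄ σ₄ f₄ (l₄ , sp₄ , it₄ , bl₄) →
           let P4 : ∀ j → arr σ₄ 0 j ≡ arr σ₁ 0 j
               P4 j = trans (arr-keep f₄ (1 <ᵇ_) 0 j) (trans (arr-keep f₃ (1 <ᵇ_) 0 j) (arr-keep f₂ (1 <ᵇ_) 0 j))
               s1 : regs σ₁ rSP ≡ s′
               s1 = trans (r1 rSP) rSP≡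
               s2 : regs σ₂ rSP ≡ 1 + s′
               s2 = trans sp₂ (trans (cong (_+ 1) s1) (ℕ.+-comm s′ 1))
               s3 : regs σ₃ rSP ≡ 2 + s′
               s3 = trans sp₃ (trans (cong (_+ 1) s2) (ℕ.+-comm (1 + s′) 1))
               s4 : regs σ₄ rSP ≡ 3 + s′
               s4 = trans sp₄ (trans (cong (_+ 1) s3) (ℕ.+-comm (2 + s′) 1))
               q2 : ∀ r → {_ : T (keeps r push)} {_ : T (keeps r partition)} {_ : T (keeps r (set 20 (lit 1) ︔ set 21 (lit 1) ︔ set 22 (lit 1) ︔ set 23 (lit 1)))} → regs σ₂ r ≡ regs σ r
               q2 r {h} {h′} {h″} = trans (reg-same f₂ r {h}) (trans (keeps-sound r (ex-seq (ex-set {20} {lit 1} {σ₁}) (ex-seq (ex-set {21} {reg rK}) (ex-seq (ex-set {22} {reg rA}) (ex-set {23} {reg rB})))) (T-true h″)) (r1 r {h′}))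
               eK2 : regs σ₂ rK ≡ a + k
               eK2 = trans (reg-same f₂ rK) pK
               up : ∀ {u w} → u ≡ w → ∀ i → i < w → u ≢ i
               up e i i< e′ = ℕ.<-irrefl (trans (sym e′) e) i<
           in weaken (l₁ +ˡ (const-≤ 2 +ˡ (const-≤ 2 +ˡ const-≤ 2 +ˡ const-≤ 2 +ˡ const-≤ 2 +ˡ upto 60 l₂))
                +ˡ (const-≤ 2 +ˡ const-≤ 2 +ˡ const-≤ 2 +ˡ const-≤ 2 +ˡ const-≤ 2 +ˡ upto 60 l₃) +ˡ const-≤ 2 +ˡ const-≤ 4 +ˡ upto 60 l₄)
            , record
            { k = k ; z = z ; k+z = k+z
            ; outs = subst (Outs x) (seg-cong a a k (λ j _ → sym (P4 (a + j)))) os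
            ; ins = subst (Ins x) (seg-cong (a + k) (a + k) z (λ j _ → sym (P4 (a + k + j)))) is
            ; perm = subst₂ _↭_ (cong₂ _++_ (seg-cong a a k (λ j _ → sym (P4 (a + j)))) (seg-cong (a + k) (a + k) z (λ j _ → sym (P4 (a + k + j)))))
                       (seg-cong a a len (λ j _ → same 0 (a + j))) pm
            ; rest = λ j q → trans (P4 j) (trans (rs j q) (same 0 j))
            ; rSP≡ = s4
            ; item₀ = _ , trans (bl₄ s′ (up s3 s′ (ℕ.m≤n⇒m≤1+n ℕ.≤-refl))) (trans (bl₃ s′ (up s2 s′ ℕ.≤-refl))
                (trans (cong (item σ₂) (sym s1)) (trans it₂ (tuple refl pK (trans (r1 rA) rA≡) (trans (r1 rB) rB≡) refl))))
            ; item₁ = trans (bl₄ (1 + s′) (up s3 (1 + s′) ℕ.≤-refl)) (trans (cong (item σ₃) (sym s2))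
                (trans it₃ (tuple refl (trans (q2 rLO) rLO≡) eK2 (trans (q2 rB) rB≡) (trans (q2 rHI) rHI≡))))
            ; item₂ = trans (cong (item σ₄) (sym s3)) (trans it₄ (tuple (reg-same f₃ 20) (trans (reg-same f₃ 21) (trans (q2 rLO) rLO≡))
                (trans (reg-same f₃ rA) (trans (q2 rA) rA≡))
                (trans (cong₂ _∸_ (trans (reg-same f₃ rK) eK2) (trans (reg-same f₃ rLV) (trans (q2 rLV) rLV≡))) refl)
                (trans (reg-same f₃ 24) (trans (q2 rHI) rHI≡))))
            ; below = λ i i< → trans (bl₄ i (up s3 i (ℕ.m≤n⇒m≤1+n (ℕ.m≤n⇒m≤1+n i<)))) (trans (bl₃ i (up s2 i (ℕ.m≤n⇒m≤1+n i<)))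
                (trans (bl₂ i (up s1 i i<)) (trans (tuple (arr-keep f₁ (_<ᵇ 2) 2 i) (arr-keep f₁ (_<ᵇ 2) 3 i) (arr-keep f₁ (_<ᵇ 2) 4 i) (arr-keep f₁ (_<ᵇ 2) 5 i) (arr-keep f₁ (_<ᵇ 2) 6 i)) (tuple (same 2 i) (same 3 i) (same 4 i) (same 5 i) (same 6 i)))))
            } })) })))))) }))))) )})
    where open Chosen ch

  env-same : ∀ {σ σ′} → Env σ → mem σ′ ≡ mem σ → regs σ′ rN ≡ regs σ rN → regs σ′ rM ≡ regs σ rM → regs σ′ rS ≡ regs σ rS →
             regs σ′ rTB ≡ regs σ rTB → regs σ′ rAB ≡ regs σ rAB → Env σ′
  env-same e refl a b c d f = record
    { N≡ = trans a (N≡ e) ; M≡ = trans b (M≡ e) ; S≡ = trans c (S≡ e) ; TB≡ = trans d (TB≡ e) ; AB≡ = trans f (AB≡ e) ; arcs = arcs e }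

  record Levelled (v a len s′ : ℕ) (σ₀ σ : State) : Set where
    field
      k z   : ℕ
      k+z   : suc (k + z) ≡ len
      outs  : Outs v (seg (arr σ 0) a k)
      mid   : arr σ 0 (a + k) ≡ v
      ins   : Ins v (seg (arr σ 0) (a + suc k) z)
      perm  : seg (arr σ 0) a k ++ v ∷ seg (arr σ 0) (a + suc k) z ↭ seg (arr σ₀ 0) a len
      rest  : Outside σ₀ σ a len
      rSP≡  : regs σ rSP ≡ 2 + s′
      item₀ : item σ s′ ≡ (0 , a , a + suc k , a + len , a + len)
      item₁ : item σ (1 + s′) ≡ (0 , a , a , a + k , a + len)
      below : ∀ i → i < s′ → item σ i ≡ item σ₀ i

  record Closed (a k x : ℕ) (σ₀ σ : State) : Set where
    field
      regs≡ : ∀ r → regs σ r ≡ regs σ₀ r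
      mid   : arr σ 0 (a + k) ≡ x
      first : 0 < k → arr σ 0 a ≡ arr σ₀ 0 (a + k)
      else  : ∀ j → a + k ≢ j → a ≢ j → arr σ 0 j ≡ arr σ₀ 0 j
      stack : ∀ i → item σ i ≡ item σ₀ i

  close-spec : ∀ {σ} a k x → regs σ rLV ≡ 1 → regs σ rA ≡ a → regs σ rK ≡ suc a + k → regs σ rX ≡ x →
               Spec close σ (λ t σ′ → t ≤ 31 × Closed a k x σ σ′)
  close-spec {σ} a k x pV pA pK pX = thenS (λ e → case trans (sym e) pV of λ ()) (byWp (ℕ.≤ᵇ⇒≤ _ _ tt , record
    { regs≡ = λ r → refl
    ; mid = trans (arr-same g1 A 0 {regs σ rK ∸ 1} {_} {a + k} K≡) pX
    ; first = λ 0<k → trans (arr-idx g1 A 0 {regs σ rK ∸ 1} {a} (λ e → ℕ.<⇒≢ (ℕ.m<m+n a 0<k) (sym (trans (sym K≡) e))))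
                        (trans (arr-same (mem σ) A 0 {regs σ rA} {_} {a} pA) (cong (arr σ 0) K≡))
    ; else = λ j n₁ n₂ → trans (arr-idx g1 A 0 {regs σ rK ∸ 1} {j} (λ e → n₁ (trans (sym K≡) e)))
                           (arr-idx (mem σ) A 0 {regs σ rA} {j} (λ e → n₂ (trans (sym pA) e)))
    ; stack = λ i → tuple (other 2 i) (other 3 i) (other 4 i) (other 5 i) (other 6 i) }))
    where
    A = regs σ rAB
    K≡ : regs σ rK ∸ 1 ≡ a + k
    K≡ = cong (_∸ 1) pK
    g1 = mem σ [ A + (regs σ rA * 16 + 0) ≔ arr σ 0 (regs σ rK ∸ 1) ]
    other : ∀ l i {h : T (l <ᵇ 16)} {h′ : T (not (0 ≡ᵇ l))} →
            (g1 [ A + ((regs σ rK ∸ 1) * 16 + 0) ≔ regs σ rX ]) (A + (i * 16 + l)) ≡ arr σ l i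
    other l i {h} {h′} = trans (arr-other g1 A 0 l (regs σ rK ∸ 1) i {_} {tt} {h} {h′}) (arr-other (mem σ) A 0 l (regs σ rA) i {_} {tt} {h} {h′})

  level-spec : ∀ {σ₀ σ a len s′} → Chosen 1 (suc a) a a (a + suc len) (a + suc len) (arr σ₀ 0 a) s′ σ₀ σ → Env σ →
               (∀ j → j < suc len → arr σ₀ 0 (a + j) < n) →
               Spec (partition ︔ finish) σ (λ t σ′ → Lin 300 140 len t × Levelled (arr σ₀ 0 a) a (suc len) s′ σ₀ σ′)
  level-spec {σ₀} {σ} {a} {len} {s′} ch env P< =
    seqS (mapS (partition-spec x (suc a) len env (subst (λ b → arr σ₀ 0 b < n) (ℕ.+-identityʳ a) (P< 0 (s≤s z≤n)))
                 (λ j j< → subst (_< n) (trans (cong (arr σ₀ 0) (ℕ.+-suc a j)) (sym (same 0 (suc a + j)))) (P< (suc j) (s≤s j<)))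
                 rI≡ (trans rB≡ (ℕ.+-suc a len)) rX≡)
      λ { t₁ σ₁ f₁ (l₁ , partitioned k z k+z pK os is pm rs) →
      let r1 : ∀ r → {_ : T (keeps r partition)} → regs σ₁ r ≡ regs σ r
          r1 r {h} = reg-same f₁ r {h}
      in seqS (mapS (close-spec a k x (trans (r1 rLV) rLV≡) (trans (r1 rA) rA≡) pK (trans (r1 rX) rX≡)) λ { t₂ σ₂ f₂ (l₂ , cl) →
         seqS (setS (setS (setS (setS (setS (mapS push-spec λ { t₃ σ₃ f₃ (l₃ , sp₃ , it₃ , bl₃) →
         setS (setS (mapS push-spec λ { t₄ σ₄ f₄ (l₄ , sp₄ , it₄ , bl₄) →
           let open Closed cl using (regs≡) renaming (mid to P2-mid; first to P2-first; else to P2-else)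
               P1 = arr σ₁ 0
               P2 = arr σ₂ 0
               P4 : ∀ j → arr σ₄ 0 j ≡ P2 j
               P4 j = trans (arr-keep f₄ (1 <ᵇ_) 0 j) (arr-keep f₃ (1 <ᵇ_) 0 j)
               -- The vertices not dominated by `x` were stored from `suc a` on. The exchange moves
               -- them to `a` on, with the last one at the front.
               segL : ∀ k′ → k′ ≡ k → seg P2 a k′ ↭ seg P1 (suc a) k′
               segL = λ { zero e → ↭-refl
                        ; (suc k₀) refl → ↭-trans (↭-reflexive (cong₂ _∷_ (trans (P2-first (s≤s z≤n)) (cong P1 (ℕ.+-suc a k₀)))
                              (seg-cong (suc a) (suc a) k₀ (λ j j< → P2-else (suc a + j)
                                (λ e → ℕ.<-irrefl (trans (sym e) (ℕ.+-suc a k₀)) (s≤s (ℕ.+-monoʳ-< a j<)))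
                                (λ e → ℕ.<-irrefl e (s≤s (ℕ.m≤m+n a j)))))))
                            (↭-trans (++-comm (P1 (suc a + k₀) ∷ []) (seg P1 (suc a) k₀)) (↭-reflexive (sym (seg-snoc P1 (suc a) k₀)))) }
               segL4 : seg (arr σ₄ 0) a k ≡ seg P2 a k
               segL4 = seg-cong a a k (λ j _ → P4 (a + j))
               segR4 : seg (arr σ₄ 0) (a + suc k) z ≡ seg P1 (suc a + k) z
               segR4 = seg-cong (a + suc k) (suc a + k) z (λ j _ → trans (P4 (a + suc k + j)) (trans (P2-else (a + suc k + j)
                   (λ e → ℕ.<-irrefl e (ℕ.<-≤-trans (ℕ.+-monoʳ-< a (ℕ.n<1+n k)) (ℕ.m≤m+n (a + suc k) j)))
                   (λ e → ℕ.<-irrefl e (ℕ.<-≤-trans (ℕ.m<m+n a (s≤s z≤n)) (ℕ.m≤m+n (a + suc k) j))))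
                   (cong (λ b → P1 (b + j)) (ℕ.+-suc a k))))
               s1 : regs σ₂ rSP ≡ s′
               s1 = trans (regs≡ rSP) (trans (r1 rSP) rSP≡)
               r2 : ∀ r → {_ : T (keeps r partition)} → regs σ₂ r ≡ regs σ r
               r2 r {h} = trans (regs≡ r) (r1 r {h})
               s3 : regs σ₃ rSP ≡ 1 + s′
               s3 = trans sp₃ (trans (cong (_+ 1) s1) (ℕ.+-comm s′ 1))
               s4 : regs σ₄ rSP ≡ 2 + s′
               s4 = trans sp₄ (trans (cong (_+ 1) s3) (ℕ.+-comm (1 + s′) 1))
               q3 : ∀ r → {_ : T (keeps r push)} {_ : T (keeps r partition)} {_ : T (keeps r (set 20 (lit 1) ︔ set 21 (lit 1) ︔ set 22 (lit 1) ︔ set 23 (lit 1) ︔ set 24 (lit 1)))} → regs σ₃ r ≡ regs σ r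
               q3 r {h} {h′} {h″} = trans (reg-same f₃ r {h}) (trans (keeps-sound r (ex-seq (ex-set {20} {lit 0} {σ₂}) (ex-seq (ex-set {21} {reg rLO}) (ex-seq (ex-set {22} {reg rK}) (ex-seq (ex-set {23} {reg rB}) (ex-set {24} {reg rHI}))))) (T-true h″)) (r2 r {h′}))
               up : ∀ {u w} → u ≡ w → ∀ i → i < w → u ≢ i
               up e i i< e′ = ℕ.<-irrefl (trans (sym e′) e) i<
           in weaken (l₁ +ˡ upto 31 l₂ +ˡ (const-≤ 2 +ˡ const-≤ 2 +ˡ const-≤ 2 +ˡ const-≤ 2 +ˡ const-≤ 2 +ˡ upto 60 l₃) +ˡ const-≤ 2 +ˡ const-≤ 4 +ˡ upto 60 l₄)
            , record
            { k = k ; z = z ; k+z = cong suc k+z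
            ; outs = subst (Outs x) (sym segL4) (All-resp-↭ (↭-sym (segL k refl)) os)
            ; mid = trans (P4 (a + k)) P2-mid
            ; ins = subst (Ins x) (sym segR4) is
            ; perm = subst₂ (λ u w → u ++ x ∷ w ↭ seg (arr σ₀ 0) a (suc len)) (sym segL4) (sym segR4)
                 (↭-trans (++⁺ʳ (x ∷ seg P1 (suc a + k) z) (segL k refl))
                 (↭-trans (shift x (seg P1 (suc a) k) (seg P1 (suc a + k) z))
                 (prep x (subst (seg P1 (suc a) k ++ seg P1 (suc a + k) z ↭_) (seg-cong (suc a) (suc a) len (λ j _ → same 0 (suc a + j))) pm))))
            ; rest = λ j q → trans (P4 j) (trans (P2-else j
                  (λ e → case q of λ { (inj₁ b) → ℕ.<⇒≱ b (subst (a ≤_) e (ℕ.m≤m+n a k))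
                                     ; (inj₂ b) → ℕ.<⇒≱ (subst (_< a + suc len) e (ℕ.+-monoʳ-< a (s≤s (subst (k ≤_) k+z (ℕ.m≤m+n k z))))) b })
                  (λ e → case q of λ { (inj₁ b) → ℕ.<-irrefl (sym e) b
                                     ; (inj₂ b) → ℕ.<⇒≱ (subst (_< a + suc len) e (ℕ.m<m+n a (s≤s z≤n))) b }))
                (trans (rs j (case q of λ { (inj₁ b) → inj₁ (ℕ.m≤n⇒m≤1+n b) ; (inj₂ b) → inj₂ (subst (_≤ j) (ℕ.+-suc a len) b) })) (same 0 j)))
            ; rSP≡ = s4
            ; item₀ = trans (bl₄ s′ (up s3 s′ ℕ.≤-refl)) (trans (cong (item σ₃) (sym s1)) (trans it₃
                (tuple refl (trans (r2 rLO) rLO≡) (trans (trans (regs≡ rK) pK) (sym (ℕ.+-suc a k))) (trans (r2 rB) rB≡) (trans (r2 rHI) rHI≡))))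
            ; item₁ = trans (cong (item σ₄) (sym s3)) (trans it₄ (tuple (reg-same f₃ 20) (trans (reg-same f₃ 21) (trans (r2 rLO) rLO≡))
                (trans (q3 rA) rA≡) (trans (cong₂ _∸_ (trans (reg-same f₃ rK) (trans (regs≡ rK) pK)) (trans (q3 rLV) rLV≡)) refl)
                (trans (reg-same f₃ 24) (trans (r2 rHI) rHI≡))))
            ; below = λ i i< → trans (bl₄ i (up s3 i (ℕ.m≤n⇒m≤1+n i<))) (trans (bl₃ i (up s1 i i<))
                (trans (Closed.stack cl i) (trans (tuple (arr-keep f₁ (_<ᵇ 2) 2 i) (arr-keep f₁ (_<ᵇ 2) 3 i) (arr-keep f₁ (_<ᵇ 2) 4 i) (arr-keep f₁ (_<ᵇ 2) 5 i) (arr-keep f₁ (_<ᵇ 2) 6 i))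
                  (tuple (same 2 i) (same 3 i) (same 4 i) (same 5 i) (same 6 i))))) } })) })))))) }) })
    where
    open Chosen ch
    x = arr σ₀ 0 a

-- Correctness and quadratic cost of the sorting loop

module Sorting (L : Layout) (G : ℕ → ℕ → Bool) (tournament : IsTournament G) where
  open Machine L G
  open Order tournament

  body-merge : ∀ {σ s′ a l₁ l₂ h} → Env σ → regs σ rSP ≡ suc s′ → item σ s′ ≡ (1 , a + l₁ , a , a + l₁ + l₂ , h) →
               (∀ j → j < l₁ + l₂ → arr σ 0 (a + j) < n) →
               Spec body σ (λ t σ′ → Lin 100 170 (l₁ + l₂) t × regs σ′ rSP ≡ s′ × (∀ i → item σ′ i ≡ item σ i) ×
                                     Merged tournament a l₁ l₂ σ σ′)
  body-merge {σ} {s′} {a} {l₁} {l₂} env p q P< =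
    seqS (mapS (pop-spec p q) λ { t σ₁ f (l , pp) → let open Popped pp in
      thenS (λ e → case trans (sym e) rT≡ of λ ())
      (mapS (merge-spec tournament a l₁ l₂ (env-frame f env) (λ j j< → subst (_< n) (sym (same 0 (a + j))) (P< j j<)) rA≡ rLO≡ rB≡)
        λ { t′ σ₂ f′ (l′ , mg) → weaken (upto 60 l +ˡ const-≤ 2 +ˡ l′) , trans (reg-same f′ rSP) rSP≡ ,
          (λ i → tuple (trans (arr-keep f′ (_<ᵇ 2) 2 i) (same 2 i)) (trans (arr-keep f′ (_<ᵇ 2) 3 i) (same 3 i))
                       (trans (arr-keep f′ (_<ᵇ 2) 4 i) (same 4 i)) (trans (arr-keep f′ (_<ᵇ 2) 5 i) (same 5 i))
                       (trans (arr-keep f′ (_<ᵇ 2) 6 i) (same 6 i))) ,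
          record { merged = subst₂ (λ u v → Merge u v _) (seg-cong a a l₁ (λ j _ → same 0 (a + j)))
                              (seg-cong (a + l₁) (a + l₁) l₂ (λ j _ → same 0 (a + l₁ + j))) (Merged.merged mg)
                 ; rest = λ j o → trans (Merged.rest mg j o) (same 0 j) } }) })

  body-small : ∀ {σ s′ lo a b h} → regs σ rSP ≡ suc s′ → item σ s′ ≡ (0 , lo , a , b , h) → ¬ (suc a < b) →
               Spec body σ (λ t σ′ → t ≤ 100 × regs σ′ rSP ≡ s′ × (∀ k i → arr σ′ k i ≡ arr σ k i))
  body-small {σ} p q nl =
    seqS (mapS (pop-spec p q) λ { t σ₁ f (l , pp) → let open Popped pp in
      elseS rT≡ (elseS (cong bit (<-false λ l → nl (subst₂ _<_ (trans (cong (_+ 1) rA≡) (ℕ.+-comm _ 1)) rB≡ l)))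
        (byWp (ℕ.≤-trans (ℕ.+-monoˡ-≤ _ l) (ℕ.≤ᵇ⇒≤ _ _ tt) , rSP≡ , same))) })

  -- `lo′ , v₁ , v₂` describe the pivots that remain. The spent pivot `x` is taken from one of the
  -- two ends of the window, so the window stays contiguous.
  record PivotStep (lo w₁ len w₂ s′ : ℕ) (σ₀ σ : State) : Set where
    field
      x lo′ v₁ v₂ : ℕ
      x∈      : x ∈ˡ seg (arr σ₀ 0) lo w₁ ++ seg (arr σ₀ 0) (lo + w₁ + len) w₂
      lo+     : lo′ + v₁ ≡ lo + w₁
      v₁+v₂   : suc (v₁ + v₂) ≡ w₁ + w₂
      v₁⊆     : ∀ {y} → y ∈ˡ seg (arr σ₀ 0) lo′ v₁ → y ∈ˡ seg (arr σ₀ 0) lo w₁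
      v₂≤     : v₂ ≤ w₂
      pivoted : Pivoted x lo′ (lo + w₁) len (lo + w₁ + len + v₂) s′ σ₀ σ

  body-pivot : ∀ {σ s′} lo w₁ len w₂ → Env σ → regs σ rSP ≡ suc s′ → 2 ≤ len → 0 < w₁ + w₂ →
               item σ s′ ≡ (0 , lo , lo + w₁ , lo + w₁ + len , lo + w₁ + len + w₂) →
               (∀ j → j < lo + w₁ + len + w₂ → arr σ 0 j < n) →
               Spec body σ (λ t σ′ → Lin 500 140 len t × PivotStep lo w₁ len w₂ s′ σ σ′)
  body-pivot {σ} {s′} lo w₁ len w₂ env p 2≤ 0< q P< =
    seqS (mapS (pop-spec p q) λ { t σ₁ f (l , pp) → let open Popped pp in
      elseS rT≡ (thenS (big {σ₁} rA≡ rB≡) (setS (setS (seqS (byWp (pick w₁ w₂ 0< l pp (env-frame f env) q P<)))))) })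
    where
    big : ∀ {σ₁} → regs σ₁ rA ≡ lo + w₁ → regs σ₁ rB ≡ lo + w₁ + len → ⟦ reg rA ⊕ lit 1 ≺ reg rB ⟧ σ₁ ≢ 0
    big a b = bit≢0 refl (<-true (subst₂ _<_ (sym (cong (_+ 1) a)) (sym b) (ℕ.+-monoʳ-< (lo + w₁) 2≤)))
    pick : ∀ {t σ₁} w₁ w₂ → 0 < w₁ + w₂ → t ≤ 60 → Popped s′ 0 lo (lo + w₁) (lo + w₁ + len) (lo + w₁ + len + w₂) σ σ₁ → Env σ₁ →
           item σ s′ ≡ (0 , lo , lo + w₁ , lo + w₁ + len , lo + w₁ + len + w₂) → (∀ j → j < lo + w₁ + len + w₂ → arr σ 0 j < n) →
           wp choose (λ t₁ σ₂ → Spec (partition ︔ finish) σ₂ (λ t₂ σ′ →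
             Lin 500 140 len (t + (2 + (6 + (2 + (2 + (t₁ + t₂)))))) × PivotStep lo w₁ len w₂ s′ σ σ′))
             (state ((regs σ₁ [ rLV ≔ 0 ]) [ rI ≔ regs σ₁ rA ]) (mem σ₁))
    pick {σ₁ = σ₁} (suc w₁) w₂ _ l pp env₁ q P< =
      (λ _ → mapS (pivot-spec {lo = suc lo} {a = lo + suc w₁} {hi = lo + suc w₁ + len + w₂} {x = arr σ 0 lo}
         (record { rLV≡ = refl ; rI≡ = rA≡ ; rLO≡ = trans (cong (_+ 1) rLO≡) (ℕ.+-comm lo 1) ; rA≡ = rA≡ ; rB≡ = rB≡ ; rHI≡ = rHI≡
                 ; rX≡ = trans (cong (arr σ₁ 0) rLO≡) (same 0 lo) ; rSP≡ = rSP≡ ; same = same })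
         (env-same env₁ refl refl refl refl refl refl)
         (P< lo (ℕ.<-≤-trans (ℕ.m<m+n lo (s≤s z≤n)) (ℕ.≤-trans (ℕ.m≤m+n _ len) (ℕ.m≤m+n _ w₂))))
         (λ j j< → P< (lo + suc w₁ + j) (ℕ.<-≤-trans (ℕ.+-monoʳ-< _ j<) (ℕ.m≤m+n _ w₂))))
        λ { t₂ σ₃ f₂ (l₂ , pv) → weaken (upto 60 l +ˡ const-≤ 2 +ˡ const-≤ 6 +ˡ const-≤ 2 +ˡ const-≤ 2 +ˡ const-≤ (4 + (9 + 4)) +ˡ l₂) , record
          { x = arr σ 0 lo ; lo′ = suc lo ; v₁ = w₁ ; v₂ = w₂ ; x∈ = here refl ; lo+ = sym (ℕ.+-suc lo w₁) ; v₁+v₂ = refl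
          ; v₁⊆ = there ; v₂≤ = ℕ.≤-refl ; pivoted = pv } }) ,
      (λ z → ⊥-elim (bit≢0 refl (<-true (subst₂ _<_ (sym rLO≡) (sym rA≡) (ℕ.m<m+n lo (s≤s z≤n)))) z))
      where open Popped pp
    pick {σ₁ = σ₁} zero (suc w₂) _ l pp env₁ q P< =
      (λ nz → ⊥-elim (nz (cong bit (<-false λ l → ℕ.<-irrefl (sym (ℕ.+-identityʳ lo)) (subst₂ _<_ rLO≡ rA≡ l))))) ,
      (λ _ → (λ _ → mapS (pivot-spec {lo = lo} {a = lo + 0} {hi = lo + 0 + len + w₂} {x = arr σ 0 (lo + 0 + len + w₂)}
         (record { rLV≡ = refl ; rI≡ = rA≡ ; rLO≡ = rLO≡ ; rA≡ = rA≡ ; rB≡ = rB≡ ; rHI≡ = hi≡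
                 ; rX≡ = trans (cong (arr σ₁ 0) hi≡) (same 0 (lo + 0 + len + w₂)) ; rSP≡ = rSP≡ ; same = same })
         (env-same env₁ refl refl refl refl refl refl)
         (P< _ (ℕ.+-monoʳ-< (lo + 0 + len) (ℕ.n<1+n w₂)))
         (λ j j< → P< (lo + 0 + j) (ℕ.<-≤-trans (ℕ.+-monoʳ-< _ j<) (ℕ.m≤m+n _ (suc w₂)))))
        λ { t₂ σ₃ f₂ (l₂ , pv) → weaken (upto 60 l +ˡ const-≤ 2 +ˡ const-≤ 6 +ˡ const-≤ 2 +ˡ const-≤ 2 +ˡ const-≤ (4 + (4 + (4 + 9))) +ˡ l₂) , record
          { x = _ ; lo′ = lo ; v₁ = 0 ; v₂ = w₂ ; x∈ = seg-∈ (arr σ 0) (lo + 0 + len) w₂ (ℕ.n<1+n w₂) ; lo+ = refl ; v₁+v₂ = refl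
          ; v₁⊆ = λ () ; v₂≤ = ℕ.n≤1+n w₂ ; pivoted = pv } }) ,
        (λ z → ⊥-elim (bit≢0 refl (<-true (subst₂ _<_ (sym rB≡) (sym rHI≡) (ℕ.m<m+n (lo + 0 + len) (s≤s z≤n)))) z)))
      where
      open Popped pp
      hi≡ = trans (cong (_∸ 1) rHI≡) (cong (_∸ 1) (ℕ.+-suc (lo + 0 + len) w₂))

  body-level : ∀ {σ s′} a len → Env σ → regs σ rSP ≡ suc s′ → 1 ≤ len → item σ s′ ≡ (0 , a , a , a + suc len , a + suc len) →
               (∀ j → j < a + suc len → arr σ 0 j < n) →
               Spec body σ (λ t σ′ → Lin 500 140 len t × Levelled (arr σ 0 a) a (suc len) s′ σ σ′)
  body-level {σ} {s′} a len env p 1≤ q P< =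
    seqS (mapS (pop-spec p q) λ { t σ₁ f (l , pp) → let open Popped pp in
      elseS rT≡ (thenS (bit≢0 refl (<-true (subst₂ _<_ (sym (cong (_+ 1) rA≡)) (sym rB≡) (ℕ.+-monoʳ-< a (s≤s 1≤)))))
       (setS (setS (seqS (byWp
        ( (λ nz → ⊥-elim (nz (cong bit (<-false λ l → ℕ.<-irrefl refl (subst₂ _<_ rLO≡ rA≡ l)))))
        , (λ _ → (λ nz → ⊥-elim (nz (cong bit (<-false λ l → ℕ.<-irrefl refl (subst₂ _<_ rB≡ rHI≡ l)))))
        , λ _ → mapS (level-spec {σ₀ = σ} {a = a} {len = len}
            (record { rLV≡ = refl ; rI≡ = trans (cong (_+ 1) rA≡) (ℕ.+-comm a 1) ; rLO≡ = rLO≡ ; rA≡ = rA≡ ; rB≡ = rB≡ ; rHI≡ = rHI≡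
                    ; rX≡ = trans (cong (arr σ₁ 0) rA≡) (same 0 a) ; rSP≡ = rSP≡ ; same = same })
            (env-same (env-frame f env) refl refl refl refl refl refl)
            (λ j j< → P< (a + j) (ℕ.+-monoʳ-< a j<)))
          λ { t₂ σ₃ f₂ (l₂ , lv) → weaken (upto 60 l +ˡ const-≤ 2 +ˡ const-≤ 6 +ˡ const-≤ 2 +ˡ const-≤ 2 +ˡ const-≤ (4 + (4 + (9 + (4 + 2)))) +ˡ l₂) , lv })))))))
      })

  record Sorted (lo w₁ a len b w₂ s′ : ℕ) (σ₀ σ : State) : Set where
    field
      rSP≡  : regs σ rSP ≡ s′
      below : ∀ i → i < s′ → item σ i ≡ item σ₀ i
      rest  : Outside σ₀ σ a len
      good  : Good (seg (arr σ₀ 0) a len) (seg (arr σ₀ 0) lo w₁ ++ seg (arr σ₀ 0) b w₂) (seg (arr σ 0) a len)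

  InRange : State → Set
  InRange σ = ∀ j → j < m → arr σ 0 j < n

  still-in-range : ∀ σ σ′ {a len} → InRange σ → Outside σ σ′ a len → seg (arr σ′ 0) a len ↭ seg (arr σ 0) a len →
                   a + len ≤ m → InRange σ′
  still-in-range σ σ′ {a} {len} r o p le j j< with j ℕ.<? a
  ... | yes j<a = subst (_< n) (sym (o j (inj₁ j<a))) (r j j<)
  ... | no  j≮a with j ℕ.<? a + len
  ...   | no  q = subst (_< n) (sym (o j (inj₂ (ℕ.≮⇒≥ q)))) (r j j<)
  ...   | yes q = subst (λ i → arr σ′ 0 i < n) a+i (in-seg (j ∸ a) i<)
    where
    a+i : a + (j ∸ a) ≡ j
    a+i = ℕ.m+[n∸m]≡n (ℕ.≮⇒≥ j≮a)
    i< : j ∸ a < len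
    i< = ℕ.+-cancelˡ-< a _ _ (subst (_< a + len) (sym a+i) q)
    in-seg : ∀ i → i < len → arr σ′ 0 (a + i) < n
    in-seg i i< with ∈-seg (arr σ 0) a len (∈-resp-↭ p (seg-∈ (arr σ′ 0) a i i<))
    ... | i′ , i′< , e = subst (_< n) (sym e) (r (a + i′) (ℕ.<-≤-trans (ℕ.+-monoʳ-< a i′<) le))

  seg-take : ∀ {f a k l y} → k ≤ l → y ∈ˡ seg f a k → y ∈ˡ seg f a l
  seg-take {f} {a} {k} {l} k≤l i = let (j , j< , e) = ∈-seg f a k i in
    subst (_∈ˡ seg f a l) (sym e) (seg-∈ f a j (ℕ.<-≤-trans j< k≤l))

  -- `k` and `z` are the lengths of the two parts and `h` is the width of their window. The `suc` in
  -- a charge pays for segments with nothing to do; a split creates one more of them. Since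
  -- `2 ≤ len`, the released `Q * len` covers this unit together with `C + D * len`, and the case
  -- `len = 2` dictates `Q = C + 2 * D`.
  time-combine : ∀ C D {X k z h N} len → X ≤ C + D * len → 2 ≤ len → k * h + z * h + len ≤ N →
                 X + ((C + 2 * D) * suc (k * h) + (C + 2 * D) * suc (z * h)) ≤ (C + 2 * D) * suc N
  time-combine C D (suc zero) p (s≤s ()) q
  time-combine C D {X} {k} {z} {h} {N} (suc (suc l)) p _ q = begin
    X + (Q * suc (k * h) + Q * suc (z * h)) ≤⟨ ℕ.+-monoˡ-≤ _ p ⟩
    C + D * (2 + l) + (Q * suc (k * h) + Q * suc (z * h)) ≡⟨ e₁ C D l (k * h) (z * h) ⟩
    (3 * C + 6 * D + D * l) + Q * (k * h + z * h) ≤⟨ ℕ.m≤m+n _ (D * l + C * l) ⟩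
    (3 * C + 6 * D + D * l) + Q * (k * h + z * h) + (D * l + C * l) ≡⟨ e₂ C D l (k * h + z * h) ⟩
    Q * suc (k * h + z * h + (2 + l)) ≤⟨ ℕ.*-monoʳ-≤ Q (s≤s q) ⟩
    Q * suc N ∎
    where
    open ℕ.≤-Reasoning
    Q = C + 2 * D
    e₁ : ∀ C D l x y → C + D * (2 + l) + ((C + 2 * D) * suc x + (C + 2 * D) * suc y) ≡ (3 * C + 6 * D + D * l) + (C + 2 * D) * (x + y)
    e₁ = solve-∀
    e₂ : ∀ C D l x → (3 * C + 6 * D + D * l) + (C + 2 * D) * x + (D * l + C * l) ≡ (C + 2 * D) * suc (x + (2 + l))
    e₂ = solve-∀

  abstract
    K : ℕ
    -- 310 per vertex is 140 for a partition and 170 for a merge; 700 covers the constant parts. The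
    -- constant is abstract so that it is not unfolded into a numeral.
    K = 700 + 2 * 310

    time-bound : ∀ {X k z h N} len → X ≤ 700 + 310 * len → 2 ≤ len → k * h + z * h + len ≤ N →
                 X + (K * suc (k * h) + K * suc (z * h)) ≤ K * suc N
    time-bound {k = k} {z} = time-combine 700 310 {k = k} {z}

    102≤K : 102 ≤ K
    102≤K = ℕ.≤ᵇ⇒≤ 102 (700 + 2 * 310) tt

    K≤1320 : K ≤ 1320
    K≤1320 = ℕ.≤-refl

  -- The iterations that remove the top item together with everything pushed on its behalf, within
  -- the charge of the segment.
  Result : ℕ → ℕ → ℕ → ℕ → ℕ → ℕ → ℕ → State → Set
  Result lo w₁ a len b w₂ s′ σ = ∃[ t ] ∃[ σ′ ] Iter (reg rSP) body σ t σ′ × t ≤ K * suc (len * (w₁ + len + w₂)) ×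
                                 Sorted lo w₁ a len b w₂ s′ σ σ′

  iterate : ∀ {σ s′ Q} → regs σ rSP ≡ suc s′ → Spec body σ Q →
            ∃[ t ] ∃[ σ′ ] Iter (reg rSP) body σ (2 + t + 0) σ′ × Frame body σ σ′ × Q t σ′
  iterate p (spec (t , σ′ , x , q)) = t , σ′ , cons (λ z → case trans (sym p) z of λ ()) x nil , frame x , q

  -- The charge `len * (w₁ + len + w₂)` also serves as termination measure: it is strictly smaller
  -- for both parts. The ends are given by equations because those of the parts arise in other
  -- shapes.
  proc : ∀ fuel lo w₁ len w₂ {a b hi s′ σ} → len * (w₁ + len + w₂) < fuel → Env σ → InRange σ → regs σ rSP ≡ suc s′ →
         item σ s′ ≡ (0 , lo , a , b , hi) → a ≡ lo + w₁ → b ≡ a + len → hi ≡ b + w₂ → hi ≤ m → Result lo w₁ a len b w₂ s′ σ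

  proc-small : ∀ lo w₁ len w₂ {a b hi s′ σ} → len ≤ 1 → regs σ rSP ≡ suc s′ → item σ s′ ≡ (0 , lo , a , b , hi) → b ≡ a + len →
               Result lo w₁ a len b w₂ s′ σ
  proc-small lo w₁ len w₂ {a} {s′ = s′} {σ = σ} le p q refl =
    let (t , σ′ , it , _ , l , sp , same) = iterate p (body-small p q (λ l → ℕ.<⇒≱ l (ℕ.≤-trans (ℕ.+-monoʳ-≤ a le) (ℕ.≤-reflexive (ℕ.+-comm a 1)))))
    in _ , σ′ , it ,
       ℕ.≤-trans (ℕ.+-monoˡ-≤ 0 (ℕ.+-monoʳ-≤ 2 l)) (ℕ.≤-trans 102≤K (ℕ.m≤m*n K (suc (len * (w₁ + len + w₂))))) , record
       { rSP≡ = sp ; below = λ i _ → tuple (same 2 i) (same 3 i) (same 4 i) (same 5 i) (same 6 i)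
       ; rest = λ j _ → same 0 j
       ; good = subst (Good (seg (arr σ 0) a len) _) (seg-cong a a len (λ j _ → sym (same 0 (a + j)))) (tiny len le) }
    where
    tiny : ∀ len {W} → len ≤ 1 → Good (seg (arr σ 0) a len) W (seg (arr σ 0) a len)
    tiny zero _ = good-empty
    tiny (suc zero) _ = good-single
    tiny (suc (suc _)) (s≤s ())

  proc-pivot : ∀ fuel lo w₁ len w₂ {s′ σ} → len * (w₁ + len + w₂) < suc fuel → Env σ → InRange σ → regs σ rSP ≡ suc s′ →
               item σ s′ ≡ (0 , lo , lo + w₁ , lo + w₁ + len , lo + w₁ + len + w₂) → lo + w₁ + len + w₂ ≤ m → 2 ≤ len → 0 < w₁ + w₂ →
               Result lo w₁ (lo + w₁) len (lo + w₁ + len) w₂ s′ σ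
  proc-pivot fuel lo w₁ len w₂ {s′} {σ} f< env rng p q hi≤ 2≤ 0<
    = first (iterate p (body-pivot lo w₁ len w₂ env p 2≤ 0< q (λ j j< → rng j (ℕ.<-≤-trans j< hi≤))))
   where
   first : ∃[ t ] ∃[ σ′ ] Iter (reg rSP) body σ (2 + t + 0) σ′ × Frame body σ σ′ × Lin 500 140 len t × PivotStep lo w₁ len w₂ s′ σ σ′ →
           Result lo w₁ (lo + w₁) len (lo + w₁ + len) w₂ s′ σ
   first (t₁ , σ₁ , it₁ , fr₁ , l₁ , ps) = go
    where
    open PivotStep ps
    open Pivoted pivoted renaming (perm to shuffle)
    a = lo + w₁
    b = a + len
    h′ = v₁ + v₂ + len
    P  = arr σ 0
    P₁ = arr σ₁ 0
    env₁ = env-frame fr₁ env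
    k≤ : k ≤ len
    k≤ = subst (k ≤_) k+z (ℕ.m≤m+n k z)
    z≤ : z ≤ len
    z≤ = subst (z ≤_) k+z (ℕ.m≤n+m z k)
    b≡ : b ≡ a + k + z
    b≡ = trans (cong (a +_) (sym k+z)) (sym (ℕ.+-assoc a k z))
    b≤ : b ≤ m
    b≤ = ℕ.≤-trans (ℕ.m≤m+n b w₂) hi≤
    e₃ : ∀ a k z v → a + (k + z) + v ≡ a + k + (z + v)
    e₃ = solve-∀
    e₄ : ∀ v k z u → v + u + (k + z) ≡ v + k + (z + u)
    e₄ = solve-∀
    e₅ : ∀ w l u → w + l + u ≡ w + u + l
    e₅ = solve-∀
    e₆ : ∀ p q r s → p + s + (q + r) ≡ p + (q + (r + s))
    e₆ = solve-∀
    e₇ : ∀ v k z u → v + u + (k + z) ≡ v + k + z + u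
    e₇ = solve-∀
    hk : v₁ + k + (z + v₂) ≡ h′
    hk = trans (sym (e₄ v₁ k z v₂)) (cong (v₁ + v₂ +_) k+z)
    hz : v₁ + k + z + v₂ ≡ h′
    hz = trans (sym (e₇ v₁ k z v₂)) (cong (v₁ + v₂ +_) k+z)
    hN : w₁ + len + w₂ ≡ suc h′
    hN = trans (e₅ w₁ len w₂) (cong (_+ len) (sym v₁+v₂))
    hi₁ : b + v₂ ≤ m
    hi₁ = ℕ.≤-trans (ℕ.+-monoʳ-≤ b v₂≤) hi≤
    rng₁ : InRange σ₁
    rng₁ = still-in-range σ σ₁ rng rest (subst (λ l → seg P₁ a l ↭ seg P a len) k+z
             (subst (_↭ seg P a len) (sym (seg-++ P₁ a k z)) shuffle)) b≤
    less : ∀ {q} → q ≤ len → q * h′ < fuel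
    less q≤ = ℕ.<-≤-trans (ℕ.≤-<-trans (ℕ.*-monoˡ-≤ h′ q≤) (ℕ.*-monoʳ-< len {{>-nonZero (ℕ.≤-trans (s≤s z≤n) 2≤)}} (ℕ.n<1+n h′)))
                (subst (λ h → len * h ≤ fuel) hN (ℕ.≤-pred f<))
    before : ∀ {f g : ℕ → ℕ} → (∀ j → j < a ⊎ b ≤ j → f j ≡ g j) → seg f lo′ v₁ ≡ seg g lo′ v₁
    before h = seg-cong lo′ lo′ v₁ (λ j j< → h (lo′ + j) (inj₁ (subst (lo′ + j <_) lo+ (ℕ.+-monoʳ-< lo′ j<))))
    after : ∀ {f g : ℕ → ℕ} → (∀ j → j < a ⊎ b ≤ j → f j ≡ g j) → seg f b v₂ ≡ seg g b v₂
    after h = seg-cong b b v₂ (λ j j< → h (b + j) (inj₂ (ℕ.m≤m+n b j)))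
    W = seg P lo w₁ ++ seg P b w₂
    old₁ : ∀ {y} → y ∈ˡ seg P lo′ v₁ → y ∈ˡ W
    old₁ = ∈-++⁺ˡ ∘ v₁⊆
    old₂ : ∀ {y} → y ∈ˡ seg P b v₂ → y ∈ˡ W
    old₂ = ∈-++⁺ʳ (seg P lo w₁) ∘ seg-take v₂≤
    W₁⊆ : ∀ {y} → y ∈ˡ seg P₁ lo′ v₁ ++ seg P₁ (a + k) (z + v₂) → y ∈ˡ seg P₁ (a + k) z ⊎ y ∈ˡ W
    W₁⊆ {y} i with ∈-++⁻ (seg P₁ lo′ v₁) i
    ... | inj₁ j = inj₂ (old₁ (subst (y ∈ˡ_) (before rest) j))
    ... | inj₂ j with ∈-++⁻ (seg P₁ (a + k) z) (subst (y ∈ˡ_) (seg-++ P₁ (a + k) z v₂) j)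
    ... | inj₁ j′ = inj₁ j′
    ... | inj₂ j′ = inj₂ (old₂ (subst (y ∈ˡ_) (trans (cong (λ c → seg P₁ c v₂) (sym b≡)) (after rest)) j′))
    go : Result lo w₁ a len b w₂ s′ σ
    second : Result lo′ v₁ a k (a + k) (z + v₂) (2 + s′) σ₁ → Result lo w₁ a len b w₂ s′ σ
    go = second (proc fuel lo′ v₁ k (z + v₂) (subst (λ h → k * h < fuel) (sym hk) (less k≤)) env₁ rng₁ rSP≡ item₂ (sym lo+) refl
              (trans (cong (λ l → a + l + v₂) (sym k+z)) (e₃ a k z v₂)) hi₁)
    second (t₂ , σ₂ , it₂ , l₂ , so₂) = third
      (proc fuel lo′ (v₁ + k) z v₂ (subst (λ h → z * h < fuel) (sym hz) (less z≤)) (env-frame (iter-frame it₂) env₁)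
              (still-in-range σ₁ σ₂ rng₁ (Sorted.rest so₂) (Good.perm (Sorted.good so₂)) (ℕ.≤-trans (ℕ.+-monoʳ-≤ a k≤) b≤)) (Sorted.rSP≡ so₂)
              (trans (Sorted.below so₂ (1 + s′) ℕ.≤-refl) item₁) (trans (cong (_+ k) (sym lo+)) (ℕ.+-assoc lo′ v₁ k)) b≡ refl hi₁)
     where
     third : Result lo′ (v₁ + k) (a + k) z b v₂ (1 + s′) σ₂ → Result lo w₁ a len b w₂ s′ σ
     third (t₃ , σ₃ , it₃ , l₃ , so₃) = finale
      where
      P₂ = arr σ₂ 0
      P₃ = arr σ₃ 0
      rng₃ : InRange σ₃
      rng₃ = still-in-range σ₂ σ₃ (still-in-range σ₁ σ₂ rng₁ (Sorted.rest so₂) (Good.perm (Sorted.good so₂)) (ℕ.≤-trans (ℕ.+-monoʳ-≤ a k≤) b≤))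
               (Sorted.rest so₃) (Good.perm (Sorted.good so₃)) (subst (_≤ m) b≡ b≤)
      env₃ = env-frame (iter-frame it₃) (env-frame (iter-frame it₂) env₁)
      P₂≡ : ∀ j → j < a ⊎ b ≤ j → P₂ j ≡ P j
      P₂≡ j o = trans (Sorted.rest so₂ j (case o of λ { (inj₁ u) → inj₁ u ; (inj₂ u) → inj₂ (ℕ.≤-trans (ℕ.+-monoʳ-≤ a k≤) u) })) (rest j o)
      P₃≡ : ∀ j → j < a ⊎ b ≤ j → P₃ j ≡ P j
      P₃≡ j o = trans (Sorted.rest so₃ j (case o of λ { (inj₁ u) → inj₁ (ℕ.<-≤-trans u (ℕ.m≤m+n a k)) ; (inj₂ u) → inj₂ (subst (_≤ j) b≡ u) })) (P₂≡ j o)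
      below₂ : ∀ i → i < 2 + s′ → item σ₂ i ≡ item σ₁ i
      below₂ = Sorted.below so₂
      -- Sorting the left part has permuted its cells, but as pivots for the right part only the set
      -- of its vertices matters.
      W₂⊆ : ∀ {y} → y ∈ˡ seg P₂ lo′ (v₁ + k) ++ seg P₂ b v₂ → y ∈ˡ seg P₁ a k ⊎ y ∈ˡ W
      W₂⊆ {y} i with ∈-++⁻ (seg P₂ lo′ (v₁ + k)) i
      ... | inj₂ j = inj₂ (old₂ (subst (y ∈ˡ_) (after P₂≡) j))
      ... | inj₁ j with ∈-++⁻ (seg P₂ lo′ v₁) (subst (y ∈ˡ_) (seg-++ P₂ lo′ v₁ k) j)
      ... | inj₁ j′ = inj₂ (old₁ (subst (y ∈ˡ_) (before P₂≡) j′))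
      ... | inj₂ j′ = inj₁ (∈-resp-↭ (Good.perm (Sorted.good so₂)) (subst (λ c → y ∈ˡ seg P₂ c k) lo+ j′))
      P₂R : seg P₂ (a + k) z ≡ seg P₁ (a + k) z
      P₂R = seg-cong (a + k) (a + k) z (λ j _ → Sorted.rest so₂ (a + k + j) (inj₂ (ℕ.m≤m+n (a + k) j)))
      P₃L : seg P₃ a k ≡ seg P₂ a k
      P₃L = seg-cong a a k (λ j j< → Sorted.rest so₃ (a + j) (inj₁ (ℕ.+-monoʳ-< a j<)))
      finale : Result lo w₁ a len b w₂ s′ σ
      finale = fourth (iterate (Sorted.rSP≡ so₃) (body-merge {l₁ = k} {l₂ = z} env₃ (Sorted.rSP≡ so₃)
                (trans (Sorted.below so₃ s′ (ℕ.n<1+n s′)) (trans (below₂ s′ (ℕ.m≤n⇒m≤1+n ℕ.≤-refl)) (trans (proj₂ item₀) (tuple refl refl refl b≡ refl))))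
                (λ j j< → rng₃ (a + j) (ℕ.<-≤-trans (ℕ.+-monoʳ-< a j<) (subst (_≤ m) (cong (a +_) (sym k+z)) b≤)))))
       where
       fourth : ∃[ t ] ∃[ σ′ ] Iter (reg rSP) body σ₃ (2 + t + 0) σ′ × Frame body σ₃ σ′ × Lin 100 170 (k + z) t × regs σ′ rSP ≡ s′ ×
                (∀ i → item σ′ i ≡ item σ₃ i) × Merged tournament a k z σ₃ σ′ → Result lo w₁ a len b w₂ s′ σ
       fourth (t₄ , σ₄ , it₄ , _ , l₄ , sp₄ , st₄ , mg) = _ , σ₄ , iter-++ it₁ (iter-++ it₂ (iter-++ it₃ it₄)) ,
        ℕ.≤-trans (ℕ.≤-reflexive (sym (e₆ (2 + t₁ + 0) t₂ t₃ (2 + t₄ + 0)))) (subst (λ N → 2 + t₁ + 0 + (2 + t₄ + 0) + (t₂ + t₃) ≤ K * suc (len * N)) (sym hN)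
          (ℕ.≤-trans (ℕ.+-monoʳ-≤ (2 + t₁ + 0 + (2 + t₄ + 0)) (ℕ.+-mono-≤ (subst (λ h → t₂ ≤ K * suc (k * h)) hk l₂) (subst (λ h → t₃ ≤ K * suc (z * h)) hz l₃)))
            (time-bound {k = k} {z} {h′} len (Lin.bound (weaken {a′ = 700} {b′ = 310} {l = len}
               ((const-≤ 2 +ˡ l₁ +ˡ const-≤ 0) +ˡ (const-≤ 2 +ˡ subst (λ l → Lin 100 170 l t₄) k+z l₄ +ˡ const-≤ 0)))) 2≤
               (ℕ.≤-reflexive (trans (cong (_+ len) (sym (ℕ.*-distribʳ-+ h′ k z))) (trans (cong (λ l → l * h′ + len) k+z)
                 (trans (ℕ.+-comm (len * h′) len) (sym (ℕ.*-suc len h′)))))))))  , record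
        { rSP≡ = sp₄
        ; below = λ i i< → trans (st₄ i) (trans (Sorted.below so₃ i (ℕ.m≤n⇒m≤1+n i<)) (trans (below₂ i (ℕ.m≤n⇒m≤1+n (ℕ.m≤n⇒m≤1+n i<))) (below i i<)))
        ; rest = λ j o → trans (Merged.rest mg j (subst (λ l → j < a ⊎ a + l ≤ j) (sym k+z) o)) (P₃≡ j o)
        ; good = subst (λ l → Good (seg P a len) W (seg (arr σ₄ 0) a l)) k+z
            (good-pivot shuffle outs ins W₁⊆ W₂⊆ (Sorted.good so₂)
               (subst (λ c → Good c _ (seg P₃ (a + k) z)) P₂R (Sorted.good so₃)) x∈
               (subst (λ c → Merge c (seg P₃ (a + k) z) _) P₃L (Merged.merged mg))) }

  -- The charge is a square here, as the window is the segment itself. Fixing one vertex leaves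
  -- parts of total length `len` in the same window.
  proc-level : ∀ fuel a len {s′ σ} → suc len * suc len < suc fuel → Env σ → InRange σ → regs σ rSP ≡ suc s′ →
               item σ s′ ≡ (0 , a , a , a + suc len , a + suc len) → a + suc len ≤ m → 1 ≤ len →
               Result a 0 a (suc len) (a + suc len) 0 s′ σ

  proc zero lo w₁ len w₂ ()
  proc (suc fuel) lo w₁ zero w₂ f< env rng p q refl refl refl hi≤ = proc-small lo w₁ 0 w₂ z≤n p q refl
  proc (suc fuel) lo w₁ (suc zero) w₂ f< env rng p q refl refl refl hi≤ = proc-small lo w₁ 1 w₂ ℕ.≤-refl p q refl
  proc (suc fuel) lo (suc w₁) len@(suc (suc _)) w₂ f< env rng p q refl refl refl hi≤ =
    proc-pivot fuel lo (suc w₁) len w₂ f< env rng p q hi≤ (s≤s (s≤s z≤n)) (s≤s z≤n)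
  proc (suc fuel) lo zero len@(suc (suc _)) (suc w₂) f< env rng p q refl refl refl hi≤ =
    proc-pivot fuel lo zero len (suc w₂) f< env rng p q hi≤ (s≤s (s≤s z≤n)) (s≤s z≤n)
  proc (suc fuel) lo zero (suc (suc l)) zero {s′ = s′} {σ = σ} f< env rng p q refl refl refl hi≤ =
    subst (λ a → Result lo 0 a (suc (suc l)) (a + suc (suc l)) 0 s′ σ) (sym (ℕ.+-identityʳ lo))
     (proc-level fuel lo (suc l) (subst (λ h → suc (suc l) * h < suc fuel) (ℕ.+-identityʳ (suc (suc l))) f<) env rng p
       (trans q (tuple refl refl (ℕ.+-identityʳ lo) (cong (_+ suc (suc l)) (ℕ.+-identityʳ lo)) (trans (ℕ.+-identityʳ _) (cong (_+ suc (suc l)) (ℕ.+-identityʳ lo)))))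
       (subst (_≤ m) (trans (ℕ.+-identityʳ _) (cong (_+ suc (suc l)) (ℕ.+-identityʳ lo))) hi≤) (s≤s z≤n))

  proc-level fuel a len {s′} {σ} f< env rng p q b≤ 1≤
    = first (iterate p (body-level a len env p 1≤ q (λ j j< → rng j (ℕ.<-≤-trans j< b≤))))
   where
   first : ∃[ t ] ∃[ σ′ ] Iter (reg rSP) body σ (2 + t + 0) σ′ × Frame body σ σ′ × Lin 500 140 len t ×
           Levelled (arr σ 0 a) a (suc len) s′ σ σ′ → Result a 0 a (suc len) (a + suc len) 0 s′ σ
   first (t₁ , σ₁ , it₁ , fr₁ , l₁ , lv) = go
    where
    open Levelled lv renaming (perm to shuffle)
    v = arr σ 0 a
    b : ℕ
    b = a + suc len
    P₁ = arr σ₁ 0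
    env₁ = env-frame fr₁ env
    b≡ : b ≡ a + suc k + z
    b≡ = trans (cong (a +_) (sym k+z)) (sym (ℕ.+-assoc a (suc k) z))
    b≡′ : b ≡ a + k + suc z
    b≡′ = trans (cong (a +_) (trans (sym k+z) (sym (ℕ.+-suc k z)))) (sym (ℕ.+-assoc a k (suc z)))
    k< : k < suc len
    k< = subst (k <_) k+z (s≤s (ℕ.m≤m+n k z))
    z< : z < suc len
    z< = subst (z <_) k+z (s≤s (ℕ.m≤n+m z k))
    whole : ∀ f → seg f a (suc len) ≡ seg f a k ++ f (a + k) ∷ seg f (a + suc k) z
    whole f = trans (cong (seg f a) (trans (sym k+z) (sym (ℕ.+-suc k z)))) (trans (seg-++ f a k (suc z))
                (cong (λ c → seg f a k ++ f (a + k) ∷ seg f c z) (sym (ℕ.+-suc a k))))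
    rng₁ : InRange σ₁
    rng₁ = still-in-range σ σ₁ rng rest (subst (_↭ seg (arr σ 0) a (suc len)) (sym (trans (whole P₁) (cong (λ y → seg P₁ a k ++ y ∷ seg P₁ (a + suc k) z) mid))) shuffle) b≤
    hk : k + suc z ≡ suc len
    hk = trans (ℕ.+-suc k z) k+z
    hz : suc k + z + 0 ≡ suc len
    hz = trans (ℕ.+-identityʳ _) k+z
    fuel≤ : suc len * suc len ≤ fuel
    fuel≤ = ℕ.≤-pred f<
    go : Result a 0 a (suc len) b 0 s′ σ
    second : Result a 0 a k (a + k) (suc z) (1 + s′) σ₁ → Result a 0 a (suc len) b 0 s′ σ
    go = second (proc fuel a 0 k (suc z) (ℕ.<-≤-trans (subst (λ h → k * h < suc len * suc len) (sym hk) (ℕ.*-monoˡ-< (suc len) k<)) fuel≤) env₁ rng₁ rSP≡ item₁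
              (sym (ℕ.+-identityʳ a)) refl b≡′ b≤)
    second (t₂ , σ₂ , it₂ , l₂ , so₂) = third
      (proc fuel a (suc k) z 0 (ℕ.<-≤-trans (subst (λ h → z * h < suc len * suc len) (sym hz) (ℕ.*-monoˡ-< (suc len) z<)) fuel≤)
              (env-frame (iter-frame it₂) env₁)
              (still-in-range σ₁ σ₂ rng₁ (Sorted.rest so₂) (Good.perm (Sorted.good so₂)) (ℕ.≤-trans (ℕ.+-monoʳ-≤ a (ℕ.<⇒≤ k<)) b≤))
              (Sorted.rSP≡ so₂) (trans (Sorted.below so₂ s′ ℕ.≤-refl) item₀) refl b≡ (sym (ℕ.+-identityʳ b)) b≤)
     where
     third : Result a (suc k) (a + suc k) z b 0 s′ σ₂ → Result a 0 a (suc len) b 0 s′ σ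
     third (t₃ , σ₃ , it₃ , l₃ , so₃) = _ , σ₃ , iter-++ it₁ (iter-++ it₂ it₃) ,
      subst (λ h → 2 + t₁ + 0 + (t₂ + t₃) ≤ K * suc (suc len * h)) (sym (ℕ.+-identityʳ (suc len)))
        (ℕ.≤-trans (ℕ.+-monoʳ-≤ (2 + t₁ + 0) (ℕ.+-mono-≤ (subst (λ h → t₂ ≤ K * suc (k * h)) hk l₂) (subst (λ h → t₃ ≤ K * suc (z * h)) hz l₃)))
          (time-bound {k = k} {z} {suc len} (suc len) (Lin.bound (weaken {a′ = 700} {b′ = 310} {l = suc len} (const-≤ 2 +ˡ shorter l₁ (ℕ.n≤1+n len) +ˡ const-≤ 0))) (s≤s 1≤)
             (ℕ.≤-reflexive (trans (cong (_+ suc len) (sym (ℕ.*-distribʳ-+ (suc len) k z))) (trans (ℕ.+-comm _ (suc len)) (cong (_* suc len) k+z)))))) ,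
      record
      { rSP≡ = Sorted.rSP≡ so₃
      ; below = λ i i< → trans (Sorted.below so₃ i i<) (trans (Sorted.below so₂ i (ℕ.m≤n⇒m≤1+n i<)) (below i i<))
      ; rest = λ j o → trans (Sorted.rest so₃ j (case o of λ { (inj₁ u) → inj₁ (ℕ.<-≤-trans u (ℕ.m≤m+n a (suc k))) ; (inj₂ u) → inj₂ (subst (_≤ j) b≡ u) }))
                     (trans (Sorted.rest so₂ j (case o of λ { (inj₁ u) → inj₁ u ; (inj₂ u) → inj₂ (ℕ.≤-trans (ℕ.+-monoʳ-≤ a (ℕ.<⇒≤ k<)) u) })) (rest j o))
      ; good = subst (Good (seg (arr σ 0) a (suc len)) _) (sym (trans (whole (arr σ₃ 0)) (cong₂ _++_ P₃L (cong (_∷ seg (arr σ₃ 0) (a + suc k) z) P₃v))))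
          (good-level shuffle outs ins W₁⊆ W₂⊆ (Sorted.good so₂) (subst (λ c → Good c _ (seg (arr σ₃ 0) (a + suc k) z)) P₂R (Sorted.good so₃))) }
      where
      P₂ = arr σ₂ 0
      P₃ = arr σ₃ 0
      P₃L : seg P₃ a k ≡ seg P₂ a k
      P₃L = seg-cong a a k (λ j j< → Sorted.rest so₃ (a + j) (inj₁ (ℕ.+-monoʳ-< a (ℕ.m≤n⇒m≤1+n j<))))
      P₂v : P₂ (a + k) ≡ v
      P₂v = trans (Sorted.rest so₂ (a + k) (inj₂ ℕ.≤-refl)) mid
      P₃v : P₃ (a + k) ≡ v
      P₃v = trans (Sorted.rest so₃ (a + k) (inj₁ (ℕ.+-monoʳ-< a (ℕ.n<1+n k)))) P₂v
      P₂R : seg P₂ (a + suc k) z ≡ seg P₁ (a + suc k) z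
      P₂R = seg-cong (a + suc k) (a + suc k) z (λ j _ → Sorted.rest so₂ (a + suc k + j) (inj₂ (ℕ.≤-trans (ℕ.+-monoʳ-≤ a (ℕ.n≤1+n k)) (ℕ.m≤m+n (a + suc k) j))))
      W₁⊆ : ∀ {y} → y ∈ˡ seg P₁ (a + k) (suc z) → y ∈ˡ (v ∷ seg P₁ (a + suc k) z)
      W₁⊆ (here e) = here (trans e mid)
      W₁⊆ {y} (there i) = there (subst (λ c → y ∈ˡ seg P₁ c z) (sym (ℕ.+-suc a k)) i)
      W₂⊆ : ∀ {y} → y ∈ˡ seg P₂ a (suc k) ++ [] → y ∈ˡ seg P₁ a k ⊎ y ≡ v
      W₂⊆ {y} i with ∈-++⁻ (seg P₂ a (suc k)) i
      ... | inj₁ j with ∈-++⁻ (seg P₂ a k) (subst (y ∈ˡ_) (seg-snoc P₂ a k) j)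
      ... | inj₁ j′ = inj₁ (∈-resp-↭ (Good.perm (Sorted.good so₂)) j′)
      ... | inj₂ (here e) = inj₂ (trans e P₂v)

  -- The list starts with the vertex 1: the switching vertex 0 is not arranged.
  fill : Cmd
  fill = while (reg rI ≺ reg rM) (put 0 (reg rI) (reg rI ⊕ lit 1) ︔ inc rI)

  sort : Cmd
  sort = set rI (lit 0) ︔ fill ︔ set rSP (lit 0) ︔ set 20 (lit 0) ︔ set 21 (lit 0) ︔ set 22 (lit 0) ︔ set 23 (reg rM) ︔
         set 24 (reg rM) ︔ push ︔ sortLoop

  fill-spec : ∀ {σ₀} → Env σ₀ → regs σ₀ rI ≡ 0 →
              Spec fill σ₀ (λ t σ → Lin 4 40 m t × (∀ j → j < m → arr σ 0 j ≡ suc j))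
  fill-spec {σ₀} env pI = byWp (loop-rule 36 Inv (λ σ → ∀ j → j < m → arr σ 0 j ≡ suc j) step m (0 , refl , pI , λ _ ())
                            (λ t σ l f d → l , d))
    where
    Inv : ℕ → State → Set
    Inv k σ = ∃[ d ] d + k ≡ m × regs σ rI ≡ d × (∀ j → j < d → arr σ 0 j ≡ suc j)
    step : ∀ k σ → Frame (put 0 (reg rI) (reg rI ⊕ lit 1) ︔ inc rI) σ₀ σ → Inv k σ → _
    step zero σ f (d , d+ , pI′ , h) = inj₁ (cong bit (<-false (λ l → ℕ.<-irrefl d≡ (subst₂ _<_ pI′ (trans (reg-same f rM) (M≡ env)) l))) ,
                                             λ j j< → h j (subst (j <_) (sym d≡) j<))
      where d≡ = trans (sym (ℕ.+-identityʳ d)) d+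
    step (suc k) σ f (d , d+ , pI′ , h) = inj₂ (k , refl ,
      bit≢0 refl (<-true (subst₂ _<_ (sym pI′) (sym (trans (reg-same f rM) (M≡ env))) (subst (d <_) d+ (ℕ.m<m+n d (s≤s z≤n))))) ,
      ℕ.≤ᵇ⇒≤ _ _ tt , suc d , trans (sym (ℕ.+-suc d k)) d+ , succ-idx₀ d pI′ , new)
      where
      new : ∀ j → j < suc d → (mem σ [ regs σ rAB + (regs σ rI * 16 + 0) ≔ regs σ rI + 1 ]) (regs σ rAB + (j * 16 + 0)) ≡ suc j
      new j j< with j ℕ.≟ d
      ... | yes refl = trans (arr-same (mem σ) (regs σ rAB) 0 {regs σ rI} {_} {j} pI′) (succ-idx₀ j pI′)
      ... | no ne = trans (arr-idx (mem σ) (regs σ rAB) 0 {regs σ rI} {j} (λ e → ne (trans (sym e) pI′))) (h j (ℕ.≤∧≢⇒< (ℕ.≤-pred j<) ne))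

  m²<n² : suc (m * m) ≤ n * n
  m²<n² = ℕ.*-mono-< m<n m<n

  m≤n² : m ≤ n * n
  m≤n² = ℕ.≤-trans (m≤m² m) (ℕ.<⇒≤ m²<n²)
    where
    m≤m² : ∀ k → k ≤ k * k
    m≤m² zero = z≤n
    m≤m² (suc k) = ℕ.m≤m*n (suc k) (suc k)

  sort-spec : ∀ {σ₀} → Env σ₀ → Spec sort σ₀ (λ t σ → Lin 100 (40 + K) (n * n) t × Good (seg suc 0 m) [] (seg (arr σ 0) 0 m))
  sort-spec {σ₀} env = setS (seqS (mapS (fill-spec (env-same env refl refl refl refl refl refl) refl) λ t₁ σ₁ f₁ h →
    setS (setS (setS (setS (setS (setS (seqS (mapS push-spec λ t₂ σ₂ f₂ p →
      finish₁ σ₁ (proj₁ h) (proj₂ h) (env-same (env-frame f₁ (env-same env refl refl refl refl refl refl)) refl refl refl refl refl refl) f₂ p)))))))))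
    where
    finish₁ : ∀ {t₁ t₂ σ₂} σ₁ → Lin 4 40 m t₁ → (∀ j → j < m → arr σ₁ 0 j ≡ suc j) →
              let σ = state ((((((regs σ₁ [ rSP ≔ 0 ]) [ 20 ≔ 0 ]) [ 21 ≔ 0 ]) [ 22 ≔ 0 ]) [ 23 ≔ regs σ₁ rM ]) [ 24 ≔ regs σ₁ rM ]) (mem σ₁) in
              Env σ → Frame push σ σ₂ →
              t₂ ≤ 60 × regs σ₂ rSP ≡ 1 × item σ₂ 0 ≡ (0 , 0 , 0 , regs σ₁ rM , regs σ₁ rM) × (∀ i → 0 ≢ i → item σ₂ i ≡ item σ i) →
              Spec sortLoop σ₂ (λ t₃ σ₃ → Lin 100 (40 + K) (n * n) (2 + (t₁ + (2 + (2 + (2 + (2 + (2 + (2 + (t₂ + t₃))))))))) ×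
                                          Good (seg suc 0 m) [] (seg (arr σ₃ 0) 0 m))
    finish₁ {t₁} {t₂} {σ₂} σ₁ l₁ P≡ env₁ f₂ (l₂ , sp , it , _) = run (proc (suc (m * (0 + m + 0))) 0 0 m 0 {0} {m} {m} ℕ.≤-refl env₂
        (λ j j< → subst (_< n) (sym (P₂ j j<)) (ℕ.≤-<-trans j< m<n)) sp (trans it (tuple refl refl refl (M≡ env₁) (M≡ env₁))) refl refl (sym (ℕ.+-identityʳ m)) ℕ.≤-refl)
      where
      env₂ = env-frame f₂ env₁
      P₂ : ∀ j → j < m → arr σ₂ 0 j ≡ suc j
      P₂ j j< = trans (arr-keep f₂ (1 <ᵇ_) 0 j) (P≡ j j<)
      run : Result 0 0 0 m m 0 0 σ₂ → _
      run (t₃ , σ₃ , it₃ , l₃ , so) = spec (_ , σ₃ , iter-while it₃ (Sorted.rSP≡ so) ,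
        weaken (const-≤ 2 +ˡ shorter l₁ m≤n² +ˡ const-≤ 2 +ˡ const-≤ 2 +ˡ const-≤ 2 +ˡ const-≤ 2 +ˡ const-≤ 2 +ˡ const-≤ 2 +ˡ upto 60 l₂ +ˡ
           lin {0} {K} (ℕ.≤-trans l₃ (ℕ.*-monoʳ-≤ K (subst (λ h → suc (m * h) ≤ n * n) (sym (ℕ.+-identityʳ m)) m²<n²))) +ˡ const-≤ 2)
          {tt} {le (40 + K)}  ,
        subst (λ C → Good C [] (seg (arr σ₃ 0) 0 m)) (seg-cong 0 0 m P₂) (Sorted.good so))
        where
        le : ∀ x → T (x + 0 <ᵇ suc x)
        le x = ℕ.<⇒<ᵇ (s≤s (ℕ.≤-reflexive (ℕ.+-identityʳ x)))

-- Interval modules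

greatest-below : ∀ {P : ℕ → Set} → (∀ i → Dec (P i)) → ∀ y →
                 (∃[ e ] e < y × P e × (∀ e′ → e < e′ → e′ < y → ¬ P e′)) ⊎ (∀ e → e < y → ¬ P e)
greatest-below P? zero = inj₂ λ _ ()
greatest-below P? (suc y) with P? y
... | yes p = inj₁ (y , ℕ.n<1+n y , p , λ e′ a b _ → ℕ.<⇒≱ a (ℕ.≤-pred b))
... | no np with greatest-below P? y
...   | inj₁ (e , e< , p , h) = inj₁ (e , ℕ.m≤n⇒m≤1+n e< , p , λ e′ a b q → case ℕ.m≤n⇒m<n∨m≡n (ℕ.≤-pred b) of λ
          { (inj₁ c) → h e′ a c q ; (inj₂ refl) → np q })
...   | inj₂ h = inj₂ λ e e< q → case ℕ.m≤n⇒m<n∨m≡n (ℕ.≤-pred e<) of λ { (inj₁ c) → h e c q ; (inj₂ refl) → np q }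

least-above : ∀ {P : ℕ → Set} → (∀ i → Dec (P i)) → ∀ y k →
              (∃[ f ] y ≤ f × f < y + k × P f × (∀ f′ → y ≤ f′ → f′ < f → ¬ P f′)) ⊎ (∀ f → y ≤ f → f < y + k → ¬ P f)
least-above P? y zero = inj₂ λ f a b _ → ℕ.<⇒≱ b (subst (_≤ f) (sym (ℕ.+-identityʳ y)) a)
least-above P? y (suc k) with P? y
... | yes p = inj₁ (y , ℕ.≤-refl , ℕ.m<m+n y (s≤s z≤n) , p , λ f′ a b _ → ℕ.<⇒≱ b a)
... | no np with least-above P? (suc y) k
...   | inj₁ (f , a , b , p , h) = inj₁ (f , ℕ.<⇒≤ a , subst (f <_) (sym (ℕ.+-suc y k)) b , p , λ f′ c d q →
          case ℕ.m≤n⇒m<n∨m≡n c of λ { (inj₁ e) → h f′ e d q ; (inj₂ refl) → np q })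
...   | inj₂ h = inj₂ λ f a b q → case ℕ.m≤n⇒m<n∨m≡n a of λ
          { (inj₁ e) → h f e (subst (f <_) (ℕ.+-suc y k) b) q ; (inj₂ refl) → np q }

Overlaps : ℕ → ℕ → ℕ → ℕ → Set
Overlaps a b c d = (a < c × c ≤ b × b < d) ⊎ (c < a × a ≤ d × d < b)

module Intervals (m : ℕ) (g : ℕ → ℕ → Bool)
                 (tour : ∀ {i j} → i < m → j < m → i ≢ j → g j i ≡ not (g i j))
                 (path : ∀ {i} → suc i < m → g (suc i) i ≡ false) where

  record IsMod (a b : ℕ) : Set where
    constructor isMod
    field homog : ∀ {x i j} → x < m → x < a ⊎ b < x → a ≤ i → i ≤ b → a ≤ j → j ≤ b → g x i ≡ g x j
  open IsMod public

  IsMod? : ∀ a {b} → b < m → Dec (IsMod a b)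
  IsMod? a {b} b< = map′
    (λ h → isMod λ {x} {i} {j} x< o ai ib aj jb → h {x} x< o {i} (ℕ.≤-<-trans ib b<) {j} (ℕ.≤-<-trans jb b<) ai ib aj jb)
    (λ h {x} x< o {i} i< {j} j< ai ib aj jb → homog h {x} {i} {j} x< o ai ib aj jb)
    (ℕ.allUpTo? (λ x → (x ℕ.<? a ⊎-dec b ℕ.<? x) →-dec ℕ.allUpTo? (λ i → ℕ.allUpTo? (λ j →
       a ℕ.≤? i →-dec i ℕ.≤? b →-dec a ℕ.≤? j →-dec j ℕ.≤? b →-dec g x i Bool.≟ g x j) m) m) m)

  singleton-mod : ∀ {a} → IsMod a a
  singleton-mod = isMod λ {x} _ _ ai ia aj ja → cong (g x) (trans (ℕ.≤-antisym ia ai) (ℕ.≤-antisym aj ja))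

  Strong′ : ℕ → ℕ → Set
  Strong′ a b = IsMod a b × (∀ {c d} → c ≤ d → d < m → IsMod c d → ¬ Overlaps a b c d)

  Overlaps? : ∀ a b c d → Dec (Overlaps a b c d)
  Overlaps? a b c d = (a ℕ.<? c ×-dec c ℕ.≤? b ×-dec b ℕ.<? d) ⊎-dec (c ℕ.<? a ×-dec a ℕ.≤? d ×-dec d ℕ.<? b)

  strong-or-overlapped : ∀ {a b} → IsMod a b → Strong′ a b ⊎ (∃[ c ] ∃[ d ] c ≤ d × d < m × IsMod c d × Overlaps a b c d)
  strong-or-overlapped {a} {b} md with ℕ.anyUpTo? (λ d → any-c d) m
    where
    any-c : ∀ d → Dec (∃[ c ] c < suc d × Σ[ d< ∈ d < m ] IsMod c d × Overlaps a b c d)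
    any-c d with d ℕ.<? m
    ... | no d≮ = no λ (_ , _ , d< , _) → d≮ d<
    ... | yes d< = map′ (λ (c , c< , p , o) → c , c< , d< , p , o) (λ (c , c< , _ , p , o) → c , c< , p , o)
                     (ℕ.anyUpTo? (λ c → IsMod? c d< ×-dec Overlaps? a b c d) (suc d))
  ... | yes (d , d< , c , c< , _ , p , o) = inj₂ (c , d , ℕ.≤-pred c< , d< , p , o)
  ... | no h = inj₁ (md , λ {c} {d} c≤ d< p o → h (d , d< , c , s≤s c≤ , d< , p , o))

  union : ∀ {a b c d} → IsMod a b → IsMod c d → a ≤ c → c ≤ b → b ≤ d → IsMod a d
  union {a} {b} {c} {d} p q ac cb bd = isMod λ x< o ai id aj jd → trans (to-c x< o ai id) (sym (to-c x< o aj jd))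
    where
    to-c : ∀ {x i} → x < m → x < a ⊎ d < x → a ≤ i → i ≤ d → g x i ≡ g x c
    to-c {x} {i} x< o ai id with i ℕ.≤? b
    ... | yes ib = homog p x< (case o of λ { (inj₁ u) → inj₁ u ; (inj₂ u) → inj₂ (ℕ.≤-<-trans bd u) }) ai ib ac cb
    ... | no ib = homog q x< (case o of λ { (inj₁ u) → inj₁ (ℕ.<-≤-trans u ac) ; (inj₂ u) → inj₂ u })
                    (ℕ.≤-trans cb (ℕ.<⇒≤ (ℕ.≰⇒> ib))) id ℕ.≤-refl (ℕ.≤-trans cb bd)

  flip-eq : ∀ {x y i} → x < m → y < m → i < m → i ≢ x → i ≢ y → g i x ≡ g i y → g x i ≡ g y i
  flip-eq x< y< i< nx ny e = trans (tour i< x< nx) (trans (cong not e) (sym (tour i< y< ny)))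

  -- Only an `x` in the intersection is in doubt. A position `i` beyond `b` sees `x` as it sees `a`,
  -- by the first module; after reversing the arcs, `x` may be replaced by `a`, which lies outside
  -- of the second module.
  difference-right : ∀ {a b c d} → IsMod a b → IsMod c d → a < c → c ≤ b → b < d → d < m → IsMod (suc b) d
  difference-right {a} {b} {c} {d} p q ac cb bd d< = isMod dif
    where
    dif : ∀ {x i j} → x < m → x < suc b ⊎ d < x → suc b ≤ i → i ≤ d → suc b ≤ j → j ≤ d → g x i ≡ g x j
    dif {x} {i} {j} x< o bi id bj jd with c ℕ.≤? x
    ... | no cx = homog q x< (inj₁ (ℕ.≰⇒> cx)) (ℕ.≤-trans cb (ℕ.<⇒≤ bi)) id (ℕ.≤-trans cb (ℕ.<⇒≤ bj)) jd
    ... | yes cx with o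
    ...   | inj₂ u = homog q x< (inj₂ u) (ℕ.≤-trans cb (ℕ.<⇒≤ bi)) id (ℕ.≤-trans cb (ℕ.<⇒≤ bj)) jd
    ...   | inj₁ u = trans (via bi id) (trans (homog q a< (inj₁ ac) (ℕ.≤-trans cb (ℕ.<⇒≤ bi)) id (ℕ.≤-trans cb (ℕ.<⇒≤ bj)) jd) (sym (via bj jd)))
      where
      a< : a < m
      a< = ℕ.<-trans (ℕ.<-≤-trans ac cb) (ℕ.<-trans bd d<)
      via : ∀ {i} → b < i → i ≤ d → g x i ≡ g a i
      via {i} bi id = flip-eq x< a< i< (λ e → ℕ.<-irrefl (sym e) (ℕ.<-≤-trans u bi)) (λ e → ℕ.<-irrefl (sym e) (ℕ.<-≤-trans ac (ℕ.≤-trans cb (ℕ.<⇒≤ bi))))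
                        (homog p i< (inj₂ bi) (ℕ.≤-trans (ℕ.<⇒≤ ac) cx) (ℕ.≤-pred u) ℕ.≤-refl (ℕ.≤-trans (ℕ.<⇒≤ ac) cb))
        where i< = ℕ.≤-<-trans id d<

  Linear : ℕ → ℕ → Set
  Linear a b = ∃[ e ] a ≤ e × e < b × IsMod a e × IsMod (suc e) b

  record Cut (a b e : ℕ) : Set where
    constructor isCut
    field across : ∀ {i j} → a ≤ i → i ≤ e → e < j → j ≤ b → g i j ≡ true
  open Cut public

  -- All arcs between two disjoint modules have one direction, and the adjacent positions `e` and
  -- `suc e` of the forward path decide which.
  linear⇒cut : ∀ {a b} → b < m → ((e , _) : Linear a b) → Cut a b e
  linear⇒cut {a} {b} b< (e , ae , eb , p , q) = isCut dom
    where
    se< = ℕ.≤-<-trans eb b<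
    e< = ℕ.<-trans (ℕ.n<1+n e) se<
    dom : ∀ {i j} → a ≤ i → i ≤ e → e < j → j ≤ b → g i j ≡ true
    dom {i} {j} ai ie ej jb = trans (tour j< i< j≢i) (cong not (trans (homog p j< (inj₂ ej) ai ie ae ℕ.≤-refl)
      (trans (tour e< j< (ℕ.<⇒≢ ej)) (cong not (trans (homog q e< (inj₁ (ℕ.n<1+n e)) ej jb ℕ.≤-refl eb)
        (trans (tour se< e< (ℕ.<⇒≢ (ℕ.n<1+n e) ∘ sym)) (cong not (path se<))))))))
      where
      j< = ℕ.≤-<-trans jb b<
      i< = ℕ.≤-<-trans ie e<
      j≢i : j ≢ i
      j≢i refl = ℕ.<⇒≱ ej ie

  Cut? : ∀ a {b} → b < m → ∀ e → Dec (Cut a b e)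
  Cut? a {b} b< e = map′
    (λ h → isCut λ {i} {j} ai ie ej jb → h {i} (ℕ.≤-<-trans (ℕ.≤-trans ie (ℕ.<⇒≤ ej)) (ℕ.≤-<-trans jb b<)) {j} (ℕ.≤-<-trans jb b<) ai ie ej jb)
    (λ h {i} i< {j} j< → across h {i} {j})
    (ℕ.allUpTo? (λ i → ℕ.allUpTo? (λ j → a ℕ.≤? i →-dec i ℕ.≤? e →-dec e ℕ.<? j →-dec j ℕ.≤? b →-dec g i j Bool.≟ true) m) m)

  -- The program remembers only the last proper prefix that is a module. If some prefix splits the
  -- interval, so does this one, by the difference of the overlapping `[a , e]` and `[suc e₀ , b]`.
  linear-last : ∀ {a b e} → b < m → Linear a b → a ≤ e → e < b → IsMod a e → (∀ e′ → e < e′ → e′ < b → ¬ IsMod a e′) → IsMod (suc e) b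
  linear-last {a} {b} {e} b< (e₀ , ae₀ , e₀b , p₀ , q₀) ae eb p mx with ℕ.<-cmp e₀ e
  ... | tri< l _ _ = difference-right p q₀ (s≤s ae₀) l eb b<
  ... | tri≈ _ refl _ = q₀
  ... | tri> _ _ l = ⊥-elim (mx e₀ l e₀b p₀)

  module _ {a b : ℕ} (sN : Strong′ a b) (b< : b < m) where

    -- If no cut separates y from y′, the part of [a , b] between the nearest cuts is strong.
    linear-order : ∀ {y y′} → Linear a b → a ≤ y → y < y′ → y′ ≤ b →
                   (∀ {c d} → Strong′ c d → a ≤ c → c ≤ y → y′ ≤ d → d ≤ b → c ≡ a × d ≡ b) → g y y′ ≡ true
    linear-order {y} {y′} ln ay yy′ y′b nostrong = split (least-above (Cut? a b<) y (y′ ∸ y))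
      where
      y+ : y + (y′ ∸ y) ≡ y′
      y+ = ℕ.m+[n∸m]≡n (ℕ.<⇒≤ yy′)

      Lower Upper : ℕ → Set
      Lower c = a ≤ c × c ≤ y × (c ≡ a ⊎ (∃[ e ] c ≡ suc e × Cut a b e)) × (∀ f → c ≤ f → f < y → ¬ Cut a b f)
      Upper d = y′ ≤ d × d ≤ b × (d ≡ b ⊎ Cut a b d) × (∀ f → y′ ≤ f → f < d → ¬ Cut a b f)

      lower : ∃[ c ] Lower c
      lower with greatest-below (λ e → Cut? a b< e ×-dec a ℕ.≤? e) y
      ... | inj₁ (e , e< , (cut , ae) , h) = suc e , ℕ.m≤n⇒m≤1+n ae , e< , inj₂ (e , refl , cut) ,
                                             λ f l u q → h f l u (q , ℕ.≤-trans ae (ℕ.<⇒≤ l))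
      ... | inj₂ h = a , ℕ.≤-refl , ay , inj₁ refl , λ f l u q → h f u (q , l)

      upper : ∃[ d ] Upper d
      upper with least-above (Cut? a b<) y′ (b ∸ y′)
      ... | inj₁ (f , l , u , cut , h) = f , l , ℕ.<⇒≤ (subst (f <_) (ℕ.m+[n∸m]≡n y′b) u) , inj₂ cut , h
      ... | inj₂ h = b , y′b , ℕ.≤-refl , inj₁ refl , λ f l u → h f l (subst (f <_) (sym (ℕ.m+[n∸m]≡n y′b)) u)

      module _ {c d} (lo : Lower c) (hi : Upper d) (none : ∀ f → y ≤ f → f < y′ → ¬ Cut a b f) where
        ac = proj₁ lo
        cy = proj₁ (proj₂ lo)
        y′d = proj₁ hi
        db = proj₁ (proj₂ hi)

        no-cut : ∀ {f} → c ≤ f → f < d → ¬ Cut a b f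
        no-cut {f} l u q with f ℕ.<? y
        ... | yes fy = proj₂ (proj₂ (proj₂ lo)) f l fy q
        ... | no nfy with f ℕ.<? y′
        ...   | yes fy′ = none f (ℕ.≮⇒≥ nfy) fy′ q
        ...   | no nfy′ = proj₂ (proj₂ (proj₂ hi)) f (ℕ.≮⇒≥ nfy′) u q

        from-left : ∀ {x i} → a ≤ x → x < c → c ≤ i → i ≤ b → g x i ≡ true
        from-left ax xc ci ib with proj₁ (proj₂ (proj₂ lo))
        ... | inj₁ refl = ⊥-elim (ℕ.<⇒≱ xc ax)
        ... | inj₂ (e , refl , cut) = across cut ax (ℕ.≤-pred xc) ci ib

        to-right : ∀ {i x} → a ≤ i → i ≤ d → d < x → x ≤ b → g i x ≡ true
        to-right ai id dx xb with proj₁ (proj₂ (proj₂ hi))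
        ... | inj₁ refl = ⊥-elim (ℕ.<⇒≱ dx xb)
        ... | inj₂ cut = across cut ai id dx xb

        opposite : ∀ {i x} → i < x → x ≤ b → g i x ≡ true → g x i ≡ false
        opposite ix xb e = trans (tour (ℕ.<-trans ix (ℕ.≤-<-trans xb b<)) (ℕ.≤-<-trans xb b<) (ℕ.<⇒≢ ix)) (cong not e)

        md : IsMod c d
        md = isMod hom
         where
         hom : ∀ {x i j} → x < m → x < c ⊎ d < x → c ≤ i → i ≤ d → c ≤ j → j ≤ d → g x i ≡ g x j
         hom {x} x< o ci id cj jd with x ℕ.<? a | b ℕ.<? x
         ... | yes xa | _ = homog (proj₁ sN) x< (inj₁ xa) (ℕ.≤-trans ac ci) (ℕ.≤-trans id db) (ℕ.≤-trans ac cj) (ℕ.≤-trans jd db)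
         ... | no _ | yes bx = homog (proj₁ sN) x< (inj₂ bx) (ℕ.≤-trans ac ci) (ℕ.≤-trans id db) (ℕ.≤-trans ac cj) (ℕ.≤-trans jd db)
         ... | no xa | no bx with o
         ...   | inj₁ xc = trans (from-left (ℕ.≮⇒≥ xa) xc ci (ℕ.≤-trans id db)) (sym (from-left (ℕ.≮⇒≥ xa) xc cj (ℕ.≤-trans jd db)))
         ...   | inj₂ dx = trans (opposite (ℕ.≤-<-trans id dx) (ℕ.≮⇒≥ bx) (to-right (ℕ.≤-trans ac ci) id dx (ℕ.≮⇒≥ bx)))
                          (sym (opposite (ℕ.≤-<-trans jd dx) (ℕ.≮⇒≥ bx) (to-right (ℕ.≤-trans ac cj) jd dx (ℕ.≮⇒≥ bx))))

        st : Strong′ c d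
        st = md , avoid
          where
          -- An overlapping module cannot leave the strong `[a , b]`; its boundary inside `[c , d]`
          -- would then be a further cut between the nearest ones.
          avoid : ∀ {p q} → p ≤ q → q < m → IsMod p q → ¬ Overlaps c d p q
          avoid {suc p′} {q} pq q< mp (inj₁ (cp , pd , dq)) with q ℕ.≤? b
          ... | no nqb = proj₂ sN pq q< mp (inj₁ (ℕ.≤-<-trans ac cp , ℕ.≤-trans pd db , ℕ.≰⇒> nqb))
          ... | yes qb = no-cut (ℕ.≤-pred cp) pd cut
            where
            cut : Cut a b p′
            cut = isCut dom
             where
             dom : ∀ {i j} → a ≤ i → i ≤ p′ → p′ < j → j ≤ b → g i j ≡ true
             dom {i} {j} ai ip pj jb with i ℕ.<? c | d ℕ.<? j
             ... | yes ic | _ = from-left ai ic (ℕ.≤-trans (ℕ.<⇒≤ cp) pj) jb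
             ... | no _ | yes dj = to-right ai (ℕ.≤-trans ip (ℕ.<⇒≤ pd)) dj jb
             ... | no _ | no dj = trans (homog mp (ℕ.≤-<-trans ip (ℕ.<-trans pd (ℕ.≤-<-trans db b<))) (inj₁ (s≤s ip)) pj (ℕ.≤-trans (ℕ.≮⇒≥ dj) (ℕ.<⇒≤ dq)) (ℕ.m≤n⇒m≤1+n pd) dq)
                                   (to-right ai (ℕ.≤-trans ip (ℕ.<⇒≤ pd)) (ℕ.n<1+n d) (ℕ.≤-trans dq qb))
          avoid {p} {q} pq q< mp (inj₂ (pc , cq , qd)) with a ℕ.≤? p
          ... | no nap = proj₂ sN pq q< mp (inj₂ (ℕ.≰⇒> nap , ℕ.≤-trans ac cq , ℕ.<-≤-trans qd db))
          ... | yes ap = no-cut cq qd cut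
            where
            cut : Cut a b q
            cut = isCut dom
             where
             dom : ∀ {i j} → a ≤ i → i ≤ q → q < j → j ≤ b → g i j ≡ true
             dom {i} {j} ai iq qj jb with i ℕ.<? c | d ℕ.<? j
             ... | yes ic | _ = from-left ai ic (ℕ.≤-trans cq (ℕ.<⇒≤ qj)) jb
             ... | no _ | yes dj = to-right ai (ℕ.≤-trans iq (ℕ.<⇒≤ qd)) dj jb
             ... | no ic | no dj = trans (tour j< i< (ℕ.<⇒≢ (ℕ.≤-<-trans iq qj) ∘ sym)) (cong not (trans
                 (homog mp j< (inj₂ qj) (ℕ.≤-trans (ℕ.<⇒≤ pc) (ℕ.≮⇒≥ ic)) iq ℕ.≤-refl pq)
                 (opposite (ℕ.≤-<-trans pq qj) jb (from-left ap pc (ℕ.≤-trans cq (ℕ.<⇒≤ qj)) jb))))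
              where
              j< = ℕ.≤-<-trans jb b<
              i< = ℕ.<-trans (ℕ.≤-<-trans iq qj) j<

        absurd : ⊥
        absurd with nostrong st ac cy y′d db
        ... | refl , refl = no-cut (proj₁ (proj₂ ln)) (proj₁ (proj₂ (proj₂ ln))) (linear⇒cut b< ln)

      split : (∃[ e ] y ≤ e × e < y + (y′ ∸ y) × Cut a b e × _) ⊎ (∀ e → y ≤ e → e < y + (y′ ∸ y) → ¬ Cut a b e) → g y y′ ≡ true
      split (inj₁ (e , l , u , cut , _)) = across cut ay l (subst (e <_) y+ u) y′b
      split (inj₂ h) = ⊥-elim (absurd (proj₂ lower) (proj₂ upper) (λ f l u → h f l (subst (f <_) (sym y+) u)))

    -- A module that is not strong is overlapped by another one, which cannot leave the strong
    -- `[a , b]`. If their union is all of `[a , b]`, the difference supplies the second half of a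
    -- split; if not, the union is a larger module to continue with. `fuel` bounds the room left on
    -- both sides.
    nonstrong⇒linear : ∀ fuel {c d} → (c ∸ a) + (b ∸ d) < fuel → IsMod c d → c ≤ d → a ≤ c → d ≤ b → ¬ (c ≡ a × d ≡ b) →
                       (∀ {p q} → Strong′ p q → a ≤ p → p ≤ c → d ≤ q → q ≤ b → p ≡ a × q ≡ b) → Linear a b
    nonstrong⇒linear (suc fuel) {c} {d} fuel> md cd ac db ne h with strong-or-overlapped md
    ... | inj₁ st = ⊥-elim (ne (h st ac ℕ.≤-refl ℕ.≤-refl db))
    ... | inj₂ (p , q , pq , q< , mp , inj₁ (cp , pd , dq)) with q ℕ.≤? b
    ...   | no nqb = ⊥-elim (proj₂ sN pq q< mp (inj₁ (ℕ.≤-<-trans ac cp , ℕ.≤-trans pd db , ℕ.≰⇒> nqb)))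
    ...   | yes qb with c ℕ.≟ a | q ℕ.≟ b
    ...     | yes refl | yes refl = d , cd , dq , md , difference-right md mp cp pd dq q<
    ...     | no nc | _ = nonstrong⇒linear fuel (ℕ.<-≤-trans (ℕ.+-monoʳ-< (c ∸ a) (ℕ.∸-monoʳ-< dq qb)) (ℕ.≤-pred fuel>))
                            (union md mp (ℕ.<⇒≤ cp) pd (ℕ.<⇒≤ dq)) (ℕ.≤-trans cd (ℕ.<⇒≤ dq)) ac qb (nc ∘ proj₁)
                            (λ s l u v → h s l u (ℕ.≤-trans (ℕ.<⇒≤ dq) v))
    ...     | yes _ | no nq = nonstrong⇒linear fuel (ℕ.<-≤-trans (ℕ.+-monoʳ-< (c ∸ a) (ℕ.∸-monoʳ-< dq qb)) (ℕ.≤-pred fuel>))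
                            (union md mp (ℕ.<⇒≤ cp) pd (ℕ.<⇒≤ dq)) (ℕ.≤-trans cd (ℕ.<⇒≤ dq)) ac qb (nq ∘ proj₂)
                            (λ s l u v → h s l u (ℕ.≤-trans (ℕ.<⇒≤ dq) v))
    nonstrong⇒linear (suc fuel) {c} {d} fuel> md cd ac db ne h | inj₂ (p , q , pq , q< , mp , inj₂ (pc , cq , qd)) with a ℕ.≤? p
    ...   | no nap = ⊥-elim (proj₂ sN pq q< mp (inj₂ (ℕ.≰⇒> nap , ℕ.≤-trans ac cq , ℕ.<-≤-trans qd db)))
    ...   | yes ap with p ℕ.≟ a | d ℕ.≟ b
    ...     | yes refl | yes refl = q , pq , qd , mp , difference-right mp md pc cq qd b<
    ...     | no np | _ = nonstrong⇒linear fuel (ℕ.<-≤-trans (ℕ.+-monoˡ-< (b ∸ d) (ℕ.∸-monoˡ-< pc ap)) (ℕ.≤-pred fuel>))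
                            (union mp md (ℕ.<⇒≤ pc) cq (ℕ.<⇒≤ qd)) (ℕ.≤-trans (ℕ.<⇒≤ pc) cd) ap db (np ∘ proj₁)
                            (λ s l u v → h s l (ℕ.≤-trans u (ℕ.<⇒≤ pc)) v)
    ...     | yes _ | no nd = nonstrong⇒linear fuel (ℕ.<-≤-trans (ℕ.+-monoˡ-< (b ∸ d) (ℕ.∸-monoˡ-< pc ap)) (ℕ.≤-pred fuel>))
                            (union mp md (ℕ.<⇒≤ pc) cq (ℕ.<⇒≤ qd)) (ℕ.≤-trans (ℕ.<⇒≤ pc) cd) ap db (nd ∘ proj₂)
                            (λ s l u v → h s l (ℕ.≤-trans u (ℕ.<⇒≤ pc)) v)

-- Loops over an initial segment of the natural numbers

frame-sub : ∀ {c d σ σ′} → (∀ r → T (keeps r d) → T (keeps r c)) → (∀ p → T (puts p d) → T (puts p c)) → Frame c σ σ′ → Frame d σ σ′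
frame-sub h k f = record
  { reg-same = λ r {q} → reg-same f r {h r q}
  ; arr-keep = λ p i {q} {q′} {q″} → arr-keep f p i {k p q} {q′} {q″}
  ; low-same = λ {q} → low-same f {k _ q} }

T-∧₁ : ∀ {a b} → T (a ∧ b) → T a
T-∧₁ {true} _ = tt

T-∧₂ : ∀ {a b} → T (a ∧ b) → T b
T-∧₂ {true} h = h

for : ℕ → Cmd → Cmd
for r c = set r (lit 0) ︔ while (reg r ≺ reg rM) (c ︔ inc r)

least : ℕ → ℕ → Cmd
least r x = cond (reg x ≺ reg r) (set r (reg x)) skip

greatest : ℕ → ℕ → Cmd
greatest r x = cond (reg r ≺ reg x) (set r (reg x)) skip

bit-injective : ∀ {a b} → bit a ≡ bit b → a ≡ b
bit-injective {true}  {true}  _ = refl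
bit-injective {false} {false} _ = refl

lt-nz : ∀ {a b} → bit (a <ᵇ b) ≢ 0 → a < b
lt-nz h = <ᵇ-true (bit≢ h)
  where
  bit≢ : ∀ {b} → bit b ≢ 0 → b ≡ true
  bit≢ {true}  _ = refl
  bit≢ {false} h = ⊥-elim (h refl)

lt-z : ∀ {a b} → bit (a <ᵇ b) ≡ 0 → b ≤ a
lt-z {a} {b} h = ℕ.≮⇒≥ λ l → case trans (sym h) (cong bit (<-true l)) of λ ()

lt⁺ : ∀ {a b} → a < b → bit (a <ᵇ b) ≢ 0
lt⁺ l h = ℕ.<⇒≱ l (lt-z h)

lt⁻ : ∀ {a b} → b ≤ a → bit (a <ᵇ b) ≡ 0
lt⁻ l = cong bit (<-false (ℕ.≤⇒≯ l))

eq-z : ∀ {a b} → bit (a ≡ᵇ b) ≡ 0 → a ≢ b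
eq-z {a} {b} h e = case trans (sym h) (cong bit (≡-true e)) of λ ()

infix 1 _⟷_
_⟷_ : Set → Set → Set
A ⟷ B = (A → B) × (B → A)

⟷-trans : ∀ {A B C : Set} → A ⟷ B → B ⟷ C → A ⟷ C
⟷-trans (f , f′) (h , h′) = h ∘ f , f′ ∘ h′

below-suc : ∀ {P : ℕ → Set} {j} → (∀ i → i < j → P i) → P j → ∀ i → i < suc j → P i
below-suc {P} {j} h p i i< with i ℕ.≟ j
... | yes refl = p
... | no ne = h i (ℕ.≤∧≢⇒< (ℕ.≤-pred i<) ne)

radix-inj : ∀ {N i j k l} → k < N → l < N → i * N + k ≡ j * N + l → i ≡ j × k ≡ l
radix-inj {N} {zero} {zero} k< l< p = refl , p
radix-inj {N} {zero} {suc j} {k} {l} k< l< p =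
  ⊥-elim (ℕ.<⇒≱ k< (ℕ.≤-trans (ℕ.m≤m+n N (j * N)) (ℕ.≤-trans (ℕ.m≤m+n (N + j * N) l) (ℕ.≤-reflexive (sym p)))))
radix-inj {N} {suc i} {zero} {k} {l} k< l< p =
  ⊥-elim (ℕ.<⇒≱ l< (ℕ.≤-trans (ℕ.m≤m+n N (i * N)) (ℕ.≤-trans (ℕ.m≤m+n (N + i * N) k) (ℕ.≤-reflexive p))))
radix-inj {N} {suc i} {suc j} {k} {l} k< l< p =
  let (e , e′) = radix-inj {N} {i} {j} k< l< (ℕ.+-cancelˡ-≡ N _ _ (trans (sym (ℕ.+-assoc N (i * N) k)) (trans p (ℕ.+-assoc N (j * N) l))))
  in cong suc e , e′

-- `(x ≺ y) ≺ ok` is the conjunction of the bit `ok` with `y ≤ x`. It replaces a product, which a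
-- safe program may not store.
below-bound : ∀ {ok x y} → ok ≤ 1 → bit (bit (x <ᵇ y) <ᵇ ok) ≢ 0 ⟷ ok ≢ 0 × y ≤ x
below-bound {ok} {x} {y} ok≤ = to , from
  where
  to : bit (bit (x <ᵇ y) <ᵇ ok) ≢ 0 → ok ≢ 0 × y ≤ x
  to h = (λ { refl → ℕ.n≮0 {bit (x <ᵇ y)} (lt-nz h) }) , ℕ.≮⇒≥ λ l → ℕ.<⇒≱ (lt-nz h) (ℕ.≤-trans ok≤ (ℕ.≤-reflexive (sym (cong bit (<-true l)))))
  from : ok ≢ 0 × y ≤ x → bit (bit (x <ᵇ y) <ᵇ ok) ≢ 0
  from (nz , l) = lt⁺ (subst (_< ok) (sym (lt⁻ {x} {y} l)) (ℕ.n≢0⇒n>0 nz))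

×-⟷ : ∀ {A B C D : Set} → A ⟷ B → C ⟷ D → A × C ⟷ B × D
×-⟷ (f , f′) (h , h′) = (λ (a , c) → f a , h c) , λ (b , d) → f′ b , h′ d

module Loops (L : Layout) (G : ℕ → ℕ → Bool) where
  open Machine L G

  for-spec : ∀ {r c σ₀} T₀ (Inv : ℕ → State → Set) → {_ : T (keeps r c)} → {_ : T (keeps rM (for r c))} → regs σ₀ rM ≡ m →
             (∀ i σ v → Inv i σ → Inv i (state (regs σ [ r ≔ v ]) (mem σ))) → Inv 0 σ₀ →
             (∀ i σ → i < m → Frame (for r c) σ₀ σ → regs σ r ≡ i → Inv i σ → Spec c σ (λ t σ′ → t ≤ T₀ × Inv (suc i) σ′)) →
             Spec (for r c) σ₀ (λ t σ′ → t ≤ 6 + (8 + T₀) * m × Inv m σ′)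
  for-spec {r} {c} {σ₀} T₀ Inv {kr} {kM} pM stable init step = byWp
    (loop-rule {reg r ≺ reg rM} {c ︔ inc r} (T₀ + 4) Inv′ (Inv m) {σ₁} go m (0 , refl , upd-same (regs σ₀) {r} {r} 0 refl , stable 0 σ₀ 0 init)
      (λ t σ l f d → ℕ.≤-trans (ℕ.+-monoʳ-≤ 2 (Lin.bound l)) (ℕ.≤-reflexive (cong (λ x → 6 + (4 + x) * m) (ℕ.+-comm T₀ 4))) , d))
    where
    σ₁ = state (regs σ₀ [ r ≔ 0 ]) (mem σ₀)
    Inv′ : ℕ → State → Set
    Inv′ k σ = ∃[ i ] i + k ≡ m × regs σ r ≡ i × Inv i σ
    fr : ∀ {σ} → Frame (c ︔ inc r) σ₁ σ → Frame (for r c) σ₀ σ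
    fr f = frame-trans (frame-sub (λ x h → T-∧₁ {not (r ≡ᵇ x)} h) (λ p h → T-∧₁ {not (r ≡ᵇ rAB)} h) (frame (ex-set {r} {lit 0} {σ₀})))
                       (frame-sub (λ x h → T-∧₂ {not (r ≡ᵇ x)} h) (λ p h → T-∧₂ {not (r ≡ᵇ rAB)} h) f)
    M′ : ∀ {σ} → Frame (c ︔ inc r) σ₁ σ → regs σ rM ≡ m
    M′ f = trans (reg-same (fr f) rM {kM}) pM
    go : ∀ k σ → Frame (c ︔ inc r) σ₁ σ → Inv′ k σ → (⟦ reg r ≺ reg rM ⟧ σ ≡ 0 × Inv m σ) ⊎
         (∃[ k′ ] k ≡ suc k′ × ⟦ reg r ≺ reg rM ⟧ σ ≢ 0 × wp (c ︔ inc r) (λ t σ′ → t ≤ T₀ + 4 × Inv′ k′ σ′) σ)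
    go zero σ f (i , i+ , pr , v) = inj₁ (lt⁻ (ℕ.≤-reflexive (trans (M′ f) (trans (sym i≡) (sym pr)))) , subst (λ i → Inv i σ) i≡ v)
      where i≡ = trans (sym (ℕ.+-identityʳ i)) i+
    go (suc k) σ f (i , i+ , pr , v) = inj₂ (k , refl , lt⁺ (subst₂ _<_ (sym pr) (sym (M′ f)) i<) ,
        toWp (step i σ i< (fr f) pr v))
      where
      i< : i < m
      i< = subst (i <_) i+ (ℕ.m<m+n i (s≤s z≤n))
      toWp : Spec c σ (λ t σ′ → t ≤ T₀ × Inv (suc i) σ′) → wp (c ︔ inc r) (λ t σ′ → t ≤ T₀ + 4 × Inv′ k σ′) σ
      toWp (spec (t , σ′ , x , l , v′)) = wp-complete x (ℕ.+-monoˡ-≤ 4 l , suc i , trans (sym (ℕ.+-suc i k)) i+ ,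
        trans (upd-same (regs σ′) {r} {r} _ refl) (succ-idx₀ i (trans (keeps-sound r x (T-true kr)) pr)) , stable (suc i) σ′ _ v′)

  quadratic : ∀ {t a b c} → t ≤ a + (c + b * m) * m → Lin a (c + b) (n * n) t
  quadratic {t} {a} {b} {c} p = lin (ℕ.≤-trans p (ℕ.+-monoʳ-≤ a (ℕ.≤-trans (ℕ.≤-reflexive (trans (ℕ.*-distribʳ-+ m c (b * m)) (cong (c * m +_) (ℕ.*-assoc b m m))))
    (ℕ.≤-trans (ℕ.+-mono-≤ (ℕ.*-monoʳ-≤ c m≤) (ℕ.*-monoʳ-≤ b (ℕ.*-mono-≤ (ℕ.<⇒≤ m<n) (ℕ.<⇒≤ m<n)))) (ℕ.≤-reflexive (sym (ℕ.*-distribʳ-+ (n * n) c b)))))))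
    where
    m≤ : m ≤ n * n
    m≤ = ℕ.≤-trans (ℕ.<⇒≤ m<n) (ℕ.m≤m*n n n {{>-nonZero (ℕ.≤-<-trans z≤n m<n)}})

  least-spec : ∀ {σ} r x → Spec (least r x) σ (λ t σ′ → t ≤ 10 × regs σ′ r ≡ regs σ x ⊓ regs σ r × mem σ′ ≡ mem σ × (∀ y → r ≢ y → regs σ′ y ≡ regs σ y))
  least-spec {σ} r x = byWp
    ( (λ nz → ℕ.≤ᵇ⇒≤ 6 10 tt , trans (upd-same (regs σ) {r} {r} _ refl) (sym (ℕ.m≤n⇒m⊓n≡m (ℕ.<⇒≤ (lt-nz nz)))) , refl , λ y ne → upd-diff (regs σ) {r} {y} _ ne)
    , (λ z → ℕ.≤ᵇ⇒≤ 5 10 tt , sym (ℕ.m≥n⇒m⊓n≡n (lt-z z)) , refl , λ _ _ → refl))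

  greatest-spec : ∀ {σ} r x → Spec (greatest r x) σ (λ t σ′ → t ≤ 10 × regs σ′ r ≡ regs σ x ⊔ regs σ r × mem σ′ ≡ mem σ × (∀ y → r ≢ y → regs σ′ y ≡ regs σ y))
  greatest-spec {σ} r x = byWp
    ( (λ nz → ℕ.≤ᵇ⇒≤ 6 10 tt , trans (upd-same (regs σ) {r} {r} _ refl) (sym (ℕ.m≥n⇒m⊔n≡m (ℕ.<⇒≤ (lt-nz nz)))) , refl , λ y ne → upd-diff (regs σ) {r} {y} _ ne)
    , (λ z → ℕ.≤ᵇ⇒≤ 5 10 tt , sym (ℕ.m≤n⇒m⊔n≡n (lt-z z)) , refl , λ _ _ → refl))

  rG rJ : ℕ
  rG = 27
  rJ = 28

  Before : ℕ → ℕ → ℕ → ℕ → Set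
  Before a′ b′ a b = a′ < a ⊎ (a′ ≡ a × b′ < b)

  -- The entries already written by a double loop that has reached `(a , b)`. Entries with `b′ < a′`
  -- are left unspecified, as they belong to no interval.
  Cells : (ℕ → ℕ → ℕ → Set) → ℕ → ℕ → (ℕ → ℕ) → Set
  Cells R a b f = ∀ a′ b′ → Before a′ b′ a b → a′ ≤ b′ → b′ < m → R a′ b′ (f (a′ * n + b′))

  before-suc : ∀ {a′ b′ a b} → Before a′ b′ a (suc b) → Before a′ b′ a b ⊎ (a′ ≡ a × b′ ≡ b)
  before-suc (inj₁ l) = inj₁ (inj₁ l)
  before-suc {b′ = b′} {b = b} (inj₂ (e , l)) with b′ ℕ.≟ b
  ... | yes e′ = inj₂ (e , e′)
  ... | no ne = inj₁ (inj₂ (e , ℕ.≤∧≢⇒< (ℕ.≤-pred l) ne))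

  cells-write : ∀ {R a b f f′} → Cells R a b f → b < m → (∀ i → a * n + b ≢ i → f′ i ≡ f i) → R a b (f′ (a * n + b)) → Cells R a (suc b) f′
  cells-write {R} {a} {b} {f} {f′} h b< o r a′ b′ bf le b′< with before-suc bf
  ... | inj₂ (refl , refl) = r
  ... | inj₁ bf′ = subst (R a′ b′) (sym (o (a′ * n + b′) ne)) (h a′ b′ bf′ le b′<)
    where
    ne : a * n + b ≢ a′ * n + b′
    ne e with radix-inj {n} {a} {a′} (ℕ.<-trans b< m<n) (ℕ.<-trans b′< m<n) e
    ... | refl , refl = case bf′ of λ { (inj₁ l) → ℕ.<-irrefl refl l ; (inj₂ (_ , l)) → ℕ.<-irrefl refl l }

  cells-skip : ∀ {R a b f} → b < a → Cells R a b f → Cells R a (suc b) f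
  cells-skip b<a h a′ b′ bf le b′< with before-suc bf
  ... | inj₁ bf′ = h a′ b′ bf′ le b′<
  ... | inj₂ (refl , refl) = ⊥-elim (ℕ.<⇒≱ b<a le)

  cells-row : ∀ {R a f} → Cells R a m f → Cells R (suc a) 0 f
  cells-row {a = a} h a′ b′ (inj₁ l) le b′< with a′ ℕ.≟ a
  ... | yes refl = h a′ b′ (inj₂ (refl , b′<)) le b′<
  ... | no ne = h a′ b′ (inj₁ (ℕ.≤∧≢⇒< (ℕ.≤-pred l) ne)) le b′<

  at : Expr
  at = reg rG ⊗ reg rN ⊕ reg rJ

  at≡ : ∀ {σ a b} → Env σ → regs σ rG ≡ a → regs σ rJ ≡ b → regs σ rG * regs σ rN + regs σ rJ ≡ a * n + b
  at≡ {σ} env refl refl = cong (λ N → regs σ rG * N + regs σ rJ) (N≡ env)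

  -- Tables of interval modules and of strong intervals

  module Tables (p : ℕ → ℕ) (p< : ∀ {j} → j < m → p j < n)
                (tour : ∀ {i j} → i < m → j < m → i ≢ j → G (p j) (p i) ≡ not (G (p i) (p j)))
                (path : ∀ {i} → suc i < m → G (p (suc i)) (p i) ≡ false) where

    g : ℕ → ℕ → Bool
    g i j = G (p i) (p j)

    open Intervals m g tour path public

    Ready : State → Set
    Ready σ = Env σ × (∀ {j} → j < m → arr σ 0 j ≡ p j)

    Cutter : ℕ → ℕ → Set
    Cutter x i = g x i ≢ g x (suc i)

    -- `v` is the extremal cutter of the pair `i , suc i` among the first `k` positions, with `i`,
    -- respectively `suc i`, as the neutral value. Only the thresholds that it meets are recorded,
    -- since later it is only compared with ends of intervals.
    LeftOK RightOK : ℕ → ℕ → ℕ → Set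
    LeftOK i k v = ∀ a → a ≤ i → (a ≤ v ⟷ (∀ x → x < k → Cutter x i → a ≤ x))
    RightOK i k v = ∀ b → suc i ≤ b → (v ≤ b ⟷ (∀ x → x < k → Cutter x i → x ≤ b))

    note cutters : Cmd
    note = cond (arcᴱ (ld 0 (reg rJ)) (ld 0 (reg rG)) ≈ arcᴱ (ld 0 (reg rJ)) (ld 0 (reg rG ⊕ lit 1))) skip (least 29 rJ ︔ greatest 30 rJ)
    cutters = for rG (set 29 (reg rG) ︔ set 30 (reg rG ⊕ lit 1) ︔ for rJ note ︔ put 7 (reg rG) (reg 29) ︔ put 8 (reg rG) (reg 30))

    note-spec : ∀ {σ i x} → Ready σ → regs σ rG ≡ i → regs σ rJ ≡ x → suc i < m → x < m → LeftOK i x (regs σ 29) → RightOK i x (regs σ 30) →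
                Spec note σ (λ t σ′ → t ≤ 130 × LeftOK i (suc x) (regs σ′ 29) × RightOK i (suc x) (regs σ′ 30))
    note-spec {σ} {i} {x} (env , P≡) pG pJ i< x< lo ro with g x i Bool.≟ g x (suc i)
    ... | yes e = thenS (λ z → eq-z z (trans v₁ (trans (cong bit e) (sym v₂)))) (byWp (ℕ.≤ᵇ⇒≤ _ _ tt ,
            (λ a ai → ⟷-trans (lo a ai) ((λ h → below-suc h (λ c → ⊥-elim (c e))) , λ h y y< → h y (ℕ.m≤n⇒m≤1+n y<))) ,
            (λ b ib → ⟷-trans (ro b ib) ((λ h → below-suc h (λ c → ⊥-elim (c e))) , λ h y y< → h y (ℕ.m≤n⇒m≤1+n y<)))))
      where
      i<′ = ℕ.<-trans (ℕ.n<1+n i) i<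
      v₁ : ⟦ arcᴱ (ld 0 (reg rJ)) (ld 0 (reg rG)) ⟧ σ ≡ bit (g x i)
      v₁ = arcᴱ-value (ld 0 (reg rJ)) (ld 0 (reg rG)) env (trans (cong (arr σ 0) pJ) (P≡ x<)) (trans (cong (arr σ 0) pG) (P≡ i<′)) (p< x<) (p< i<′)
      v₂ : ⟦ arcᴱ (ld 0 (reg rJ)) (ld 0 (reg rG ⊕ lit 1)) ⟧ σ ≡ bit (g x (suc i))
      v₂ = arcᴱ-value (ld 0 (reg rJ)) (ld 0 (reg rG ⊕ lit 1)) env (trans (cong (arr σ 0) pJ) (P≡ x<)) (trans (cong (arr σ 0) (succ-idx₀ i pG)) (P≡ i<)) (p< x<) (p< i<)
    ... | no ne = elseS (cong bit (¬true λ t → ne (bit-injective (trans (sym v₁) (trans (≡ᵇ-true t) v₂)))))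
          (seqS (mapS (least-spec 29 rJ) λ t₁ σ₁ f₁ (l₁ , e₁ , _ , o₁) → mapS (greatest-spec 30 rJ) λ t₂ σ₂ f₂ (l₂ , e₂ , _ , o₂) →
             ℕ.+-monoʳ-≤ 102 (ℕ.≤-trans (ℕ.+-mono-≤ l₁ l₂) (ℕ.≤ᵇ⇒≤ 20 28 tt)) ,
             subst (LeftOK i (suc x)) (sym (trans (o₂ 29 (λ ())) (trans e₁ (cong (_⊓ regs σ 29) pJ))))
               (λ a ai → (λ h → below-suc (proj₁ (lo a ai) (ℕ.≤-trans h (ℕ.m⊓n≤n x (regs σ 29)))) (λ _ → ℕ.≤-trans h (ℕ.m⊓n≤m x (regs σ 29)))) ,
                          λ h → ℕ.⊓-glb (h x (ℕ.n<1+n x) ne) (proj₂ (lo a ai) (λ y y< → h y (ℕ.m≤n⇒m≤1+n y<)))) ,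
             subst (RightOK i (suc x)) (sym (trans e₂ (cong₂ _⊔_ (trans (o₁ rJ (λ ())) pJ) (o₁ 30 (λ ())))))
               (λ b ib → (λ h → below-suc (proj₁ (ro b ib) (ℕ.≤-trans (ℕ.m≤n⊔m x (regs σ 30)) h)) (λ _ → ℕ.≤-trans (ℕ.m≤m⊔n x (regs σ 30)) h)) ,
                          λ h → ℕ.⊔-lub (h x (ℕ.n<1+n x) ne) (proj₂ (ro b ib) (λ y y< → h y (ℕ.m≤n⇒m≤1+n y<))))))
      where
      i<′ = ℕ.<-trans (ℕ.n<1+n i) i<
      v₁ : ⟦ arcᴱ (ld 0 (reg rJ)) (ld 0 (reg rG)) ⟧ σ ≡ bit (g x i)
      v₁ = arcᴱ-value (ld 0 (reg rJ)) (ld 0 (reg rG)) env (trans (cong (arr σ 0) pJ) (P≡ x<)) (trans (cong (arr σ 0) pG) (P≡ i<′)) (p< x<) (p< i<′)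
      v₂ : ⟦ arcᴱ (ld 0 (reg rJ)) (ld 0 (reg rG ⊕ lit 1)) ⟧ σ ≡ bit (g x (suc i))
      v₂ = arcᴱ-value (ld 0 (reg rJ)) (ld 0 (reg rG ⊕ lit 1)) env (trans (cong (arr σ 0) pJ) (P≡ x<)) (trans (cong (arr σ 0) (succ-idx₀ i pG)) (P≡ i<)) (p< x<) (p< i<)

    -- The last `i` has no successor. The body then runs on meaningless data, and only its running
    -- time matters.
    note-any : ∀ {σ} → Spec note σ (λ t σ′ → t ≤ 130)
    note-any = byWp ((λ _ → ℕ.≤ᵇ⇒≤ _ _ tt) , λ _ → (λ _ → (λ _ → ℕ.≤ᵇ⇒≤ _ _ tt) , λ _ → ℕ.≤ᵇ⇒≤ _ _ tt) , λ _ → (λ _ → ℕ.≤ᵇ⇒≤ _ _ tt) , λ _ → ℕ.≤ᵇ⇒≤ _ _ tt)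

    CutterTables : State → Set
    CutterTables σ = ∀ i → suc i < m → LeftOK i m (arr σ 7 i) × RightOK i m (arr σ 8 i)

    cutters-spec : ∀ {σ₀} → Ready σ₀ → Spec cutters σ₀ (λ t σ → Lin 6 300 (n * n) t × CutterTables σ)
    cutters-spec {σ₀} (env , P≡) = mapS (for-spec {rG} (30 + 138 * m) Inv (M≡ env) (λ _ _ _ h → h) (λ _ ()) step)
        (λ t σ f (l , h) → weaken (quadratic {a = 6} {b = 138} {c = 38} l) , λ i i< → h i (ℕ.<-trans (ℕ.n<1+n i) i<) i<)
      where
      Inv : ℕ → State → Set
      Inv k σ = ∀ i → i < k → suc i < m → LeftOK i m (arr σ 7 i) × RightOK i m (arr σ 8 i)
      step : ∀ i σ → i < m → Frame cutters σ₀ σ → regs σ rG ≡ i → Inv i σ → Spec _ σ _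
      step i σ i< f pG h = setS (setS (seqS (mapS (for-spec {rJ} {note} 130 Row (M≡ env₁) (λ _ _ _ h → h) init row)
          λ t₁ σ₁ f₁ (l₁ , r) → byWp (
            ℕ.≤-trans (ℕ.+-monoʳ-≤ 6 (ℕ.+-monoˡ-≤ 18 l₁)) (ℕ.≤-reflexive (cong (6 +_) (ℕ.+-comm (6 + 138 * m) 18))) ,
            new σ₁ (trans (reg-same f₁ rG) pG) (λ j → trans (arr-keep f₁ (λ _ → false) 7 j) refl) (λ j → trans (arr-keep f₁ (λ _ → false) 8 j) refl) r))))
        where
        envσ = env-frame f env
        env₁ : Env (state ((regs σ [ 29 ≔ regs σ rG ]) [ 30 ≔ regs σ rG + 1 ]) (mem σ))
        env₁ = env-same envσ refl refl refl refl refl refl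
        Row : ℕ → State → Set
        Row x σ′ = suc i < m → LeftOK i x (regs σ′ 29) × RightOK i x (regs σ′ 30)
        init : suc i < m → LeftOK i 0 (regs σ rG) × RightOK i 0 (regs σ rG + 1)
        init _ = subst (LeftOK i 0) (sym pG) (λ a ai → (λ _ _ ()) , λ _ → ai) ,
                 subst (RightOK i 0) (sym (succ-idx₀ i pG)) (λ b ib → (λ _ _ ()) , λ _ → ib)
        row : ∀ x σ′ → x < m → Frame (for rJ note) (state ((regs σ [ 29 ≔ regs σ rG ]) [ 30 ≔ regs σ rG + 1 ]) (mem σ)) σ′ → regs σ′ rJ ≡ x → Row x σ′ →
              Spec note σ′ (λ t σ″ → t ≤ 130 × Row (suc x) σ″)
        row x σ′ x< f′ pJ r with suc i ℕ.<? m
        ... | no ni = mapS note-any λ t σ″ _ l → l , λ i< → ⊥-elim (ni i<)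
        ... | yes i<m = mapS (note-spec (env-frame f′ env₁ , λ {j} j< → trans (arr-keep f′ (λ _ → false) 0 j) (trans (arr-keep f (6 <ᵇ_) 0 j) (P≡ j<)))
                (trans (reg-same f′ rG) pG) pJ i<m x< (proj₁ (r i<m)) (proj₂ (r i<m))) λ t σ″ _ (l , q) → l , λ _ → q
        new : ∀ σ₁ → regs σ₁ rG ≡ i → (∀ j → arr σ₁ 7 j ≡ arr σ 7 j) → (∀ j → arr σ₁ 8 j ≡ arr σ 8 j) → Row m σ₁ →
              Inv (suc i) (state (regs σ₁) ((mem σ₁ [ regs σ₁ rAB + (regs σ₁ rG * 16 + 7) ≔ regs σ₁ 29 ]) [ regs σ₁ rAB + (regs σ₁ rG * 16 + 8) ≔ regs σ₁ 30 ]))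
        new σ₁ pG₁ s7 s8 r i′ i′< si′ with i′ ℕ.≟ i
        ... | yes refl = subst (LeftOK i m) (sym (trans (arr-other m₁ A 8 7 (regs σ₁ rG) i′) (arr-same (mem σ₁) A 7 pG₁))) (proj₁ (r si′)) ,
                         subst (RightOK i m) (sym (arr-same m₁ A 8 pG₁)) (proj₂ (r si′))
          where
          A = regs σ₁ rAB
          m₁ = mem σ₁ [ A + (regs σ₁ rG * 16 + 7) ≔ regs σ₁ 29 ]
        ... | no ne = subst (LeftOK i′ m) (sym (trans (arr-other m₁ A 8 7 (regs σ₁ rG) i′) (trans (arr-idx (mem σ₁) A 7 {regs σ₁ rG} {i′} ne′) (s7 i′)))) (proj₁ old) ,
                      subst (RightOK i′ m) (sym (trans (arr-idx m₁ A 8 {regs σ₁ rG} {i′} ne′) (trans (arr-other (mem σ₁) A 7 8 (regs σ₁ rG) i′) (s8 i′)))) (proj₂ old)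
          where
          A = regs σ₁ rAB
          m₁ = mem σ₁ [ A + (regs σ₁ rG * 16 + 7) ≔ regs σ₁ 29 ]
          ne′ : regs σ₁ rG ≢ i′
          ne′ e = ne (trans (sym e) pG₁)
          old = h i′ (ℕ.≤∧≢⇒< (ℕ.≤-pred i′<) ne) si′

    IsModCell : ℕ → ℕ → ℕ → Set
    IsModCell a b v = v ≢ 0 ⟷ IsMod a b

    -- A position is homogeneous on an interval as soon as it cuts no adjacent pair in it. Cutters
    -- inside the interval do no harm, so the extremal cutters decide whether one lies outside.
    no-cutters⟷ : ∀ {lc rc : ℕ → ℕ} {a b} → (∀ i → suc i < m → LeftOK i m (lc i) × RightOK i m (rc i)) → a ≤ b → b < m →
                  ((∀ i → a ≤ i → i < b → a ≤ lc i) × (∀ i → a ≤ i → i < b → rc i ≤ b)) ⟷ IsMod a b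
    no-cutters⟷ {lc} {rc} {a} {b} ct ab b< = to , from
      where
      to : ((∀ i → a ≤ i → i < b → a ≤ lc i) × (∀ i → a ≤ i → i < b → rc i ≤ b)) → IsMod a b
      to (hl , hr) = isMod λ {x} {i} {j} x< o ai ib aj jb → trans (chain x< o ai ib) (sym (chain x< o aj jb))
        where
        next : ∀ {x i} → x < m → x < a ⊎ b < x → a ≤ i → i < b → g x i ≡ g x (suc i)
        next {x} {i} x< o ai ib with g x i Bool.≟ g x (suc i)
        ... | yes e = e
        ... | no ne = ⊥-elim (case o of λ
             { (inj₁ l) → ℕ.<⇒≱ l (proj₁ (proj₁ (ct i i<) a ai) (hl i ai ib) x x< ne)
             ; (inj₂ l) → ℕ.<⇒≱ l (proj₁ (proj₂ (ct i i<) b ib) (hr i ai ib) x x< ne) })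
          where i< = ℕ.≤-<-trans ib b<
        chain : ∀ {x i} → x < m → x < a ⊎ b < x → a ≤ i → i ≤ b → g x i ≡ g x a
        chain {x} {zero} x< o z≤n ib = refl
        chain {x} {suc i} x< o ai ib with a ℕ.≟ suc i
        ... | yes refl = refl
        ... | no ne = trans (sym (next x< o (ℕ.≤-pred (ℕ.≤∧≢⇒< ai ne)) ib)) (chain x< o (ℕ.≤-pred (ℕ.≤∧≢⇒< ai ne)) (ℕ.<⇒≤ ib))
      from : IsMod a b → _
      from md = (λ i ai ib → proj₂ (proj₁ (ct i (ℕ.≤-<-trans ib b<)) a ai) λ x x< c → ℕ.≮⇒≥ λ l → c (homog md x< (inj₁ l) ai (ℕ.<⇒≤ ib) (ℕ.m≤n⇒m≤1+n ai) ib)) ,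
                (λ i ai ib → proj₂ (proj₂ (ct i (ℕ.≤-<-trans ib b<)) b ib) λ x x< c → ℕ.≮⇒≥ λ l → c (homog md x< (inj₂ l) ai (ℕ.<⇒≤ ib) (ℕ.m≤n⇒m≤1+n ai) ib))

    -- Row `a` is scanned by increasing right end. Register 29 tells whether the left cutters met so
    -- far stay at or after `a`; register 30 is the greatest right cutter. The entry is written
    -- before the pair starting at `j` is taken in, because that pair is not inside `[a , j]`.
    modCell mods : Cmd
    modCell = cond (reg rJ ≺ reg rG) skip
      (put 9 at ((reg rJ ≺ reg 30) ≺ reg 29) ︔ set 29 ((ld 7 (reg rJ) ≺ reg rG) ≺ reg 29) ︔ set 31 (ld 8 (reg rJ)) ︔ greatest 30 31)
    mods = for rG (set 29 (lit 1) ︔ set 30 (lit 0) ︔ for rJ modCell)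

    mods-spec : ∀ {σ₀} → Env σ₀ → CutterTables σ₀ → Spec mods σ₀ (λ t σ → Lin 6 300 (n * n) t × Cells IsModCell m 0 (arr σ 9))
    mods-spec {σ₀} env ct = mapS (for-spec {rG} (10 + 88 * m) (λ a σ → Cells IsModCell a 0 (arr σ 9)) (M≡ env) (λ _ _ _ h → h) (λ { _ _ (inj₁ ()) }) step)
        (λ t σ f (l , h) → weaken (quadratic {a = 6} {b = 88} {c = 18} l) , h)
      where
      lc rc : ℕ → ℕ
      lc = arr σ₀ 7
      rc = arr σ₀ 8
      Row : ℕ → ℕ → State → Set
      Row a j σ = Cells IsModCell a j (arr σ 9) × regs σ 29 ≤ 1 × (regs σ 29 ≢ 0 ⟷ (∀ i → i < j → a ≤ i → a ≤ lc i)) ×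
                  (∀ b → regs σ 30 ≤ b ⟷ (∀ i → i < j → a ≤ i → rc i ≤ b))
      step : ∀ a σ → a < m → Frame mods σ₀ σ → regs σ rG ≡ a → Cells IsModCell a 0 (arr σ 9) → Spec _ σ _
      step a σ a< f pG h = setS (setS (mapS (for-spec {rJ} {modCell} 80 (Row a) (M≡ env₁) (λ _ _ _ h → h)
            (h , ℕ.≤-refl , ((λ _ _ ()) , (λ _ ())) , λ b → (λ _ _ ()) , λ _ → z≤n) row)
          λ t₁ σ₁ f₁ (l₁ , r) → ℕ.≤-trans (ℕ.+-monoʳ-≤ 4 l₁) (ℕ.≤-refl) , cells-row {IsModCell} {a} {arr σ₁ 9} (proj₁ r)))
        where
        σ′₀ = state ((regs σ [ 29 ≔ 1 ]) [ 30 ≔ 0 ]) (mem σ)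
        env₁ : Env σ′₀
        env₁ = env-same (env-frame f env) refl refl refl refl refl refl
        row : ∀ j σ′ → j < m → Frame (for rJ modCell) σ′₀ σ′ → regs σ′ rJ ≡ j → Row a j σ′ → Spec modCell σ′ (λ t σ″ → t ≤ 80 × Row a (suc j) σ″)
        row j σ′ j< f′ pJ (cs , ok≤ , okk , rr) with j ℕ.<? a
        ... | yes ja = thenS (lt⁺ (subst₂ _<_ (sym pJ) (sym pG′) ja)) (byWp (ℕ.≤ᵇ⇒≤ _ _ tt , cells-skip {IsModCell} {a} {j} {arr σ′ 9} ja cs , ok≤ ,
                  ⟷-trans okk ((λ h → below-suc h (λ aj → ⊥-elim (ℕ.<⇒≱ ja aj))) , λ h i i< → h i (ℕ.m≤n⇒m≤1+n i<)) ,
                  λ b → ⟷-trans (rr b) ((λ h → below-suc h (λ aj → ⊥-elim (ℕ.<⇒≱ ja aj))) , λ h i i< → h i (ℕ.m≤n⇒m≤1+n i<))))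
          where
          pG′ : regs σ′ rG ≡ a
          pG′ = trans (reg-same f′ rG) pG
        ... | no nja = elseS (lt⁻ (subst₂ _≤_ (sym pG′) (sym pJ) aj)) (byWp ((λ nz → ℕ.≤ᵇ⇒≤ _ _ tt , rest (ℕ.m≥n⇒m⊔n≡m (ℕ.<⇒≤ (lt-nz nz)))) ,
                                                                     (λ z → ℕ.≤ᵇ⇒≤ _ _ tt , rest (ℕ.m≤n⇒m⊔n≡n (lt-z z)))))
          where
          pG′ : regs σ′ rG ≡ a
          pG′ = trans (reg-same f′ rG) pG
          aj = ℕ.≮⇒≥ nja
          env′ = env-frame f′ env₁
          A = regs σ′ rAB
          v = bit (bit (regs σ′ rJ <ᵇ regs σ′ 30) <ᵇ regs σ′ 29)
          μ = mem σ′ [ A + ((regs σ′ rG * regs σ′ rN + regs σ′ rJ) * 16 + 9) ≔ v ]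
          idx : regs σ′ rG * regs σ′ rN + regs σ′ rJ ≡ a * n + j
          idx = at≡ env′ pG′ pJ
          keep : ∀ k i → {_ : T (k <ᵇ 16)} → {_ : T (not (9 ≡ᵇ k))} → μ (A + (i * 16 + k)) ≡ arr σ′ k i
          keep k i {h} {h′} = arr-other (mem σ′) A 9 k (regs σ′ rG * regs σ′ rN + regs σ′ rJ) i {v} {tt} {h} {h′}
          lc≡ : μ (A + (regs σ′ rJ * 16 + 7)) ≡ lc j
          lc≡ = trans (keep 7 (regs σ′ rJ)) (trans (cong (arr σ′ 7) pJ) (trans (arr-keep f′ (_≡ᵇ 9) 7 j) (arr-keep f (_≡ᵇ 9) 7 j)))
          rc≡ : μ (A + (regs σ′ rJ * 16 + 8)) ≡ rc j
          rc≡ = trans (keep 8 (regs σ′ rJ)) (trans (cong (arr σ′ 8) pJ) (trans (arr-keep f′ (_≡ᵇ 9) 8 j) (arr-keep f (_≡ᵇ 9) 8 j)))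
          mod : IsModCell a j v
          mod = ⟷-trans (below-bound {regs σ′ 29} {regs σ′ rJ} {regs σ′ 30} ok≤)
                (⟷-trans (×-⟷ okk (subst (λ x → regs σ′ 30 ≤ x ⟷ (∀ i → i < j → a ≤ i → rc i ≤ j)) (sym pJ) (rr j)))
                (⟷-trans ((λ (u , w) → (λ i ai ij → u i ij ai) , λ i ai ij → w i ij ai) , λ (u , w) → (λ i ij ai → u i ai ij) , λ i ij ai → w i ai ij)
                         (no-cutters⟷ {lc} {rc} ct aj j<)))
          cs′ : Cells IsModCell a (suc j) (λ i → μ (A + (i * 16 + 9)))
          cs′ = cells-write {IsModCell} {a} {j} {arr σ′ 9} cs j< (λ i ne → arr-idx (mem σ′) A 9 {regs σ′ rG * regs σ′ rN + regs σ′ rJ} {i} {v} (λ e → ne (trans (sym idx) e)))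
                  (subst (IsModCell a j) (sym (arr-same (mem σ′) A 9 {regs σ′ rG * regs σ′ rN + regs σ′ rJ} {v} {a * n + j} idx)) mod)
          ok″ = bit (bit (μ (A + (regs σ′ rJ * 16 + 7)) <ᵇ regs σ′ rG) <ᵇ regs σ′ 29)
          ok′ : ok″ ≢ 0 ⟷ (∀ i → i < suc j → a ≤ i → a ≤ lc i)
          ok′ = ⟷-trans (below-bound {regs σ′ 29} {μ (A + (regs σ′ rJ * 16 + 7))} {regs σ′ rG} ok≤)
                (⟷-trans (×-⟷ okk ((λ l → subst₂ _≤_ pG′ lc≡ l) , λ l → subst₂ _≤_ (sym pG′) (sym lc≡) l))
                  ((λ (u , w) → below-suc u (λ _ → w)) , λ h → (λ i i< → h i (ℕ.m≤n⇒m≤1+n i<)) , h j (ℕ.n<1+n j) aj))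
          rest : ∀ {w} → μ (A + (regs σ′ rJ * 16 + 8)) ⊔ regs σ′ 30 ≡ w → Cells IsModCell a (suc j) (λ i → μ (A + (i * 16 + 9))) × ok″ ≤ 1 ×
                 (ok″ ≢ 0 ⟷ (∀ i → i < suc j → a ≤ i → a ≤ lc i)) × (∀ b → w ≤ b ⟷ (∀ i → i < suc j → a ≤ i → rc i ≤ b))
          rest refl = cs′ , bit≤1 _ , ok′ , λ b →
            (λ h → below-suc (proj₁ (rr b) (ℕ.≤-trans (ℕ.m≤n⊔m _ (regs σ′ 30)) h)) (λ _ → subst (_≤ b) rc≡ (ℕ.≤-trans (ℕ.m≤m⊔n _ (regs σ′ 30)) h))) ,
            λ h → ℕ.⊔-lub (subst (_≤ b) (sym rc≡) (h j (ℕ.n<1+n j) aj)) (proj₂ (rr b) (λ i i< → h i (ℕ.m≤n⇒m≤1+n i<)))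

    -- Again extrema in threshold form: the last end of a module starting at `b` and the first start
    -- of a module ending at `b`. The singleton module makes `b` the neutral value.
    MaxEnd MinStart : ℕ → ℕ → Set
    MaxEnd b v = ∀ d → b ≤ d → (v ≤ d ⟷ (∀ t → t < m → b ≤ t → IsMod b t → t ≤ d))
    MinStart b v = ∀ c → c ≤ b → (c ≤ v ⟷ (∀ s → s < m → s ≤ b → IsMod s b → c ≤ s))

    EndTables : State → Set
    EndTables σ = ∀ b → b < m → MaxEnd b (arr σ 10 b) × MinStart b (arr σ 11 b)

    endCell ends : Cmd
    endCell = cond (reg rJ ≺ reg rG) (cond (ld 9 (reg rJ ⊗ reg rN ⊕ reg rG)) (least 30 rJ) skip) (cond (ld 9 at) (greatest 29 rJ) skip)
    ends = for rG (set 29 (reg rG) ︔ set 30 (reg rG) ︔ for rJ endCell ︔ put 10 (reg rG) (reg 29) ︔ put 11 (reg rG) (reg 30))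

    ends-spec : ∀ {σ₀} → Env σ₀ → Cells IsModCell m 0 (arr σ₀ 9) → Spec ends σ₀ (λ t σ → Lin 6 300 (n * n) t × EndTables σ)
    ends-spec {σ₀} env md = mapS (for-spec {rG} (30 + 68 * m) Inv (M≡ env) (λ _ _ _ h → h) (λ _ ()) step)
        (λ t σ f (l , h) → weaken (quadratic {a = 6} {b = 68} {c = 38} l) , h)
      where
      Inv : ℕ → State → Set
      Inv k σ = ∀ b → b < k → MaxEnd b (arr σ 10 b) × MinStart b (arr σ 11 b)
      module Step (i : ℕ) (σ : State) (i< : i < m) (f : Frame ends σ₀ σ) (pG : regs σ rG ≡ i) (h : Inv i σ) where
        σ′₀ = state ((regs σ [ 29 ≔ regs σ rG ]) [ 30 ≔ regs σ rG ]) (mem σ)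
        env₁ : Env σ′₀
        env₁ = env-same (env-frame f env) refl refl refl refl refl refl
        RowMax RowMin : ℕ → ℕ → Set
        RowMax j v = ∀ d → i ≤ d → (v ≤ d ⟷ (∀ t → t < j → i ≤ t → IsMod i t → t ≤ d))
        RowMin j v = ∀ c → c ≤ i → (c ≤ v ⟷ (∀ s → s < j → s ≤ i → IsMod s i → c ≤ s))
        Row : ℕ → State → Set
        Row j σ′ = RowMax j (regs σ′ 29) × RowMin j (regs σ′ 30)
        skipMax : ∀ {j v} → (i ≤ j → ¬ IsMod i j) → RowMax j v → RowMax (suc j) v
        skipMax ne r d id = ⟷-trans (r d id) ((λ u → below-suc u (λ l q → ⊥-elim (ne l q))) , λ u t t< → u t (ℕ.m≤n⇒m≤1+n t<))
        skipMin : ∀ {j v} → (j ≤ i → ¬ IsMod j i) → RowMin j v → RowMin (suc j) v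
        skipMin ne r c ci = ⟷-trans (r c ci) ((λ u → below-suc u (λ l q → ⊥-elim (ne l q))) , λ u t t< → u t (ℕ.m≤n⇒m≤1+n t<))
        lastMin : ∀ {j v} → i ≤ j → RowMin j v → RowMin (suc j) v
        lastMin ij r c ci = ⟷-trans (r c ci) ((λ u → below-suc u (λ _ _ → ℕ.≤-trans ci ij)) , λ u t t< → u t (ℕ.m≤n⇒m≤1+n t<))
        row : ∀ j σ′ → j < m → Frame (for rJ endCell) σ′₀ σ′ → regs σ′ rJ ≡ j → Row j σ′ → Spec endCell σ′ (λ t σ″ → t ≤ 60 × Row (suc j) σ″)
        row j σ′ j< f′ pJ (rx , rn) with j ℕ.<? i
        ... | yes ji = thenS (lt⁺ (subst₂ _<_ (sym pJ) (sym pG′) ji)) inner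
          where
          pG′ = trans (reg-same f′ rG) pG
          env′ = env-frame f′ env₁
          val : arr σ′ 9 (regs σ′ rJ * regs σ′ rN + regs σ′ rG) ≡ arr σ₀ 9 (j * n + i)
          val = trans (cong (arr σ′ 9) (trans (cong₂ (λ x y → x * regs σ′ rN + y) pJ pG′) (cong (λ N → j * N + i) (N≡ env′))))
                      (trans (arr-keep f′ (_≡ᵇ 10) 9 (j * n + i)) (arr-keep f (9 <ᵇ_) 9 (j * n + i)))
          cell-mod = md j i (inj₁ j<) (ℕ.<⇒≤ ji) i<
          inner : Spec (cond (ld 9 (reg rJ ⊗ reg rN ⊕ reg rG)) (least 30 rJ) skip) σ′ (λ t σ″ → 4 + t ≤ 60 × Row (suc j) σ″)
          inner with IsMod? j i<
          ... | no nm = elseS (case arr σ₀ 9 (j * n + i) ℕ.≟ 0 of λ { (yes z) → trans val z ; (no nz) → ⊥-elim (nm (proj₁ cell-mod nz)) })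
                          (byWp (ℕ.≤ᵇ⇒≤ _ _ tt , skipMax (λ l → ⊥-elim (ℕ.<⇒≱ ji l)) rx , skipMin (λ _ → nm) rn))
          ... | yes ym = thenS (λ z → proj₂ cell-mod ym (trans (sym val) z)) (mapS (least-spec 30 rJ) λ t σ″ _ (l , e , _ , o) →
                  ℕ.≤-trans (ℕ.+-monoʳ-≤ 17 l) (ℕ.≤ᵇ⇒≤ _ _ tt) , subst (RowMax (suc j)) (sym (o 29 (λ ()))) (skipMax (λ l → ⊥-elim (ℕ.<⇒≱ ji l)) rx) ,
                  subst (RowMin (suc j)) (sym (trans e (cong (_⊓ regs σ′ 30) pJ)))
                    (λ c ci → (λ u → below-suc (proj₁ (rn c ci) (ℕ.≤-trans u (ℕ.m⊓n≤n j (regs σ′ 30)))) (λ _ _ → ℕ.≤-trans u (ℕ.m⊓n≤m j (regs σ′ 30)))) ,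
                       λ u → ℕ.⊓-glb (u j (ℕ.n<1+n j) (ℕ.<⇒≤ ji) ym) (proj₂ (rn c ci) (λ s s< → u s (ℕ.m≤n⇒m≤1+n s<)))))
        ... | no nji = elseS (lt⁻ (subst₂ _≤_ (sym pG′) (sym pJ) ij)) inner
          where
          ij = ℕ.≮⇒≥ nji
          pG′ = trans (reg-same f′ rG) pG
          env′ = env-frame f′ env₁
          val : arr σ′ 9 (regs σ′ rG * regs σ′ rN + regs σ′ rJ) ≡ arr σ₀ 9 (i * n + j)
          val = trans (cong (arr σ′ 9) (at≡ env′ pG′ pJ)) (trans (arr-keep f′ (_≡ᵇ 10) 9 (i * n + j)) (arr-keep f (9 <ᵇ_) 9 (i * n + j)))
          cell-mod = md i j (inj₁ i<) ij j<
          inner : Spec (cond (ld 9 at) (greatest 29 rJ) skip) σ′ (λ t σ″ → 4 + t ≤ 60 × Row (suc j) σ″)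
          inner with IsMod? i j<
          ... | no nm = elseS (case arr σ₀ 9 (i * n + j) ℕ.≟ 0 of λ { (yes z) → trans val z ; (no nz) → ⊥-elim (nm (proj₁ cell-mod nz)) })
                          (byWp (ℕ.≤ᵇ⇒≤ _ _ tt , skipMax (λ _ → nm) rx , lastMin ij rn))
          ... | yes ym = thenS (λ z → proj₂ cell-mod ym (trans (sym val) z)) (mapS (greatest-spec 29 rJ) λ t σ″ _ (l , e , _ , o) →
                  ℕ.≤-trans (ℕ.+-monoʳ-≤ 17 l) (ℕ.≤ᵇ⇒≤ _ _ tt) ,
                  subst (RowMax (suc j)) (sym (trans e (cong (_⊔ regs σ′ 29) pJ)))
                    (λ d id → (λ u → below-suc (proj₁ (rx d id) (ℕ.≤-trans (ℕ.m≤n⊔m j (regs σ′ 29)) u)) (λ _ _ → ℕ.≤-trans (ℕ.m≤m⊔n j (regs σ′ 29)) u)) ,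
                       λ u → ℕ.⊔-lub (u j (ℕ.n<1+n j) ij ym) (proj₂ (rx d id) (λ s s< → u s (ℕ.m≤n⇒m≤1+n s<)))) ,
                  subst (RowMin (suc j)) (sym (o 30 (λ ()))) (lastMin ij rn))
        new : ∀ σ₁ → regs σ₁ rG ≡ i → (∀ j → arr σ₁ 10 j ≡ arr σ 10 j) → (∀ j → arr σ₁ 11 j ≡ arr σ 11 j) → Row m σ₁ →
              Inv (suc i) (state (regs σ₁) ((mem σ₁ [ regs σ₁ rAB + (regs σ₁ rG * 16 + 10) ≔ regs σ₁ 29 ]) [ regs σ₁ rAB + (regs σ₁ rG * 16 + 11) ≔ regs σ₁ 30 ]))
        new σ₁ pG₁ s10 s11 r i′ i′< with i′ ℕ.≟ i
        ... | yes refl = subst (MaxEnd i) (sym (trans (arr-other m₁ A 11 10 (regs σ₁ rG) i′) (arr-same (mem σ₁) A 10 pG₁))) (proj₁ r) ,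
                         subst (MinStart i) (sym (arr-same m₁ A 11 pG₁)) (proj₂ r)
          where
          A = regs σ₁ rAB
          m₁ = mem σ₁ [ A + (regs σ₁ rG * 16 + 10) ≔ regs σ₁ 29 ]
        ... | no ne = subst (MaxEnd i′) (sym (trans (arr-other m₁ A 11 10 (regs σ₁ rG) i′) (trans (arr-idx (mem σ₁) A 10 {regs σ₁ rG} {i′} ne′) (s10 i′)))) (proj₁ old) ,
                      subst (MinStart i′) (sym (trans (arr-idx m₁ A 11 {regs σ₁ rG} {i′} ne′) (trans (arr-other (mem σ₁) A 10 11 (regs σ₁ rG) i′) (s11 i′)))) (proj₂ old)
          where
          A = regs σ₁ rAB
          m₁ = mem σ₁ [ A + (regs σ₁ rG * 16 + 10) ≔ regs σ₁ 29 ]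
          ne′ : regs σ₁ rG ≢ i′
          ne′ e = ne (trans (sym e) pG₁)
          old = h i′ (ℕ.≤∧≢⇒< (ℕ.≤-pred i′<) ne)
      step : ∀ i σ → i < m → Frame ends σ₀ σ → regs σ rG ≡ i → Inv i σ → Spec _ σ _
      step i σ i< f pG h = setS (setS (seqS (mapS (for-spec {rJ} {endCell} 60 Row (M≡ env₁) (λ _ _ _ h → h)
            (subst (RowMax 0) (sym pG) (λ d id → (λ _ _ ()) , λ _ → id) , subst (RowMin 0) (sym pG) (λ c ci → (λ _ _ ()) , λ _ → ci)) row)
          λ t₁ σ₁ f₁ (l₁ , r) → byWp (
            ℕ.≤-trans (ℕ.+-monoʳ-≤ 4 (ℕ.+-monoˡ-≤ 18 l₁)) (ℕ.≤-trans (ℕ.≤-reflexive (cong (4 +_) (ℕ.+-comm (6 + 68 * m) 18))) (ℕ.m≤n+m _ 2)) ,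
            new σ₁ (trans (reg-same f₁ rG) pG) (λ j → arr-keep f₁ (λ _ → false) 10 j) (λ j → arr-keep f₁ (λ _ → false) 11 j) r))))
        where open Step i σ i< f pG h

    -- The nonzero values are the output codes of circular and prime. Complete nodes are never
    -- produced, which frees 0 for the intervals that are not strong. A singleton may carry either
    -- nonzero value, since leaves are coded by their vertex.
    StrongCell : ℕ → ℕ → ℕ → Set
    StrongCell a b v = (v ≡ 0 × ¬ Strong′ a b) ⊎ (v ≡ 1 × Strong′ a b × (a < b → Linear a b)) ⊎ (v ≡ 2 × Strong′ a b × (a < b → ¬ Linear a b))

    module _ {D E : ℕ → ℕ} (ends-ok : ∀ b → b < m → MaxEnd b (D b) × MinStart b (E b)) where

      -- A module overlapping from the left ends at some `t` with `a ≤ t` and `t < j`, and starts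
      -- before `a`; one overlapping from the right starts at some `s` with `a < s` and `s ≤ j`, and
      -- ends after `j`. `E` and `D` hold the worst cases.
      strong⟷ : ∀ {a j} → a ≤ j → j < m → IsMod a j →
                ((∀ t → t < j → a ≤ t → a ≤ E t) × (∀ s → s < suc j → a < s → D s ≤ j)) ⟷ Strong′ a j
      strong⟷ {a} {j} aj j< mod = to , from
        where
        to : (∀ t → t < j → a ≤ t → a ≤ E t) × (∀ s → s < suc j → a < s → D s ≤ j) → Strong′ a j
        to (he , hd) = mod , λ {c} {d} cd d< mc → λ
          { (inj₁ (ac , cj , jd)) → ℕ.<⇒≱ jd (proj₁ (proj₁ (ends-ok c (ℕ.≤-<-trans cj j<)) j cj) (hd c (s≤s cj) ac) d d< cd mc)
          ; (inj₂ (ca , ad , dj)) → ℕ.<⇒≱ ca (proj₁ (proj₂ (ends-ok d d<) a ad) (he d dj ad) c (ℕ.≤-<-trans cd d<) cd mc) }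
        from : Strong′ a j → _
        from (_ , h) = (λ t tj at′ → proj₂ (proj₂ (ends-ok t (ℕ.<-trans tj j<)) a at′) λ s s< st ms → ℕ.≮⇒≥ λ l → h st (ℕ.<-trans tj j<) ms (inj₂ (l , at′ , tj))) ,
                       (λ s sj as → proj₂ (proj₁ (ends-ok s (ℕ.≤-<-trans (ℕ.≤-pred sj) j<)) j (ℕ.≤-pred sj)) λ t t< st ms → ℕ.≮⇒≥ λ l → h st t< ms (inj₁ (as , ℕ.≤-pred sj , l)))

    raise decide strongCell strongs : Cmd
    raise = cond (reg rG ≺ reg rJ) (set 31 (ld 10 (reg rJ)) ︔ greatest 30 31) skip
    decide = put 12 at (lit 0) ︔
             -- Register 32 is the last `v` before `j` for which `[a , v]` is a module, so by
             -- `linear-last` the value drops from 2 to 1 exactly when a split exists.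
             cond (ld 9 at) (cond ((reg rJ ≺ reg 30) ≺ reg 29) (put 12 at (lit 2 ⊖ (lit 0 ≺ ld 9 ((reg 32 ⊕ lit 1) ⊗ reg rN ⊕ reg rJ)))) skip ︔ set 32 (reg rJ)) skip
    -- The right bound concerns starts up to and including `j`, the left bound only ends before `j`:
    -- hence `raise` precedes the decision and register 29 is updated after it.
    strongCell = cond (reg rJ ≺ reg rG) skip (raise ︔ decide ︔ set 29 ((ld 11 (reg rJ) ≺ reg rG) ≺ reg 29))
    strongs = for rG (set 29 (lit 1) ︔ set 30 (lit 0) ︔ set 32 (reg rG) ︔ for rJ strongCell)

    strongs-spec : ∀ {σ₀} → Env σ₀ → Cells IsModCell m 0 (arr σ₀ 9) → EndTables σ₀ →
                   Spec strongs σ₀ (λ t σ → Lin 6 300 (n * n) t × Cells StrongCell m 0 (arr σ 12))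
    strongs-spec {σ₀} env md et = mapS (for-spec {rG} (12 + 208 * m) (λ a σ → Cells StrongCell a 0 (arr σ 12)) (M≡ env) (λ _ _ _ h → h) (λ { _ _ (inj₁ ()) }) step)
        (λ t σ f (l , h) → weaken (quadratic {a = 6} {b = 208} {c = 20} l) , h)
      where
      D E : ℕ → ℕ
      D = arr σ₀ 10
      E = arr σ₀ 11
      module Step (a : ℕ) (σ : State) (a< : a < m) (f : Frame strongs σ₀ σ) (pG : regs σ rG ≡ a) where
        σ′₀ = state (((regs σ [ 29 ≔ 1 ]) [ 30 ≔ 0 ]) [ 32 ≔ regs σ rG ]) (mem σ)
        env₁ : Env σ′₀
        env₁ = env-same (env-frame f env) refl refl refl refl refl refl
        LeftInv HighInv PrefixInv : ℕ → ℕ → Set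
        LeftInv j v = v ≢ 0 ⟷ (∀ t → t < j → a ≤ t → a ≤ E t)
        HighInv j v = ∀ d → (v ≤ d ⟷ (∀ s → s < j → a < s → D s ≤ d))
        PrefixInv j v = a < j → a ≤ v × v < j × IsMod a v × (∀ e → v < e → e < j → ¬ IsMod a e)
        Row : ℕ → State → Set
        Row j σ = Cells StrongCell a j (arr σ 12) × regs σ 29 ≤ 1 × LeftInv j (regs σ 29) × HighInv j (regs σ 30) × PrefixInv j (regs σ 32)
        init : Cells StrongCell a 0 (arr σ 12) → Row 0 σ′₀
        init h = h , ℕ.≤-refl , ((λ _ _ ()) , λ _ ()) , (λ d → (λ _ _ ()) , λ _ → z≤n) , λ ()

        record At (j : ℕ) (σ′ : State) : Set where
          field
            env′ : Env σ′
            pG′  : regs σ′ rG ≡ a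
            pJ   : regs σ′ rJ ≡ j
            md′  : ∀ i → arr σ′ 9 i ≡ arr σ₀ 9 i
            D′   : ∀ i → arr σ′ 10 i ≡ D i
            E′   : ∀ i → arr σ′ 11 i ≡ E i
        at-frame : ∀ {j c σ₁ σ₂} → At j σ₁ → Frame c σ₁ σ₂ → {_ : Pure c} {_ : T (keeps rG c)} {_ : T (keeps rJ c)} {_ : T (puts (11 <ᵇ_) c)} → At j σ₂
        at-frame q f {h₁} {h₂} {h₃} {h₄} = record
          { env′ = env-frame f {h₁} env′ ; pG′ = trans (reg-same f rG {h₂}) pG′ ; pJ = trans (reg-same f rJ {h₃}) pJ
          ; md′ = λ i → trans (arr-keep f (11 <ᵇ_) 9 {h₄} i) (md′ i) ; D′ = λ i → trans (arr-keep f (11 <ᵇ_) 10 {h₄} i) (D′ i) ; E′ = λ i → trans (arr-keep f (11 <ᵇ_) 11 {h₄} i) (E′ i) }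
          where open At q

        raise-spec : ∀ {j σ′} → At j σ′ → a ≤ j → HighInv j (regs σ′ 30) →
                     Spec raise σ′ (λ t σ″ → t ≤ 25 × HighInv (suc j) (regs σ″ 30) × mem σ″ ≡ mem σ′ × (∀ y → 31 ≢ y → 30 ≢ y → regs σ″ y ≡ regs σ′ y))
        raise-spec {j} {σ′} q aj hi with a ℕ.<? j
        ... | no na = elseS (lt⁻ (subst₂ _≤_ (sym (At.pJ q)) (sym (At.pG′ q)) (ℕ.≮⇒≥ na))) (byWp (ℕ.≤ᵇ⇒≤ _ _ tt ,
                (λ d → ⟷-trans (hi d) ((λ u → below-suc u (λ l → ⊥-elim (na l))) , λ u s s< → u s (ℕ.m≤n⇒m≤1+n s<))) , refl , λ _ _ _ → refl))
        ... | yes ya = thenS (lt⁺ (subst₂ _<_ (sym (At.pG′ q)) (sym (At.pJ q)) ya)) (setS (mapS (greatest-spec 30 31) λ t σ″ _ (l , e , m≡ , o) →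
                ℕ.≤-trans (ℕ.+-monoʳ-≤ 13 l) (ℕ.≤ᵇ⇒≤ _ _ tt) ,
                subst (HighInv (suc j)) (sym (trans e (cong (_⊔ regs σ′ 30) v≡)))
                  (λ d → (λ u → below-suc (proj₁ (hi d) (ℕ.≤-trans (ℕ.m≤n⊔m (D j) (regs σ′ 30)) u)) (λ _ → ℕ.≤-trans (ℕ.m≤m⊔n (D j) (regs σ′ 30)) u)) ,
                          λ u → ℕ.⊔-lub (u j (ℕ.n<1+n j) ya) (proj₂ (hi d) (λ s s< → u s (ℕ.m≤n⇒m≤1+n s<)))) ,
                m≡ , λ y n₁ n₂ → trans (o y n₂) (upd-diff (regs σ′) {31} {y} _ n₁)))
          where
          v≡ : arr σ′ 10 (regs σ′ rJ) ≡ D j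
          v≡ = trans (cong (arr σ′ 10) (At.pJ q)) (At.D′ q j)

        decide-spec : ∀ {j σ′} → At j σ′ → j < m → a ≤ j → Cells StrongCell a j (arr σ′ 12) → regs σ′ 29 ≤ 1 → LeftInv j (regs σ′ 29) →
                      HighInv (suc j) (regs σ′ 30) → PrefixInv j (regs σ′ 32) →
                      Spec decide σ′ (λ t σ″ → t ≤ 100 × Cells StrongCell a (suc j) (arr σ″ 12) × PrefixInv (suc j) (regs σ″ 32))
        decide-spec {j} {σ′} q j< aj cs ok≤ lf hi pf = byWp (
            (λ nz → let mod = proj₁ entry nz in
               (λ nz′ → ℕ.≤ᵇ⇒≤ _ _ tt , cs″ (strong mod (proj₁ (verdict mod) nz′)) , newpf mod) ,
               (λ z′ → ℕ.≤ᵇ⇒≤ _ _ tt , cs′ (λ s → proj₂ (verdict mod) s z′) , newpf mod)) ,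
            (λ z → ℕ.≤ᵇ⇒≤ _ _ tt , cs′ (λ s → proj₂ entry (proj₁ s) z) , λ _ → oldpf (λ md → proj₂ entry md z)))
          where
          open At q
          A = regs σ′ rAB
          ix = regs σ′ rG * regs σ′ rN + regs σ′ rJ
          idx : ix ≡ a * n + j
          idx = at≡ env′ pG′ pJ
          μ = mem σ′ [ A + (ix * 16 + 12) ≔ 0 ]
          μ9 : ∀ i → μ (A + (i * 16 + 9)) ≡ arr σ₀ 9 i
          μ9 i = trans (arr-other (mem σ′) A 12 9 ix i) (md′ i)
          entry : μ (A + (ix * 16 + 9)) ≢ 0 ⟷ IsMod a j
          entry = subst (λ v → v ≢ 0 ⟷ IsMod a j) (sym (trans (μ9 ix) (cong (arr σ₀ 9) idx))) (md a j (inj₁ a<) aj j<)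
          verdict : IsMod a j → bit (bit (regs σ′ rJ <ᵇ regs σ′ 30) <ᵇ regs σ′ 29) ≢ 0 ⟷ Strong′ a j
          verdict mod = ⟷-trans (below-bound {regs σ′ 29} {regs σ′ rJ} {regs σ′ 30} ok≤)
            (⟷-trans (×-⟷ lf (subst (λ x → regs σ′ 30 ≤ x ⟷ (∀ s → s < suc j → a < s → D s ≤ j)) (sym pJ) (hi j)))
                     (strong⟷ {D} {E} et aj j< mod))
          others : ∀ i → a * n + j ≢ i → μ (A + (i * 16 + 12)) ≡ arr σ′ 12 i
          others i ne = arr-idx (mem σ′) A 12 {ix} {i} {0} (λ e → ne (trans (sym idx) e))
          cs′ : ¬ Strong′ a j → Cells StrongCell a (suc j) (λ i → μ (A + (i * 16 + 12)))
          cs′ ns = cells-write {StrongCell} {a} {j} {arr σ′ 12} {λ i → μ (A + (i * 16 + 12))} cs j< others (inj₁ (arr-same (mem σ′) A 12 {ix} {0} {a * n + j} idx , ns))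
          v = 2 ∸ bit (0 <ᵇ μ (A + (((regs σ′ 32 + 1) * regs σ′ rN + regs σ′ rJ) * 16 + 9)))
          cs″ : StrongCell a j v → Cells StrongCell a (suc j) (λ i → (μ [ A + (ix * 16 + 12) ≔ v ]) (A + (i * 16 + 12)))
          cs″ sc = cells-write {StrongCell} {a} {j} {arr σ′ 12} {λ i → (μ [ A + (ix * 16 + 12) ≔ v ]) (A + (i * 16 + 12))} cs j<
                     (λ i ne → trans (arr-idx μ A 12 {ix} {i} {v} (λ e → ne (trans (sym idx) e))) (others i ne))
                     (subst (StrongCell a j) (sym (arr-same μ A 12 {ix} {v} {a * n + j} idx)) sc)
          strong : IsMod a j → Strong′ a j → StrongCell a j v
          strong mod st with a ℕ.<? j
          ... | no na with μ (A + (((regs σ′ 32 + 1) * regs σ′ rN + regs σ′ rJ) * 16 + 9))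
          ...   | zero = inj₂ (inj₂ (refl , st , λ l → ⊥-elim (na l)))
          ...   | suc _ = inj₂ (inj₁ (refl , st , λ l → ⊥-elim (na l)))
          strong mod st | yes ya with μ (A + (((regs σ′ 32 + 1) * regs σ′ rN + regs σ′ rJ) * 16 + 9)) in e
          ...   | zero = inj₂ (inj₂ (refl , st , λ _ ln → proj₂ suffix (linear-last j< ln av vj mv mx) e))
            where
            av = proj₁ (pf ya)
            vj = proj₁ (proj₂ (pf ya))
            mv = proj₁ (proj₂ (proj₂ (pf ya)))
            mx = proj₂ (proj₂ (proj₂ (pf ya)))
            suffix : μ (A + (((regs σ′ 32 + 1) * regs σ′ rN + regs σ′ rJ) * 16 + 9)) ≢ 0 ⟷ IsMod (suc (regs σ′ 32)) j
            suffix = subst (λ v → v ≢ 0 ⟷ IsMod (suc (regs σ′ 32)) j) (sym (trans (μ9 ((regs σ′ 32 + 1) * regs σ′ rN + regs σ′ rJ)) (cong (arr σ₀ 9) (cong₂ _+_ (cong₂ _*_ (ℕ.+-comm (regs σ′ 32) 1) (N≡ env′)) pJ))))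
                       (md (suc (regs σ′ 32)) j (inj₁ (ℕ.≤-<-trans vj j<)) vj j<)
          ...   | suc w = inj₂ (inj₁ (refl , st , λ _ → regs σ′ 32 , av , vj , mv , proj₁ suffix (λ z → case trans (sym e) z of λ ())))
            where
            av = proj₁ (pf ya)
            vj = proj₁ (proj₂ (pf ya))
            mv = proj₁ (proj₂ (proj₂ (pf ya)))
            suffix : μ (A + (((regs σ′ 32 + 1) * regs σ′ rN + regs σ′ rJ) * 16 + 9)) ≢ 0 ⟷ IsMod (suc (regs σ′ 32)) j
            suffix = subst (λ v → v ≢ 0 ⟷ IsMod (suc (regs σ′ 32)) j) (sym (trans (μ9 ((regs σ′ 32 + 1) * regs σ′ rN + regs σ′ rJ)) (cong (arr σ₀ 9) (cong₂ _+_ (cong₂ _*_ (ℕ.+-comm (regs σ′ 32) 1) (N≡ env′)) pJ))))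
                       (md (suc (regs σ′ 32)) j (inj₁ (ℕ.≤-<-trans vj j<)) vj j<)
          newpf : IsMod a j → PrefixInv (suc j) (regs σ′ rJ)
          newpf mod = subst (PrefixInv (suc j)) (sym pJ) (λ _ → aj , ℕ.n<1+n j , mod , λ e u w _ → ℕ.<⇒≱ u (ℕ.≤-pred w))
          oldpf : ¬ IsMod a j → a ≤ regs σ′ 32 × regs σ′ 32 < suc j × IsMod a (regs σ′ 32) × (∀ e → regs σ′ 32 < e → e < suc j → ¬ IsMod a e)
          oldpf nm with a ℕ.≟ j
          ... | yes refl = ⊥-elim (nm singleton-mod)
          ... | no ne = let (u , w , mv , mx) = pf (ℕ.≤∧≢⇒< aj ne) in u , ℕ.m≤n⇒m≤1+n w , mv ,
                 λ e l l′ → case e ℕ.≟ j of λ { (yes refl) → nm ; (no ne′) → mx e l (ℕ.≤∧≢⇒< (ℕ.≤-pred l′) ne′) }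

        row : ∀ j σ′ → j < m → Frame (for rJ strongCell) σ′₀ σ′ → regs σ′ rJ ≡ j → Row j σ′ → Spec strongCell σ′ (λ t σ″ → t ≤ 200 × Row (suc j) σ″)
        row j σ′ j< f′ pJ (cs , ok≤ , lf , hi , pf) with j ℕ.<? a
        ... | yes ja = thenS (lt⁺ (subst₂ _<_ (sym pJ) (sym (trans (reg-same f′ rG) pG)) ja)) (byWp (ℕ.≤ᵇ⇒≤ _ _ tt , cells-skip {StrongCell} {a} {j} {arr σ′ 12} ja cs , ok≤ ,
                  ⟷-trans lf ((λ u → below-suc u (λ l → ⊥-elim (ℕ.<⇒≱ ja l))) , λ u t t< → u t (ℕ.m≤n⇒m≤1+n t<)) ,
                  (λ d → ⟷-trans (hi d) ((λ u → below-suc u (λ l → ⊥-elim (ℕ.<⇒≱ ja (ℕ.<⇒≤ l)))) , λ u t t< → u t (ℕ.m≤n⇒m≤1+n t<))) ,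
                  λ l → ⊥-elim (ℕ.<⇒≱ ja (ℕ.≤-pred l))))
        ... | no nja = elseS (lt⁻ (subst₂ _≤_ (sym (At.pG′ q₀)) (sym pJ) aj))
              (seqS (mapS (raise-spec q₀ aj hi) λ t₁ σ₁ f₁ (l₁ , hi₁ , m₁ , o₁) →
               seqS (mapS (decide-spec (at-frame q₀ f₁) j< aj (subst₂ (λ μ A → Cells StrongCell a j (λ i → μ (A + (i * 16 + 12)))) (sym m₁) (sym (o₁ rAB (λ ()) (λ ()))) cs)
                        (subst (_≤ 1) (sym (o₁ 29 (λ ()) (λ ()))) ok≤) (subst (LeftInv j) (sym (o₁ 29 (λ ()) (λ ()))) lf) hi₁ (subst (PrefixInv j) (sym (o₁ 32 (λ ()) (λ ()))) pf))
                 λ t₂ σ₂ f₂ (l₂ , cs₂ , pf₂) → byWp (finish₃ σ₁ σ₂ f₁ f₂ l₁ l₂ cs₂ (trans (reg-same f₂ 29) (o₁ 29 (λ ()) (λ ()))) (subst (HighInv (suc j)) (sym (reg-same f₂ 30)) hi₁) pf₂))))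
          where
          aj = ℕ.≮⇒≥ nja
          q₀ : At j σ′
          q₀ = record { env′ = env-frame f′ env₁ ; pG′ = trans (reg-same f′ rG) pG ; pJ = pJ
                      ; md′ = λ i → trans (arr-keep f′ (11 <ᵇ_) 9 i) (arr-keep f (11 <ᵇ_) 9 i)
                      ; D′ = λ i → trans (arr-keep f′ (11 <ᵇ_) 10 i) (arr-keep f (11 <ᵇ_) 10 i)
                      ; E′ = λ i → trans (arr-keep f′ (11 <ᵇ_) 11 i) (arr-keep f (11 <ᵇ_) 11 i) }
          finish₃ : ∀ {t₁ t₂} σ₁ σ₂ → Frame raise σ′ σ₁ → Frame decide σ₁ σ₂ → t₁ ≤ 25 → t₂ ≤ 100 → Cells StrongCell a (suc j) (arr σ₂ 12) → regs σ₂ 29 ≡ regs σ′ 29 →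
                    HighInv (suc j) (regs σ₂ 30) → PrefixInv (suc j) (regs σ₂ 32) →
                    4 + (t₁ + (t₂ + 13)) ≤ 200 ×
                    Row (suc j) (state (regs σ₂ [ 29 ≔ bit (bit (arr σ₂ 11 (regs σ₂ rJ) <ᵇ regs σ₂ rG) <ᵇ regs σ₂ 29) ]) (mem σ₂))
          finish₃ σ₁ σ₂ f₁ f₂ l₁ l₂ cs₂ e₂₉ hi₂ pf₂ = ℕ.≤-trans (ℕ.+-monoʳ-≤ 4 (ℕ.+-mono-≤ l₁ (ℕ.+-monoˡ-≤ 13 l₂))) (ℕ.≤ᵇ⇒≤ _ _ tt) , cs₂ , bit≤1 _ ,
             ⟷-trans (below-bound {regs σ₂ 29} {arr σ₂ 11 (regs σ₂ rJ)} {regs σ₂ rG} (subst (_≤ 1) (sym e₂₉) ok≤))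
               (⟷-trans (×-⟷ (subst (LeftInv j) (sym e₂₉) lf) ((λ l → subst₂ _≤_ pG″ E≡ l) , λ l → subst₂ _≤_ (sym pG″) (sym E≡) l))
                 ((λ (u , w) → below-suc u (λ _ → w)) , λ h → (λ i i< → h i (ℕ.m≤n⇒m≤1+n i<)) , h j (ℕ.n<1+n j) aj)) ,
             hi₂ , pf₂
            where
            q₂ = at-frame (at-frame q₀ f₁) f₂
            pG″ = At.pG′ q₂
            E≡ : arr σ₂ 11 (regs σ₂ rJ) ≡ E j
            E≡ = trans (cong (arr σ₂ 11) (At.pJ q₂)) (At.E′ q₂ j)
      step : ∀ a σ → a < m → Frame strongs σ₀ σ → regs σ rG ≡ a → Cells StrongCell a 0 (arr σ 12) → Spec _ σ _
      step a σ a< f pG h = setS (setS (setS (mapS (for-spec {rJ} {strongCell} 200 Row (M≡ env₁) (λ _ _ _ h → h) (init h) row)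
          λ t₁ σ₁ f₁ (l₁ , r) → ℕ.+-monoʳ-≤ 6 l₁ , cells-row {StrongCell} {a} {arr σ₁ 12} (proj₁ r))))
        where open Step a σ a< f pG

-- Graphs of rooted trees

module RootedTree {n N : ℕ} (par : Fin N → Fin (suc N)) (par≤ : ∀ i → toℕ (par i) ≤ toℕ i)
                  (kind′ : Fin (suc N) → Kind n) where

  children : Fin (suc N) → List (Fin (suc N))
  children v = map suc (filter (λ i → par i Fin.≟ v) (allFin N))

  neighbours : Fin (suc N) → List (Fin (suc N))
  neighbours zero    = children zero
  neighbours (suc i) = par i ∷ children (suc i)

  graph : LabelledGraph n
  graph = record { size = suc N ; kind = kind′ ; nbrs = neighbours }

  open LabelledGraph graph public

  child⁺ : ∀ i {v} → par i ≡ v → suc i ∈ˡ children v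
  child⁺ i {v} p = ∈-map⁺ suc (∈-filter⁺ (λ i → par i Fin.≟ v) (∈-allFin i) p)

  child⁻ : ∀ {u v} → u ∈ˡ children v → ∃[ i ] u ≡ suc i × par i ≡ v
  child⁻ {u} {v} h = let (i , j , p) = ∈-map⁻ suc h in i , p , proj₂ (∈-filter⁻ (λ i → par i Fin.≟ v) {xs = allFin N} j)

  adj-child : ∀ i → Adj (par i) (suc i)
  adj-child i with par i in e
  ... | zero  = child⁺ i e
  ... | suc _ = there (child⁺ i e)

  adj-parent : ∀ i → Adj (suc i) (par i)
  adj-parent i = here refl

  data Link : Node → Node → Set where
    down : ∀ i → Link (par i) (suc i)
    up   : ∀ i → Link (suc i) (par i)

  link : ∀ {u v} → Adj u v → Link u v
  link {zero} h with child⁻ h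
  ... | i , refl , p = subst (λ u → Link u (suc i)) p (down i)
  link {suc j} (here refl) = up j
  link {suc j} (there h) with child⁻ h
  ... | i , refl , p = subst (λ u → Link u (suc i)) p (down i)

  adj : ∀ {u v} → Link u v → Adj u v
  adj (down i) = adj-child i
  adj (up i)   = adj-parent i

  flip : ∀ {u v} → Link u v → Link v u
  flip (down i) = up i
  flip (up i)   = down i

  par< : ∀ i → toℕ (par i) < toℕ (suc {N} i)
  par< i = s≤s (par≤ i)

  children-unique : ∀ v → Unique (children v)
  children-unique v = Unique.map⁺ Fin.suc-injective (Unique.filter⁺ (λ i → par i Fin.≟ v) (Unique.allFin⁺ N))

  simple : IsSimple
  simple = record
    { unique = λ { zero → children-unique zero
                 ; (suc i) → All.tabulate (λ h e → case child⁻ h of λ { (j , refl , q) →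
                     ℕ.<-asym (subst (λ v → toℕ v < suc (toℕ i)) e (par< i)) (subst (λ v → toℕ v < suc (toℕ j)) q (par< j)) }) ∷ children-unique (suc i) }
    ; loopless = λ v h → irrefl (link h)
    ; symmetric = λ h → adj (flip (link h)) }
    where
    irrefl′ : ∀ {u v} → Link u v → toℕ u ≢ toℕ v
    irrefl′ (down i) e = ℕ.<⇒≢ (par< i) e
    irrefl′ (up i) e = ℕ.<⇒≢ (par< i) (sym e)
    irrefl : ∀ {v} → ¬ Link v v
    irrefl l = irrefl′ l refl

  -- Numbers decrease towards the root, so the path of parents is found by induction on a bound for
  -- the number; `P` carries what must hold along it.
  climb : ∀ {R : Node → Node → Set} {P : Node → Set} → (∀ i → P (suc i) → R (suc i) (par i) × P (par i)) → ∀ v → P v → Star R v zero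
  climb {R} {P} h v p = go (toℕ v) v ℕ.≤-refl p
    where
    go : ∀ f v → toℕ v ≤ f → P v → Star R v zero
    go f zero le p = ε
    go (suc f) (suc i) (s≤s le) p = proj₁ (h i p) ◅ go f (par i) (ℕ.≤-trans (par≤ i) le) (proj₂ (h i p))

  connected′ : ∀ u v → Star Adj u v
  connected′ u v = climb {R = Adj} {P = λ _ → Node} (λ i x → adj-parent i , x) u u ◅◅
                   reverse (λ {a} {b} h → adj {b} {a} (flip (link {a} {b} h))) (climb {R = Adj} {P = λ _ → Node} (λ i x → adj-parent i , x) v v)

  -- A non-backtracking walk, first from u to w and finally from y to z.
  data Walk : Node → Node → Node → Node → Set where
    edge : ∀ {u w} → Link u w → Walk u w u w
    step : ∀ {u w x y z} → Link u w → u ≢ x → Walk w x y z → Walk u w y z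

  first : ∀ {u w y z} → Walk u w y z → Link u w
  first (edge l) = l
  first (step l _ _) = l

  lower : ∀ {u v} → Link u v → toℕ v < toℕ u → ∃[ i ] u ≡ suc i × v ≡ par i
  lower (down i) l = ⊥-elim (ℕ.<-asym l (par< i))
  lower (up i) l = i , refl , refl

  lower-unique : ∀ {u v w} → Link u v → Link u w → toℕ v < toℕ u → toℕ w < toℕ u → v ≡ w
  lower-unique l l′ p q with lower l p | lower l′ q
  ... | i , refl , refl | .i , refl , refl = refl

  comparable : ∀ {u v} → Link u v → toℕ u < toℕ v ⊎ toℕ v < toℕ u
  comparable (down i) = inj₁ (par< i)
  comparable (up i) = inj₂ (par< i)

  -- The parent is the only neighbour with a smaller number. After a step to a larger number,
  -- turning back would mean taking the same edge, so the numbers keep growing.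
  descend : ∀ {u w y z} → Walk u w y z → toℕ u < toℕ w → toℕ u < toℕ z × toℕ y < toℕ z
  descend (edge l) p = p , p
  descend (step l ne k) p with comparable (first k)
  ... | inj₁ q = let (a , b) = descend k q in ℕ.<-trans p a , b
  ... | inj₂ q = ⊥-elim (ne (lower-unique (flip l) (first k) p q))

  ascend : ∀ {u w y z} → Walk u w y z → toℕ w < toℕ u → toℕ z < toℕ u ⊎ toℕ y < toℕ z
  ascend (edge l) p = inj₁ p
  ascend (step l ne k) p with comparable (first k)
  ... | inj₁ q = inj₂ (proj₂ (descend k q))
  ... | inj₂ q with ascend k q
  ...   | inj₁ r = inj₁ (ℕ.<-trans r p)
  ...   | inj₂ r = inj₂ r

  last-link : ∀ {u w y z} → Walk u w y z → Link y z
  last-link (edge l) = l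
  last-link (step _ _ k) = last-link k

  -- The numbers along the walk rise, fall, or fall and then rise. The first two are impossible for
  -- a closed walk; in the third, `w` and `y` are both the parent of `v`.
  no-cycle : ∀ {v w y} → Walk v w y v → w ≢ y → ⊥
  no-cycle k ne with comparable (first k)
  ... | inj₁ p = ℕ.<-irrefl refl (proj₁ (descend k p))
  ... | inj₂ p with ascend k p
  ...   | inj₁ q = ℕ.<-irrefl refl q
  ...   | inj₂ q = ne (lower-unique (first k) (flip (last-link k)) p q)

  walk : ∀ {u w ws z} → Linked Adj (u ∷ w ∷ ws ∷ʳ z) → Unique (u ∷ w ∷ ws) → All (z ≢_) (u ∷ w ∷ ws) →
         ∃[ y ] y ∈ˡ (w ∷ ws) × Walk u w y z
  walk {ws = []} (a ∷ b ∷ [-]) _ (nz ∷ _) = _ , here refl , step (link a) (nz ∘ sym) (edge (link b))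
  walk {ws = x ∷ ws} (a ∷ l) ((_ ∷ ne ∷ _) ∷ un) (_ ∷ nz) =
    let (y , i , k) = walk l un nz in y , there i , step (link a) ne k

  acyclic′ : ∀ vs → ¬ Cycle vs
  acyclic′ (v ∷ w ∷ []) (s≤s () , _)
  acyclic′ (v ∷ w ∷ x ∷ vs) (_ , (vw ∷ vx ∷ vvs) ∷ (w≢ ∷ un) , a ∷ l) =
    let (y , i , k) = walk l (w≢ ∷ un) (vw ∷ vx ∷ vvs) in
    no-cycle (step (link a) vx k) (All.lookup w≢ i)

  isTree′ : IsTree
  isTree′ = record { nonempty = s≤s z≤n ; isSimple = simple ; connected = connected′ ; acyclic = acyclic′ }

  data Below (v : Node) : Node → Set where
    self  : Below v v
    above : ∀ {i} → Below v (par i) → Below v (suc i)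

  below-≤ : ∀ {v w} → Below v w → toℕ v ≤ toℕ w
  below-≤ self = ℕ.≤-refl
  below-≤ (above {i} b) = ℕ.≤-trans (below-≤ b) (ℕ.<⇒≤ (par< i))

  parent-not-below : ∀ i → ¬ Below (suc i) (par i)
  parent-not-below i b = ℕ.<⇒≱ (par< i) (below-≤ b)

  not-below-parent : ∀ {v i} → ¬ Below v (suc i) → ¬ Below v (par i)
  not-below-parent nb b = nb (above b)

  -- The components left by the removal of an edge, respectively of a node.

  side-child⁻ : ∀ {i w} → Star (AdjWithoutEdge (suc i) (par i)) (suc i) w → Below (suc i) w
  side-child⁻ {i} = go self
    where
    next : ∀ {a b} → Below (suc i) a → Link a b → ¬ SameEdge (suc i) (par i) a b → Below (suc i) b
    next q (down j) ne = above q
    next self (up .i) ne = ⊥-elim (ne (inj₁ (refl , refl)))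
    next (above q) (up j) ne = q
    go : ∀ {a w} → Below (suc i) a → Star (AdjWithoutEdge (suc i) (par i)) a w → Below (suc i) w
    go q ε = q
    go q ((h , ne) ◅ s) = go (next q (link h) ne) s

  side-child⁺ : ∀ {i w} → Below (suc i) w → Star (AdjWithoutEdge (suc i) (par i)) (suc i) w
  side-child⁺ self = ε
  side-child⁺ {i} (above {j} b) = side-child⁺ b ◅◅ (adj-child j , λ
    { (inj₁ (p , q)) → ℕ.<-irrefl refl (ℕ.<-trans (subst (λ u → toℕ u < suc (toℕ j)) p (par< j)) (subst (λ u → toℕ u < suc (toℕ i)) (sym q) (par< i)))
    ; (inj₂ (p , q)) → parent-not-below i (subst (Below (suc i)) p b) }) ◅ ε

  side-parent⁻ : ∀ {i w} → Star (AdjWithoutEdge (par i) (suc i)) (par i) w → ¬ Below (suc i) w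
  side-parent⁻ {i} = go (parent-not-below i)
    where
    next : ∀ {a b} → ¬ Below (suc i) a → Link a b → ¬ SameEdge (par i) (suc i) a b → ¬ Below (suc i) b
    next nq (down .i) ne self = ne (inj₁ (refl , refl))
    next nq (down j) ne (above q) = nq q
    next nq (up j) ne q = nq (above q)
    go : ∀ {a w} → ¬ Below (suc i) a → Star (AdjWithoutEdge (par i) (suc i)) a w → ¬ Below (suc i) w
    go q ε = q
    go q ((h , ne) ◅ s) = go (next q (link h) ne) s

  side-parent⁺ : ∀ {i w} → ¬ Below (suc i) w → Star (AdjWithoutEdge (par i) (suc i)) (par i) w
  side-parent⁺ {i} {w} nb = to-root (par i) (parent-not-below i) ◅◅ reverse symm (to-root w nb)
    where
    symm : ∀ {a b} → AdjWithoutEdge (par i) (suc i) a b → AdjWithoutEdge (par i) (suc i) b a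
    symm (h , ne) = adj (flip (link h)) , λ { (inj₁ (p , q)) → ne (inj₂ (q , p)) ; (inj₂ (p , q)) → ne (inj₁ (q , p)) }
    to-root : ∀ v → ¬ Below (suc i) v → Star (AdjWithoutEdge (par i) (suc i)) v zero
    to-root = climb (λ j nb → (adj-parent j , λ
      { (inj₁ (p , q)) → ℕ.<-irrefl refl (ℕ.<-trans (subst (λ u → toℕ u < suc (toℕ j)) q (par< j)) (subst (λ u → toℕ u < suc (toℕ i)) (sym p) (par< i)))
      ; (inj₂ (p , q)) → nb (subst (Below (suc i)) (sym p) self) }) , not-below-parent nb)

  part-child⁻ : ∀ {i w} → Star (AdjWithoutNode (par i)) (suc i) w → Below (suc i) w
  part-child⁻ {i} = go self
    where
    next : ∀ {a b} → Below (suc i) a → Link a b → b ≢ par i → Below (suc i) b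
    next q (down j) ne = above q
    next self (up .i) ne = ⊥-elim (ne refl)
    next (above q) (up j) ne = q
    go : ∀ {a w} → Below (suc i) a → Star (AdjWithoutNode (par i)) a w → Below (suc i) w
    go q ε = q
    go q ((h , _ , ne) ◅ s) = go (next q (link h) ne) s

  part-child⁺ : ∀ {i w} → Below (suc i) w → Star (AdjWithoutNode (par i)) (suc i) w
  part-child⁺ self = ε
  part-child⁺ {i} (above {j} b) = part-child⁺ b ◅◅ (adj-child j , (λ e → parent-not-below i (subst (Below (suc i)) e b)) ,
                                                    (λ e → parent-not-below i (subst (Below (suc i)) e (above b)))) ◅ ε

  part-parent⁻ : ∀ {i w} → Star (AdjWithoutNode (suc i)) (par i) w → ¬ Below (suc i) w
  part-parent⁻ {i} = go (parent-not-below i)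
    where
    next : ∀ {a b} → ¬ Below (suc i) a → Link a b → b ≢ suc i → ¬ Below (suc i) b
    next nq (down j) ne self = ne refl
    next nq (down j) ne (above q) = nq q
    next nq (up j) ne q = nq (above q)
    go : ∀ {a w} → ¬ Below (suc i) a → Star (AdjWithoutNode (suc i)) a w → ¬ Below (suc i) w
    go q ε = q
    go q ((h , _ , ne) ◅ s) = go (next q (link h) ne) s

  part-parent⁺ : ∀ {i w} → ¬ Below (suc i) w → Star (AdjWithoutNode (suc i)) (par i) w
  part-parent⁺ {i} {w} nb = to-root (par i) (parent-not-below i) ◅◅ reverse (λ (h , a , b) → adj (flip (link h)) , b , a) (to-root w nb)
    where
    to-root : ∀ v → ¬ Below (suc i) v → Star (AdjWithoutNode (suc i)) v zero
    to-root = climb (λ j nb → (adj-parent j , (λ e → nb (subst (Below (suc i)) (sym e) self)) ,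
                               (λ e → nb (above (subst (Below (suc i)) (sym e) self)))) , not-below-parent nb)

  child-towards : ∀ {v w} → Below v w → v ≢ w → ∃[ i ] par i ≡ v × Below (suc i) w
  child-towards self ne = ⊥-elim (ne refl)
  child-towards {v} (above {j} b) ne with v Fin.≟ par j
  ... | yes e = j , sym e , self
  ... | no ne′ = let (i , p , q) = child-towards b ne′ in i , p , above q

-- The nodes created so far, newest first; the node at the head has the number suc (length rs)

Interval² : Set
Interval² = ℕ × ℕ

contains : ℕ → ℕ → Interval² → Bool
contains c d (a , b) = (a ≤ᵇ c) ∧ (d ≤ᵇ b)

-- Numbers count from 1 in the order of creation. The default 0 is the leaf of the vertex 0, to
-- which an interval contained in no other is attached.
newest : (Interval² → Bool) → List Interval² → ℕ
newest P [] = 0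
newest P (x ∷ rs) = if P x then suc (length rs) else newest P rs

newest-≤ : ∀ P rs → newest P rs ≤ length rs
newest-≤ P [] = z≤n
newest-≤ P (x ∷ rs) with P x
... | true  = ℕ.≤-refl
... | false = ℕ.m≤n⇒m≤1+n (newest-≤ P rs)

newest-cong : ∀ {P Q} rs → (∀ x → x ∈ˡ rs → P x ≡ Q x) → newest P rs ≡ newest Q rs
newest-cong [] h = refl
newest-cong (x ∷ rs) h rewrite h x (here refl) | newest-cong rs (λ y i → h y (there i)) = refl

newest-none : ∀ {P} rs → (∀ x → x ∈ˡ rs → P x ≡ false) → newest P rs ≡ 0
newest-none [] h = refl
newest-none (x ∷ rs) h rewrite h x (here refl) = newest-none rs (λ y i → h y (there i))

newest-∨ : ∀ P Q rs → newest (λ x → P x ∨ Q x) rs ≡ newest P rs ⊔ newest Q rs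
newest-∨ P Q [] = refl
newest-∨ P Q (x ∷ rs) with P x | Q x
... | true  | true  = sym (ℕ.⊔-idem _)
... | true  | false = sym (ℕ.m≥n⇒m⊔n≡m (ℕ.m≤n⇒m≤1+n (newest-≤ Q rs)))
... | false | true  = sym (ℕ.m≤n⇒m⊔n≡n (ℕ.m≤n⇒m≤1+n (newest-≤ P rs)))
... | false | false = newest-∨ P Q rs

parent : List Interval² → Interval² → ℕ
parent rs (c , d) = newest (contains c d) rs

-- This mirrors the stores made at a creation: the new record receives its parent, and the new
-- number is appended to the record of the parent.
neighbourNumbers : List Interval² → ℕ → List ℕ
neighbourNumbers [] u = []
neighbourNumbers (x ∷ rs) u =
  if u ≡ᵇ suc (length rs) then parent rs x ∷ [] else
  neighbourNumbers rs u ++ (if u ≡ᵇ parent rs x then suc (length rs) ∷ [] else [])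

neighbourNumbers-≤ : ∀ rs u → length (neighbourNumbers rs u) ≤ suc (length rs)
neighbourNumbers-≤ [] u = z≤n
neighbourNumbers-≤ (x ∷ rs) u with u ≡ᵇ suc (length rs)
... | true = s≤s z≤n
... | false with u ≡ᵇ parent rs x
...   | true  = ℕ.≤-trans (ℕ.≤-reflexive (trans (length-++ (neighbourNumbers rs u)) (ℕ.+-comm _ 1))) (s≤s (neighbourNumbers-≤ rs u))
...   | false = ℕ.≤-trans (ℕ.≤-reflexive (trans (length-++ (neighbourNumbers rs u)) (ℕ.+-identityʳ _))) (ℕ.m≤n⇒m≤1+n (neighbourNumbers-≤ rs u))

codes : (Interval² → ℕ) → List Interval² → ℕ → ℕ
codes κ [] u = 3
codes κ (x ∷ rs) u = if u ≡ᵇ suc (length rs) then κ x else codes κ rs u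

≤ᵇ-true : ∀ {a b} → (a ≤ᵇ b) ≡ true → a ≤ b
≤ᵇ-true {a} {b} p = ℕ.≤ᵇ⇒≤ a b (subst T (sym p) tt)

≤-trueᵇ : ∀ {a b} → a ≤ b → (a ≤ᵇ b) ≡ true
≤-trueᵇ p = T-true (ℕ.≤⇒≤ᵇ p)

contains⁺ : ∀ {a b c d} → a ≤ c → d ≤ b → contains c d (a , b) ≡ true
contains⁺ p q rewrite ≤-trueᵇ p | ≤-trueᵇ q = refl

contains⁻ : ∀ {a b c d} → contains c d (a , b) ≡ true → a ≤ c × d ≤ b
contains⁻ {a} {b} {c} {d} h = let (p , q) = ∧-true {a ≤ᵇ c} h in ≤ᵇ-true p , ≤ᵇ-true q

≡ᵇ-false : ∀ {a b} → a ≢ b → (a ≡ᵇ b) ≡ false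
≡ᵇ-false ne = ¬true (λ q → ne (≡ᵇ-true q))

module Nodes (m : ℕ) (Str : ℕ → ℕ → Set) where

  -- Position (c , j) of the double loop treats the interval [c , m ∸ suc j].
  Processed : ℕ → ℕ → Interval² → Set
  Processed c j (a , b) = a < c ⊎ (a ≡ c × m ≤ b + j)

  Earlier : Interval² → Interval² → Set
  Earlier (c , d) (a , b) = a < c ⊎ (a ≡ c × d < b)

  record Listed (c j : ℕ) (rs : List Interval²) : Set where
    field
      sound    : ∀ {a b} → (a , b) ∈ˡ rs → Str a b × a ≤ b × b < m × Processed c j (a , b)
      full     : ∀ {a b} → a ≤ b → b < m → Str a b → Processed c j (a , b) → (a , b) ∈ˡ rs
      sorted   : AllPairs Earlier rs
  open Listed public

  module _ {c j d : ℕ} (d+ : suc (d + j) ≡ m) (cd : c ≤ d) {rs : List Interval²} (ok : Listed c j rs) where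

    not-yet : ∀ {a b} → Processed c j (a , b) → a < c ⊎ (a ≡ c × d < b)
    not-yet (inj₁ l) = inj₁ l
    not-yet (inj₂ (e , l)) = inj₂ (e , ℕ.+-cancelʳ-≤ j (suc d) _ (subst (_≤ _) (sym d+) l))

    -- The interval itself is not listed yet, so a node containing it starts before `c` or ends
    -- after `d`; that is, it contains the interval lengthened by one position to the left or to the
    -- right. Both answers are in the table already, and the newest node is the one with the greater
    -- number.
    parent-recurrence : parent rs (c , d) ≡ newest (λ (a , b) → (a <ᵇ c) ∧ (d ≤ᵇ b)) rs ⊔ newest (λ (a , b) → (a ≤ᵇ c) ∧ (d <ᵇ b)) rs
    parent-recurrence = trans (newest-cong rs eq′) (newest-∨ (λ (a , b) → (a <ᵇ c) ∧ (d ≤ᵇ b)) (λ (a , b) → (a ≤ᵇ c) ∧ (d <ᵇ b)) rs)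
      where
      eq′ : ∀ x → x ∈ˡ rs → contains c d x ≡ ((proj₁ x <ᵇ c) ∧ (d ≤ᵇ proj₂ x)) ∨ ((proj₁ x ≤ᵇ c) ∧ (d <ᵇ proj₂ x))
      eq′ (a , b) i with not-yet (proj₂ (proj₂ (proj₂ (sound ok i))))
      ... | inj₁ l rewrite <-true l | ≤-trueᵇ (ℕ.<⇒≤ l) with d ≤ᵇ b in e
      ...   | true = refl
      ...   | false = sym (<-false {d} {b} (λ l′ → case trans (sym e) (≤-trueᵇ {d} {b} (ℕ.<⇒≤ l′)) of λ ()))
      eq′ (a , b) i | inj₂ (refl , l) rewrite ≤-trueᵇ (ℕ.≤-refl {a}) | ≤-trueᵇ (ℕ.<⇒≤ l) | <-true l | <-false (ℕ.<-irrefl {a} refl) = refl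

    -- A node created now contains no interval visited before; so old table entries remain correct
    -- for the longer list.
    untouched : ∀ {a b} → Processed c j (a , b) → a ≤ b → contains a b (c , d) ≡ false
    untouched {a} {b} pr ab = ¬true λ q → case not-yet pr of λ
      { (inj₁ l) → ℕ.<⇒≱ l (proj₁ (contains⁻ {c} {d} {a} {b} q)) ; (inj₂ (_ , l)) → ℕ.<⇒≱ l (proj₂ (contains⁻ {c} {d} {a} {b} q)) }

    now : ∀ {a b} → Processed c (suc j) (a , b) → Processed c j (a , b) ⊎ (a ≡ c × b ≡ d)
    now (inj₁ l) = inj₁ (inj₁ l)
    now {a} {b} (inj₂ (e , l)) with b ℕ.≟ d
    ... | yes e′ = inj₂ (e , e′)
    ... | no ne = inj₁ (inj₂ (e , ℕ.≤-trans (ℕ.≤-reflexive (sym d+)) (ℕ.+-monoˡ-≤ j (ℕ.≤∧≢⇒< d≤b (ne ∘ sym)))))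
      where
      d≤b : d ≤ b
      d≤b = ℕ.+-cancelʳ-≤ (suc j) d b (subst (_≤ b + suc j) (trans (sym d+) (sym (ℕ.+-suc d j))) l)

    later : ∀ {a b} → Processed c j (a , b) → Processed c (suc j) (a , b)
    later (inj₁ l) = inj₁ l
    later {b = b} (inj₂ (e , l)) = inj₂ (e , ℕ.≤-trans l (ℕ.+-monoʳ-≤ b (ℕ.n≤1+n j)))

    here-now : Processed c (suc j) (c , d)
    here-now = inj₂ (refl , ℕ.≤-reflexive (trans (sym d+) (sym (ℕ.+-suc d j))))

    d<m : d < m
    d<m = subst (suc d ≤_) d+ (s≤s (ℕ.m≤m+n d j))

    listed-skip : ¬ Str c d → Listed c (suc j) rs
    listed-skip ns = record
      { sound = λ i → let (s , ab , b< , pr) = sound ok i in s , ab , b< , later pr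
      ; full = λ ab b< st pr → case now pr of λ { (inj₁ pr′) → full ok ab b< st pr′ ; (inj₂ (refl , refl)) → ⊥-elim (ns st) }
      ; sorted = sorted ok }

    listed-add : Str c d → Listed c (suc j) ((c , d) ∷ rs)
    listed-add st = record
      { sound = λ { (here refl) → st , cd , d<m , here-now
                  ; (there i) → let (s , ab , b< , pr) = sound ok i in s , ab , b< , later pr }
      ; full = λ ab b< st pr → case now pr of λ { (inj₁ pr′) → there (full ok ab b< st pr′) ; (inj₂ (refl , refl)) → here refl }
      ; sorted = All.tabulate (λ i → not-yet (proj₂ (proj₂ (proj₂ (sound ok i))))) ∷ sorted ok }

  listed-below : ∀ {c j d rs} → suc (d + j) ≡ m → d < c → Listed c j rs → Listed c (suc j) rs
  listed-below {c} {j} {d} d+ dc ok = record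
    { sound = λ i → let (s , ab , b< , pr) = sound ok i in s , ab , b< , (case pr of λ { (inj₁ l) → inj₁ l ; (inj₂ (e , l)) → inj₂ (e , ℕ.≤-trans l (ℕ.+-monoʳ-≤ _ (ℕ.n≤1+n j))) })
    ; full = λ {a} {b} ab b< st pr → full ok ab b< st (case pr of λ
        { (inj₁ l) → inj₁ l ; (inj₂ (refl , l)) → inj₂ (refl , ℕ.≤-trans (ℕ.≤-reflexive (sym d+)) (ℕ.+-monoˡ-≤ j (ℕ.<-≤-trans dc ab))) })
    ; sorted = sorted ok }

  listed-row : ∀ {c rs} → Listed c m rs → Listed (suc c) 0 rs
  listed-row {c} ok = record
    { sound = λ i → let (s , ab , b< , pr) = sound ok i in s , ab , b< , inj₁ (case pr of λ { (inj₁ l) → ℕ.m≤n⇒m≤1+n l ; (inj₂ (refl , _)) → ℕ.≤-refl })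
    ; full = λ {a} {b} ab b< st pr → full ok ab b< st (case pr of λ
        { (inj₁ l) → (case a ℕ.≟ c of λ { (yes e) → inj₂ (e , ℕ.m≤n+m m b) ; (no ne) → inj₁ (ℕ.≤∧≢⇒< (ℕ.≤-pred l) ne) })
        ; (inj₂ (refl , l)) → ⊥-elim (ℕ.<⇒≱ b< (subst (m ≤_) (ℕ.+-identityʳ b) l)) })
    ; sorted = sorted ok }

-- Writing the tree into memory

module Output (L : Layout) (G : ℕ → ℕ → Bool)
              (s≡ : Layout.s L ≡ Layout.n L * Layout.n L + 4) (ab≡ : Layout.ab L ≡ Layout.tb L + Layout.s L * Layout.s L) where
  open Machine L G
  open Loops L G

  abstract
    -- Row 0 is the table of pointers and row `suc u` is the record of node `u`. Abstract, so that
    -- addresses are not unfolded.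
    slot : ℕ → ℕ → ℕ
    slot u j = tb + (u * s + j)

    slot≡ : ∀ u j → slot u j ≡ tb + (u * s + j)
    slot≡ u j = refl

  slot-skip : ∀ (f : ℕ → ℕ) {u j v} u′ j′ → j < s → j′ < s → u ≢ u′ ⊎ j ≢ j′ → (f [ slot u j ≔ v ]) (slot u′ j′) ≡ f (slot u′ j′)
  slot-skip f {u} {j} u′ j′ j< j′< ne = upd-diff f _ λ e → let (p , q) = radix-inj {s} {u} {u′} j< j′< (ℕ.+-cancelˡ-≡ tb _ _ (trans (sym (slot≡ u j)) (trans e (slot≡ u′ j′)))) in
    case ne of λ { (inj₁ x) → x p ; (inj₂ x) → x q }

  slot-same : ∀ (f : ℕ → ℕ) {u j} v → (f [ slot u j ≔ v ]) (slot u j) ≡ v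
  slot-same f {u} {j} v = upd-same f {slot u j} {slot u j} v refl

  slot< : ∀ {u j} → u < s → j < s → slot u j < ab
  slot< {u} {j} u< j< = subst₂ _<_ (sym (slot≡ u j)) (sym ab≡) (ℕ.+-monoʳ-< tb (ℕ.<-≤-trans (ℕ.+-monoʳ-< (u * s) j<)
    (ℕ.≤-trans (ℕ.≤-reflexive (ℕ.+-comm (u * s) s)) (ℕ.*-monoˡ-≤ s u<))))

  next-row : ∀ u → slot u 0 + s ≡ slot (suc u) 0
  next-row u = trans (cong (_+ s) (slot≡ u 0)) (trans (ℕ.+-assoc tb _ s) (trans (cong (tb +_) (trans (cong (_+ s) (ℕ.+-identityʳ _))
                 (trans (ℕ.+-comm _ s) (sym (ℕ.+-identityʳ _))))) (sym (slot≡ (suc u) 0))))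

  cellAt : (ℕ → ℕ) → ℕ → ℕ → ℕ
  cellAt f k i = f (ab + (i * 16 + k))

  slot-cell : ∀ f {u j v} k i → u < s → j < s → cellAt (f [ slot u j ≔ v ]) k i ≡ cellAt f k i
  slot-cell f k i u< j< = upd-diff f _ λ e → ℕ.<⇒≱ (slot< u< j<) (subst (ab ≤_) (sym e) (ℕ.m≤m+n ab _))

  cell-slot : ∀ f {k i v} u j → u < s → j < s → (f [ ab + (i * 16 + k) ≔ v ]) (slot u j) ≡ f (slot u j)
  cell-slot f u j u< j< = upd-diff f _ λ e → ℕ.<⇒≱ (slot< u< j<) (subst (ab ≤_) e (ℕ.m≤m+n ab _))

  rC rPtr rD : ℕ
  rC   = 38
  rPtr = 39
  rD   = 40

  here′ : Expr
  here′ = reg rG ⊗ reg rN ⊕ reg rD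

  below′ : Expr
  below′ = (reg rG ⊕ lit 1) ⊗ reg rN ⊕ reg rD

  -- Entry `suc a * n + b` of array 13 is the newest node containing `[a , b]`. The shift by one row
  -- and the column `m` provide zeros for intervals lengthened beyond the left or the right border.
  create emit emitCell output : Cmd
  create = put 13 below′ (reg rC) ︔ store (reg rTB ⊕ reg rC) (reg rPtr) ︔
           cond (reg rG ≈ reg rD) (store (reg rPtr) (ld 0 (reg rG) ⊕ lit 3)) (store (reg rPtr) (ld 12 here′)) ︔
           store (reg rPtr ⊕ lit 1) (lit 1) ︔ store (reg rPtr ⊕ lit 2) (reg 34) ︔
           set 36 (load (reg rTB ⊕ reg 34)) ︔ set 37 (load (reg 36 ⊕ lit 1)) ︔
           store (reg 36 ⊕ lit 2 ⊕ reg 37) (reg rC) ︔ store (reg 36 ⊕ lit 1) (reg 37 ⊕ lit 1) ︔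
           inc rC ︔ set rPtr (reg rPtr ⊕ reg rS)
  emit = set 34 (ld 13 here′) ︔ set 35 (ld 13 ((reg rG ⊕ lit 1) ⊗ reg rN ⊕ (reg rD ⊕ lit 1))) ︔ greatest 34 35 ︔
         cond (ld 12 here′) create (put 13 below′ (reg 34))
  -- The loop counter `rJ` increases, while the right end runs down from `m ∸ 1`.
  emitCell = set rD (reg rM ⊖ (reg rJ ⊕ lit 1)) ︔ cond (reg rD ≺ reg rG) skip emit
  -- Node 0 exists from the start: code 3 is the leaf with label 0, and its degree is still 0.
  output = set rPtr (reg rTB ⊕ reg rS) ︔ store (reg rTB) (reg rPtr) ︔ store (reg rPtr) (lit 3) ︔ store (reg rPtr ⊕ lit 1) (lit 0) ︔
           set rC (lit 1) ︔ set rPtr (reg rPtr ⊕ reg rS) ︔ for rG (for rJ emitCell) ︔ set 0 (reg rC) ︔ set 1 (reg rTB)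

  record Record (f : ℕ → ℕ) (u κ : ℕ) (ns : List ℕ) : Set where
    field
      code  : f (slot (suc u) 0) ≡ κ
      count : f (slot (suc u) 1) ≡ length ns
      items : seg (λ i → f (slot (suc u) (2 + i))) 0 (length ns) ≡ ns
  open Record public

  module Emission (Str : ℕ → ℕ → Set) (f₀ : ℕ → ℕ) (κ : Interval² → ℕ)
                  (κ-leaf : ∀ {a} → a < m → κ (a , a) ≡ cellAt f₀ 0 a + 3)
                  (κ-node : ∀ {a b} → a < b → b < m → κ (a , b) ≡ cellAt f₀ 12 (a * n + b))
                  (str : ∀ {a b} → a ≤ b → b < m → cellAt f₀ 12 (a * n + b) ≢ 0 ⟷ Str a b) where
    open Nodes m Str public

    Written : List Interval² → (ℕ → ℕ) → Set
    Written rs f = ∀ u → u ≤ length rs → f (slot 0 u) ≡ slot (suc u) 0 × Record f u (codes κ rs u) (neighbourNumbers rs u)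

    record Emitted (c j : ℕ) (rs : List Interval²) (cnt ptr : ℕ) (f : ℕ → ℕ) : Set where
      field
        cnt≡   : cnt ≡ suc (length rs)
        ptr≡   : ptr ≡ slot (suc (suc (length rs))) 0
        -- At most one node per visited position; this crude count is all that the row length `s`
        -- requires.
        few    : length rs ≤ c * m + j
        listed : Listed c j rs
        keep₀  : ∀ i → cellAt f 0 i ≡ cellAt f₀ 0 i
        keep₁₂ : ∀ i → cellAt f 12 i ≡ cellAt f₀ 12 i
        zero-c : ∀ b → b < n → cellAt f 13 b ≡ 0
        zero-d : ∀ a → cellAt f 13 (suc a * n + m) ≡ 0
        ups    : ∀ a b → a ≤ b → b < m → Processed c j (a , b) → cellAt f 13 (suc a * n + b) ≡ parent rs (a , b)
        written : Written rs f
    open Emitted public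

    module _ {c j d : ℕ} {rs : List Interval²} {cnt ptr : ℕ} {f : ℕ → ℕ} (c< : c < m) (j< : j < m) (d+ : suc (d + j) ≡ m) (cd : c ≤ d)
             (em : Emitted c j rs cnt ptr f) where

      k : ℕ
      k = suc (length rs)
      q = parent rs (c , d)
      dm : d < m
      dm = d<m {c} {j} {d} d+ cd (listed em)

      short : length rs < m * m
      short = ℕ.≤-<-trans (few em) (ℕ.<-≤-trans (ℕ.+-monoʳ-< (c * m) j<) (ℕ.≤-trans (ℕ.≤-reflexive (ℕ.+-comm (c * m) m)) (ℕ.*-monoˡ-≤ m c<)))

      room : 4 + length rs < s
      room = subst (4 + length rs <_) (trans (ℕ.+-comm 4 (n * n)) (sym s≡)) (ℕ.+-monoʳ-< 4 (ℕ.<-≤-trans short (ℕ.*-mono-≤ (ℕ.<⇒≤ m<n) (ℕ.<⇒≤ m<n))))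

      le : ∀ {x} → x ≤ 4 + length rs → x < s
      le p = ℕ.≤-<-trans p room

      q≤ : q ≤ length rs
      q≤ = newest-≤ (contains c d) rs

      first≡ : cellAt f 13 (c * n + d) ≡ newest (λ (a , b) → (a <ᵇ c) ∧ (d ≤ᵇ b)) rs
      first≡ = go c refl
        where
        go : ∀ c′ → c′ ≡ c → cellAt f 13 (c′ * n + d) ≡ newest (λ (a , b) → (a <ᵇ c′) ∧ (d ≤ᵇ b)) rs
        go zero e = trans (zero-c em d (ℕ.<-trans dm m<n)) (sym (newest-none rs (λ _ _ → refl)))
        go (suc c′) refl = trans (ups em c′ d (ℕ.≤-trans (ℕ.n≤1+n c′) cd) dm (inj₁ (ℕ.n<1+n c′)))
                             (newest-cong rs (λ { (zero , b) _ → refl ; (suc a , b) _ → refl }))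

      second≡ : cellAt f 13 (suc c * n + suc d) ≡ newest (λ (a , b) → (a ≤ᵇ c) ∧ (d <ᵇ b)) rs
      second≡ with suc d ℕ.<? m
      ... | yes sd< = ups em c (suc d) (ℕ.m≤n⇒m≤1+n cd) sd< (inj₂ (refl , ℕ.≤-reflexive (sym d+)))
      ... | no nsd = trans (cong (λ x → cellAt f 13 (suc c * n + x)) sd≡) (trans (zero-d em c)
              (sym (newest-none rs λ { (a , b) i → trans (cong ((a ≤ᵇ c) ∧_) (<-false (λ l → ℕ.<⇒≱ (proj₁ (proj₂ (proj₂ (sound (listed em) i)))) (subst (_≤ b) sd≡ l)))) (∧-f (a ≤ᵇ c)) })))
        where
        sd≡ : suc d ≡ m
        sd≡ = ℕ.≤-antisym dm (ℕ.≮⇒≥ nsd)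
        ∧-f : ∀ b → b ∧ false ≡ false
        ∧-f true = refl
        ∧-f false = refl

      q≡ : cellAt f 13 (suc c * n + suc d) ⊔ cellAt f 13 (c * n + d) ≡ q
      q≡ = trans (cong₂ _⊔_ second≡ first≡) (trans (ℕ.⊔-comm (newest (λ (a , b) → (a ≤ᵇ c) ∧ (d <ᵇ b)) rs) _) (sym (parent-recurrence d+ cd (listed em))))

      up-other : ∀ g v {a b} → b < n → (a , b) ≢ (c , d) → cellAt (g [ ab + ((suc c * n + d) * 16 + 13) ≔ v ]) 13 (suc a * n + b) ≡ cellAt g 13 (suc a * n + b)
      up-other g v {a} {b} b< ne = arr-idx g ab 13 {suc c * n + d} {suc a * n + b} {v}
        (λ e → let (p , p′) = radix-inj {n} {suc c} {suc a} (ℕ.<-trans dm m<n) b< e in ne (sym (cong₂ _,_ (ℕ.suc-injective p) p′)))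

      up-row : ∀ g v {b} → b < n → cellAt (g [ ab + ((suc c * n + d) * 16 + 13) ≔ v ]) 13 b ≡ cellAt g 13 b
      up-row g v {b} b< = arr-idx g ab 13 {suc c * n + d} {b} {v} (λ e → case proj₁ (radix-inj {n} {suc c} {0} (ℕ.<-trans dm m<n) b< e) of λ ())

      put-slot : ∀ v u j → u < s → j < s → (f [ ab + ((suc c * n + d) * 16 + 13) ≔ v ]) (slot u j) ≡ f (slot u j)
      put-slot v = cell-slot f {13} {suc c * n + d} {v}

      skipped : ¬ Str c d → Emitted c (suc j) rs cnt ptr (f [ ab + ((suc c * n + d) * 16 + 13) ≔ q ])
      skipped ns = record
        { cnt≡ = cnt≡ em ; ptr≡ = ptr≡ em ; few = ℕ.≤-trans (few em) (ℕ.+-monoʳ-≤ (c * m) (ℕ.n≤1+n j)) ; listed = listed-skip d+ cd (listed em) ns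
        ; keep₀ = λ i → trans (arr-other f ab 13 0 (suc c * n + d) i) (keep₀ em i)
        ; keep₁₂ = λ i → trans (arr-other f ab 13 12 (suc c * n + d) i) (keep₁₂ em i)
        ; zero-c = λ b b< → trans (up-row f q {b} b<) (zero-c em b b<)
        ; zero-d = λ a → trans (up-other f q {a} {m} m<n (λ { refl → ℕ.<-irrefl refl dm })) (zero-d em a)
        ; ups = λ a b ab′ b< pr → up-new a b ab′ b< (now d+ cd (listed em) pr)
        ; written = λ u u≤ → let (t , r) = written em u u≤
                                 su< = le (ℕ.≤-trans (s≤s u≤) (ℕ.m≤n+m _ 3)) in
            trans (put-slot q 0 u (le z≤n) (le (ℕ.≤-trans u≤ (ℕ.m≤n+m _ 4)))) t , record
            { code = trans (put-slot q (suc u) 0 su< (le z≤n)) (code r) ; count = trans (put-slot q (suc u) 1 su< (le (s≤s z≤n))) (count r)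
            ; items = trans (seg-cong 0 0 (length (neighbourNumbers rs u)) (λ i i< → put-slot q (suc u) (2 + i) su<
                (le (ℕ.≤-trans (s≤s (ℕ.≤-trans i< (neighbourNumbers-≤ rs u))) (ℕ.m≤n+m (2 + length rs) 2))))) (items r) } }
        where
        up-new : ∀ a b → a ≤ b → b < m → Processed c j (a , b) ⊎ (a ≡ c × b ≡ d) → cellAt (f [ ab + ((suc c * n + d) * 16 + 13) ≔ q ]) 13 (suc a * n + b) ≡ parent rs (a , b)
        up-new a b ab′ b< (inj₁ pr) = trans (up-other f q {a} {b} (ℕ.<-trans b< m<n) (λ { refl → case trans (sym (untouched d+ cd (listed em) pr ab′)) (contains⁺ {c} {d} {c} {d} ℕ.≤-refl ℕ.≤-refl) of λ () }))
                                         (ups em a b ab′ b< pr)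
        up-new a b ab′ b< (inj₂ (refl , refl)) = arr-same f ab 13 {suc c * n + d} {q} {suc c * n + d} refl

      ns : List ℕ
      ns = neighbourNumbers rs q

      -- The memory after each of the seven stores of `create`, in the order of the program.
      f₁ f₂ f₃ f₄ f₅ f₆ f₇ : ℕ → ℕ
      f₁ = f [ ab + ((suc c * n + d) * 16 + 13) ≔ k ]
      f₂ = f₁ [ slot 0 k ≔ slot (suc k) 0 ]
      f₃ = f₂ [ slot (suc k) 0 ≔ κ (c , d) ]
      f₄ = f₃ [ slot (suc k) 1 ≔ 1 ]
      f₅ = f₄ [ slot (suc k) 2 ≔ q ]
      f₆ = f₅ [ slot (suc q) (2 + length ns) ≔ k ]
      f₇ = f₆ [ slot (suc q) 1 ≔ suc (length ns) ]

      ns≤ : length ns ≤ suc (length rs)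
      ns≤ = neighbourNumbers-≤ rs q

      q≢k : suc q ≢ suc k
      q≢k e = ℕ.<-irrefl (ℕ.suc-injective e) (s≤s q≤)

      1< = le (s≤s (z≤n {3 + length rs}))
      2< = le (s≤s (s≤s (z≤n {2 + length rs})))
      n< : 2 + length ns < s
      n< = le (ℕ.≤-trans (s≤s (s≤s ns≤)) (ℕ.n≤1+n _))

      other-row : ∀ u j → u < s → j < s → u ≢ suc k → u ≢ suc q → u ≢ 0 ⊎ j ≢ k → f₇ (slot u j) ≡ f (slot u j)
      other-row u j u< j′< nk nq n0 =
        trans (slot-skip f₆ u j 1< j′< (inj₁ (nq ∘ sym))) (trans (slot-skip f₅ u j n< j′< (inj₁ (nq ∘ sym)))
        (trans (slot-skip f₄ u j 2< j′< (inj₁ (nk ∘ sym))) (trans (slot-skip f₃ u j 1< j′< (inj₁ (nk ∘ sym)))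
        (trans (slot-skip f₂ u j (le z≤n) j′< (inj₁ (nk ∘ sym))) (trans (slot-skip f₁ u j (le (ℕ.m≤n+m _ 3)) j′< (case n0 of λ { (inj₁ x) → inj₁ (x ∘ sym) ; (inj₂ x) → inj₂ (x ∘ sym) }))
        (put-slot k u j u< j′<))))))

      parent-row : ∀ j → j < s → f₅ (slot (suc q) j) ≡ f (slot (suc q) j)
      parent-row j j′< = trans (slot-skip f₄ (suc q) j 2< j′< (inj₁ (q≢k ∘ sym))) (trans (slot-skip f₃ (suc q) j 1< j′< (inj₁ (q≢k ∘ sym)))
        (trans (slot-skip f₂ (suc q) j (le z≤n) j′< (inj₁ (q≢k ∘ sym))) (trans (slot-skip f₁ (suc q) j (le (ℕ.m≤n+m _ 3)) j′< (inj₁ λ ()))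
        (put-slot k (suc q) j (le (ℕ.≤-trans (s≤s q≤) (ℕ.m≤n+m _ 3))) j′<))))

      new-row : ∀ j → j < s → f₇ (slot (suc k) j) ≡ f₅ (slot (suc k) j)
      new-row j j′< = trans (slot-skip f₆ (suc k) j 1< j′< (inj₁ q≢k)) (slot-skip f₅ (suc k) j n< j′< (inj₁ q≢k))

      f₇-cell : ∀ i′ i → cellAt f₇ i′ i ≡ cellAt f₁ i′ i
      f₇-cell i′ i = trans (slot-cell f₆ i′ i q< 1<) (trans (slot-cell f₅ i′ i q< n<) (trans (slot-cell f₄ i′ i k< 2<) (trans (slot-cell f₃ i′ i k< 1<)
        (trans (slot-cell f₂ i′ i k< (le z≤n)) (slot-cell f₁ i′ i (le z≤n) (le (ℕ.m≤n+m _ 3)))))))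
        where
        q< = le (ℕ.≤-trans (s≤s q≤) (ℕ.m≤n+m _ 3))
        k< = le (ℕ.m≤n+m _ 2)

      written-new : Written ((c , d) ∷ rs) f₇
      written-new u u≤ with u ℕ.≟ k
      ... | yes refl rewrite ≡-true {k} {k} refl = table , record
          { code = trans (new-row 0 (le z≤n)) (trans (slot-skip f₄ (suc k) 0 2< (le z≤n) (inj₂ λ ())) (trans (slot-skip f₃ (suc k) 0 1< (le z≤n) (inj₂ λ ())) (slot-same f₂ (κ (c , d)))))
          ; count = trans (new-row 1 1<) (trans (slot-skip f₄ (suc k) 1 2< 1< (inj₂ λ ())) (slot-same f₃ 1))
          ; items = cong (_∷ []) (trans (new-row 2 2<) (slot-same f₄ q)) }
        where
        table : f₇ (slot 0 k) ≡ slot (suc k) 0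
        table = trans (slot-skip f₆ 0 k 1< k< (inj₁ λ ())) (trans (slot-skip f₅ 0 k n< k< (inj₁ λ ())) (trans (slot-skip f₄ 0 k 2< k< (inj₁ λ ()))
          (trans (slot-skip f₃ 0 k 1< k< (inj₁ λ ())) (trans (slot-skip f₂ 0 k (le z≤n) k< (inj₁ λ ())) (slot-same f₁ (slot (suc k) 0))))))
          where k< = le (ℕ.m≤n+m _ 3)
      ... | no ne rewrite ≡ᵇ-false ne with ℕ.≤-pred (ℕ.≤∧≢⇒< u≤ ne)
      ...   | u≤′ with u ℕ.≟ q
      ...     | yes refl rewrite ≡-true {q} {q} refl = table , record
          { code = trans (slot-skip f₆ (suc q) 0 1< (le z≤n) (inj₂ λ ())) (trans (slot-skip f₅ (suc q) 0 n< (le z≤n) (inj₂ λ ())) (trans (parent-row 0 (le z≤n)) (code r)))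
          ; count = trans (slot-same f₆ (suc (length ns))) (sym len)
          ; items = trans (cong (seg (λ i → f₇ (slot (suc q) (2 + i))) 0) len) (trans (seg-snoc _ 0 (length ns)) (cong₂ (λ x y → x ++ y ∷ [])
              (trans (seg-cong 0 0 (length ns) (λ i i< → let i<s = ℕ.<-trans (ℕ.+-monoʳ-< 2 i<) n< in
                trans (slot-skip f₆ (suc q) (2 + i) 1< i<s (inj₂ λ ())) (trans (slot-skip f₅ (suc q) (2 + i) n< i<s (inj₂ λ e → ℕ.<-irrefl (sym (ℕ.suc-injective (ℕ.suc-injective e))) i<))
                  (parent-row (2 + i) i<s)))) (items r))
              (trans (slot-skip f₆ (suc q) (2 + length ns) 1< n< (inj₂ λ ())) (slot-same f₅ k)))) }
        where
        r = proj₂ (written em q q≤)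
        len : length (ns ++ k ∷ []) ≡ suc (length ns)
        len = trans (length-++ ns) (ℕ.+-comm (length ns) 1)
        table : f₇ (slot 0 q) ≡ slot (suc q) 0
        table = trans (other-row 0 q (le z≤n) (le (ℕ.≤-trans q≤ (ℕ.m≤n+m _ 4))) (λ ()) (λ ()) (inj₂ (q≢k ∘ cong suc))) (proj₁ (written em q q≤))
      ...     | no nq rewrite ≡ᵇ-false nq = table , subst (Record f₇ u (codes κ rs u)) (sym (++-identityʳ (neighbourNumbers rs u))) (record
          { code = trans (row 0 (le z≤n)) (code r)
          ; count = trans (row 1 1<) (count r)
          ; items = trans (seg-cong 0 0 (length (neighbourNumbers rs u)) (λ i i< → row (2 + i)
                (le (ℕ.≤-trans (s≤s (ℕ.≤-trans i< (neighbourNumbers-≤ rs u))) (ℕ.m≤n+m (2 + length rs) 2))))) (items r) })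
        where
        r = proj₂ (written em u u≤′)
        row : ∀ j → j < s → f₇ (slot (suc u) j) ≡ f (slot (suc u) j)
        row j j< = other-row (suc u) j (le (ℕ.≤-trans (s≤s u≤′) (ℕ.m≤n+m _ 3))) j< (ne ∘ ℕ.suc-injective) (nq ∘ ℕ.suc-injective) (inj₁ λ ())
        table : f₇ (slot 0 u) ≡ slot (suc u) 0
        table = trans (other-row 0 u (le z≤n) (le (ℕ.≤-trans u≤′ (ℕ.m≤n+m _ 4))) (λ ()) (λ ()) (inj₂ ne)) (proj₁ (written em u u≤′))

      created : Str c d → Emitted c (suc j) ((c , d) ∷ rs) (cnt + 1) (ptr + s) f₇
      created st = record
        { cnt≡ = trans (cong (_+ 1) (cnt≡ em)) (ℕ.+-comm _ 1)
        ; ptr≡ = trans (cong (_+ s) (ptr≡ em)) (next-row (suc (suc (length rs))))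
        ; few = ℕ.≤-trans (s≤s (few em)) (ℕ.≤-reflexive (sym (ℕ.+-suc (c * m) j)))
        ; listed = listed-add d+ cd (listed em) st
        ; keep₀ = λ i → trans (f₇-cell 0 i) (trans (arr-other f ab 13 0 (suc c * n + d) i) (keep₀ em i))
        ; keep₁₂ = λ i → trans (f₇-cell 12 i) (trans (arr-other f ab 13 12 (suc c * n + d) i) (keep₁₂ em i))
        ; zero-c = λ b b< → trans (f₇-cell 13 b) (trans (up-row f k {b} b<) (zero-c em b b<))
        ; zero-d = λ a → trans (f₇-cell 13 (suc a * n + m)) (trans (up-other f k {a} {m} m<n (λ { refl → ℕ.<-irrefl refl dm })) (zero-d em a))
        ; ups = λ a b ab′ b< pr → trans (f₇-cell 13 (suc a * n + b)) (up-new a b ab′ b< (now d+ cd (listed em) pr))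
        ; written = written-new }
        where
        up-new : ∀ a b → a ≤ b → b < m → Processed c j (a , b) ⊎ (a ≡ c × b ≡ d) → cellAt f₁ 13 (suc a * n + b) ≡ parent ((c , d) ∷ rs) (a , b)
        up-new a b ab′ b< (inj₁ pr) rewrite untouched d+ cd (listed em) pr ab′ =
          trans (up-other f k {a} {b} (ℕ.<-trans b< m<n) (λ { refl → case trans (sym (untouched d+ cd (listed em) pr ab′)) (contains⁺ {c} {d} {c} {d} ℕ.≤-refl ℕ.≤-refl) of λ () }))
                (ups em a b ab′ b< pr)
        up-new a b ab′ b< (inj₂ (refl , refl)) rewrite contains⁺ {c} {d} {c} {d} ℕ.≤-refl ℕ.≤-refl = arr-same f ab 13 {suc c * n + d} {k} {suc c * n + d} refl

  slot-+ : ∀ u j → slot u 0 + j ≡ slot u j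
  slot-+ u j = trans (cong (_+ j) (slot≡ u 0)) (trans (ℕ.+-assoc tb _ j) (trans (cong (λ x → tb + (x + j)) (ℕ.+-identityʳ (u * s))) (sym (slot≡ u j))))

  slot-0 : ∀ u → tb + u ≡ slot 0 u
  slot-0 u = sym (slot≡ 0 u)

  Consts : State → Set
  Consts σ = regs σ rN ≡ n × regs σ rM ≡ m × regs σ rS ≡ s × regs σ rTB ≡ tb × regs σ rAB ≡ ab

  consts-frame : ∀ {c σ σ′} → Frame c σ σ′ → {_ : T (keeps rN c)} {_ : T (keeps rM c)} {_ : T (keeps rS c)} {_ : T (keeps rTB c)} {_ : T (keeps rAB c)} →
                 Consts σ → Consts σ′
  consts-frame f {h₁} {h₂} {h₃} {h₄} {h₅} (a , b , c , d , e) =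
    trans (reg-same f rN {h₁}) a , trans (reg-same f rM {h₂}) b , trans (reg-same f rS {h₃}) c , trans (reg-same f rTB {h₄}) d , trans (reg-same f rAB {h₅}) e

  module OutputSpec (Str : ℕ → ℕ → Set) (f₀ : ℕ → ℕ) (κ : Interval² → ℕ)
                    (κ-leaf : ∀ {a} → a < m → κ (a , a) ≡ cellAt f₀ 0 a + 3)
                    (κ-node : ∀ {a b} → a < b → b < m → κ (a , b) ≡ cellAt f₀ 12 (a * n + b))
                    (str : ∀ {a b} → a ≤ b → b < m → cellAt f₀ 12 (a * n + b) ≢ 0 ⟷ Str a b) where
    open Emission Str f₀ κ κ-leaf κ-node str public

    Progress : ℕ → ℕ → State → Set
    Progress c j σ = ∃[ rs ] Emitted c j rs (regs σ rC) (regs σ rPtr) (mem σ)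

    module _ {c j d : ℕ} {rs : List Interval²} {cnt ptr : ℕ} {f : ℕ → ℕ} (c< : c < m) (j< : j < m) (d+ : suc (d + j) ≡ m) (cd : c ≤ d)
             (em : Emitted c j rs cnt ptr f) where

      label : Cmd
      label = cond (reg rG ≈ reg rD) (store (reg rPtr) (ld 0 (reg rG) ⊕ lit 3)) (store (reg rPtr) (ld 12 here′))

      f₂-cell : ∀ l i → {_ : T (l <ᵇ 16)} {_ : T (not (13 ≡ᵇ l))} → cellAt (f₂ c< j< d+ cd em) l i ≡ cellAt f l i
      f₂-cell l i {h} {h′} = trans (slot-cell (f₁ c< j< d+ cd em) l i (le c< j< d+ cd em z≤n) (le c< j< d+ cd em (ℕ.m≤n+m _ 3)))
                         (arr-other f ab 13 l (suc c * n + d) i {_} {tt} {h} {h′})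

      label-spec : ∀ ρ → Consts (state ρ f) → ρ rG ≡ c → ρ rD ≡ d → ρ rPtr ≡ slot (suc (suc (length rs))) 0 →
                   Spec label (state ρ (f₂ c< j< d+ cd em)) (λ t σ′ → t ≤ 40 × σ′ ≡ state ρ (f₃ c< j< d+ cd em))
      label-spec ρ (N≡′ , _ , _ , _ , AB≡′) pG pD pP with c ℕ.≟ d
      ... | yes refl = thenS (λ z → eq-z z (trans pG (sym pD))) (byWp (ℕ.≤ᵇ⇒≤ _ _ tt ,
             cong (state ρ) (cong₂ (λ a v → f₂ c< j< d+ cd em [ a ≔ v ]) pP
               (trans (cong (_+ 3) (trans (cong₂ (λ A i → f₂ c< j< d+ cd em (A + (i * 16 + 0))) AB≡′ pG) (trans (f₂-cell 0 c) (keep₀ em c)))) (sym (κ-leaf c<))))))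
      ... | no ne = elseS (cong bit (≡ᵇ-false (λ e → ne (trans (sym pG) (trans e pD))))) (byWp (ℕ.≤ᵇ⇒≤ _ _ tt ,
             cong (state ρ) (cong₂ (λ a v → f₂ c< j< d+ cd em [ a ≔ v ]) pP
               (trans (cong₂ (λ A i → f₂ c< j< d+ cd em (A + (i * 16 + 12))) AB≡′ (cong₂ _+_ (cong₂ _*_ pG N≡′) pD))
                 (trans (f₂-cell 12 (c * n + d)) (trans (keep₁₂ em (c * n + d)) (sym (κ-node (ℕ.≤∧≢⇒< cd ne) (dm c< j< d+ cd em)))))))))

      create-spec : ∀ ρ → Consts (state ρ f) → ρ rG ≡ c → ρ rD ≡ d → ρ rC ≡ cnt → ρ rPtr ≡ ptr → ρ 34 ≡ parent rs (c , d) →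
                    Spec create (state ρ f) (λ t σ′ → t ≤ 150 × regs σ′ rC ≡ cnt + 1 × regs σ′ rPtr ≡ ptr + s × mem σ′ ≡ f₇ c< j< d+ cd em)
      create-spec ρ cs@(N≡′ , _ , S≡′ , TB≡′ , AB≡′) pG pD pC pP p34 =
        storeS {a = ab + ((suc c * n + d) * 16 + 13)} {v = suc (length rs)}
               (cong₂ (λ A x → A + (x * 16 + 13)) AB≡′ (cong₂ _+_ (cong₂ _*_ (succ-idx₀ c pG) N≡′) pD)) pC′
        (storeS {a = slot 0 (suc (length rs))} {v = slot (suc (suc (length rs))) 0} (trans (cong₂ _+_ TB≡′ pC′) (slot-0 _)) pP′
        (seqS (mapS (label-spec ρ cs pG pD pP′) λ { t₂ _ _ (l₂ , refl) →
         storeS {a = slot (suc (suc (length rs))) 1} {v = 1} (trans (cong (_+ 1) pP′) (slot-+ _ 1)) refl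
        (storeS {a = slot (suc (suc (length rs))) 2} {v = q c< j< d+ cd em} (trans (cong (_+ 2) pP′) (slot-+ _ 2)) p34
        (setS (setS
        (storeS {a = slot (suc (q c< j< d+ cd em)) (2 + length (ns c< j< d+ cd em))} {v = suc (length rs)}
           (trans (cong₂ (λ x y → x + 2 + y) v36 v37) (trans (ℕ.+-assoc (slot (suc (q c< j< d+ cd em)) 0) 2 _) (slot-+ _ _))) pC′
        (storeS {a = slot (suc (q c< j< d+ cd em)) 1} {v = suc (length (ns c< j< d+ cd em))}
           (trans (cong (_+ 1) v36) (slot-+ _ 1)) (trans (cong (_+ 1) v37) (ℕ.+-comm _ 1))
        (byWp (ℕ.≤-trans (ℕ.+-monoʳ-≤ 20 (ℕ.+-monoˡ-≤ 42 l₂)) (ℕ.≤ᵇ⇒≤ 102 150 tt) , cong (_+ 1) pC , cong₂ _+_ pP S≡′ , refl)))))))})))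
        where
        pC′ = trans pC (cnt≡ em)
        pP′ = trans pP (ptr≡ em)
        qq = q c< j< d+ cd em
        kk : ℕ
        kk = suc (length rs)
        q≤′ : qq ≤ length rs
        q≤′ = q≤ c< j< d+ cd em
        fit : ∀ {x} → x ≤ 4 + length rs → x < s
        fit = le c< j< d+ cd em
        f5 = f₅ c< j< d+ cd em
        v36 : f5 (ρ rTB + ρ 34) ≡ slot (suc qq) 0
        v36 = trans (cong f5 (trans (cong₂ _+_ TB≡′ p34) (slot-0 qq)))
          (trans (slot-skip (f₄ c< j< d+ cd em) 0 qq (2< c< j< d+ cd em) q< (inj₁ λ ())) (trans (slot-skip (f₃ c< j< d+ cd em) 0 qq (1< c< j< d+ cd em) q< (inj₁ λ ()))
          (trans (slot-skip (f₂ c< j< d+ cd em) 0 qq (fit z≤n) q< (inj₁ λ ())) (trans (slot-skip (f₁ c< j< d+ cd em) 0 qq (fit (ℕ.m≤n+m _ 3)) q< (inj₂ λ e → ℕ.<-irrefl (sym e) (s≤s q≤′)))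
          (trans (put-slot c< j< d+ cd em kk 0 qq (fit z≤n) q<) (proj₁ (written em qq q≤′)))))))
          where q< = fit (ℕ.≤-trans q≤′ (ℕ.m≤n+m _ 4))
        v37 : f5 (f5 (ρ rTB + ρ 34) + 1) ≡ length (ns c< j< d+ cd em)
        v37 = trans (cong f5 (trans (cong (_+ 1) v36) (slot-+ _ 1))) (trans (parent-row c< j< d+ cd em 1 (1< c< j< d+ cd em)) (count (proj₂ (written em qq q≤′))))

      emit-spec : ∀ ρ → Consts (state ρ f) → ρ rG ≡ c → ρ rD ≡ d → ρ rC ≡ cnt → ρ rPtr ≡ ptr →
                  Spec emit (state ρ f) (λ t σ′ → t ≤ 250 × Progress c (suc j) σ′)
      emit-spec ρ cs@(N≡′ , _ , _ , _ , AB≡′) pG pD pC pP = setS (setS (seqS (mapS (greatest-spec 34 35) λ { t₁ (state ρ₁ _) _ (l₁ , e , refl , o) →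
          next ρ₁ l₁ (trans e (trans (cong₂ _⊔_ v35 v34) (q≡ c< j< d+ cd em))) (λ y n₁ n₂ → trans (o y n₁) (trans (upd-diff (ρ [ 34 ≔ _ ]) {35} {y} _ n₂) (upd-diff ρ {34} {y} _ n₁))) })))
        where
        v34 : f (ρ rAB + ((ρ rG * ρ rN + ρ rD) * 16 + 13)) ≡ cellAt f 13 (c * n + d)
        v34 = cong₂ (λ A i → f (A + (i * 16 + 13))) AB≡′ (cong₂ _+_ (cong₂ _*_ pG N≡′) pD)
        v35 : f (ρ rAB + (((ρ rG + 1) * ρ rN + (ρ rD + 1)) * 16 + 13)) ≡ cellAt f 13 (suc c * n + suc d)
        v35 = cong₂ (λ A i → f (A + (i * 16 + 13))) AB≡′ (cong₂ _+_ (cong₂ _*_ (succ-idx₀ c pG) N≡′) (succ-idx₀ d pD))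
        next : ∀ {t₁} ρ₁ → t₁ ≤ 10 → ρ₁ 34 ≡ parent rs (c , d) → (∀ y → 34 ≢ y → 35 ≢ y → ρ₁ y ≡ ρ y) →
               Spec (cond (ld 12 here′) create (put 13 below′ (reg 34))) (state ρ₁ f) (λ t σ′ → 13 + (17 + (t₁ + t)) ≤ 250 × Progress c (suc j) σ′)
        next {t₁} ρ₁ l₁ e34 o = branch (cellAt f₀ 12 (c * n + d) ℕ.≟ 0)
          where
          cs₁ : Consts (state ρ₁ f)
          cs₁ = trans (o rN (λ ()) (λ ())) N≡′ , trans (o rM (λ ()) (λ ())) (proj₁ (proj₂ cs)) , trans (o rS (λ ()) (λ ())) (proj₁ (proj₂ (proj₂ cs))) ,
                trans (o rTB (λ ()) (λ ())) (proj₁ (proj₂ (proj₂ (proj₂ cs)))) , trans (o rAB (λ ()) (λ ())) AB≡′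
          pG₁ = trans (o rG (λ ()) (λ ())) pG
          pD₁ = trans (o rD (λ ()) (λ ())) pD
          pC₁ = trans (o rC (λ ()) (λ ())) pC
          pP₁ = trans (o rPtr (λ ()) (λ ())) pP
          value : f (ρ₁ rAB + ((ρ₁ rG * ρ₁ rN + ρ₁ rD) * 16 + 12)) ≡ cellAt f₀ 12 (c * n + d)
          value = trans (cong₂ (λ A i → f (A + (i * 16 + 12))) (proj₂ (proj₂ (proj₂ (proj₂ cs₁)))) (cong₂ _+_ (cong₂ _*_ pG₁ (proj₁ cs₁)) pD₁)) (keep₁₂ em (c * n + d))
          yes-no = str cd (dm c< j< d+ cd em)
          branch : Dec (cellAt f₀ 12 (c * n + d) ≡ 0) → Spec (cond (ld 12 here′) create (put 13 below′ (reg 34))) (state ρ₁ f) (λ t σ′ → 13 + (17 + (t₁ + t)) ≤ 250 × Progress c (suc j) σ′)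
          branch (no nz) = thenS (λ z → nz (trans (sym value) z)) (mapS (create-spec ρ₁ cs₁ pG₁ pD₁ pC₁ pP₁ e34) λ { t (state ρ₂ _) _ (l , e₁ , e₂ , refl) →
              ℕ.≤-trans (ℕ.+-monoʳ-≤ 30 (ℕ.+-mono-≤ l₁ (ℕ.+-monoʳ-≤ 13 l))) (ℕ.≤ᵇ⇒≤ 203 250 tt) ,
              _ , subst₂ (λ x y → Emitted c (suc j) ((c , d) ∷ rs) x y (f₇ c< j< d+ cd em)) (sym e₁) (sym e₂) (created c< j< d+ cd em (proj₁ yes-no nz)) })
          branch (yes z) = elseS (trans value z) (byWp (ℕ.≤-trans (ℕ.+-monoʳ-≤ 30 (ℕ.+-monoˡ-≤ 28 l₁)) (ℕ.≤ᵇ⇒≤ 68 250 tt) ,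
              rs , subst₂ (λ x y → Emitted c (suc j) rs x y _) (sym pC₁) (sym pP₁) (subst (Emitted c (suc j) rs cnt ptr)
                 (sym (cong₂ (λ a v → f [ a ≔ v ]) (cong₂ (λ A x → A + (x * 16 + 13)) (proj₂ (proj₂ (proj₂ (proj₂ cs₁)))) (cong₂ _+_ (cong₂ _*_ (succ-idx₀ c pG₁) (proj₁ cs₁)) pD₁)) e34))
                 (skipped c< j< d+ cd em (λ st → proj₂ yes-no st z)))))

    emitted-below : ∀ {c j d rs cnt ptr f} → suc (d + j) ≡ m → d < c → Emitted c j rs cnt ptr f → Emitted c (suc j) rs cnt ptr f
    emitted-below {c} {j} {d} d+ dc em = record
      { cnt≡ = cnt≡ em ; ptr≡ = ptr≡ em ; few = ℕ.≤-trans (few em) (ℕ.+-monoʳ-≤ (c * m) (ℕ.n≤1+n j)) ; listed = listed-below d+ dc (listed em)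
      ; keep₀ = keep₀ em ; keep₁₂ = keep₁₂ em ; zero-c = zero-c em ; zero-d = zero-d em ; written = written em
      ; ups = λ a b ab′ b< pr → ups em a b ab′ b< (case pr of λ
          { (inj₁ l) → inj₁ l ; (inj₂ (refl , l)) → inj₂ (refl , ℕ.≤-trans (ℕ.≤-reflexive (sym d+)) (ℕ.+-monoˡ-≤ j (ℕ.<-≤-trans dc ab′))) }) }

    emitted-row : ∀ {c rs cnt ptr f} → Emitted c m rs cnt ptr f → Emitted (suc c) 0 rs cnt ptr f
    emitted-row {c} em = record
      { cnt≡ = cnt≡ em ; ptr≡ = ptr≡ em ; few = ℕ.≤-trans (few em) (ℕ.≤-reflexive (trans (ℕ.+-comm (c * m) m) (sym (ℕ.+-identityʳ _)))) ; listed = listed-row (listed em)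
      ; keep₀ = keep₀ em ; keep₁₂ = keep₁₂ em ; zero-c = zero-c em ; zero-d = zero-d em ; written = written em
      ; ups = λ a b ab′ b< pr → ups em a b ab′ b< (case pr of λ
          { (inj₁ l) → (case a ℕ.≟ c of λ { (yes e) → inj₂ (e , ℕ.m≤n+m m b) ; (no ne) → inj₁ (ℕ.≤∧≢⇒< (ℕ.≤-pred l) ne) })
          ; (inj₂ (refl , l)) → ⊥-elim (ℕ.<⇒≱ b< (subst (m ≤_) (ℕ.+-identityʳ b) l)) }) }

    emitCell-spec : ∀ {c j σ} → c < m → j < m → Consts σ → regs σ rG ≡ c → regs σ rJ ≡ j → Progress c j σ →
                    Spec emitCell σ (λ t σ′ → t ≤ 300 × Progress c (suc j) σ′)
    emitCell-spec {c} {j} {σ} c< j< cs pG pJ (rs , em) with (m ∸ suc j) ℕ.<? c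
    ... | yes dc = setS (thenS (lt⁺ (subst₂ _<_ (sym d≡) (sym pG) dc)) (byWp (ℕ.≤ᵇ⇒≤ _ _ tt , rs , emitted-below d+ dc em)))
      where
      d≡ : regs σ rM ∸ (regs σ rJ + 1) ≡ m ∸ suc j
      d≡ = cong₂ _∸_ (proj₁ (proj₂ cs)) (succ-idx₀ j pJ)
      d+ : suc (m ∸ suc j + j) ≡ m
      d+ = trans (sym (ℕ.+-suc (m ∸ suc j) j)) (ℕ.m∸n+n≡m j<)
    ... | no ndc = setS (elseS (lt⁻ (subst₂ _≤_ (sym pG) (sym d≡) cd)) (mapS (emit-spec c< j< d+ cd em (regs σ [ rD ≔ regs σ rM ∸ (regs σ rJ + 1) ]) cs pG d≡ refl refl)
          λ t σ′ _ (l , pr) → ℕ.≤-trans (ℕ.+-monoʳ-≤ 10 l) (ℕ.≤ᵇ⇒≤ 260 300 tt) , pr))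
      where
      cd = ℕ.≮⇒≥ ndc
      d≡ : regs σ rM ∸ (regs σ rJ + 1) ≡ m ∸ suc j
      d≡ = cong₂ _∸_ (proj₁ (proj₂ cs)) (succ-idx₀ j pJ)
      d+ : suc (m ∸ suc j + j) ≡ m
      d+ = trans (sym (ℕ.+-suc (m ∸ suc j) j)) (ℕ.m∸n+n≡m j<)

    Result′ : State → Set
    Result′ σ = ∃[ rs ] Listed m 0 rs × Written rs (mem σ) × regs σ 0 ≡ suc (length rs) × regs σ 1 ≡ tb

    start-written : ∀ (f : ℕ → ℕ) → Written [] (((f [ slot 0 0 ≔ slot 1 0 ]) [ slot 1 0 ≔ 3 ]) [ slot 1 1 ≔ 0 ])
    start-written f zero z≤n =
      trans (slot-skip f₂′ 0 0 1<s 0<s (inj₁ λ ())) (trans (slot-skip f₁′ 0 0 0<s 0<s (inj₁ λ ())) (slot-same f (slot 1 0))) , record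
      { code = trans (slot-skip f₂′ 1 0 1<s 0<s (inj₂ λ ())) (slot-same f₁′ 3) ; count = slot-same f₂′ 0 ; items = refl }
      where
      f₁′ = f [ slot 0 0 ≔ slot 1 0 ]
      f₂′ = f₁′ [ slot 1 0 ≔ 3 ]
      1<s : 1 < s
      1<s = subst (1 <_) (sym s≡) (ℕ.≤-trans (s≤s (s≤s z≤n)) (ℕ.m≤n+m 4 (n * n)))
      0<s : 0 < s
      0<s = ℕ.<-trans (s≤s z≤n) 1<s

    start-cell : ∀ (f : ℕ → ℕ) k i → cellAt (((f [ slot 0 0 ≔ slot 1 0 ]) [ slot 1 0 ≔ 3 ]) [ slot 1 1 ≔ 0 ]) k i ≡ cellAt f k i
    start-cell f k i = trans (slot-cell f₂′ k i 1<s 1<s) (trans (slot-cell f₁′ k i 1<s 0<s) (slot-cell f k i 0<s 0<s))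
      where
      f₁′ = f [ slot 0 0 ≔ slot 1 0 ]
      f₂′ = f₁′ [ slot 1 0 ≔ 3 ]
      1<s : 1 < s
      1<s = subst (1 <_) (sym s≡) (ℕ.≤-trans (s≤s (s≤s z≤n)) (ℕ.m≤n+m 4 (n * n)))
      0<s : 0 < s
      0<s = ℕ.<-trans (s≤s z≤n) 1<s

    output-spec : ∀ {σ₀} → Consts σ₀ → mem σ₀ ≡ f₀ → (∀ i → cellAt f₀ 13 i ≡ 0) → Spec output σ₀ (λ t σ → Lin 100 400 (n * n) t × Result′ σ)
    output-spec {state ρ _} cs@(N≡′ , M≡′ , S≡′ , TB≡′ , AB≡′) refl zeros =
      setS (storeS {a = slot 0 0} {v = slot 1 0} (trans TB≡′ (trans (sym (ℕ.+-identityʳ tb)) (slot-0 0))) ptr₁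
      (storeS {a = slot 1 0} {v = 3} ptr₁ refl (storeS {a = slot 1 1} {v = 0} (trans (cong (_+ 1) ptr₁) (slot-+ 1 1)) refl (setS (setS
      (seqS (mapS (for-spec {rG} {for rJ emitCell} (6 + 308 * m) (λ c σ → Progress c 0 σ) M≡′ (λ _ _ _ h → h) start rows)
        λ t σ f (l , rs , em) → byWp (weaken (const-≤ 4 +ˡ const-≤ 3 +ˡ const-≤ 3 +ˡ const-≤ 5 +ˡ const-≤ 2 +ˡ const-≤ 4 +ˡ quadratic {a = 6} {b = 308} {c = 14} l +ˡ const-≤ 2 +ˡ const-≤ 2) ,
           rs , listed em , written em , cnt≡ em , trans (reg-same f rTB) TB≡′))))))))
      where
      ptr₁ : ρ rTB + ρ rS ≡ slot 1 0
      ptr₁ = trans (cong₂ _+_ (trans TB≡′ (trans (sym (ℕ.+-identityʳ tb)) (slot-0 0))) S≡′) (next-row 0)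
      ptr₂ : (ρ rTB + ρ rS) + ρ rS ≡ slot 2 0
      ptr₂ = trans (cong₂ _+_ ptr₁ S≡′) (next-row 1)
      g₀ = ((f₀ [ slot 0 0 ≔ slot 1 0 ]) [ slot 1 0 ≔ 3 ]) [ slot 1 1 ≔ 0 ]
      start : ∃[ rs ] Emitted 0 0 rs 1 ((ρ rTB + ρ rS) + ρ rS) g₀
      start = [] , record
        { cnt≡ = refl ; ptr≡ = ptr₂ ; few = z≤n
        ; listed = record { sound = λ () ; full = λ {a} {b} ab b< st → λ { (inj₁ ()) ; (inj₂ (refl , l)) → ⊥-elim (ℕ.<⇒≱ b< (subst (m ≤_) (ℕ.+-identityʳ b) l)) } ; sorted = [] }
        ; keep₀ = start-cell f₀ 0 ; keep₁₂ = start-cell f₀ 12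
        ; zero-c = λ b _ → trans (start-cell f₀ 13 b) (zeros b) ; zero-d = λ a → trans (start-cell f₀ 13 (suc a * n + m)) (zeros (suc a * n + m))
        ; ups = λ a b ab b< → λ { (inj₁ ()) ; (inj₂ (refl , l)) → ⊥-elim (ℕ.<⇒≱ b< (subst (m ≤_) (ℕ.+-identityʳ b) l)) }
        ; written = start-written f₀ }
      rows : ∀ c σ → c < m → Frame (for rG (for rJ emitCell)) (state (((ρ [ rPtr ≔ ρ rTB + ρ rS ]) [ rC ≔ 1 ]) [ rPtr ≔ (ρ rTB + ρ rS) + ρ rS ]) g₀) σ →
             regs σ rG ≡ c → Progress c 0 σ → Spec (for rJ emitCell) σ (λ t σ′ → t ≤ 6 + 308 * m × Progress (suc c) 0 σ′)
      rows c σ c< f pG pr = mapS (for-spec {rJ} {emitCell} 300 (λ j σ → Progress c j σ) (proj₁ (proj₂ cs₁)) (λ _ _ _ h → h) pr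
          (λ j σ′ j< f′ pJ pr′ → emitCell-spec c< j< (consts-frame f′ cs₁) (trans (reg-same f′ rG) pG) pJ pr′))
          λ t σ′ _ (l , rs , em) → l , rs , emitted-row em
        where
        cs₁ : Consts σ
        cs₁ = consts-frame f cs

-- Reading nodes, parents and neighbours off the list of creations

nodeAt : List Interval² → ℕ → Interval²
nodeAt [] u = 0 , 0
nodeAt (x ∷ rs) u = if u ≡ᵇ length rs then x else nodeAt rs u

parentAt : List Interval² → ℕ → ℕ
parentAt [] u = 0
parentAt (x ∷ rs) u = if u ≡ᵇ length rs then parent rs x else parentAt rs u

below-length : ∀ {x : Interval²} {rs u} → u < length (x ∷ rs) → u ≢ length rs → u < length rs
below-length u< ne = ℕ.≤∧≢⇒< (ℕ.≤-pred u<) ne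

nodeAt-∈ : ∀ rs {u} → u < length rs → nodeAt rs u ∈ˡ rs
nodeAt-∈ (x ∷ rs) {u} u< with u ℕ.≟ length rs
... | yes refl rewrite ≡-true {length rs} refl = here refl
... | no ne rewrite ≡ᵇ-false ne = there (nodeAt-∈ rs (below-length {x} {rs} u< ne))

∈-nodeAt : ∀ rs {x} → x ∈ˡ rs → ∃[ u ] u < length rs × nodeAt rs u ≡ x
∈-nodeAt (x ∷ rs) (here refl) = length rs , ℕ.≤-refl , at-head
  where
  at-head : nodeAt (x ∷ rs) (length rs) ≡ x
  at-head rewrite ≡-true {length rs} refl = refl
∈-nodeAt (x ∷ rs) {y} (there i) with ∈-nodeAt rs i
... | u , u< , e = u , ℕ.m≤n⇒m≤1+n u< , trans at-tail e
  where
  at-tail : nodeAt (x ∷ rs) u ≡ nodeAt rs u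
  at-tail rewrite ≡ᵇ-false (ℕ.<⇒≢ u<) = refl

nodeAt-sorted : ∀ {R : Interval² → Interval² → Set} {rs} → AllPairs R rs → ∀ {u v} → u < v → v < length rs → R (nodeAt rs v) (nodeAt rs u)
nodeAt-sorted {rs = x ∷ rs} (a ∷ ap) {u} {v} uv v< with v ℕ.≟ length rs
... | yes refl rewrite ≡-true {length rs} refl | ≡ᵇ-false (ℕ.<⇒≢ uv) = All.lookup a (nodeAt-∈ rs uv)
... | no ne rewrite ≡ᵇ-false ne | ≡ᵇ-false (ℕ.<⇒≢ (ℕ.<-trans uv (below-length {x} {rs} v< ne))) = nodeAt-sorted ap uv (below-length {x} {rs} v< ne)

newest-spec : ∀ P rs → (newest P rs ≡ 0 × (∀ w → w < length rs → P (nodeAt rs w) ≡ false)) ⊎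
              (∃[ u ] newest P rs ≡ suc u × u < length rs × P (nodeAt rs u) ≡ true × (∀ w → u < w → w < length rs → P (nodeAt rs w) ≡ false))
newest-spec P [] = inj₁ (refl , λ _ ())
newest-spec P (x ∷ rs) with P x in px
... | true = inj₂ (length rs , refl , ℕ.≤-refl , at-head , λ w l u → ⊥-elim (ℕ.<⇒≱ l (ℕ.≤-pred u)))
  where
  at-head : P (nodeAt (x ∷ rs) (length rs)) ≡ true
  at-head rewrite ≡-true {length rs} refl = px
... | false with newest-spec P rs
...   | inj₁ (e , h) = inj₁ (e , all)
  where
  all : ∀ w → w < suc (length rs) → P (nodeAt (x ∷ rs) w) ≡ false
  all w w< with w ℕ.≟ length rs
  ... | yes refl rewrite ≡-true {length rs} refl = px
  ... | no ne rewrite ≡ᵇ-false ne = h w (below-length {x} {rs} w< ne)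
...   | inj₂ (u , e , u< , pu , h) = inj₂ (u , e , ℕ.m≤n⇒m≤1+n u< , at-u , all)
  where
  at-u : P (nodeAt (x ∷ rs) u) ≡ true
  at-u rewrite ≡ᵇ-false (ℕ.<⇒≢ u<) = pu
  all : ∀ w → u < w → w < suc (length rs) → P (nodeAt (x ∷ rs) w) ≡ false
  all w uw w< with w ℕ.≟ length rs
  ... | yes refl rewrite ≡-true {length rs} refl = px
  ... | no ne rewrite ≡ᵇ-false ne = h w uw (below-length {x} {rs} w< ne)

-- The parent was chosen when only older nodes were listed, so minimality is asserted against the
-- nodes `w < v` only.
parentAt-spec : ∀ rs {v} → v < length rs → let (c , d) = nodeAt rs v in
  (parentAt rs v ≡ 0 × (∀ w → w < v → contains c d (nodeAt rs w) ≡ false)) ⊎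
  (∃[ u ] parentAt rs v ≡ suc u × u < v × contains c d (nodeAt rs u) ≡ true × (∀ w → u < w → w < v → contains c d (nodeAt rs w) ≡ false))
parentAt-spec (x ∷ rs) {v} v< with v ℕ.≟ length rs
... | no ne rewrite ≡ᵇ-false ne with parentAt-spec rs {v} (below-length {x} {rs} v< ne)
...   | inj₁ (e , h) = inj₁ (e , λ w wv → older w wv (h w wv))
  where
  older : ∀ w → w < v → contains (proj₁ (nodeAt rs v)) (proj₂ (nodeAt rs v)) (nodeAt rs w) ≡ false → contains (proj₁ (nodeAt rs v)) (proj₂ (nodeAt rs v)) (nodeAt (x ∷ rs) w) ≡ false
  older w wv q rewrite ≡ᵇ-false (ℕ.<⇒≢ (ℕ.<-trans wv (below-length {x} {rs} v< ne))) = q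
...   | inj₂ (u , e , uv , p , h) = inj₂ (u , e , uv , older u uv p , λ w uw wv → older w wv (h w uw wv))
  where
  older : ∀ w → w < v → ∀ {b} → contains (proj₁ (nodeAt rs v)) (proj₂ (nodeAt rs v)) (nodeAt rs w) ≡ b →
          contains (proj₁ (nodeAt rs v)) (proj₂ (nodeAt rs v)) (nodeAt (x ∷ rs) w) ≡ b
  older w wv q rewrite ≡ᵇ-false (ℕ.<⇒≢ (ℕ.<-trans wv (below-length {x} {rs} v< ne))) = q
parentAt-spec (x@(c , d) ∷ rs) {v} v< | yes refl rewrite ≡-true {length rs} refl with newest-spec (contains c d) rs
...   | inj₁ (e , h) = inj₁ (e , λ w wv → older w wv (h w wv))
  where
  older : ∀ w → w < length rs → contains c d (nodeAt rs w) ≡ false → contains c d (nodeAt (x ∷ rs) w) ≡ false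
  older w wv q rewrite ≡ᵇ-false (ℕ.<⇒≢ wv) = q
...   | inj₂ (u , e , u< , p , h) = inj₂ (u , e , u< , older u u< p , λ w uw wv → older w wv (h w uw wv))
  where
  older : ∀ w → w < length rs → ∀ {b} → contains c d (nodeAt rs w) ≡ b → contains c d (nodeAt (x ∷ rs) w) ≡ b
  older w wv q rewrite ≡ᵇ-false (ℕ.<⇒≢ wv) = q

parentAt-≤ : ∀ rs {v} → v < length rs → parentAt rs v ≤ v
parentAt-≤ rs v< with parentAt-spec rs v<
... | inj₁ (e , _) = subst (_≤ _) (sym e) z≤n
... | inj₂ (u , e , uv , _) = subst (_≤ _) (sym e) uv

childNumbers : List Interval² → ℕ → ℕ → List ℕ
childNumbers rs N u = map suc (filter (λ v → parentAt rs v ℕ.≟ u) (seg id 0 N))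

filter-cong : ∀ {P Q : ℕ → Set} (P? : ∀ v → Dec (P v)) (Q? : ∀ v → Dec (Q v)) xs → (∀ v → v ∈ˡ xs → (P v → Q v) × (Q v → P v)) →
              filter P? xs ≡ filter Q? xs
filter-cong P? Q? [] h = refl
filter-cong P? Q? (x ∷ xs) h with P? x | Q? x
... | yes p | yes q = cong (x ∷_) (filter-cong P? Q? xs (λ v i → h v (there i)))
... | no p  | no q  = filter-cong P? Q? xs (λ v i → h v (there i))
... | yes p | no q  = ⊥-elim (q (proj₁ (h x (here refl)) p))
... | no p  | yes q = ⊥-elim (p (proj₂ (h x (here refl)) q))

childNumbers-∷ : ∀ x rs u → childNumbers (x ∷ rs) (suc (length rs)) u ≡
                 childNumbers rs (length rs) u ++ (if u ≡ᵇ parent rs x then suc (length rs) ∷ [] else [])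
childNumbers-∷ x rs u = trans (cong (λ l → map suc (filter Q? l)) (seg-snoc id 0 N)) (trans (cong (map suc) (filter-++ Q? (seg id 0 N) (N ∷ [])))
    (trans (map-++ suc (filter Q? (seg id 0 N)) (filter Q? (N ∷ []))) (cong₂ _++_ (cong (map suc) (filter-cong Q? (λ v → parentAt rs v ℕ.≟ u) (seg id 0 N) same)) last)))
  where
  N = length rs
  Q? = λ v → parentAt (x ∷ rs) v ℕ.≟ u
  same : ∀ v → v ∈ˡ seg id 0 N → (parentAt (x ∷ rs) v ≡ u → parentAt rs v ≡ u) × (parentAt rs v ≡ u → parentAt (x ∷ rs) v ≡ u)
  same v i with ∈-seg id 0 N i
  ... | .v , v< , refl rewrite ≡ᵇ-false (ℕ.<⇒≢ v<) = id , id
  head≡ : parentAt (x ∷ rs) N ≡ parent rs x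
  head≡ rewrite ≡-true {N} refl = refl
  last : map suc (filter Q? (N ∷ [])) ≡ (if u ≡ᵇ parent rs x then suc N ∷ [] else [])
  last with u ℕ.≟ parent rs x
  ... | yes e rewrite ≡-true {u} {parent rs x} e = cong (map suc) (filter-accept Q? {N} {[]} (trans head≡ (sym e)))
  ... | no ne rewrite ≡ᵇ-false {u} {parent rs x} ne = cong (map suc) (filter-reject Q? {N} {[]} (λ e → ne (trans (sym e) head≡)))

neighbourNumbers-root : ∀ rs → neighbourNumbers rs 0 ≡ childNumbers rs (length rs) 0
neighbourNumbers-root [] = refl
neighbourNumbers-root (x ∷ rs) = trans (cong (_++ (if 0 ≡ᵇ parent rs x then suc (length rs) ∷ [] else [])) (neighbourNumbers-root rs)) (sym (childNumbers-∷ x rs 0))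

childNumbers-none : ∀ rs N u → N ≤ length rs → N ≤ u → 0 < u → childNumbers rs N u ≡ []
childNumbers-none rs N u N≤ N≤u 0<u = cong (map suc) (filter-none (λ v → parentAt rs v ℕ.≟ u) (All.tabulate λ i e →
  let (j , j< , v≡) = ∈-seg id 0 N i
      v< = subst (_< N) (sym v≡) j<
  in ℕ.<⇒≱ (ℕ.≤-<-trans (parentAt-≤ rs (ℕ.<-≤-trans v< N≤)) v<) (subst (N ≤_) (sym e) N≤u)))

-- Children were appended in the order of creation, which is the increasing order of numbers that
-- filtering produces.
neighbourNumbers-node : ∀ rs {u} → u < length rs → neighbourNumbers rs (suc u) ≡ parentAt rs u ∷ childNumbers rs (length rs) (suc u)
neighbourNumbers-node (x ∷ rs) {u} u< with u ℕ.≟ length rs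
... | yes refl rewrite ≡-true {length rs} refl = cong (parent rs x ∷_) (sym (trans (childNumbers-∷ x rs (suc (length rs)))
        (cong₂ _++_ (childNumbers-none rs (length rs) (suc (length rs)) ℕ.≤-refl (ℕ.n≤1+n _) (s≤s z≤n)) last)))
  where
  last : (if suc (length rs) ≡ᵇ parent rs x then suc (length rs) ∷ [] else []) ≡ []
  last rewrite ≡ᵇ-false {suc (length rs)} {parent rs x} (λ e → ℕ.<-irrefl (sym e) (s≤s (newest-≤ (contains (proj₁ x) (proj₂ x)) rs))) = refl
... | no ne rewrite ≡ᵇ-false ne = trans (cong (_++ (if suc u ≡ᵇ parent rs x then suc (length rs) ∷ [] else [])) (neighbourNumbers-node rs (below-length {x} {rs} u< ne)))
        (cong (parentAt rs u ∷_) (sym (childNumbers-∷ x rs (suc u))))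

map-toℕ-allFin : ∀ {k} N o (h : Fin N → Fin k) → (∀ i → toℕ (h i) ≡ o + toℕ i) → map toℕ (tabulate h) ≡ seg id o N
map-toℕ-allFin zero o h e = refl
map-toℕ-allFin (suc N) o h e = cong₂ _∷_ (trans (e zero) (ℕ.+-identityʳ o)) (map-toℕ-allFin N (suc o) (h ∘ suc) (λ i → trans (e (suc i)) (ℕ.+-suc o (toℕ i))))

map-filter : ∀ {k} {P : Fin k → Set} {Q : ℕ → Set} (P? : ∀ i → Dec (P i)) (Q? : ∀ v → Dec (Q v)) → (∀ i → (P i → Q (toℕ i)) × (Q (toℕ i) → P i)) →
             ∀ xs → map toℕ (filter P? xs) ≡ filter Q? (map toℕ xs)
map-filter P? Q? h [] = refl
map-filter P? Q? h (x ∷ xs) with P? x | Q? (toℕ x)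
... | yes p | yes q = cong (toℕ x ∷_) (map-filter P? Q? h xs)
... | no p  | no q  = map-filter P? Q? h xs
... | yes p | no q  = ⊥-elim (q (proj₁ (h x) p))
... | no p  | yes q = ⊥-elim (p (proj₂ (h x) q))

-- Parity identities, and umodules in the switched tournament

every : ∀ {P : Bool → Set} → (∀ b → Dec (P b)) → Dec (∀ b → P b)
every P? = map′ (λ (f , t) → λ { false → f ; true → t }) (λ h → h false , h true) (P? false ×-dec P? true)

xor-not : ∀ a b c → (not a xor c) xor b ≡ not ((a xor b) xor c)
xor-not = toWitness {a? = every λ a → every λ b → every λ c → ((not a xor c) xor b) Bool.≟ not ((a xor b) xor c)} tt

xor-same : ∀ a b → (a xor b) xor b ≡ a
xor-same = toWitness {a? = every λ a → every λ b → ((a xor b) xor b) Bool.≟ a} tt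

xor-move : ∀ a b c d e → a xor b ≡ c xor d → (not a xor e) xor b ≡ (not c xor e) xor d
xor-move = toWitness {a? = every λ a → every λ b → every λ c → every λ d → every λ e →
  ((a xor b) Bool.≟ (c xor d)) →-dec (((not a xor e) xor b) Bool.≟ ((not c xor e) xor d))} tt

xor-swap : ∀ a b c d e → a xor b ≡ c xor d → (a xor e) xor not c ≡ (b xor e) xor not d
xor-swap = toWitness {a? = every λ a → every λ b → every λ c → every λ d → every λ e →
  ((a xor b) Bool.≟ (c xor d)) →-dec (((a xor e) xor not c) Bool.≟ ((b xor e) xor not d))} tt

-- Two homogeneity equations share the terms `u` and `v`, the arcs to the switching vertex. Adding
-- them cancels these terms and leaves the parity of a rectangle.
xor-cross : ∀ a b c d e f u v → (not a xor e) xor u ≡ (not c xor e) xor v → (not b xor f) xor u ≡ (not d xor f) xor v → a ≡ b → c ≡ d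
xor-cross = toWitness {a? = every λ a → every λ b → every λ c → every λ d → every λ e → every λ f → every λ u → every λ v →
  (((not a xor e) xor u) Bool.≟ ((not c xor e) xor v)) →-dec ((((not b xor f) xor u) Bool.≟ ((not d xor f) xor v)) →-dec ((a Bool.≟ b) →-dec (c Bool.≟ d)))} tt

xor-equal : ∀ {a b c d : Bool} → (a ≡ b → c ≡ d) → (c ≡ d → a ≡ b) → a xor b ≡ c xor d
xor-equal {false} {false} {false} {false} f h = refl
xor-equal {false} {false} {false} {true}  f h = case f refl of λ ()
xor-equal {false} {false} {true}  {false} f h = case f refl of λ ()
xor-equal {false} {false} {true}  {true}  f h = refl
xor-equal {true}  {true}  {false} {false} f h = refl
xor-equal {true}  {true}  {false} {true}  f h = case f refl of λ ()
xor-equal {true}  {true}  {true}  {false} f h = case f refl of λ ()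
xor-equal {true}  {true}  {true}  {true}  f h = refl
xor-equal {false} {true}  {false} {false} f h = case h refl of λ ()
xor-equal {false} {true}  {false} {true}  f h = refl
xor-equal {false} {true}  {true}  {false} f h = refl
xor-equal {false} {true}  {true}  {true}  f h = case h refl of λ ()
xor-equal {true}  {false} {false} {false} f h = case h refl of λ ()
xor-equal {true}  {false} {false} {true}  f h = refl
xor-equal {true}  {false} {true}  {false} f h = refl
xor-equal {true}  {false} {true}  {true}  f h = case h refl of λ ()

-- The tournament switched so that 0 dominates all other vertices; outside of the
-- vertex set the arcs are those of the natural order.
module Switch {m : ℕ} (T′ : Tournament (suc m)) where
  open Tournament T′ public

  n : ℕ
  n = suc m

  Vertex : Set
  Vertex = Fin n

  switch : Vertex → Vertex → Bool
  switch u v = (arc u v xor arc u zero) xor arc v zero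

  orient′ : ∀ {u v} → u ≢ v → arc v u ≡ not (arc u v)
  orient′ = orient _ _

  G : ℕ → ℕ → Bool
  G u v with u ℕ.<? n | v ℕ.<? n
  ... | yes u< | yes v< = switch (fromℕ< u<) (fromℕ< v<)
  ... | _      | _      = u <ᵇ v

  G-switch : ∀ u v → G (toℕ u) (toℕ v) ≡ switch u v
  G-switch u v with toℕ u ℕ.<? n | toℕ v ℕ.<? n
  ... | yes u< | yes v< = cong₂ switch (Fin.fromℕ<-toℕ u u<) (Fin.fromℕ<-toℕ v v<)
  ... | no ¬u | _ = ⊥-elim (¬u (Fin.toℕ<n u))
  ... | yes _ | no ¬v = ⊥-elim (¬v (Fin.toℕ<n v))

  G-tournament : IsTournament G
  G-tournament = record { irr = irr′ ; tour = tour′ }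
    where
    irr′ : ∀ u → G u u ≡ false
    irr′ u with u ℕ.<? n
    ... | yes u< = trans (xor-same (arc x x) (arc x zero)) (irrefl x)
      where x = fromℕ< u<
    ... | no _ = <-false (ℕ.<-irrefl {u} refl)
    order : ∀ u v → u ≢ v → (v <ᵇ u) ≡ not (u <ᵇ v)
    order u v ne with ℕ.<-cmp u v
    ... | tri< l _ nl = trans (<-false nl) (cong not (sym (<-true l)))
    ... | tri≈ _ e _ = ⊥-elim (ne e)
    ... | tri> nl _ l = trans (<-true l) (cong not (sym (<-false nl)))
    tour′ : ∀ u v → u ≢ v → G v u ≡ not (G u v)
    tour′ u v ne with u ℕ.<? n | v ℕ.<? n
    ... | yes u< | yes v< = trans (cong (λ z → (z xor arc y zero) xor arc x zero) (orient′ {x} {y} (ne ∘ Fin.fromℕ<-injective _ _ u< v<))) (xor-not (arc x y) (arc x zero) (arc y zero))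
      where
      x = fromℕ< u<
      y = fromℕ< v<
    ... | yes _ | no _ = order u v ne
    ... | no _ | yes _ = order u v ne
    ... | no _ | no _ = order u v ne

  ∈N⁺ : ∀ {u v} → v ∈ N⁺ T′ u ⇔ arc u v ≡ true
  ∈N⁺ {u} {v} = mk⇔ (λ h → trans (sym (Vec.lookup∘tabulate (arc u) v)) (Vec.[]=⇒lookup h))
                    (λ h → Vec.lookup⇒[]= v _ (trans (Vec.lookup∘tabulate (arc u) v) h))

  ∈N⁻ : ∀ {u v} → v ∈ N⁻ T′ u ⇔ arc v u ≡ true
  ∈N⁻ {u} {v} = mk⇔ (λ h → trans (sym (Vec.lookup∘tabulate (λ w → arc w u) v)) (Vec.[]=⇒lookup h))
                    (λ h → Vec.lookup⇒[]= v _ (trans (Vec.lookup∘tabulate (λ w → arc w u) v) h))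

  open Equivalence using (to; from)

  H⇒≡ : ∀ {u x x′} → u ≢ x → u ≢ x′ → H T′ u x x′ → arc u x ≡ arc u x′
  H⇒≡ ne ne′ (inj₁ (p , q)) = trans (to ∈N⁺ p) (sym (to ∈N⁺ q))
  H⇒≡ ne ne′ (inj₂ (p , q)) = trans (trans (orient′ (ne ∘ sym)) (cong not (to ∈N⁻ p))) (sym (trans (orient′ (ne′ ∘ sym)) (cong not (to ∈N⁻ q))))

  ≡⇒H : ∀ {u x x′} → u ≢ x → u ≢ x′ → arc u x ≡ arc u x′ → H T′ u x x′
  ≡⇒H {u} {x} {x′} ne ne′ e with arc u x in ex
  ... | true  = inj₁ (from ∈N⁺ ex , from ∈N⁺ (sym e))
  ... | false = inj₂ (from ∈N⁻ (trans (orient′ ne) (cong not ex)) , from ∈N⁻ (trans (orient′ ne′) (cong not (sym e))))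

  distinct : ∀ {U : Subset n} {u x} → u ∈ U → x ∉ U → u ≢ x
  distinct i j refl = j i

  -- For vertices of a tournament `H` only says that two arcs at one vertex agree. Its equivalence
  -- for `u` and `u′` is thus the even parity of the four arcs.
  rectangle : ∀ {U} → Umodule T′ U → ∀ {u u′ x x′} → u ∈ U → u′ ∈ U → x ∉ U → x′ ∉ U → arc u x xor arc u x′ ≡ arc u′ x xor arc u′ x′
  rectangle h i i′ j j′ = xor-equal
    (λ e → H⇒≡ (distinct i′ j) (distinct i′ j′) (to (h i i′ j j′) (≡⇒H (distinct i j) (distinct i j′) e)))
    (λ e → H⇒≡ (distinct i j) (distinct i j′) (from (h i i′ j j′) (≡⇒H (distinct i′ j) (distinct i′ j′) e)))

  -- Modules of the switched tournament.
  Homogeneous : (Vertex → Set) → Set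
  Homogeneous M = ∀ {z y y′} → ¬ M z → M y → M y′ → switch z y ≡ switch z y′

  -- The vertex 0 serves as the corner `x′` of the rectangle, outside of `U`.
  umodule⇒homogeneous : ∀ {U} → zero ∉ U → Umodule T′ U → Homogeneous (_∈ U)
  umodule⇒homogeneous 0∉ h {z} {y} {y′} nz i i′ =
    trans (cong (λ a → (a xor arc z zero) xor arc y zero) (orient′ (distinct i nz)))
    (trans (xor-move (arc y z) (arc y zero) (arc y′ z) (arc y′ zero) (arc z zero) (rectangle h i i′ nz 0∉))
           (cong (λ a → (a xor arc z zero) xor arc y′ zero) (sym (orient′ (distinct i′ nz)))))

  -- Here 0 lies in `U` and serves as the corner `u′`; the complement is the part without 0.
  co-umodule⇒homogeneous : ∀ {U} → zero ∈ U → Umodule T′ U → Homogeneous (_∉ U)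
  co-umodule⇒homogeneous {U} 0∈ h {z} {y} {y′} nz i i′ =
    trans (cong (λ a → (arc z y xor arc z zero) xor a) (orient′ (distinct 0∈ i)))
    (trans (xor-swap (arc z y) (arc z y′) (arc zero y) (arc zero y′) (arc z zero) (rectangle h z∈ 0∈ i i′))
           (cong (λ a → (arc z y′ xor arc z zero) xor a) (sym (orient′ (distinct 0∈ i′)))))
    where
    z∈ : z ∈ U
    z∈ with z ∈? U
    ... | yes p = p
    ... | no np = ⊥-elim (nz np)

  homogeneous⇒umodule : ∀ {U} → Homogeneous (_∈ U) → Umodule T′ U
  homogeneous⇒umodule {U} h {u} {u′} {x} {x′} i i′ j j′ = mk⇔ (carry i i′) (carry i′ i)
    where
    turned : ∀ {x} {u u′} → u ∈ U → u′ ∈ U → x ∉ U → (not (arc u x) xor arc x zero) xor arc u zero ≡ (not (arc u′ x) xor arc x zero) xor arc u′ zero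
    turned {x} {u} {u′} i i′ j = trans (cong (λ a → (a xor arc x zero) xor arc u zero) (sym (orient′ (distinct i j))))
      (trans (h j i i′) (cong (λ a → (a xor arc x zero) xor arc u′ zero) (orient′ (distinct i′ j))))
    carry : ∀ {u u′} → u ∈ U → u′ ∈ U → H T′ u x x′ → H T′ u′ x x′
    carry {u} {u′} i i′ q = ≡⇒H (distinct i′ j) (distinct i′ j′)
      (xor-cross (arc u x) (arc u x′) (arc u′ x) (arc u′ x′) (arc x zero) (arc x′ zero) (arc u zero) (arc u′ zero)
        (turned i i′ j) (turned i i′ j′) (H⇒≡ (distinct i j) (distinct i j′) q))

-- Positions of the vertices in the sorted order

module Arrangement {m : ℕ} (T′ : Tournament (suc m)) (p : ℕ → ℕ) where
  open Switch T′
  open Order G-tournament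

  module _ (good : Good (seg suc 0 m) [] (seg p 0 m)) where

    p-range : ∀ {j} → j < m → ∃[ i ] i < m × p j ≡ suc i
    p-range {j} j< = ∈-seg suc 0 m (∈-resp-↭ (perm good) (seg-∈ p 0 j j<))

    p-onto : ∀ {i} → i < m → ∃[ j ] j < m × suc i ≡ p j
    p-onto {i} i< = ∈-seg p 0 m (∈-resp-↭ (↭-sym (perm good)) (seg-∈ suc 0 i i<))

    seg-unique : ∀ f a l → (∀ i j → i < j → j < l → f (a + i) ≢ f (a + j)) → Unique (seg f a l)
    seg-unique f a zero h = []
    seg-unique f a (suc l) h = All.tabulate (λ i e → let (j , j< , e′) = ∈-seg f (suc a) l i in
        h 0 (suc j) (s≤s z≤n) (s≤s j<) (trans (cong f (ℕ.+-identityʳ a)) (trans (trans e e′) (cong f (sym (ℕ.+-suc a j))))))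
      ∷ seg-unique f (suc a) l (λ i j ij j< → subst₂ (λ x y → f x ≢ f y) (ℕ.+-suc a i) (ℕ.+-suc a j) (h (suc i) (suc j) (s≤s ij) (s≤s j<)))

    unique-seg : ∀ f a l → Unique (seg f a l) → ∀ i j → i < j → j < l → f (a + i) ≢ f (a + j)
    unique-seg f a (suc l) (h ∷ u) zero (suc j) _ (s≤s j<) e =
      All.lookup h (seg-∈ f (suc a) j j<) (trans (cong f (sym (ℕ.+-identityʳ a))) (trans e (cong f (ℕ.+-suc a j))))
    unique-seg f a (suc l) (h ∷ u) (suc i) (suc j) (s≤s ij) (s≤s j<) e =
      unique-seg f (suc a) l u i j ij j< (subst₂ (λ x y → f x ≡ f y) (ℕ.+-suc a i) (ℕ.+-suc a j) e)

    p-injective : ∀ {i j} → i < m → j < m → p i ≡ p j → i ≡ j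
    p-injective {i} {j} i< j< e with ℕ.<-cmp i j
    ... | tri≈ _ q _ = q
    ... | tri< l _ _ = ⊥-elim (unique-seg p 0 m uniq i j l j< e)
      where uniq = Setoid.Unique-resp-↭ (setoid ℕ) (↭⇒↭ₛ (↭-sym (perm good))) (seg-unique suc 0 m (λ i j ij _ q → ℕ.<-irrefl (ℕ.suc-injective q) ij))
    ... | tri> _ _ l = ⊥-elim (unique-seg p 0 m uniq j i l i< (sym e))
      where uniq = Setoid.Unique-resp-↭ (setoid ℕ) (↭⇒↭ₛ (↭-sym (perm good))) (seg-unique suc 0 m (λ i j ij _ q → ℕ.<-irrefl (ℕ.suc-injective q) ij))

    linked-seg : ∀ f a l → Linked Forward (seg f a l) → ∀ i → suc i < l → Forward (f (a + i)) (f (a + suc i))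
    linked-seg f a (suc (suc l)) (r ∷ _) zero _ = subst₂ (λ x y → Forward (f x) (f y)) (sym (ℕ.+-identityʳ a)) (sym (trans (ℕ.+-suc a 0) (cong suc (ℕ.+-identityʳ a)))) r
    linked-seg f a (suc (suc l)) (_ ∷ rs) (suc i) (s≤s si<) =
      subst₂ (λ x y → Forward (f x) (f y)) (sym (ℕ.+-suc a i)) (sym (ℕ.+-suc a (suc i))) (linked-seg f (suc a) (suc l) rs i si<)
    linked-seg f a (suc zero) _ _ (s≤s ())

    p-path : ∀ {i} → suc i < m → G (p (suc i)) (p i) ≡ false
    p-path {i} = linked-seg p 0 m (path good) i

    Spans : (ℕ → Bool) → ℕ → ℕ → ℕ → ℕ → Set
    Spans M o l a b = o ≤ a × a ≤ b × b < o + l ×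
                      (∀ j → o ≤ j → j < o + l → M (p j) ≡ true → a ≤ j × j ≤ b) × (∀ j → a ≤ j → j ≤ b → M (p j) ≡ true)

    none-seg : ∀ {M : ℕ → Bool} o l → All (λ y → M y ≡ false) (seg p o l) → ∀ j → o ≤ j → j < o + l → M (p j) ≡ false
    none-seg {M} o l h j oj j< = subst (λ i → M (p i) ≡ false) (ℕ.m+[n∸m]≡n oj)
      (All.lookup h (seg-∈ p o (j ∸ o) (ℕ.+-cancelˡ-< o _ _ (subst (_< o + l) (sym (ℕ.m+[n∸m]≡n oj)) j<))))

    run-span : ∀ {M : ℕ → Bool} o l → Run⁺ M (seg p o l) → All (λ y → M y ≡ false) (seg p o l) ⊎ (∃[ b ] Spans M o l o b)
    run-span o zero r = inj₁ []
    run-span o (suc l) (done h) = inj₁ h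
    run-span {M} o (suc l) (more q r) = inj₂ (case run-span (suc o) l r of λ
      { (inj₁ h) → o , ℕ.≤-refl , ℕ.≤-refl , ℕ.m<m+n o (s≤s z≤n) ,
          (λ j oj j< e → oj , ℕ.≮⇒≥ λ l′ → case trans (sym e) (none-seg {M} (suc o) l h j l′ (subst (j <_) (ℕ.+-suc o l) j<)) of λ ()) ,
          (λ j oj jo → subst (λ i → M (p i) ≡ true) (ℕ.≤-antisym oj jo) q)
      ; (inj₂ (b , _ , ab , b< , f , h)) → b , ℕ.≤-refl , ℕ.<⇒≤ ab , subst (b <_) (sym (ℕ.+-suc o l)) b< ,
          (λ j oj j< e → oj , (case ℕ.m≤n⇒m<n∨m≡n oj of λ { (inj₁ l′) → proj₂ (f j l′ (subst (j <_) (ℕ.+-suc o l) j<) e) ; (inj₂ refl) → ℕ.<⇒≤ ab })) ,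
          (λ j oj jb → case ℕ.m≤n⇒m<n∨m≡n oj of λ { (inj₁ l′) → h j l′ jb ; (inj₂ refl) → q }) })

    contig-span : ∀ {M : ℕ → Bool} o l → Contig M (seg p o l) → All (λ y → M y ≡ false) (seg p o l) ⊎ (∃[ a ] ∃[ b ] Spans M o l a b)
    contig-span o zero _ = inj₁ []
    contig-span o (suc l) (start r) = case run-span o (suc l) r of λ { (inj₁ h) → inj₁ h ; (inj₂ (b , h)) → inj₂ (o , b , h) }
    contig-span {M} o (suc l) (skip q c) = case contig-span (suc o) l c of λ
      { (inj₁ h) → inj₁ (q ∷ h)
      ; (inj₂ (a , b , oa , ab , b< , f , h)) → inj₂ (a , b , ℕ.<⇒≤ oa , ab , subst (b <_) (sym (ℕ.+-suc o l)) b< ,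
          (λ j oj j< e → case ℕ.m≤n⇒m<n∨m≡n oj of λ { (inj₁ l′) → f j l′ (subst (j <_) (ℕ.+-suc o l) j<) e
                                                     ; (inj₂ refl) → ⊥-elim (case trans (sym e) q of λ ()) }) , h) }

-- Bipartitions and complements

∁∁ : ∀ {n} (A : Subset n) → ∁ (∁ A) ≡ A
∁∁ A = trans (sym (Vec.map-∘ not not A)) (trans (Vec.map-cong Bool.not-involutive A) (Vec.map-id A))

Nonempty-∁∁ : ∀ {n} {A B : Subset n} → Nonempty (A ∩ B) → Nonempty (∁ (∁ A) ∩ B)
Nonempty-∁∁ {A = A} {B} = subst (λ S → Nonempty (S ∩ B)) (sym (∁∁ A))

Overlap-sym : ∀ {n} {A B : Subset n} → Overlap A B → Overlap B A
Overlap-sym ((x , h) , (y , k) , (z , l) , (w , o)) = (x , swap h) , (z , swap l) , (y , swap k) , (w , swap o)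
  where
  swap : ∀ {n} {A B : Subset n} {x} → x ∈ A ∩ B → x ∈ B ∩ A
  swap {A = A} {B} h = let (a , b) = x∈p∩q⁻ A B h in x∈p∩q⁺ (b , a)

Overlap-∁ : ∀ {n} {A B : Subset n} → Overlap A B → Overlap (∁ A) B
Overlap-∁ {A = A} {B} (h , k , l , o) = l , o , Nonempty-∁∁ {A = A} {B} h , Nonempty-∁∁ {A = A} {∁ B} k

Overlap-∁⁻ : ∀ {n} {A B : Subset n} → Overlap (∁ A) B → Overlap A B
Overlap-∁⁻ {A = A} {B} o = subst (λ S → Overlap S B) (∁∁ A) (Overlap-∁ {A = ∁ A} {B} o)

from-does : ∀ {P : Set} (d : Dec P) → does d ≡ true → P
from-does (yes h) _ = h
from-does (no _) ()

module _ {n : ℕ} {T : Tournament n} where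
  InB-∁ : ∀ {A} → InB T A → InB T (∁ A)
  InB-∁ {A} (h , k , inj₁ u) = k , subst Nonempty (sym (∁∁ A)) h , inj₂ (λ {a} {b} {c} {d} → subst (Umodule T) (sym (∁∁ A)) u {a} {b} {c} {d})
  InB-∁ {A} (h , k , inj₂ u) = k , subst Nonempty (sym (∁∁ A)) h , inj₁ u

  Strong-∁ : ∀ {A} → Strong T A → Strong T (∁ A)
  Strong-∁ {A} (h , k) = InB-∁ h , λ B i o → k B i (Overlap-∁⁻ {A = A} {B} o)

  InB-∁⁻ : ∀ {A} → InB T (∁ A) → InB T A
  InB-∁⁻ {A} h = subst (InB T) (∁∁ A) (InB-∁ h)

  Strong-∁⁻ : ∀ {A} → Strong T (∁ A) → Strong T A
  Strong-∁⁻ {A} h = subst (Strong T) (∁∁ A) (Strong-∁ h)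

-- Umodules as interval modules

module Bridge {m : ℕ} (T′ : Tournament (suc m)) (p : ℕ → ℕ) (good : Order.Good (Switch.G-tournament T′) (seg suc 0 m) [] (seg p 0 m))
  (tour : ∀ {i j} → i < m → j < m → i ≢ j → Switch.G T′ (p j) (p i) ≡ not (Switch.G T′ (p i) (p j)))
  (path : ∀ {i} → suc i < m → Switch.G T′ (p (suc i)) (p i) ≡ false) where
  open Switch T′
  open Order G-tournament using (Good; contig; Module; Contig)
  open Arrangement T′ p
  open Intervals m (λ i j → G (p i) (p j)) tour path
  open Equivalence using (to; from)

  vertex : ∀ {j} → j < m → Vertex
  vertex j< = let (i , i< , _) = p-range good j< in suc (fromℕ< i<)

  toℕ-vertex : ∀ {j} (j< : j < m) → toℕ (vertex j<) ≡ p j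
  toℕ-vertex j< = let (i , i< , e) = p-range good j< in trans (cong suc (Fin.toℕ-fromℕ< i<)) (sym e)

  position : ∀ {x : Vertex} → x ≢ zero → ∃[ j ] j < m × toℕ x ≡ p j
  position {zero} ne = ⊥-elim (ne refl)
  position {suc x} _ = p-onto good (Fin.toℕ<n x)

  p≢0 : ∀ {j} → j < m → p j ≢ 0
  p≢0 j< e = let (i , i< , e′) = p-range good j< in case trans (sym e) e′ of λ ()

  InInt : ℕ → ℕ → Vertex → Set
  InInt a b x = ∃[ j ] a ≤ j × j ≤ b × toℕ x ≡ p j

  InInt? : ∀ a b x → Dec (InInt a b x)
  InInt? a b x = map′ (λ (j , j< , aj , e) → j , aj , ℕ.≤-pred j< , e) (λ (j , aj , jb , e) → j , s≤s jb , aj , e)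
                      (ℕ.anyUpTo? (λ j → a ℕ.≤? j ×-dec toℕ x ℕ.≟ p j) (suc b))

  subset-of : ∀ {P : Vertex → Set} → (∀ x → Dec (P x)) → Subset n
  subset-of P? = Vec.tabulate (λ x → does (P? x))

  subset-of-≐ : ∀ {P : Vertex → Set} (P? : ∀ x → Dec (P x)) → subset-of P? ≐ P
  subset-of-≐ P? x = mk⇔
    (λ i → from-does (P? x) (trans (sym (Vec.lookup∘tabulate (λ x → does (P? x)) x)) (Vec.[]=⇒lookup i)))
    (λ h → Vec.lookup⇒[]= x _ (trans (Vec.lookup∘tabulate (λ x → does (P? x)) x) (dec-true (P? x) h)))

  inInt-zero : ∀ {a b} → b < m → ¬ InInt a b zero
  inInt-zero b< (j , _ , jb , e) = p≢0 (ℕ.≤-<-trans jb b<) (sym e)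

  inInt-vertex : ∀ {a b j x} → b < m → j < m → toℕ x ≡ p j → InInt a b x → a ≤ j × j ≤ b
  inInt-vertex {a} {b} b< j< e (k , ak , kb , e′) =
    subst (λ j → a ≤ j × j ≤ b) (p-injective good (ℕ.≤-<-trans kb b<) j< (trans (sym e′) e)) (ak , kb)

  zero-switch : ∀ {y} → y ≢ zero → switch zero y ≡ true
  zero-switch {y} ne = trans (cong₂ (λ a b → (a xor b) xor arc y zero) (orient′ ne) (irrefl zero)) (lemma (arc y zero))
    where
    lemma : ∀ a → (not a xor false) xor a ≡ true
    lemma false = refl
    lemma true = refl

  isMod⇒homogeneous : ∀ {A a b} → b < m → IsMod a b → A ≐ InInt a b → Homogeneous (_∈ A)
  isMod⇒homogeneous {A} {a} {b} b< md A≐ {z} {y} {y′} nz i i′ with z Fin.≟ zero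
  -- After switching, 0 dominates every other vertex and is therefore homogeneous to any set without
  -- it.
  ... | yes refl = trans (zero-switch (nonzero i)) (sym (zero-switch (nonzero i′)))
    where
    nonzero : ∀ {y} → y ∈ A → y ≢ zero
    nonzero i refl = inInt-zero b< (to (A≐ zero) i)
  ... | no z≢0 = placed (position z≢0) (to (A≐ y) i) (to (A≐ y′) i′)
    where
    placed : ∃[ k ] k < m × toℕ z ≡ p k → InInt a b y → InInt a b y′ → switch z y ≡ switch z y′
    placed (k , k< , ez) (j , aj , jb , ey) (j′ , aj′ , jb′ , ey′) = trans (sym (G-switch z y)) (trans (cong₂ G ez ey) (trans (homog md k< outside aj jb aj′ jb′) (trans (sym (cong₂ G ez ey′)) (G-switch z y′))))
      where
      outside : k < a ⊎ b < k
      outside with a ℕ.≤? k | k ℕ.≤? b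
      ... | no ak | _ = inj₁ (ℕ.≰⇒> ak)
      ... | yes _ | no kb = inj₂ (ℕ.≰⇒> kb)
      ... | yes ak | yes kb = ⊥-elim (nz (from (A≐ z) (k , ak , kb , ez)))

  homogeneous⇒isMod : ∀ {A a b} → b < m → Homogeneous (_∈ A) → A ≐ InInt a b → IsMod a b
  homogeneous⇒isMod {A} {a} {b} b< hom A≐ = isMod λ {x} {i} {j} x< o ai ib aj jb →
    let vx = vertex x<
        i< = ℕ.≤-<-trans ib b<
        j< = ℕ.≤-<-trans jb b<
        e = cong₂ G (toℕ-vertex x<) (toℕ-vertex i<)
        e′ = cong₂ G (toℕ-vertex x<) (toℕ-vertex j<)
    in trans (sym e) (trans (G-switch vx (vertex i<)) (trans
         (hom (λ h → outside o (inInt-vertex b< x< (toℕ-vertex x<) (to (A≐ vx) h)))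
              (from (A≐ (vertex i<)) (i , ai , ib , toℕ-vertex i<)) (from (A≐ (vertex j<)) (j , aj , jb , toℕ-vertex j<)))
         (trans (sym (G-switch vx (vertex j<))) e′)))
    where
    outside : ∀ {x} → x < a ⊎ b < x → a ≤ x × x ≤ b → ⊥
    outside (inj₁ l) (q , _) = ℕ.<⇒≱ l q
    outside (inj₂ l) (_ , q) = ℕ.<⇒≱ l q

  inB⇒homogeneous : ∀ {A} → InB T′ A → zero ∉ A → Homogeneous (_∈ A)
  inB⇒homogeneous (_ , _ , inj₁ u) 0∉ = umodule⇒homogeneous 0∉ u
  inB⇒homogeneous (_ , _ , inj₂ u) 0∉ nz i i′ =
    co-umodule⇒homogeneous (x∉p⇒x∈∁p 0∉) u (λ h → nz (x∉∁p⇒x∈p h)) (λ h → x∈∁p⇒x∉p h i) (λ h → x∈∁p⇒x∉p h i′)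

  -- The sorted list has no outer pivots, so its contiguity clause applies to every module without
  -- 0.
  homogeneous⇒interval : ∀ {A} → zero ∉ A → Nonempty A → Homogeneous (_∈ A) → ∃[ a ] ∃[ b ] a ≤ b × b < m × A ≐ InInt a b
  homogeneous⇒interval {A} 0∉ (x₀ , x₀∈) hom = case contig-span good 0 m (contig good M (λ ()) modular) of λ
    { (inj₁ h) → ⊥-elim (let (j , j< , e) = position (λ e → 0∉ (subst (_∈ A) e x₀∈)) in
        case trans (sym (M-true x₀∈)) (trans (cong M e) (All.lookup h (seg-∈ p 0 j j<))) of λ ())
    ; (inj₂ (a , b , _ , ab , b< , f , h)) → a , b , ab , b< , λ x → mk⇔
        (λ i → let (j , j< , e) = position (λ e → 0∉ (subst (_∈ A) e i))
                   (aj , jb) = f j z≤n j< (trans (cong M (sym e)) (M-true i)) in j , aj , jb , e)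
        (λ (j , aj , jb , e) → M-false x (trans (cong M e) (h j aj jb))) }
    where
    M : ℕ → Bool
    M v with v ℕ.<? n
    ... | yes v< = does (fromℕ< v< ∈? A)
    ... | no _ = false
    M-true : ∀ {x} → x ∈ A → M (toℕ x) ≡ true
    M-true {x} h with toℕ x ℕ.<? n
    ... | no nx = ⊥-elim (nx (Fin.toℕ<n x))
    ... | yes x< rewrite Fin.fromℕ<-toℕ x x< = dec-true (x ∈? A) h
    M-false : ∀ x → M (toℕ x) ≡ true → x ∈ A
    M-false x e with toℕ x ℕ.<? n
    M-false x () | no _
    ... | yes x< rewrite Fin.fromℕ<-toℕ x x< = from-does (x ∈? A) e
    named : ∀ {v} → v ∈ˡ seg suc 0 m → ∃[ x ] v ≡ toℕ {n} x
    named i = let (k , k< , e) = ∈-seg suc 0 m i in suc (fromℕ< k<) , trans e (cong suc (sym (Fin.toℕ-fromℕ< k<)))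
    modular : Module M (seg suc 0 m) []
    modular (inj₁ iz) fz iy iy′ ty ty′ with named iz | named iy | named iy′
    ... | z , refl | y , refl | y′ , refl = trans (G-switch z y) (trans
          (hom (λ h → case trans (sym fz) (M-true h) of λ ()) (M-false y ty) (M-false y′ ty′)) (sym (G-switch z y′)))

  -- The part without the vertex 0 of a bipartition.
  Rep : Subset n → ℕ → ℕ → Set
  Rep A a b = A ≐ InInt a b ⊎ ∁ A ≐ InInt a b

  inB⇒rep : ∀ {A} → InB T′ A → ∃[ a ] ∃[ b ] a ≤ b × b < m × IsMod a b × Rep A a b
  inB⇒rep {A} h with zero ∈? A
  ... | no 0∉ = let hom = inB⇒homogeneous h 0∉
                    (a , b , ab , b< , r) = homogeneous⇒interval 0∉ (proj₁ h) hom
                in a , b , ab , b< , homogeneous⇒isMod b< hom r , inj₁ r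
  ... | yes 0∈ = let h′ = InB-∁ {T = T′} h
                     0∉ = λ i → x∈∁p⇒x∉p i 0∈
                     hom = inB⇒homogeneous h′ 0∉
                     (a , b , ab , b< , r) = homogeneous⇒interval 0∉ (proj₁ h′) hom
                in a , b , ab , b< , homogeneous⇒isMod b< hom r , inj₂ r

  isMod⇒inB₁ : ∀ {A a b} → a ≤ b → b < m → IsMod a b → A ≐ InInt a b → InB T′ A
  isMod⇒inB₁ {A} {a} {b} ab b< md r =
    (vertex a< , from (r (vertex a<)) (a , ℕ.≤-refl , ab , toℕ-vertex a<)) ,
    (zero , x∉p⇒x∈∁p (λ i → inInt-zero b< (to (r zero) i))) ,
    inj₁ (homogeneous⇒umodule (isMod⇒homogeneous b< md r))
    where a< = ℕ.≤-<-trans ab b<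

  isMod⇒inB : ∀ {A a b} → a ≤ b → b < m → IsMod a b → Rep A a b → InB T′ A
  isMod⇒inB ab b< md (inj₁ r) = isMod⇒inB₁ ab b< md r
  isMod⇒inB ab b< md (inj₂ r) = InB-∁⁻ {T = T′} (isMod⇒inB₁ ab b< md r)

  IntSet : ℕ → ℕ → Subset n
  IntSet a b = subset-of (InInt? a b)

  IntSet-≐ : ∀ a b → IntSet a b ≐ InInt a b
  IntSet-≐ a b = subset-of-≐ (InInt? a b)

  strong⇒strong₁ : ∀ {A a b} → a ≤ b → b < m → Strong T′ A → A ≐ InInt a b → Strong′ a b
  strong⇒strong₁ {A} {a} {b} ab b< (h , k) r =
    homogeneous⇒isMod b< (inB⇒homogeneous h (λ i → inInt-zero b< (to (r zero) i))) r ,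
    λ {c} {d} cd d< md o → k (IntSet c d) (isMod⇒inB₁ cd d< md (IntSet-≐ c d)) (overlapping cd d< o)
    where
    a< = ℕ.≤-<-trans ab b<
    overlapping : ∀ {c d} → c ≤ d → d < m → Overlaps a b c d → Overlap A (IntSet c d)
    overlapping {c} {d} cd d< o = meets o , rest₁ o , rest₂ o ,
      -- The vertex 0 lies outside of both intervals and witnesses the fourth intersection; overlap
      -- of bipartitions thus reduces to overlap of intervals.
      (zero , x∈p∩q⁺ (x∉p⇒x∈∁p (λ i → inInt-zero b< (to (r zero) i)) , x∉p⇒x∈∁p (λ i → inInt-zero d< (to (IntSet-≐ c d zero) i))))
      where
      c< = ℕ.≤-<-trans cd d<
      in-A : ∀ {j} (j< : j < m) → a ≤ j → j ≤ b → vertex j< ∈ A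
      in-A {j} j< aj jb = from (r (vertex j<)) (j , aj , jb , toℕ-vertex j<)
      in-B : ∀ {j} (j< : j < m) → c ≤ j → j ≤ d → vertex j< ∈ IntSet c d
      in-B {j} j< aj jb = from (IntSet-≐ c d (vertex j<)) (j , aj , jb , toℕ-vertex j<)
      out-A : ∀ {j} (j< : j < m) → ¬ (a ≤ j × j ≤ b) → vertex j< ∈ ∁ A
      out-A {j} j< no-in = x∉p⇒x∈∁p (λ i → no-in (inInt-vertex b< j< (toℕ-vertex j<) (to (r (vertex j<)) i)))
      out-B : ∀ {j} (j< : j < m) → ¬ (c ≤ j × j ≤ d) → vertex j< ∈ ∁ (IntSet c d)
      out-B {j} j< no-in = x∉p⇒x∈∁p (λ i → no-in (inInt-vertex d< j< (toℕ-vertex j<) (to (IntSet-≐ c d (vertex j<)) i)))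
      meets : Overlaps a b c d → Nonempty (A ∩ IntSet c d)
      meets (inj₁ (ac , cb , bd)) = vertex c< , x∈p∩q⁺ (in-A c< (ℕ.<⇒≤ ac) cb , in-B c< ℕ.≤-refl cd)
      meets (inj₂ (ca , ad , db)) = vertex a< , x∈p∩q⁺ (in-A a< ℕ.≤-refl ab , in-B a< (ℕ.<⇒≤ ca) ad)
      rest₁ : Overlaps a b c d → Nonempty (A ∩ ∁ (IntSet c d))
      rest₁ (inj₁ (ac , cb , bd)) = vertex a< , x∈p∩q⁺ (in-A a< ℕ.≤-refl ab , out-B a< (λ (q , _) → ℕ.<⇒≱ ac q))
      rest₁ (inj₂ (ca , ad , db)) = vertex b< , x∈p∩q⁺ (in-A b< ab ℕ.≤-refl , out-B b< (λ (_ , q) → ℕ.<⇒≱ db q))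
      rest₂ : Overlaps a b c d → Nonempty (∁ A ∩ IntSet c d)
      rest₂ (inj₁ (ac , cb , bd)) = vertex d< , x∈p∩q⁺ (out-A d< (λ (_ , q) → ℕ.<⇒≱ bd q) , in-B d< cd ℕ.≤-refl)
      rest₂ (inj₂ (ca , ad , db)) = vertex c< , x∈p∩q⁺ (out-A c< (λ (q , _) → ℕ.<⇒≱ ca q) , in-B c< ℕ.≤-refl cd)

  strong⇒strong : ∀ {A a b} → a ≤ b → b < m → Strong T′ A → Rep A a b → Strong′ a b
  strong⇒strong ab b< s (inj₁ r) = strong⇒strong₁ ab b< s r
  strong⇒strong ab b< s (inj₂ r) = strong⇒strong₁ ab b< (Strong-∁ {T = T′} s) r

  crossing : ∀ {a b c d i j k : ℕ} → a ≤ i × i ≤ b → c ≤ i × i ≤ d → a ≤ j × j ≤ b → ¬ (c ≤ j × j ≤ d) → c ≤ k × k ≤ d → ¬ (a ≤ k × k ≤ b) → Overlaps a b c d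
  crossing {a} {b} {c} {d} {i} {j} {k} (ai , ib) (ci , id) (aj , jb) nj (ck , kd) nk with c ℕ.≤? j | a ℕ.≤? k
  ... | no cj | no ak = ⊥-elim (ℕ.<-asym (ℕ.≤-<-trans aj (ℕ.≰⇒> cj)) (ℕ.≤-<-trans ck (ℕ.≰⇒> ak)))
  ... | no cj | yes ak = inj₁ (ℕ.≤-<-trans aj (ℕ.≰⇒> cj) , ℕ.≤-trans ci ib , ℕ.<-≤-trans (ℕ.≰⇒> (λ kb → nk (ak , kb))) kd)
  ... | yes cj | no ak = inj₂ (ℕ.≤-<-trans ck (ℕ.≰⇒> ak) , ℕ.≤-trans ai id , ℕ.<-≤-trans (ℕ.≰⇒> (λ jd → nj (cj , jd))) jb)
  ... | yes cj | yes ak = ⊥-elim (ℕ.<-asym (ℕ.<-≤-trans (ℕ.≰⇒> (λ jd → nj (cj , jd))) jb) (ℕ.<-≤-trans (ℕ.≰⇒> (λ kb → nk (ak , kb))) kd))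

  overlap⇒overlaps : ∀ {A B a b c d} → b < m → d < m → A ≐ InInt a b → B ≐ InInt c d → Overlap A B → Overlaps a b c d
  overlap⇒overlaps {A} {B} {a} {b} {c} {d} b< d< r q ((x , hx) , (y , hy) , (z , hz) , _) =
    let (xA , xB) = x∈p∩q⁻ A B hx
        (yA , yB) = x∈p∩q⁻ A (∁ B) hy
        (zA , zB) = x∈p∩q⁻ (∁ A) B hz
        (i , ai , ib , ex) = to (r x) xA
        (j , aj , jb , ey) = to (r y) yA
        (k , ck , kd , ez) = to (q z) zB
    in crossing (ai , ib) (inInt-vertex d< (ℕ.≤-<-trans ib b<) ex (to (q x) xB)) (aj , jb)
         (λ (cj , jd) → x∈∁p⇒x∉p yB (from (q y) (j , cj , jd , ey))) (ck , kd)
         (λ (ak , kb) → x∈∁p⇒x∉p zA (from (r z) (k , ak , kb , ez)))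

  strong′⇒strong₁ : ∀ {A a b} → a ≤ b → b < m → Strong′ a b → A ≐ InInt a b → Strong T′ A
  strong′⇒strong₁ {A} {a} {b} ab b< (md , k) r = isMod⇒inB₁ ab b< md r , avoid
    where
    avoid : ∀ B → InB T′ B → ¬ Overlap A B
    avoid B i o with inB⇒rep i
    ... | c , d , cd , d< , md′ , inj₁ q = k cd d< md′ (overlap⇒overlaps b< d< r q o)
    ... | c , d , cd , d< , md′ , inj₂ q = k cd d< md′ (overlap⇒overlaps {B = ∁ B} b< d< r q
            (Overlap-sym {A = ∁ B} (Overlap-∁ {A = B} (Overlap-sym {A = A} o))))

  strong′⇒strong : ∀ {A a b} → a ≤ b → b < m → Strong′ a b → Rep A a b → Strong T′ A
  strong′⇒strong ab b< s (inj₁ r) = strong′⇒strong₁ ab b< s r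
  strong′⇒strong ab b< s (inj₂ r) = Strong-∁⁻ {T = T′} (strong′⇒strong₁ ab b< s r)

  inInt-≡ : ∀ {a b c d} → a ≤ b → b < m → c ≤ d → d < m → (∀ x → InInt a b x ⇔ InInt c d x) → a ≡ c × b ≡ d
  inInt-≡ {a} {b} {c} {d} ab b< cd d< h =
    ℕ.≤-antisym (proj₁ (back ℕ.≤-refl cd)) (proj₁ (forth ℕ.≤-refl ab)) , ℕ.≤-antisym (proj₂ (forth ab ℕ.≤-refl)) (proj₂ (back cd ℕ.≤-refl))
    where
    forth : ∀ {j} → a ≤ j → j ≤ b → c ≤ j × j ≤ d
    forth {j} aj jb = let j< = ℕ.≤-<-trans jb b< in inInt-vertex d< j< (toℕ-vertex j<) (to (h (vertex j<)) (j , aj , jb , toℕ-vertex j<))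
    back : ∀ {j} → c ≤ j → j ≤ d → a ≤ j × j ≤ b
    back {j} cj jd = let j< = ℕ.≤-<-trans jd d< in inInt-vertex b< j< (toℕ-vertex j<) (from (h (vertex j<)) (j , cj , jd , toℕ-vertex j<))

-- The inclusion tree of the strong intervals

lookup-pair : ∀ {A : Set} {R : A → A → Set} {xs} → AllPairs R xs → ∀ {i j} → i Fin.< j → R (lookup xs i) (lookup xs j)
lookup-pair {xs = x ∷ xs} (a ∷ _) {zero} {suc j} _ = All.lookup a (∈-lookup {xs = xs} j)
lookup-pair {xs = x ∷ xs} (_ ∷ ps) {suc i} {suc j} (s≤s l) = lookup-pair ps l

module Hierarchy (m : ℕ) (g : ℕ → ℕ → Bool)
                 (tour : ∀ {i j} → i < m → j < m → i ≢ j → g j i ≡ not (g i j))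
                 (path : ∀ {i} → suc i < m → g (suc i) i ≡ false)
                 (rs : List Interval²) (listed : Nodes.Listed m (Intervals.Strong′ m g tour path) m 0 rs) where
  open Intervals m g tour path
  open Nodes m Strong′ using (Listed; sound; full; sorted)

  N : ℕ
  N = length rs

  lo hi : Fin N → ℕ
  lo i = proj₁ (nodeAt rs (toℕ i))
  hi i = proj₂ (nodeAt rs (toℕ i))

  node-sound : ∀ i → Strong′ (lo i) (hi i) × lo i ≤ hi i × hi i < m
  node-sound i = let (s , ab , b< , _) = sound listed (nodeAt-∈ rs (Fin.toℕ<n i)) in s , ab , b<

  strong = λ i → proj₁ (node-sound i)
  lo≤hi  = λ i → proj₁ (proj₂ (node-sound i))
  hi<    = λ i → proj₂ (proj₂ (node-sound i))

  lo< : ∀ i → lo i < m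
  lo< i = ℕ.≤-<-trans (lo≤hi i) (hi< i)

  node-of : ∀ {a b} → a ≤ b → b < m → Strong′ a b → ∃[ i ] lo i ≡ a × hi i ≡ b
  node-of {a} {b} ab b< s =
    let (u , u< , e) = ∈-nodeAt rs (full listed ab b< s (inj₁ (ℕ.≤-<-trans ab b<)))
        e′ = trans (cong (nodeAt rs) (Fin.toℕ-fromℕ< u<)) e
    in fromℕ< u< , cong proj₁ e′ , cong proj₂ e′

  order : ∀ {i j} → i Fin.< j → lo i < lo j ⊎ (lo i ≡ lo j × hi j < hi i)
  order {i} {j} l = nodeAt-sorted (sorted listed) l (Fin.toℕ<n j)

  infix 4 _⊑_

  _⊑_ : Fin N → Fin N → Set
  j ⊑ i = lo i ≤ lo j × hi j ≤ hi i

  ⊑-refl : ∀ {i} → i ⊑ i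
  ⊑-refl = ℕ.≤-refl , ℕ.≤-refl

  ⊑-trans : ∀ {i j k} → i ⊑ j → j ⊑ k → i ⊑ k
  ⊑-trans (a , b) (c , d) = ℕ.≤-trans c a , ℕ.≤-trans b d

  not-newer : ∀ {i j} → i Fin.< j → ¬ i ⊑ j
  not-newer l (a , b) = case order l of λ { (inj₁ q) → ℕ.<⇒≱ q a ; (inj₂ (_ , q)) → ℕ.<⇒≱ q b }

  ⊑-antisym : ∀ {i j} → i ⊑ j → j ⊑ i → i ≡ j
  ⊑-antisym {i} {j} p q with ℕ.<-cmp (toℕ i) (toℕ j)
  ... | tri< l _ _ = ⊥-elim (not-newer l p)
  ... | tri≈ _ e _ = Fin.toℕ-injective e
  ... | tri> _ _ l = ⊥-elim (not-newer l q)

  same-node : ∀ {i j} → lo i ≡ lo j → hi i ≡ hi j → i ≡ j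
  same-node e f = ⊑-antisym (ℕ.≤-reflexive (sym e) , ℕ.≤-reflexive f) (ℕ.≤-reflexive e , ℕ.≤-reflexive (sym f))

  no-crossing : ∀ i j → ¬ Overlaps (lo i) (hi i) (lo j) (hi j)
  no-crossing i j = proj₂ (strong i) (lo≤hi j) (hi< j) (proj₁ (strong j))

  -- Strong intervals with a common point are nested, and creation by left end and then by
  -- decreasing right end puts the larger one first.
  newer-inside : ∀ {i j c d} → c ≤ d → i Fin.< j → lo i ≤ c × d ≤ hi i → lo j ≤ c × d ≤ hi j → j ⊑ i
  newer-inside {i} {j} cd l (a , b) (a′ , b′) with order l
  ... | inj₂ (e , q) = ℕ.≤-reflexive e , ℕ.<⇒≤ q
  ... | inj₁ q = ℕ.<⇒≤ q , ℕ.≮⇒≥ (λ r → no-crossing i j (inj₁ (q , ℕ.≤-trans a′ (ℕ.≤-trans cd b) , r)))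

  singleton-strong : ∀ a → Strong′ a a
  singleton-strong a = singleton-mod , λ { _ _ _ (inj₁ (p , q , _)) → ℕ.<⇒≱ p q ; _ _ _ (inj₂ (_ , p , q)) → ℕ.<⇒≱ q p }

  whole-strong : ∀ {k} → suc k ≡ m → Strong′ 0 k
  whole-strong {k} refl = isMod (λ { x< (inj₁ ()) ; x< (inj₂ l) → ⊥-elim (ℕ.<⇒≱ l (ℕ.≤-pred x<)) }) ,
                  λ { _ d< _ (inj₁ (_ , _ , q)) → ℕ.<⇒≱ q (ℕ.≤-pred d<) ; _ _ _ (inj₂ (() , _)) }

  root : 0 < m → ∃[ r ] lo r ≡ 0 × suc (hi r) ≡ m
  root (s≤s {n = k} _) = let (r , e , f) = node-of z≤n ℕ.≤-refl (whole-strong refl) in r , e , cong suc f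

  below-whole : ∀ {r} → lo r ≡ 0 → suc (hi r) ≡ m → ∀ i → i ⊑ r
  below-whole e f i = subst (_≤ lo i) (sym e) z≤n , ℕ.≤-pred (subst (hi i <_) (sym f) (hi< i))

  par : Fin N → Fin (suc N)
  par i = fromℕ< (s≤s (ℕ.≤-trans (parentAt-≤ rs (Fin.toℕ<n i)) (ℕ.<⇒≤ (Fin.toℕ<n i))))

  toℕ-par : ∀ i → toℕ (par i) ≡ parentAt rs (toℕ i)
  toℕ-par i = Fin.toℕ-fromℕ< _

  par≤ : ∀ i → toℕ (par i) ≤ toℕ i
  par≤ i = subst (_≤ toℕ i) (sym (toℕ-par i)) (parentAt-≤ rs (Fin.toℕ<n i))

  older : ∀ {i j} → i ⊑ j → i ≢ j → j Fin.< i
  older {i} {j} p ne with ℕ.<-cmp (toℕ j) (toℕ i)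
  ... | tri< l _ _ = l
  ... | tri≈ _ e _ = ⊥-elim (ne (Fin.toℕ-injective (sym e)))
  ... | tri> _ _ l = ⊥-elim (not-newer l p)

  data Parent (i : Fin N) : Fin (suc N) → Set where
    outermost : (∀ k → i ⊑ k → i ≡ k) → Parent i zero
    within    : ∀ j → i ⊑ j → i ≢ j → (∀ k → i ⊑ k → i ≢ k → j ⊑ k) → Parent i (suc j)

  -- All nodes containing `i` are comparable by inclusion, and among them a newer node is a smaller
  -- one; so the newest is the smallest.
  parent-of : ∀ i → Parent i (par i)
  parent-of i with parentAt-spec rs (Fin.toℕ<n i)
  ... | inj₁ (e , h) = subst (Parent i) (Fin.toℕ-injective (sym (trans (toℕ-par i) e))) (outermost out)
    where
    out : ∀ k → i ⊑ k → i ≡ k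
    out k p with i Fin.≟ k
    ... | yes q = q
    ... | no ne = ⊥-elim (case trans (sym (h (toℕ k) (older p ne))) (contains⁺ (proj₁ p) (proj₂ p)) of λ ())
  ... | inj₂ (u , e , u< , c , h) = subst (Parent i) (Fin.toℕ-injective (sym (trans (toℕ-par i) (trans e (cong suc (sym (Fin.toℕ-fromℕ< uN))))))) (within j p ne minimal)
    where
    uN = ℕ.<-trans u< (Fin.toℕ<n i)
    j : Fin N
    j = fromℕ< uN
    j≡ : toℕ j ≡ u
    j≡ = Fin.toℕ-fromℕ< uN
    p : i ⊑ j
    p = contains⁻ {lo j} {hi j} (subst (λ u → contains (lo i) (hi i) (nodeAt rs u) ≡ true) (sym j≡) c)
    ne : i ≢ j
    ne q = ℕ.<⇒≢ u< (trans (sym j≡) (cong toℕ (sym q)))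
    minimal : ∀ k → i ⊑ k → i ≢ k → j ⊑ k
    minimal k q ne′ with ℕ.<-cmp (toℕ k) (toℕ j)
    ... | tri< l _ _ = newer-inside (lo≤hi i) l q p
    ... | tri≈ _ r _ = subst (j ⊑_) (Fin.toℕ-injective (sym r)) ⊑-refl
    ... | tri> _ _ l = ⊥-elim (case trans (sym (h (toℕ k) (subst (_< toℕ k) j≡ l) (older q ne′))) (contains⁺ (proj₁ q) (proj₂ q)) of λ ())

  child-inside : ∀ {i j} → par i ≡ suc j → i ⊑ j × i ≢ j × (∀ k → i ⊑ k → i ≢ k → j ⊑ k)
  child-inside {i} e with par i | parent-of i
  child-inside refl | _ | within _ p ne h = p , ne , h

  outermost-inside : ∀ {i} → par i ≡ zero → ∀ k → i ⊑ k → i ≡ k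
  outermost-inside {i} e with par i | parent-of i
  outermost-inside refl | _ | outermost h = h

  -- Siblings do not overlap, being strong, and are not nested, since the outer one would separate
  -- the inner one from their common parent. They are disjoint, in the order of creation.
  siblings-ordered : ∀ {i j k} → par i ≡ suc k → par j ≡ suc k → i Fin.< j → hi i < lo j
  siblings-ordered {i} {j} {k} e f l = ℕ.≰⇒> λ q → case ℕ.<-cmp (lo i) (lo j) of λ
      { (tri< a _ _) → case hi j ℕ.≤? hi i of λ
          { (yes r) → nested f e (ℕ.<⇒≢ l ∘ cong toℕ ∘ sym) (ℕ.<⇒≤ a , r)
          ; (no r) → no-crossing i j (inj₁ (a , q , ℕ.≰⇒> r)) }
      ; (tri≈ _ a _) → case order l of λ
          { (inj₁ b) → ℕ.<⇒≢ b a
          ; (inj₂ (_ , b)) → nested f e (ℕ.<⇒≢ l ∘ cong toℕ ∘ sym) (ℕ.≤-reflexive a , ℕ.<⇒≤ b) }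
      ; (tri> _ _ a) → case order l of λ { (inj₁ b) → ℕ.<-asym a b ; (inj₂ (b , _)) → ℕ.<⇒≢ a (sym b) } }
    where
    nested : ∀ {i j} → par i ≡ suc k → par j ≡ suc k → i ≢ j → ¬ i ⊑ j
    nested {i} {j} e f ne p = let (q , ne′ , _) = child-inside f
                              in ne′ (⊑-antisym q (proj₂ (proj₂ (child-inside e)) j p ne))

  -- Found as the newest node around `[c , d]`; the interval of all positions is strong and
  -- guarantees that there is one.
  smallest : ∀ {c d} → c ≤ d → d < m → ∃[ i ] lo i ≤ c × d ≤ hi i × (∀ k → lo k ≤ c → d ≤ hi k → i ⊑ k)
  smallest {c} {d} cd d< with greatest-below (λ u → proj₁ (nodeAt rs u) ℕ.≤? c ×-dec d ℕ.≤? proj₂ (nodeAt rs u)) N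
  ... | inj₂ none = ⊥-elim (let (r , e , f) = root (ℕ.≤-<-trans z≤n d<)
                            in none (toℕ r) (Fin.toℕ<n r) (subst (_≤ c) (sym e) z≤n , ℕ.≤-pred (subst (d <_) (sym f) d<)))
  ... | inj₁ (u , u< , p , h) = i , proj₁ p′ , proj₂ p′ , minimal
    where
    i : Fin N
    i = fromℕ< u<
    i≡ : toℕ i ≡ u
    i≡ = Fin.toℕ-fromℕ< u<
    p′ : lo i ≤ c × d ≤ hi i
    p′ = subst (λ u → proj₁ (nodeAt rs u) ≤ c × d ≤ proj₂ (nodeAt rs u)) (sym i≡) p
    minimal : ∀ k → lo k ≤ c → d ≤ hi k → i ⊑ k
    minimal k a b with ℕ.<-cmp (toℕ k) (toℕ i)
    ... | tri< l _ _ = newer-inside cd l (a , b) p′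
    ... | tri≈ _ r _ = subst (i ⊑_) (Fin.toℕ-injective (sym r)) ⊑-refl
    ... | tri> _ _ l = ⊥-elim (h (toℕ k) (subst (_< toℕ k) i≡ l) (Fin.toℕ<n k) (a , b))

  module HierarchyTree {n : ℕ} (kind′ : Fin (suc N) → Kind n) where
    open RootedTree par par≤ kind′ public

    below⇒⊑ : ∀ {i j} → Below (suc i) (suc j) → j ⊑ i
    below⇒⊑ {i} b = go b refl
      where
      go : ∀ {v j} → Below (suc i) v → v ≡ suc j → j ⊑ i
      go self refl = ⊑-refl
      go (above {k} b) refl with par k | parent-of k
      ... | _ | outermost _ = ⊥-elim (case b of λ ())
      ... | _ | within l p _ _ = ⊑-trans p (go b refl)

    ⊑⇒below : ∀ {i j} → j ⊑ i → Below (suc i) (suc j)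
    ⊑⇒below {i} {j} = go (toℕ j) j ℕ.≤-refl
      where
      go : ∀ f j → toℕ j ≤ f → j ⊑ i → Below (suc i) (suc j)
      go f j le p with i Fin.≟ j
      ... | yes refl = self
      ... | no ne = above (climb-on f le (par j) (parent-of j) (par≤ j))
        where
        climb-on : ∀ f → toℕ j ≤ f → ∀ v → Parent j v → toℕ v ≤ toℕ j → Below (suc i) v
        climb-on f le _ (outermost h) _ = ⊥-elim (ne (sym (h i p)))
        climb-on zero le _ (within k _ _ _) l = ⊥-elim (ℕ.<⇒≱ (s≤s z≤n) (ℕ.≤-trans l le))
        climb-on (suc f) le _ (within k q _ h) l = go f k (ℕ.≤-pred (ℕ.≤-trans l le)) (h i p (ne ∘ sym))

    leaf-node : ∀ {j} → j < m → ∃[ k ] lo k ≡ j × hi k ≡ j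
    leaf-node {j} j< = node-of ℕ.≤-refl j< (singleton-strong j)

    child-around : ∀ {i j} → lo i < hi i → lo i ≤ j → j ≤ hi i → ∃[ c ] par c ≡ suc i × lo c ≤ j × j ≤ hi c
    child-around {i} {j} l a b =
      let (k , e , f) = leaf-node (ℕ.≤-<-trans b (hi< i))
          (c , q , r) = child-towards (⊑⇒below {i} {k} (subst (lo i ≤_) (sym e) a , subst (_≤ hi i) (sym f) b))
                          (λ q → let q′ = Fin.suc-injective q in ℕ.<⇒≢ l (trans (cong lo q′) (trans e (trans (sym f) (sym (cong hi q′))))))
          (s , t) = below⇒⊑ r
      in c , q , subst (lo c ≤_) e s , subst (_≤ hi c) f t

    -- A strong interval is a node. If it lies below `i` without being `i`, it is inside a child,
    -- which would then contain both `y` and `y′`.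
    strong-within : ∀ {i y y′} → (∀ e → par e ≡ suc i → lo e ≤ y → y′ ≤ hi e → ⊥) → y ≤ y′ →
                    ∀ {a b} → Strong′ a b → a ≤ y → y′ ≤ b → lo i ≤ a → b ≤ hi i → a ≡ lo i × b ≡ hi i
    strong-within {i} {y} {y′} split yy′ {a} {b} s ay yb ia bi =
      from-node (node-of (ℕ.≤-trans ay (ℕ.≤-trans yy′ yb)) (ℕ.≤-<-trans bi (hi< i)) s)
      where
      from-node : ∃[ k ] lo k ≡ a × hi k ≡ b → a ≡ lo i × b ≡ hi i
      from-node (k , refl , refl) with k Fin.≟ i
      ... | yes refl = refl , refl
      ... | no ne = let (e , pe , q) = child-towards (⊑⇒below (ia , bi)) (λ { refl → ne refl })
                        (s , t) = below⇒⊑ q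
                    in ⊥-elim (split e pe (ℕ.≤-trans s ay) (ℕ.≤-trans yb t))

    child-at : ∀ {i} (t : Fin (length (children (suc i)))) → ∃[ c ] lookup (children (suc i)) t ≡ suc c × par c ≡ suc i
    child-at {i} t = child⁻ (∈-lookup {xs = children (suc i)} t)

    index-of : ∀ {i c} → par c ≡ suc i → ∃[ t ] lookup (children (suc i)) t ≡ suc c
    index-of {i} {c} e = let h = child⁺ c e in Any.index h , sym (Any.lookup-index h)

    children-increasing : ∀ v → AllPairs Fin._<_ (children v)
    children-increasing v = AllPairs.map⁺ (AllPairs.filter⁺ (λ i → par i Fin.≟ v) (AllPairs.tabulate⁺-< λ l → s≤s l))

lonely : ∀ {A : Set} {xs : List A} → Unique xs → (∀ {x y} → x ∈ˡ xs → y ∈ˡ xs → x ≡ y) → length xs ≤ 1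
lonely {xs = []} _ _ = z≤n
lonely {xs = x ∷ []} _ _ = s≤s z≤n
lonely {xs = x ∷ y ∷ xs} ((ne ∷ _) ∷ _) h = ⊥-elim (ne (h (here refl) (there (here refl))))

least∈ : ∀ {k} {J : Subset k} → Nonempty J → ∃[ t ] t ∈ J × (∀ {s} → s ∈ J → t Fin.≤ s)
least∈ {J = true Vec.∷ J} _ = zero , Vec.here , λ _ → z≤n
least∈ {J = false Vec.∷ J} (suc x , Vec.there h) =
  let (t , i , l) = least∈ {J = J} (x , h) in suc t , Vec.there i , λ { (Vec.there j) → s≤s (l j) }

greatest∈ : ∀ {k} {J : Subset k} → Nonempty J → ∃[ t ] t ∈ J × (∀ {s} → s ∈ J → s Fin.≤ t)
greatest∈ {J = b Vec.∷ J} ne with nonempty? J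
... | yes h = let (t , i , l) = greatest∈ h in suc t , Vec.there i , λ { Vec.here → z≤n ; (Vec.there j) → s≤s (l j) }
greatest∈ {J = b Vec.∷ J} (zero , Vec.here) | no nh = zero , Vec.here , λ { Vec.here → z≤n ; (Vec.there j) → ⊥-elim (nh (_ , j)) }
greatest∈ {J = b Vec.∷ J} (suc x , Vec.there h) | no nh = ⊥-elim (nh (x , h))

1≤∣_∣ : ∀ {k} {J : Subset k} → Nonempty J → 1 ≤ ∣ J ∣
1≤∣_∣ {J = J} (x , h) = subst (_≤ ∣ J ∣) (∣⁅x⁆∣≡1 x) (p⊆q⇒∣p∣≤∣q∣ λ i → subst (_∈ J) (sym (x∈⁅y⁆⇒x≡y x i)) h)

nonempty : ∀ {k} {J : Subset k} → 1 ≤ ∣ J ∣ → Nonempty J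
nonempty {k} {J} l with nonempty? J
... | yes h = h
... | no nh = ⊥-elim (ℕ.<⇒≱ (subst (0 <_) (trans (cong ∣_∣ (Empty-unique nh)) (∣⊥∣≡0 k)) l) z≤n)

nonempty-∁ : ∀ {k} {J : Subset k} → ∣ J ∣ < k → Nonempty (∁ J)
nonempty-∁ {k} {J} l with nonempty? (∁ J)
... | yes h = h
... | no nh = ⊥-elim (ℕ.<⇒≱ l (subst (_≤ ∣ J ∣) (∣⊤∣≡n k) (p⊆q⇒∣p∣≤∣q∣ {p = Sub.⊤} {q = J} λ {x} _ → x∉∁p⇒x∈p λ i → nh (x , i))))

open Equivalence using (to; from)

⇔-trans : ∀ {A B C : Set} → A ⇔ B → B ⇔ C → A ⇔ C
⇔-trans f g = mk⇔ (λ a → to g (to f a)) (λ c → from f (from g c))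

⇔-sym : ∀ {A B : Set} → A ⇔ B → B ⇔ A
⇔-sym f = mk⇔ (from f) (to f)

⇔-¬ : ∀ {A B : Set} → A ⇔ B → (¬ A) ⇔ (¬ B)
⇔-¬ f = mk⇔ (λ na b → na (from f b)) (λ nb a → nb (to f a))

≐-∁ : ∀ {n} {A : Subset n} {P : Fin n → Set} → A ≐ P → ∁ A ≐ (λ x → ¬ P x)
≐-∁ h x = mk⇔ (λ i q → x∈∁p⇒x∉p i (from (h x) q)) (λ nq → x∉p⇒x∈∁p λ i → nq (to (h x) i))

≐-∁⁻ : ∀ {n} {A : Subset n} {P : Fin n → Set} → ∁ A ≐ P → A ≐ (λ x → ¬ P x)
≐-∁⁻ {A = A} {P} h = subst (_≐ (λ x → ¬ P x)) (∁∁ A) (≐-∁ h)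

¬¬-⇔ : ∀ {P : Set} → Dec P → (¬ ¬ P) ⇔ P
¬¬-⇔ (yes h) = mk⇔ (λ _ → h) (λ h nh → nh h)
¬¬-⇔ (no nh) = mk⇔ (λ nnh → ⊥-elim (nnh nh)) (λ h nh → nh h)

-- Verification of the decomposition tree

module Assembly {m : ℕ} (T′ : Tournament (suc m)) (p : ℕ → ℕ) (good : Order.Good (Switch.G-tournament T′) (seg suc 0 m) [] (seg p 0 m))
  (tour : ∀ {i j} → i < m → j < m → i ≢ j → Switch.G T′ (p j) (p i) ≡ not (Switch.G T′ (p i) (p j)))
  (path : ∀ {i} → suc i < m → Switch.G T′ (p (suc i)) (p i) ≡ false)
  (rs : List Interval²) (listed : Nodes.Listed m (Intervals.Strong′ m (λ i j → Switch.G T′ (p i) (p j)) tour path) m 0 rs)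
  (κ : Interval² → ℕ) (κ-leaf : ∀ {a} → a < m → κ (a , a) ≡ p a + 3)
  (κ-node : ∀ {a b} → a < b → b < m → Intervals.Strong′ m (λ i j → Switch.G T′ (p i) (p j)) tour path a b →
            (κ (a , b) ≡ 1 × Intervals.Linear m (λ i j → Switch.G T′ (p i) (p j)) tour path a b) ⊎
            (κ (a , b) ≡ 2 × ¬ Intervals.Linear m (λ i j → Switch.G T′ (p i) (p j)) tour path a b)) where
  open Switch T′ using (n; Vertex; G)
  open Arrangement T′ p
  open Bridge T′ p good tour path
  open Intervals m (λ i j → G (p i) (p j)) tour path
  open Hierarchy m (λ i j → G (p i) (p j)) tour path rs listed

  node-kind : ∀ i → Dec (lo i ≡ hi i) → Kind n
  node-kind i (yes _) = leaf (vertex (lo< i))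
  node-kind i (no _)  = internal (if κ (lo i , hi i) ≡ᵇ 1 then circular else prime)

  kinds : Fin (suc N) → Kind n
  kinds zero    = leaf zero
  kinds (suc i) = node-kind i (lo i ℕ.≟ hi i)

  open HierarchyTree kinds

  -- Couples each label with its justification, so that a case distinction on a node provides both.
  data Shape (i : Fin N) : Kind n → Set where
    single : lo i ≡ hi i → Shape i (leaf (vertex (lo< i)))
    linear : lo i < hi i → κ (lo i , hi i) ≡ 1 → Linear (lo i) (hi i) → Shape i (internal circular)
    other  : lo i < hi i → κ (lo i , hi i) ≡ 2 → ¬ Linear (lo i) (hi i) → Shape i (internal prime)

  shape : ∀ i → Shape i (kinds (suc i))
  shape i with lo i ℕ.≟ hi i
  ... | yes e = single e
  ... | no ne = by-code (κ-node l (hi< i) (strong i))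
    where
    l = ℕ.≤∧≢⇒< (lo≤hi i) ne
    by-code : (κ (lo i , hi i) ≡ 1 × Linear (lo i) (hi i)) ⊎ (κ (lo i , hi i) ≡ 2 × ¬ Linear (lo i) (hi i)) →
              Shape i (internal (if κ (lo i , hi i) ≡ᵇ 1 then circular else prime))
    by-code (inj₁ (e , ln)) = subst (λ v → Shape i (internal (if v ≡ᵇ 1 then circular else prime))) (sym e) (linear l e ln)
    by-code (inj₂ (e , nl)) = subst (λ v → Shape i (internal (if v ≡ᵇ 1 then circular else prime))) (sym e) (other l e nl)

  Labelled : Vertex → Node → Set
  Labelled x w = kinds w ≡ leaf x

  labelled-suc : ∀ {k x} → Labelled x (suc k) → lo k ≡ hi k × toℕ x ≡ p (lo k)
  labelled-suc {k} e with kinds (suc k) | shape k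
  labelled-suc {k} refl | _ | single q = q , toℕ-vertex (lo< k)

  labelled : ∀ {k x} → lo k ≡ hi k → toℕ x ≡ p (lo k) → Labelled x (suc k)
  labelled {k} q e with kinds (suc k) | shape k
  ... | _ | single _ = cong leaf (Fin.toℕ-injective (trans (toℕ-vertex (lo< k)) (sym e)))
  ... | _ | linear l _ _ = ⊥-elim (ℕ.<⇒≢ l q)
  ... | _ | other l _ _ = ⊥-elim (ℕ.<⇒≢ l q)

  leaf-of : ∀ x → ∃[ w ] Labelled x w
  leaf-of zero = zero , refl
  leaf-of x@(suc _) =
    let (j , j< , e) = position {x} (λ ())
        (k , e₁ , e₂) = leaf-node j<
    in suc k , labelled {k} (trans e₁ (sym e₂)) (trans e (cong p (sym e₁)))

  leaf-unique : ∀ {v w x} → Labelled x v → Labelled x w → v ≡ w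
  leaf-unique {zero} {zero} e f = refl
  leaf-unique {zero} {suc k} refl f = ⊥-elim (p≢0 (lo< k) (sym (proj₂ (labelled-suc {k} f))))
  leaf-unique {suc k} {zero} e refl = ⊥-elim (p≢0 (lo< k) (sym (proj₂ (labelled-suc {k} e))))
  leaf-unique {suc k} {suc l} e f =
    let (a , b) = labelled-suc {k} e
        (c , d) = labelled-suc {l} f
        q = p-injective good (lo< k) (lo< l) (trans (sym b) d)
    in cong suc (same-node q (trans (sym a) (trans q c)))

  Inside : Fin N → Vertex → Set
  Inside i = InInt (lo i) (hi i)

  below-inside : ∀ i x → (∃[ w ] Labelled x w × Below (suc i) w) ⇔ Inside i x
  below-inside i x = mk⇔ fwd bwd
    where
    fwd : (∃[ w ] Labelled x w × Below (suc i) w) → Inside i x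
    fwd (zero , _ , b) = ⊥-elim (case below-≤ b of λ ())
    fwd (suc k , e , b) = let (a , q) = labelled-suc {k} e
                              (s , t) = below⇒⊑ b
                          in lo k , s , ℕ.≤-trans (ℕ.≤-reflexive a) t , q
    bwd : Inside i x → ∃[ w ] Labelled x w × Below (suc i) w
    bwd (j , a , b , e) =
      let (k , e₁ , e₂) = leaf-node (ℕ.≤-<-trans b (hi< i))
      in suc k , labelled {k} (trans e₁ (sym e₂)) (trans e (cong p (sym e₁))) ,
         ⊑⇒below {i} {k} (subst (lo i ≤_) (sym e₁) a , subst (_≤ hi i) (sym e₂) b)

  not-below-outside : ∀ i x → (∃[ w ] Labelled x w × ¬ Below (suc i) w) ⇔ (¬ Inside i x)
  not-below-outside i x = mk⇔
    (λ (w , e , nb) h → let (w′ , e′ , b) = from (below-inside i x) h in nb (subst (Below (suc i)) (leaf-unique {w′} {w} e′ e) b))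
    (λ nh → let (w , e) = leaf-of x in w , e , λ b → nh (to (below-inside i x) (w , e , b)))

  side-inside : ∀ i x → Side (suc i) (par i) x ⇔ Inside i x
  side-inside i x = ⇔-trans (mk⇔ (λ (w , e , s) → w , e , side-child⁻ s) (λ (w , e , b) → w , e , side-child⁺ b)) (below-inside i x)

  side-outside : ∀ i x → Side (par i) (suc i) x ⇔ (¬ Inside i x)
  side-outside i x = ⇔-trans (mk⇔ (λ (w , e , s) → w , e , side-parent⁻ s) (λ (w , e , b) → w , e , side-parent⁺ b)) (not-below-outside i x)

  edge⇒rep : ∀ {i A} → EdgeBipartition graph (suc i) (par i) A → Rep A (lo i) (hi i)
  edge⇒rep {i} (inj₁ (h , _)) = inj₁ λ x → ⇔-trans (h x) (side-inside i x)
  edge⇒rep {i} (inj₂ (_ , h)) = inj₂ λ x → ⇔-trans (h x) (side-inside i x)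

  rep⇒edge : ∀ {i A} → Rep A (lo i) (hi i) → EdgeBipartition graph (suc i) (par i) A
  rep⇒edge {i} {A} (inj₁ h) = inj₁ ((λ x → ⇔-trans (h x) (⇔-sym (side-inside i x))) , λ x → ⇔-trans (≐-∁ h x) (⇔-sym (side-outside i x)))
  rep⇒edge {i} {A} (inj₂ h) = inj₂ ((λ x → ⇔-trans (≐-∁⁻ h x) (⇔-sym (side-outside i x))) , λ x → ⇔-trans (h x) (⇔-sym (side-inside i x)))

  rep-unique : ∀ {A a b c d} → a ≤ b → b < m → c ≤ d → d < m → Rep A a b → Rep A c d → a ≡ c × b ≡ d
  rep-unique ab b< cd d< (inj₁ h) (inj₁ k) = inInt-≡ ab b< cd d< λ x → ⇔-trans (⇔-sym (h x)) (k x)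
  rep-unique ab b< cd d< (inj₂ h) (inj₂ k) = inInt-≡ ab b< cd d< λ x → ⇔-trans (⇔-sym (h x)) (k x)
  rep-unique ab b< cd d< (inj₁ h) (inj₂ k) = ⊥-elim (inInt-zero d< (to (k zero) (x∉p⇒x∈∁p λ i → inInt-zero b< (to (h zero) i))))
  rep-unique ab b< cd d< (inj₂ h) (inj₁ k) = ⊥-elim (inInt-zero b< (to (h zero) (x∉p⇒x∈∁p λ i → inInt-zero d< (to (k zero) i))))

  swap-edge : ∀ {u v A} → EdgeBipartition graph u v A → EdgeBipartition graph v u A
  swap-edge (inj₁ h) = inj₂ h
  swap-edge (inj₂ h) = inj₁ h

  edge-strong : ∀ {u v} → Adj u v → ∃[ A ] Strong T′ A × EdgeBipartition graph u v A
  edge-strong {u} {v} h = by-link (link {u} {v} h)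
    where
    by-link : ∀ {u v} → Link u v → ∃[ A ] Strong T′ A × EdgeBipartition graph u v A
    by-link (up i) = IntSet (lo i) (hi i) , strong′⇒strong (lo≤hi i) (hi< i) (strong i) (inj₁ (IntSet-≐ _ _)) , rep⇒edge {i} (inj₁ (IntSet-≐ _ _))
    by-link (down i) = let (A , s , e) = by-link (up i) in A , s , swap-edge {suc i} {par i} e

  strong-edge : ∀ A → Strong T′ A → ∃[ u ] ∃[ v ] Adj u v × EdgeBipartition graph u v A
  strong-edge A s =
    let (a , b , ab , b< , _ , r) = inB⇒rep (proj₁ s)
        (i , e , f) = node-of ab b< (strong⇒strong ab b< s r)
    in suc i , par i , adj-parent i , rep⇒edge {i} (subst₂ (Rep A) (sym e) (sym f) r)

  lower-end : ∀ {u v} A → Adj u v → EdgeBipartition graph u v A → ∃[ i ] SameEdge u v (suc i) (par i) × Rep A (lo i) (hi i)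
  lower-end {u} {v} A h = by-link (link {u} {v} h)
    where
    by-link : ∀ {u v} → Link u v → EdgeBipartition graph u v A → ∃[ i ] SameEdge u v (suc i) (par i) × Rep A (lo i) (hi i)
    by-link (up i) e = i , inj₁ (refl , refl) , edge⇒rep {i} e
    by-link (down i) e = i , inj₂ (refl , refl) , edge⇒rep {i} (swap-edge {par i} {suc i} e)

  same-edge : ∀ {u v a b c d : Node} → SameEdge u v c d → SameEdge a b c d → SameEdge u v a b
  same-edge (inj₁ (refl , refl)) (inj₁ (refl , refl)) = inj₁ (refl , refl)
  same-edge (inj₁ (refl , refl)) (inj₂ (refl , refl)) = inj₂ (refl , refl)
  same-edge (inj₂ (refl , refl)) (inj₁ (refl , refl)) = inj₂ (refl , refl)
  same-edge (inj₂ (refl , refl)) (inj₂ (refl , refl)) = inj₁ (refl , refl)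

  edge-once : ∀ {u v a b} A → Adj u v → Adj a b → EdgeBipartition graph u v A → EdgeBipartition graph a b A → SameEdge u v a b
  edge-once {u} {v} {a} {b} A h k e f =
    let (i , s , r) = lower-end {u} {v} A h e
        (j , t , q) = lower-end {a} {b} A k f
        (e₁ , e₂) = rep-unique (lo≤hi i) (hi< i) (lo≤hi j) (hi< j) r q
    in same-edge s (subst (λ i → SameEdge a b (suc i) (par i)) (sym (same-node {i} {j} e₁ e₂)) t)

  0<m : Fin N → 0 < m
  0<m i = ℕ.≤-<-trans z≤n (lo< i)

  leaves-degree : ∀ v → IsLeaf v ⇔ degree v ≤ 1
  leaves-degree zero = mk⇔ (λ _ → lonely (children-unique zero) λ h k → same (child⁻ h) (child⁻ k)) (λ _ → zero , refl)
    where
    same : ∀ {x y} → ∃[ i ] x ≡ suc i × par i ≡ zero → ∃[ i ] y ≡ suc i × par i ≡ zero → x ≡ y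
    -- A child of node 0 is contained in no other node, so it is the interval of all positions;
    -- hence node 0 has at most one child and is a leaf.
    same (i , refl , e) (j , refl , f) = let (r , a , b) = root (0<m i) in
      cong suc (trans (outermost-inside e r (below-whole a b i)) (sym (outermost-inside f r (below-whole a b j))))
  leaves-degree (suc i) = mk⇔
    (λ (x , e) → s≤s (no-child (proj₁ (labelled-suc {i} e)) (children (suc i)) id))
    λ d → vertex (lo< i) , labelled {i} (lone (ℕ.≤-pred d)) (toℕ-vertex (lo< i))
    where
    no-child : lo i ≡ hi i → ∀ xs → (∀ {x} → x ∈ˡ xs → x ∈ˡ children (suc i)) → length xs ≤ 0
    no-child e [] h = z≤n
    no-child e (x ∷ xs) h with child⁻ (h (here refl))
    ... | c , refl , q = let ((a , b) , ne , _) = child-inside q in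
      ⊥-elim (ne (⊑-antisym (a , b) (ℕ.≤-trans (lo≤hi c) (ℕ.≤-trans b (ℕ.≤-reflexive (sym e))) , ℕ.≤-trans (ℕ.≤-reflexive (sym e)) (ℕ.≤-trans a (lo≤hi c)))))
    lone : length (children (suc i)) ≤ 0 → lo i ≡ hi i
    lone d with lo i ℕ.≟ hi i
    ... | yes e = e
    ... | no ne = let (c , e , _) = child-around {i} (ℕ.≤∧≢⇒< (lo≤hi i) ne) ℕ.≤-refl (lo≤hi i)
                  in ⊥-elim (empty d (child⁺ c e))
      where
      empty : ∀ {A : Set} {x : A} {xs} → length xs ≤ 0 → ¬ x ∈ˡ xs
      empty {xs = x ∷ xs} () (here _)
      empty {xs = x ∷ xs} () (there _)

  leaf-labels : LeavesLabelledBijectively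
  leaf-labels = record { leaves = leaves-degree ; injective = λ {v} {w} → leaf-unique {v} {w} ; surjective = leaf-of }

  internal-degree : ∀ {i} → lo i < hi i → 1 < degree (suc i)
  internal-degree {i} l = ℕ.≰⇒> λ d → let (x , e) = from (leaves-degree (suc i)) d in ℕ.<⇒≢ l (proj₁ (labelled-suc {i} e))

  -- Index 0 of the neighbours is the parent, whose part consists of everything outside of `i`;
  -- index `suc t` is the child `t`, counted from left to right. At a circular node the outer part
  -- closes the cycle of the children.
  module At (i : Fin N) (l : lo i < hi i) where

    r : ℕ
    r = length (children (suc i))

    kid : Fin r → Fin N
    kid t = proj₁ (child-at t)

    kid-lookup : ∀ t → lookup (children (suc i)) t ≡ suc (kid t)
    kid-lookup t = proj₁ (proj₂ (child-at t))

    kid-par : ∀ t → par (kid t) ≡ suc i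
    kid-par t = proj₂ (proj₂ (child-at t))

    kid-index : ∀ {c} → par c ≡ suc i → ∃[ t ] kid t ≡ c
    kid-index e = let (t , q) = index-of e in t , Fin.suc-injective (trans (sym (kid-lookup t)) q)

    kid-⊑ : ∀ t → kid t ⊑ i
    kid-⊑ t = proj₁ (child-inside (kid-par t))

    kid-mono : ∀ {t s} → t Fin.< s → kid t Fin.< kid s
    kid-mono {t} {s} q = ℕ.≤-pred (subst₂ Fin._<_ (kid-lookup t) (kid-lookup s) (lookup-pair (children-increasing (suc i)) q))

    kid-apart : ∀ {t s} → t Fin.< s → hi (kid t) < lo (kid s)
    kid-apart {t} {s} q = siblings-ordered (kid-par t) (kid-par s) (kid-mono q)

    kid-lo : ∀ {t s} → t Fin.≤ s → lo (kid t) ≤ lo (kid s)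
    kid-lo {t} {s} q = case ℕ.m≤n⇒m<n∨m≡n q of λ
      { (inj₁ q′) → ℕ.≤-trans (lo≤hi (kid t)) (ℕ.<⇒≤ (kid-apart {t} {s} q′))
      ; (inj₂ e)  → ℕ.≤-reflexive (cong (lo ∘ kid) (Fin.toℕ-injective e)) }

    kid-hi : ∀ {t s} → t Fin.≤ s → hi (kid t) ≤ hi (kid s)
    kid-hi {t} {s} q = case ℕ.m≤n⇒m<n∨m≡n q of λ
      { (inj₁ q′) → ℕ.≤-trans (ℕ.<⇒≤ (kid-apart {t} {s} q′)) (lo≤hi (kid s))
      ; (inj₂ e)  → ℕ.≤-reflexive (cong (hi ∘ kid) (Fin.toℕ-injective e)) }

    kid-around : ∀ {j} → lo i ≤ j → j ≤ hi i → ∃[ t ] lo (kid t) ≤ j × j ≤ hi (kid t)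
    kid-around {j} a b =
      let (c , e , q) = child-around {i} l a b
          (t , e′) = kid-index e
      in t , subst (λ c → lo c ≤ j × j ≤ hi c) (sym e′) q

    kid-≤ : ∀ {t s j k} → lo (kid t) ≤ j → k ≤ hi (kid s) → j ≤ k → t Fin.≤ s
    kid-≤ {t} {s} a b q = ℕ.≮⇒≥ λ q′ → ℕ.<⇒≱ (ℕ.<-≤-trans (kid-apart {s} {t} q′) a) (ℕ.≤-trans q b)

    part-kid : ∀ t x → Part (suc i) (suc t) x ⇔ Inside (kid t) x
    part-kid t x = ⇔-trans (mk⇔
      (λ (w , e , s) → w , e , part-child⁻ (subst₂ (λ M v → Star (AdjWithoutNode M) v w) (sym (kid-par t)) (kid-lookup t) s))
      (λ (w , e , b) → w , e , subst₂ (λ M v → Star (AdjWithoutNode M) v w) (kid-par t) (sym (kid-lookup t)) (part-child⁺ b)))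
      (below-inside (kid t) x)

    part-outside : ∀ x → Part (suc i) zero x ⇔ (¬ Inside i x)
    part-outside x = ⇔-trans (mk⇔ (λ (w , e , s) → w , e , part-parent⁻ s) (λ (w , e , b) → w , e , part-parent⁺ b)) (not-below-outside i x)

    inside-kid : ∀ {t x} → Inside (kid t) x → Inside i x
    inside-kid {t} (j , a , b , e) = let (c , d) = kid-⊑ t in j , ℕ.≤-trans c a , ℕ.≤-trans b d , e

    part-unique : ∀ {t s x} → Part (suc i) t x → Part (suc i) s x → t ≡ s
    part-unique {zero} {zero} _ _ = refl
    part-unique {zero} {suc s} {x} h k = ⊥-elim (to (part-outside x) h (inside-kid {s} (to (part-kid s x) k)))
    part-unique {suc t} {zero} {x} h k = ⊥-elim (to (part-outside x) k (inside-kid {t} (to (part-kid t x) h)))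
    part-unique {suc t} {suc s} {x} h k =
      let (j , a , b , e) = to (part-kid t x) h
          (j′ , c , d , e′) = to (part-kid s x) k
          q = p-injective good (ℕ.≤-<-trans b (hi< (kid t))) (ℕ.≤-<-trans d (hi< (kid s))) (trans (sym e) e′)
      in cong suc (Fin.≤-antisym (kid-≤ {t} {s} a d (ℕ.≤-reflexive q)) (kid-≤ {s} {t} c b (ℕ.≤-reflexive (sym q))))

    part-total : ∀ x → ∃[ t ] Part (suc i) t x
    part-total x with InInt? (lo i) (hi i) x
    ... | no nh = zero , from (part-outside x) nh
    ... | yes (j , a , b , e) = let (t , c , d) = kid-around a b in suc t , from (part-kid t x) (j , c , d , e)

    parts-∁ : ∀ (J : Subset (suc r)) x → Parts (suc i) (∁ J) x ⇔ (¬ Parts (suc i) J x)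
    parts-∁ J x = mk⇔
      (λ (t , h , q) (s , k , q′) → x∈∁p⇒x∉p h (subst (_∈ J) (part-unique {s} {t} {x} q′ q) k))
      (λ nh → let (t , q) = part-total x in t , x∉p⇒x∈∁p (λ h → nh (t , h , q)) , q)

    parts-⁅⁆ : ∀ (t : Fin (suc r)) x → Parts (suc i) ⁅ t ⁆ x ⇔ Part (suc i) t x
    parts-⁅⁆ t x = mk⇔ (λ (s , h , q) → subst (λ t → Part (suc i) t x) (x∈⁅y⁆⇒x≡y t h) q) (λ q → t , x∈⁅x⁆ t , q)

    allowed-⁅⁆ : ∀ {k} → Shape i (internal k) → ∀ (t : Fin (suc r)) → Allowed k ⁅ t ⁆
    allowed-⁅⁆ (linear _ _ _) t h k a b with x∈⁅y⁆⇒x≡y t h | x∈⁅y⁆⇒x≡y t k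
    ... | refl | refl = subst (_∈ ⁅ t ⁆) (Fin.≤-antisym a b) (x∈⁅x⁆ t)
    allowed-⁅⁆ (other _ _ _) t = t , refl

    labelled-node : ∃[ k ] kinds (suc i) ≡ internal k × Shape i (internal k)
    labelled-node with kinds (suc i) | shape i
    ... | _ | single e = ⊥-elim (ℕ.<⇒≢ l e)
    ... | _ | linear a b c = circular , refl , linear a b c
    ... | _ | other a b c = prime , refl , other a b c

    Rep-of : (Vertex → Set) → ℕ → ℕ → Set
    Rep-of S c d = (∀ x → S x ⇔ InInt c d x) ⊎ (∀ x → S x ⇔ (¬ InInt c d x))

    node⇒rep : ∀ {I A c d} → Rep-of (Parts (suc i) I) c d → NodeBipartition graph (suc i) I A → Rep A c d
    node⇒rep (inj₁ h) (inj₁ k) = inj₁ λ x → ⇔-trans (k x) (h x)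
    node⇒rep (inj₁ h) (inj₂ k) = inj₂ λ x → ⇔-trans (k x) (h x)
    node⇒rep {c = c} {d} (inj₂ h) (inj₁ k) = inj₂ λ x → ⇔-trans (≐-∁ k x) (⇔-trans (⇔-¬ (h x)) (¬¬-⇔ (InInt? c d x)))
    node⇒rep {c = c} {d} (inj₂ h) (inj₂ k) = inj₁ λ x → ⇔-trans (≐-∁⁻ k x) (⇔-trans (⇔-¬ (h x)) (¬¬-⇔ (InInt? c d x)))

    rep⇒node : ∀ {I A c d} → Rep-of (Parts (suc i) I) c d → Rep A c d → NodeBipartition graph (suc i) I A
    rep⇒node (inj₁ h) (inj₁ k) = inj₁ λ x → ⇔-trans (k x) (⇔-sym (h x))
    rep⇒node (inj₁ h) (inj₂ k) = inj₂ λ x → ⇔-trans (k x) (⇔-sym (h x))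
    rep⇒node (inj₂ h) (inj₁ k) = inj₂ λ x → ⇔-trans (≐-∁ k x) (⇔-sym (h x))
    rep⇒node (inj₂ h) (inj₂ k) = inj₁ λ x → ⇔-trans (≐-∁⁻ k x) (⇔-sym (h x))

    single-part : ∀ (t : Fin (suc r)) {c d} → Rep-of (Part (suc i) t) c d → Rep-of (Parts (suc i) ⁅ t ⁆) c d
    single-part t (inj₁ h) = inj₁ λ x → ⇔-trans (parts-⁅⁆ t x) (h x)
    single-part t (inj₂ h) = inj₂ λ x → ⇔-trans (parts-⁅⁆ t x) (h x)

    singleton-represented : ∀ (t : Fin (suc r)) {A c d} → Rep-of (Part (suc i) t) c d → Rep A c d → Represented graph A
    singleton-represented t {A} {c} {d} h k = let (lb , e , sh) = labelled-node in
      suc i , lb , e , ⁅ t ⁆ , ℕ.≤-reflexive (sym (∣⁅x⁆∣≡1 t)) , subst (_< degree (suc i)) (sym (∣⁅x⁆∣≡1 t)) (internal-degree l) ,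
      allowed-⁅⁆ sh t , rep⇒node {⁅ t ⁆} (single-part t h) k

    -- When no child contains both positions, no strong interval between them and `i` exists other
    -- than `i`, as `linear-order` demands.
    forward : Linear (lo i) (hi i) → ∀ {x y} → lo i ≤ x → x < y → y ≤ hi i →
              (∀ t → lo (kid t) ≤ x → y ≤ hi (kid t) → ⊥) → G (p x) (p y) ≡ true
    forward ln {x} {y} a q b split = linear-order (strong i) (hi< i) ln a q b λ {c} {d} s → λ ac cy yd db →
      strong-within split′ (ℕ.<⇒≤ q) s cy yd ac db
      where
      split′ : ∀ e → par e ≡ suc i → lo e ≤ x → y ≤ hi e → ⊥
      split′ e pe a′ b′ = let (t , q) = kid-index pe in
        split t (subst (λ e → lo e ≤ x) (sym q) a′) (subst (λ e → y ≤ hi e) (sym q) b′)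

    module Segment (ln : Linear (lo i) (hi i)) {t₁ t₂ : Fin r} (t₁≤t₂ : t₁ Fin.≤ t₂) where

      c d : ℕ
      c = lo (kid t₁)
      d = hi (kid t₂)

      c≤d : c ≤ d
      c≤d = ℕ.≤-trans (lo≤hi (kid t₁)) (kid-hi {t₁} {t₂} t₁≤t₂)

      before : ∀ {x y} → x < c → c ≤ y → ∀ t → lo (kid t) ≤ x → y ≤ hi (kid t) → ⊥
      before {x} {y} xc cy t a b = ℕ.<⇒≱ xc (ℕ.≤-trans (kid-lo {t₁} {t} (kid-≤ {t₁} {t} ℕ.≤-refl b cy)) a)

      after : ∀ {x y} → d < x → y ≤ d → ∀ t → lo (kid t) ≤ y → x ≤ hi (kid t) → ⊥
      after {x} {y} dx yd t a b = ℕ.<⇒≱ dx (ℕ.≤-trans b (kid-hi {t} {t₂} (kid-≤ {t} {t₂} a ℕ.≤-refl yd)))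

      low : ∀ {y} → c ≤ y → lo i ≤ y
      low = ℕ.≤-trans (proj₁ (kid-⊑ t₁))

      high : ∀ {y} → y ≤ d → y ≤ hi i
      high q = ℕ.≤-trans q (proj₂ (kid-⊑ t₂))

      -- By `forward`, all earlier positions of `i` beat the segment and all later ones lose to it;
      -- positions outside of `i` are homogeneous because `i` is a module.
      segment-mod : IsMod c d
      segment-mod = isMod hom
        where
        hom : ∀ {x y y′} → x < m → x < c ⊎ d < x → c ≤ y → y ≤ d → c ≤ y′ → y′ ≤ d → G (p x) (p y) ≡ G (p x) (p y′)
        hom {x} {y} {y′} x< o cy yd cy′ yd′ with lo i ℕ.≤? x | x ℕ.≤? hi i
        ... | no n | _ = homog (proj₁ (strong i)) x< (inj₁ (ℕ.≰⇒> n)) (low cy) (high yd) (low cy′) (high yd′)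
        ... | yes _ | no n = homog (proj₁ (strong i)) x< (inj₂ (ℕ.≰⇒> n)) (low cy) (high yd) (low cy′) (high yd′)
        ... | yes a | yes b = inside o
          where
          from-left : x < c → ∀ {y} → c ≤ y → y ≤ d → G (p x) (p y) ≡ true
          from-left xc cy yd = forward ln a (ℕ.<-≤-trans xc cy) (high yd) (before xc cy)
          from-right : d < x → ∀ {y} → c ≤ y → y ≤ d → G (p x) (p y) ≡ false
          from-right dx cy yd = let yx = ℕ.≤-<-trans yd dx in
            trans (tour (ℕ.<-trans yx x<) x< (ℕ.<⇒≢ yx)) (cong not (forward ln (low cy) yx b (after dx yd)))
          inside : x < c ⊎ d < x → G (p x) (p y) ≡ G (p x) (p y′)
          inside (inj₁ xc) = trans (from-left xc cy yd) (sym (from-left xc cy′ yd′))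
          inside (inj₂ dx) = trans (from-right dx cy yd) (sym (from-right dx cy′ yd′))

    module _ (ln : Linear (lo i) (hi i)) where

      segment : ∀ {J} → Nonempty J → Interval J → zero ∉ J → ∃[ c ] ∃[ d ] c ≤ d × d < m × IsMod c d × (∀ x → Parts (suc i) J x ⇔ InInt c d x)
      segment {J} ne iv 0∉ = between (least∈ ne) (greatest∈ ne)
        where
        Least Greatest : Set
        Least    = ∃[ t ] t ∈ J × (∀ {s} → s ∈ J → t Fin.≤ s)
        Greatest = ∃[ t ] t ∈ J × (∀ {s} → s ∈ J → s Fin.≤ t)
        between : Least → Greatest → ∃[ c ] ∃[ d ] c ≤ d × d < m × IsMod c d × (∀ x → Parts (suc i) J x ⇔ InInt c d x)
        between (zero , h , _) _ = ⊥-elim (0∉ h)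
        between (suc _ , _) (zero , h , _) = ⊥-elim (0∉ h)
        between (suc t₁ , h₁ , lower) (suc t₂ , h₂ , upper) = c , d , c≤d , hi< (kid t₂) , segment-mod , λ x → mk⇔ (fwd x) (bwd x)
          where
          open Segment ln {t₁} {t₂} (ℕ.≤-pred (lower h₂))
          fwd : ∀ x → Parts (suc i) J x → InInt c d x
          fwd x (zero , h , _) = ⊥-elim (0∉ h)
          fwd x (suc t , h , q) = let (j , a , b , e) = to (part-kid t x) q in
            j , ℕ.≤-trans (kid-lo {t₁} {t} (ℕ.≤-pred (lower h))) a , ℕ.≤-trans b (kid-hi {t} {t₂} (ℕ.≤-pred (upper h))) , e
          bwd : ∀ x → InInt c d x → Parts (suc i) J x
          bwd x (j , a , b , e) =
            let (t , u , v) = kid-around (ℕ.≤-trans (proj₁ (kid-⊑ t₁)) a) (ℕ.≤-trans b (proj₂ (kid-⊑ t₂)))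
            in suc t , iv h₁ h₂ (s≤s (kid-≤ {t₁} {t} ℕ.≤-refl v a)) (s≤s (kid-≤ {t} {t₂} u ℕ.≤-refl b)) , from (part-kid t x) (j , u , v , e)

      -- The parts of an interval that contains 0 are the complement of the parts of an interval that does not.
      circular-rep : ∀ {I} → Nonempty I → Nonempty (∁ I) → Interval I → ∃[ c ] ∃[ d ] c ≤ d × d < m × IsMod c d × Rep-of (Parts (suc i) I) c d
      circular-rep {I} ne ne′ iv = decide (zero ∈? I)
        where
        decide : Dec (zero ∈ I) → ∃[ c ] ∃[ d ] c ≤ d × d < m × IsMod c d × Rep-of (Parts (suc i) I) c d
        decide (no 0∉) = let (c , d , cd , d< , md , h) = segment ne iv 0∉ in c , d , cd , d< , md , inj₁ h
        decide (yes 0∈) =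
          let (c , d , cd , d< , md , h) = segment ne′ iv′ (λ h → x∈∁p⇒x∉p h 0∈)
          in c , d , cd , d< , md , inj₂ λ x → ⇔-trans (subst (λ J → Parts (suc i) I x ⇔ Parts (suc i) J x) (sym (∁∁ I)) (mk⇔ id id))
                                                         (⇔-trans (parts-∁ (∁ I) x) (⇔-¬ (h x)))
          where
          iv′ : Interval (∁ I)
          iv′ h k a b = x∉p⇒x∈∁p λ q → x∈∁p⇒x∉p h (iv 0∈ q z≤n a)

    part-rep : ∀ (t : Fin (suc r)) → ∃[ c ] ∃[ d ] c ≤ d × d < m × IsMod c d × Rep-of (Part (suc i) t) c d
    part-rep zero = lo i , hi i , lo≤hi i , hi< i , proj₁ (strong i) , inj₂ part-outside
    part-rep (suc t) = let k = kid t in lo k , hi k , lo≤hi k , hi< k , proj₁ (strong k) , inj₁ (part-kid t)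

    allowed-rep : ∀ {k I} → Shape i (internal k) → Allowed k I → Nonempty I → Nonempty (∁ I) →
                  ∃[ c ] ∃[ d ] c ≤ d × d < m × IsMod c d × Rep-of (Parts (suc i) I) c d
    allowed-rep (linear _ _ ln) iv ne ne′ = circular-rep ln ne ne′ iv
    allowed-rep (other _ _ _) (t , refl) _ _ = let (c , d , cd , d< , md , h) = part-rep t in c , d , cd , d< , md , single-part t h

    module Between {c d : ℕ} (c≤d : c ≤ d) (d< : d < m) (md : IsMod c d) (weak : ¬ Strong′ c d)
                   (ic : lo i ≤ c) (di : d ≤ hi i) (minimal : ∀ k → lo k ≤ c → d ≤ hi k → i ⊑ k) where

      proper : ¬ (c ≡ lo i × d ≡ hi i)
      proper (refl , refl) = weak (strong i)

      linear-here : Linear (lo i) (hi i)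
      linear-here = nonstrong⇒linear (strong i) (hi< i) (suc ((c ∸ lo i) + (hi i ∸ d))) (ℕ.n<1+n _) md c≤d ic di proper sandwiched
        where
        sandwiched : ∀ {a b} → Strong′ a b → lo i ≤ a → a ≤ c → d ≤ b → b ≤ hi i → a ≡ lo i × b ≡ hi i
        sandwiched s ia ac db bi with node-of (ℕ.≤-trans ac (ℕ.≤-trans c≤d db)) (ℕ.≤-<-trans bi (hi< i)) s
        ... | k , refl , refl = let (u , v) = minimal k ac db in ℕ.≤-antisym u ia , ℕ.≤-antisym bi v

      not-around : ∀ t → ¬ (lo (kid t) ≤ c × d ≤ hi (kid t))
      not-around t (a , b) = proj₁ (proj₂ (child-inside (kid-par t))) (⊑-antisym (kid-⊑ t) (minimal (kid t) a b))

      -- A child is strong, so it does not overlap `[c , d]`; it does not contain `[c , d]` either,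
      -- because `i` is the smallest node that does. Being met, it lies inside.
      meets-inside : ∀ {t j} → lo (kid t) ≤ j → j ≤ hi (kid t) → c ≤ j → j ≤ d → c ≤ lo (kid t) × hi (kid t) ≤ d
      meets-inside {t} {j} a b cj jd = decide (c ℕ.≤? lo (kid t)) (hi (kid t) ℕ.≤? d)
        where
        crossing-free : ¬ Overlaps (lo (kid t)) (hi (kid t)) c d
        crossing-free = proj₂ (strong (kid t)) c≤d d< md
        decide : Dec (c ≤ lo (kid t)) → Dec (hi (kid t) ≤ d) → c ≤ lo (kid t) × hi (kid t) ≤ d
        decide (yes q) (yes q′) = q , q′
        decide (no nq) (no nq′) = ⊥-elim (not-around t (ℕ.<⇒≤ (ℕ.≰⇒> nq) , ℕ.<⇒≤ (ℕ.≰⇒> nq′)))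
        decide (no nq) (yes q′) = ⊥-elim (case ℕ.m≤n⇒m<n∨m≡n q′ of λ
          { (inj₁ q″) → crossing-free (inj₁ (ℕ.≰⇒> nq , ℕ.≤-trans cj b , q″))
          ; (inj₂ e)  → not-around t (ℕ.<⇒≤ (ℕ.≰⇒> nq) , ℕ.≤-reflexive (sym e)) })
        decide (yes q) (no nq′) = ⊥-elim (case ℕ.m≤n⇒m<n∨m≡n q of λ
          { (inj₁ q″) → crossing-free (inj₂ (q″ , ℕ.≤-trans a jd , ℕ.≰⇒> nq′))
          ; (inj₂ e)  → not-around t (ℕ.≤-reflexive (sym e) , ℕ.<⇒≤ (ℕ.≰⇒> nq′)) })

      within? : ∀ t → Dec (c ≤ lo (kid t) × hi (kid t) ≤ d)
      within? t = c ℕ.≤? lo (kid t) ×-dec hi (kid t) ℕ.≤? d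

      I′ : Subset r
      I′ = Vec.tabulate (λ t → does (within? t))

      I : Subset (suc r)
      -- Index 0 is the part outside of `i`, hence disjoint from `[c , d]`.
      I = false Vec.∷ I′

      I′-∈ : ∀ t → t ∈ I′ ⇔ (c ≤ lo (kid t) × hi (kid t) ≤ d)
      I′-∈ t = mk⇔
        (λ h → from-does (within? t) (trans (sym (Vec.lookup∘tabulate (λ t → does (within? t)) t)) (Vec.[]=⇒lookup h)))
        (λ h → Vec.lookup⇒[]= t I′ (trans (Vec.lookup∘tabulate (λ t → does (within? t)) t) (dec-true (within? t) h)))

      I-interval : Interval I
      I-interval {l = suc u} (Vec.there h) (Vec.there k) a b = up-to h k a b
        where
        up-to : ∀ {s j} → s ∈ I′ → u ∈ I′ → suc s Fin.≤ j → j Fin.≤ suc u → j ∈ I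
        up-to {s} {suc j} h k (s≤s a) (s≤s b) = Vec.there (from (I′-∈ j)
          (ℕ.≤-trans (proj₁ (to (I′-∈ s) h)) (kid-lo {s} {j} a) , ℕ.≤-trans (kid-hi {j} {u} b) (proj₂ (to (I′-∈ u) k))))

      inside-parts : ∀ x → Parts (suc i) I x ⇔ InInt c d x
      inside-parts x = mk⇔ fwd bwd
        where
        fwd : Parts (suc i) I x → InInt c d x
        fwd (suc t , Vec.there h , q) = let (j , a , b , e) = to (part-kid t x) q
                                            (u , v) = to (I′-∈ t) h
                                        in j , ℕ.≤-trans u a , ℕ.≤-trans b v , e
        bwd : InInt c d x → Parts (suc i) I x
        bwd (j , a , b , e) = let (t , u , v) = kid-around (ℕ.≤-trans ic a) (ℕ.≤-trans b di)
                              in suc t , Vec.there (from (I′-∈ t) (meets-inside {t} u v a b)) , from (part-kid t x) (j , u , v , e)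

      I-nonempty : Nonempty I
      I-nonempty = let (t , u , v) = kid-around ic (ℕ.≤-trans c≤d di)
                   in suc t , Vec.there (from (I′-∈ t) (meets-inside {t} u v ℕ.≤-refl c≤d))

      represented : ∀ {A} → Rep A c d → Represented graph A
      represented {A} h = by-shape labelled-node
        where
        by-shape : ∃[ k ] kinds (suc i) ≡ internal k × Shape i (internal k) → Represented graph A
        by-shape (_ , e , linear _ _ _) = suc i , circular , e , I , 1≤∣_∣ I-nonempty , s≤s (∣p∣≤n I′) , I-interval , rep⇒node {I} (inj₁ inside-parts) h
        by-shape (_ , e , other _ _ nl) = ⊥-elim (nl linear-here)

  represented⇒inB : ∀ {A} → Represented graph A → InB T′ A
  represented⇒inB (zero , _ , () , _)
  represented⇒inB {A} (suc i , k , e , I , 1≤ , <k , al , nb) = by-shape (shape i)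
    where
    by-rep : (l : lo i < hi i) → ∃[ c ] ∃[ d ] c ≤ d × d < m × IsMod c d × At.Rep-of i l (Parts (suc i) I) c d → InB T′ A
    by-rep l (c , d , cd , d< , md , h) = isMod⇒inB cd d< md (At.node⇒rep i l {I} h nb)
    by-shape : Shape i (kinds (suc i)) → InB T′ A
    by-shape sh with subst (Shape i) e sh
    ... | q@(linear l _ _) = by-rep l (At.allowed-rep i l q al (nonempty 1≤) (nonempty-∁ <k))
    ... | q@(other l _ _) = by-rep l (At.allowed-rep i l q al (nonempty 1≤) (nonempty-∁ <k))

  inB⇒represented : 3 ≤ n → ∀ {A} → InB T′ A → Represented graph A
  inB⇒represented 3≤n {A} h = let (c , d , cd , d< , md , rp) = inB⇒rep h in by-strength cd d< md rp (strong-or-overlapped md)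
    where
    Overlapped : ℕ → ℕ → Set
    Overlapped c d = ∃[ a ] ∃[ b ] a ≤ b × b < m × IsMod a b × Overlaps c d a b

    weak-case : ∀ {c d} → c ≤ d → d < m → IsMod c d → Rep A c d → ¬ Strong′ c d →
                ∃[ i ] lo i ≤ c × d ≤ hi i × (∀ k → lo k ≤ c → d ≤ hi k → i ⊑ k) → Represented graph A
    weak-case {c} {d} cd d< md rp weak (i , ic , di , minimal) = At.Between.represented i l cd d< md weak ic di minimal rp
      where
      l : lo i < hi i
      l = ℕ.≤∧≢⇒< (lo≤hi i) λ e → weak (subst₂ Strong′
            (ℕ.≤-antisym ic (ℕ.≤-trans cd (ℕ.≤-trans di (ℕ.≤-reflexive (sym e)))))
            (ℕ.≤-antisym (ℕ.≤-trans (ℕ.≤-reflexive (sym e)) (ℕ.≤-trans ic cd)) di) (strong i))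

    -- A strong interval is a single part of its parent node. The interval of all positions hangs
    -- below the leaf 0, so it is represented at its own node, as the complement of the part of
    -- index 0; that node is internal because `3 ≤ n`.
    by-parent : ∀ k → Rep A (lo k) (hi k) → ∀ v → par k ≡ v → Parent k v → Represented graph A
    by-parent k rp (suc i) e (within _ q ne _) = let (t , e′) = At.kid-index i l e in
      At.singleton-represented i l (suc t) (inj₁ (At.part-kid i l t)) (subst (λ k → Rep A (lo k) (hi k)) (sym e′) rp)
      where
      l : lo i < hi i
      l = ℕ.≤∧≢⇒< (lo≤hi i) λ e′ → ne (⊑-antisym q (ℕ.≤-trans (lo≤hi k) (ℕ.≤-trans (proj₂ q) (ℕ.≤-reflexive (sym e′))) ,
                                                   ℕ.≤-trans (ℕ.≤-reflexive (sym e′)) (ℕ.≤-trans (proj₁ q) (lo≤hi k))))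
    by-parent k rp zero e (outermost out) = At.singleton-represented k l zero (inj₂ (At.part-outside k l)) rp
      where
      top = root (0<m k)
      k≡ : k ≡ proj₁ top
      k≡ = out (proj₁ top) (below-whole (proj₁ (proj₂ top)) (proj₂ (proj₂ top)) k)
      l : lo k < hi k
      l = subst (λ k → lo k < hi k) (sym k≡) (subst (_< hi (proj₁ top)) (sym (proj₁ (proj₂ top)))
            (ℕ.≤-pred (subst (2 ≤_) (sym (proj₂ (proj₂ top))) (ℕ.≤-pred 3≤n))))

    by-strength : ∀ {c d} → c ≤ d → d < m → IsMod c d → Rep A c d → Strong′ c d ⊎ Overlapped c d → Represented graph A
    by-strength cd d< md rp (inj₁ s) = let (k , e , f) = node-of cd d< s in
      by-parent k (subst₂ (Rep A) (sym e) (sym f) rp) (par k) refl (parent-of k)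
    by-strength cd d< md rp (inj₂ (a , b , ab , b< , md′ , o)) =
      weak-case cd d< md rp (λ s → proj₂ s ab b< md′ o) (smallest cd d<)

  is-decomposition-tree : IsDecompositionTree T′ graph
  is-decomposition-tree = record
    { isTree      = isTree′
    ; leafLabels  = leaf-labels
    ; edge⇒strong = λ {u} {v} → edge-strong {u} {v}
    ; strong⇒edge = strong-edge
    ; edge-unique = λ {u} {v} {a} {b} → edge-once {u} {v} {a} {b}
    ; represents  = λ 3≤n A → mk⇔ (inB⇒represented 3≤n) represented⇒inB }

  codes-root : ∀ xs → codes κ xs 0 ≡ 3
  codes-root [] = refl
  codes-root (x ∷ xs) = codes-root xs

  codes-node : ∀ xs {u} → u < length xs → codes κ xs (suc u) ≡ κ (nodeAt xs u)
  codes-node (x ∷ xs) {u} u< with u ℕ.≟ length xs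
  ... | yes refl rewrite ≡-true {length xs} refl = refl
  ... | no ne rewrite ≡ᵇ-false ne = codes-node xs (below-length {x} {xs} u< ne)

  kinds-code : ∀ v → encodeKind (kinds v) ≡ codes κ rs (toℕ v)
  kinds-code zero = sym (codes-root rs)
  kinds-code (suc i) = trans (by-shape (shape i)) (sym (codes-node rs (Fin.toℕ<n i)))
    where
    by-shape : ∀ {k} → Shape i k → encodeKind k ≡ κ (lo i , hi i)
    by-shape (single e) = trans (cong (3 +_) (toℕ-vertex (lo< i))) (trans (ℕ.+-comm 3 _) (trans (sym (κ-leaf (lo< i))) (cong (λ b → κ (lo i , b)) e)))
    by-shape (linear _ e _) = sym e
    by-shape (other _ e _) = sym e

  children-numbers : ∀ v → map toℕ (children v) ≡ childNumbers rs N (toℕ v)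
  children-numbers v = trans (map-∘-suc (filter (λ i → par i Fin.≟ v) (allFin N))) (cong (map suc) (trans
    (map-filter (λ i → par i Fin.≟ v) (λ u → parentAt rs u ℕ.≟ toℕ v)
      (λ i → (λ e → trans (sym (toℕ-par i)) (cong toℕ e)) , (λ e → Fin.toℕ-injective (trans (toℕ-par i) e))) (allFin N))
    (cong (filter (λ u → parentAt rs u ℕ.≟ toℕ v)) (map-toℕ-allFin N 0 id (λ _ → refl)))))
    where
    map-∘-suc : ∀ {k} (xs : List (Fin k)) → map toℕ (map suc xs) ≡ map suc (map toℕ xs)
    map-∘-suc [] = refl
    map-∘-suc (x ∷ xs) = cong (suc (toℕ x) ∷_) (map-∘-suc xs)

  numbers : ∀ v → map toℕ (neighbours v) ≡ neighbourNumbers rs (toℕ v)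
  numbers zero = trans (children-numbers zero) (sym (neighbourNumbers-root rs))
  numbers (suc i) = trans (cong₂ _∷_ (toℕ-par i) (children-numbers (suc i))) (sym (neighbourNumbers-node rs (Fin.toℕ<n i)))

-- The whole program, its running time and its word size

seg-lookup : ∀ {k} (h : ℕ → ℕ) o (xs : List (Fin k)) → seg h o (length xs) ≡ map toℕ xs → ∀ i → h (o + toℕ i) ≡ toℕ (lookup xs i)
seg-lookup h o (x ∷ xs) e zero = trans (cong h (ℕ.+-identityʳ o)) (proj₁ (∷-injective e))
seg-lookup h o (x ∷ xs) e (suc i) = trans (cong h (ℕ.+-suc o (toℕ i))) (seg-lookup h (suc o) xs (proj₂ (∷-injective e)) i)

input-arc : ∀ {n} (T : Tournament n) (i j : Fin n) → mem (input T) (n * toℕ i + toℕ j) ≡ bit (Tournament.arc T i j)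
input-arc {n} T i j = trans (cong (mem (input T)) (sym (Fin.toℕ-combine i j))) at-pair
  where
  bit-at : Fin n × Fin n → ℕ
  bit-at (i , j) = bit (Tournament.arc T i j)
  at-pair : mem (input T) (toℕ (Fin.combine i j)) ≡ bit (Tournament.arc T i j)
  at-pair with toℕ (Fin.combine i j) ℕ.<? n * n
  ... | no h = ⊥-elim (h (Fin.toℕ<n (Fin.combine i j)))
  ... | yes h = trans (cong (bit-at ∘ Fin.remQuot n) (Fin.fromℕ<-toℕ (Fin.combine i j) h)) (cong bit-at (Fin.remQuot-combine i j))

input-zero : ∀ {n} (T : Tournament n) {a} → n * n ≤ a → mem (input T) a ≡ 0
input-zero {n} T {a} le with a ℕ.<? n * n
... | yes h = ⊥-elim (ℕ.<⇒≱ h le)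
... | no _  = refl

input-≤1 : ∀ {n} (T : Tournament n) a → mem (input T) a ≤ 1
input-≤1 {n} T a with a ℕ.<? n * n
... | yes h = bit≤1 _
... | no _  = z≤n

switched-bits : ∀ a b c → bit (bit (bit a ≡ᵇ bit b) ≡ᵇ bit c) ≡ bit ((a xor b) xor c)
switched-bits = toWitness {a? = every λ a → every λ b → every λ c → bit (bit (bit a ≡ᵇ bit b) ≡ᵇ bit c) ℕ.≟ bit ((a xor b) xor c)} tt

layout : ℕ → Layout
layout m = record { n = n ; m = m ; s = s ; tb = n * n ; ab = n * n + s * s ; n²≤ab = ℕ.m≤m+n (n * n) (s * s) ; m<n = ℕ.n<1+n m }
  where
  n = suc m
  -- Row 0 needs a pointer for the leaf 0 and for at most one node per interval; a record needs two
  -- header cells and no more neighbours than there are nodes.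
  s = n * n + 4

-- The sizes are products, which `safe` forbids to store; this prefix is therefore run directly and
-- only the remainder is lifted.
setup : Cmd
setup = set rN (reg 0) ︔ set rM (reg rN ⊖ lit 1) ︔ set rS (bin mul (reg rN) (reg rN) ⊕ lit 4) ︔ set rTB (bin mul (reg rN) (reg rN)) ︔
        set rAB (reg rTB ⊕ bin mul (reg rS) (reg rS))

one-vertex : Tournament 1
one-vertex = record { arc = λ _ _ → false ; irrefl = λ _ → refl ; orient = λ { zero zero ne → ⊥-elim (ne refl) } }

-- The commands do not depend on the parameters of the modules that define them.
sortᶜ cuttersᶜ modsᶜ endsᶜ strongsᶜ outputᶜ decompose : Cmd
sortᶜ    = Sorting.sort (layout 0) (Switch.G one-vertex) (Switch.G-tournament one-vertex)
cuttersᶜ = Loops.Tables.cutters (layout 0) (Switch.G one-vertex) id (λ ()) (λ ()) (λ ())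
modsᶜ    = Loops.Tables.mods (layout 0) (Switch.G one-vertex) id (λ ()) (λ ()) (λ ())
endsᶜ    = Loops.Tables.ends (layout 0) (Switch.G one-vertex) id (λ ()) (λ ()) (λ ())
strongsᶜ = Loops.Tables.strongs (layout 0) (Switch.G one-vertex) id (λ ()) (λ ()) (λ ())
outputᶜ  = Output.output (layout 0) (Switch.G one-vertex) refl refl
decompose = sortᶜ ︔ cuttersᶜ ︔ modsᶜ ︔ endsᶜ ︔ strongsᶜ ︔ outputᶜ

module Decomposition {k : ℕ} (T′ : Tournament (suc k)) where
  open Switch T′ using (G; G-switch; G-tournament; switch)
  open Machine (layout k) G
  open Order G-tournament using (Good)
  open IsTournament G-tournament using (tour)
  open Loops (layout k) G
  open Sorting (layout k) G G-tournament using (K; K≤1320; sort-spec)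
  open Output (layout k) G refl refl

  σ₁ : State
  σ₁ = state (((((regs (input T′) [ rN ≔ n ]) [ rM ≔ m ]) [ rS ≔ s ]) [ rTB ≔ tb ]) [ rAB ≔ ab ]) (mem (input T′))

  env₁ : Env σ₁
  env₁ = record { N≡ = refl ; M≡ = refl ; S≡ = refl ; TB≡ = refl ; AB≡ = refl ; arcs = λ u< v< →
      subst₂ (λ u v → switched (mem (input T′)) n u v ≡ bit (G u v)) (Fin.toℕ-fromℕ< u<) (Fin.toℕ-fromℕ< v<) (at-vertices (fromℕ< u<) (fromℕ< v<)) }
    where
    at-vertices : ∀ (x y : Fin n) → switched (mem (input T′)) n (toℕ x) (toℕ y) ≡ bit (G (toℕ x) (toℕ y))
    at-vertices x y = trans (cong₂ (λ a b → bit (a ≡ᵇ b)) (cong₂ (λ a b → bit (a ≡ᵇ b)) (input-arc T′ x y) (input-arc T′ x zero)) (input-arc T′ y zero))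
      (trans (switched-bits (Tournament.arc T′ x y) (Tournament.arc T′ x zero) (Tournament.arc T′ y zero)) (cong bit (sym (G-switch x y))))

  Final : State → Set
  Final σ = Σ[ D ∈ LabelledGraph n ] Outputs σ D × IsDecompositionTree T′ D

  module Sorted {σ₂ : State} (env₂ : Env σ₂) (good : Good (seg suc 0 m) [] (seg (arr σ₂ 0) 0 m)) (zeros₂ : ∀ i → arr σ₂ 13 i ≡ 0) where

    p : ℕ → ℕ
    p = arr σ₂ 0

    open Arrangement T′ p using (p-range; p-injective; p-path)

    p< : ∀ {j} → j < m → p j < n
    p< j< = let (i , i< , e) = p-range good j< in subst (_< n) (sym e) (s≤s i<)

    tour′ : ∀ {i j} → i < m → j < m → i ≢ j → G (p j) (p i) ≡ not (G (p i) (p j))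
    tour′ i< j< ne = tour _ _ (ne ∘ p-injective good i< j<)

    path′ : ∀ {i} → suc i < m → G (p (suc i)) (p i) ≡ false
    path′ = p-path good

    open Tables p p< tour′ path′

    codeOf : (ℕ → ℕ) → Interval² → ℕ
    codeOf f (a , b) = if a ≡ᵇ b then cellAt f 0 a + 3 else cellAt f 12 (a * n + b)

    codeOf-leaf : ∀ f {a} → codeOf f (a , a) ≡ cellAt f 0 a + 3
    codeOf-leaf f {a} rewrite ≡-true {a} refl = refl

    codeOf-node : ∀ f {a b} → a < b → codeOf f (a , b) ≡ cellAt f 12 (a * n + b)
    codeOf-node f l rewrite ≡ᵇ-false (ℕ.<⇒≢ l) = refl

    strong-cell : ∀ {a b v} → StrongCell a b v → v ≢ 0 ⟷ Strong′ a b
    strong-cell (inj₁ (e , ns)) = (λ ne → ⊥-elim (ne e)) , λ st → ⊥-elim (ns st)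
    strong-cell (inj₂ (inj₁ (e , st , _))) = (λ _ → st) , λ _ e′ → case trans (sym e) e′ of λ ()
    strong-cell (inj₂ (inj₂ (e , st , _))) = (λ _ → st) , λ _ e′ → case trans (sym e) e′ of λ ()

    node-cell : ∀ {a b v} → a < b → Strong′ a b → StrongCell a b v → (v ≡ 1 × Linear a b) ⊎ (v ≡ 2 × ¬ Linear a b)
    node-cell l st (inj₁ (_ , ns)) = ⊥-elim (ns st)
    node-cell l st (inj₂ (inj₁ (e , _ , ln))) = inj₁ (e , ln l)
    node-cell l st (inj₂ (inj₂ (e , _ , nl))) = inj₂ (e , nl l)

    module Tabulated {σ : State} (env : Env σ) (p≡ : ∀ i → arr σ 0 i ≡ p i) (zeros : ∀ i → arr σ 13 i ≡ 0) (sg : Cells StrongCell m 0 (arr σ 12)) where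

      f₀ : ℕ → ℕ
      f₀ = mem σ

      cell-arr : ∀ j i → cellAt f₀ j i ≡ arr σ j i
      cell-arr j i = cong (λ A → f₀ (A + (i * 16 + j))) (sym (AB≡ env))

      cell₁₂ : ∀ {a b} → a ≤ b → b < m → StrongCell a b (cellAt f₀ 12 (a * n + b))
      cell₁₂ {a} {b} ab b< = subst (StrongCell a b) (sym (cell-arr 12 (a * n + b))) (sg a b (inj₁ (ℕ.≤-<-trans ab b<)) ab b<)

      open OutputSpec Strong′ f₀ (codeOf f₀) (λ {a} _ → codeOf-leaf f₀ {a}) (λ l _ → codeOf-node f₀ l) (λ ab b< → strong-cell (cell₁₂ ab b<))

      final : ∀ {σ′} → Result′ σ′ → Final σ′
      final {σ′} (rs , listed , written , size≡ , table) = graph , outputs , is-decomposition-tree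
        where
        open Assembly T′ p good tour′ path′ rs listed (codeOf f₀)
               (λ {a} a< → trans (codeOf-leaf f₀ {a}) (cong (_+ 3) (trans (cell-arr 0 a) (p≡ a))))
               (λ l b< st → subst (λ v → (v ≡ 1 × _) ⊎ (v ≡ 2 × _)) (sym (codeOf-node f₀ l)) (node-cell l st (cell₁₂ (ℕ.<⇒≤ l) b<)))
        open Hierarchy m g tour′ path′ rs listed using (N)
        graph : LabelledGraph n
        graph = Hierarchy.HierarchyTree.graph m g tour′ path′ rs listed kinds
        open LabelledGraph graph
        row : ∀ v → mem σ′ (regs σ′ 1 + toℕ v) ≡ slot (suc (toℕ v)) 0
        row v = trans (cong (mem σ′) (trans (cong (_+ toℕ v) table) (slot-0 (toℕ v)))) (proj₁ (written (toℕ v) (ℕ.≤-pred (Fin.toℕ<n v))))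
        rec : ∀ v → Record (mem σ′) (toℕ v) (codes (codeOf f₀) rs (toℕ v)) (neighbourNumbers rs (toℕ v))
        rec v = proj₂ (written (toℕ v) (ℕ.≤-pred (Fin.toℕ<n v)))
        count≡ : ∀ v → length (neighbourNumbers rs (toℕ v)) ≡ degree v
        count≡ v = trans (cong length (sym (numbers v))) (length-map toℕ (nbrs v))
        outputs : Outputs σ′ graph
        outputs = record
          { size-ok = size≡
          ; kind-ok = λ v → trans (cong (mem σ′) (row v)) (trans (code (rec v)) (sym (kinds-code v)))
          ; degree-ok = λ v → trans (cong (mem σ′) (trans (cong (_+ 1) (row v)) (slot-+ _ 1))) (trans (count (rec v)) (count≡ v))
          ; nbrs-ok = λ v i → trans (cong (mem σ′) (trans (cong (λ x → x + 2 + toℕ i) (row v))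
                        (trans (ℕ.+-assoc (slot (suc (toℕ v)) 0) 2 (toℕ i)) (slot-+ _ (2 + toℕ i)))))
                      (seg-lookup (λ j → mem σ′ (slot (suc (toℕ v)) (2 + j))) 0 (nbrs v)
                        (trans (cong (seg (λ j → mem σ′ (slot (suc (toℕ v)) (2 + j))) 0) (sym (count≡ v))) (trans (items (rec v)) (sym (numbers v)))) i) }

      finish-spec : Spec outputᶜ σ (λ t σ′ → Lin 100 400 (n * n) t × Final σ′)
      finish-spec = mapS (output-spec (N≡ env , M≡ env , S≡ env , TB≡ env , AB≡ env) refl (λ i → trans (cell-arr 13 i) (zeros i)))
                 λ t σ′ _ (l , r) → l , final r

    only : ℕ → ℕ → Bool
    only j i = not (i ≡ᵇ j)

    tables-spec : Spec (cuttersᶜ ︔ modsᶜ ︔ endsᶜ ︔ strongsᶜ ︔ outputᶜ) σ₂ (λ t σ → Lin 124 1600 (n * n) t × Final σ)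
    tables-spec =
      seqS (mapS (cutters-spec (env₂ , λ _ → refl)) λ t₃ σ₃ f₃ (l₃ , ct) →
      seqS (mapS (mods-spec (env-frame f₃ env₂) ct) λ t₄ σ₄ f₄ (l₄ , md) →
      seqS (mapS (ends-spec (env-frame f₄ (env-frame f₃ env₂)) md) λ t₅ σ₅ f₅ (l₅ , et) →
      seqS (mapS (strongs-spec (env-frame f₅ (env-frame f₄ (env-frame f₃ env₂))) (moved {IsModCell} (λ i → sym (arr-keep f₅ (only 9) 9 i)) md) et) λ t₆ σ₆ f₆ (l₆ , sg) →
      mapS (Tabulated.finish-spec (env-frame f₆ (env-frame f₅ (env-frame f₄ (env-frame f₃ env₂))))
              (λ i → trans (arr-keep f₆ (only 0) 0 i) (trans (arr-keep f₅ (only 0) 0 i) (trans (arr-keep f₄ (only 0) 0 i) (arr-keep f₃ (only 0) 0 i))))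
              (λ i → trans (arr-keep f₆ (only 13) 13 i) (trans (arr-keep f₅ (only 13) 13 i) (trans (arr-keep f₄ (only 13) 13 i) (trans (arr-keep f₃ (only 13) 13 i) (zeros₂ i)))))
              sg) λ t σ _ (l , r) → l₃ +ˡ l₄ +ˡ l₅ +ˡ l₆ +ˡ l , r))))
      where
      moved : ∀ {R : ℕ → ℕ → ℕ → Set} {f f′} → (∀ i → f i ≡ f′ i) → Cells R m 0 f → Cells R m 0 f′
      moved {R} e h a b q ab b< = subst (R a b) (e (a * n + b)) (h a b q ab b<)

  decompose-spec : Spec decompose σ₁ (λ t σ → Lin 224 2960 (n * n) t × Final σ)
  decompose-spec = seqS (mapS (sort-spec env₁) after-sort)
    where
    after-sort : ∀ t₂ σ₂ → Frame sortᶜ σ₁ σ₂ → Lin 100 (40 + K) (n * n) t₂ × Good (seg suc 0 m) [] (seg (arr σ₂ 0) 0 m) →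
                 Spec (cuttersᶜ ︔ modsᶜ ︔ endsᶜ ︔ strongsᶜ ︔ outputᶜ) σ₂ (λ t σ → Lin 224 2960 (n * n) (t₂ + t) × Final σ)
    after-sort t₂ σ₂ f₂ (l , good) = mapS (Sorted.tables-spec {σ₂} (env-frame f₂ env₁) good
        (λ i → trans (arr-keep f₂ (λ j → not (j ≡ᵇ 13)) 13 i) (input-zero T′ (ℕ.≤-trans (ℕ.m≤m+n (n * n) (s * s)) (ℕ.m≤m+n ab (i * 16 + 13))))))
      λ t σ _ (l′ , r) → sorted-in l +ˡ l′ , r
      where
      sorted-in : Lin 100 (40 + K) (n * n) t₂ → Lin 100 1360 (n * n) t₂
      sorted-in (lin h) = lin (ℕ.≤-trans h (ℕ.+-monoʳ-≤ 100 (ℕ.*-monoˡ-≤ (n * n) (ℕ.+-monoʳ-≤ 40 K≤1320))))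

linear-time : ∀ a b c d {N t} → Lin a b N t → 1 ≤ N → (c + a) + b ≤ d → c + t ≤ d * N
linear-time a b c d {N} {t} (lin h) 1≤N l = begin
  c + t                 ≤⟨ ℕ.+-monoʳ-≤ c h ⟩
  c + (a + b * N)       ≡⟨ ℕ.+-assoc c a (b * N) ⟨
  (c + a) + b * N       ≤⟨ ℕ.+-monoˡ-≤ (b * N) (ℕ.m≤m*n (c + a) N {{>-nonZero 1≤N}}) ⟩
  (c + a) * N + b * N   ≡⟨ ℕ.*-distribʳ-+ N (c + a) b ⟨
  ((c + a) + b) * N     ≤⟨ ℕ.*-monoˡ-≤ N l ⟩
  d * N                 ∎
  where open ℕ.≤-Reasoning

module Execution {k : ℕ} (T′ : Tournament (suc k)) where
  open Decomposition T′
  open Layout (layout k)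

  -- The base stays a variable: the powers of suc n would be unfolded.
  module Words (B : ℕ) (2≤B : 2 ≤ B) (n≤B : n ≤ B) (w : ℕ) (setup≤ : exponentᶜ 20 setup ≤ w) (decompose≤ : exponentᶜ 56 decompose ≤ w) where

    n≤^ : n ≤ B ^ 1
    n≤^ = ℕ.≤-trans n≤B (ℕ.≤-reflexive (sym (ℕ.*-identityʳ B)))

    n²≤^ : n * n ≤ B ^ 2
    n²≤^ = *≤^ 2≤B 1 1 n≤^ n≤^

    s≤^ : s ≤ B ^ 8
    s≤^ = suc*≤^ 2≤B {x = n * n} {y = 4} 2 4 (op≤ 2≤B add (n * n) 4) n²≤^ (lit≤^ 2≤B 4)

    -- The exponents 2 of `n * n` and 16 of `s * s` give 3 + 17 = 20, the common bound for all
    -- values at the end of `setup`.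
    ab≤^ : ab ≤ B ^ 20
    ab≤^ = suc*≤^ 2≤B {x = n * n} {y = s * s} 2 16 (op≤ 2≤B add (n * n) (s * s)) n²≤^ (*≤^ 2≤B 8 8 s≤^ s≤^)

    power : ∀ {x} a → x ≤ B ^ a → {_ : T (a <ᵇ 21)} → x ≤ B ^ 20
    power a h {l} = ℕ.≤-trans h (^-mono 2≤B {a} {20} (ℕ.≤-pred (ℕ.<ᵇ⇒< a 21 l)))

    16≤^ : 16 ≤ B ^ 20
    16≤^ = power 16 (lit≤^ 2≤B 16)

    AllBounded : State → Set
    AllBounded = Bounded (B ^ 20) (B ^ 20)

    bounded-set : ∀ {σ r v} → AllBounded σ → v ≤ B ^ 20 → AllBounded (state (regs σ [ r ≔ v ]) (mem σ))
    bounded-set {σ} {r} {v} b h = record { regs≤ = new ; mem≤ = mem≤ b ; const≤ = λ x _ → new x }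
      where
      new : ∀ x → (regs σ [ r ≔ v ]) x ≤ B ^ 20
      new x with r ℕ.≟ x
      ... | yes _ = h
      ... | no _  = regs≤ b x

    input-bounded : AllBounded (input T′)
    input-bounded = record { regs≤ = small ; mem≤ = λ a → ℕ.≤-trans (input-≤1 T′ a) (power 0 (1≤^ 2≤B 0)) ; const≤ = λ x _ → small x }
      where
      small : ∀ r → regs (input T′) r ≤ B ^ 20
      small zero = power 1 n≤^
      small (suc r) = z≤n

    bounded₁ = bounded-set {r = rN} input-bounded (power 1 n≤^)
    bounded₂ = bounded-set {r = rM} bounded₁ (power 1 (ℕ.≤-trans (ℕ.n≤1+n m) n≤^))
    bounded₃ = bounded-set {r = rS} bounded₂ (power 8 s≤^)
    bounded₄ = bounded-set {r = rTB} bounded₃ (power 2 n²≤^)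
    bounded₅ = bounded-set {r = rAB} bounded₄ ab≤^

    -- The 22 units are 2 + 4 + 6 + 4 + 6 for the five assignments.
    run-setup : Run (B ^ w) setup (input T′) 22 σ₁
    run-setup =
      run-seq (run-set (fits 2≤B 20 w (reg 0) input-bounded (ℕ.≤-trans (ℕ.≤ᵇ⇒≤ (exponent 20 (reg 0)) (exponentᶜ 20 setup) tt) setup≤)))
      (run-seq (run-set (fits 2≤B 20 w (reg rN ⊖ lit 1) bounded₁ (ℕ.≤-trans (ℕ.≤ᵇ⇒≤ (exponent 20 (reg rN ⊖ lit 1)) (exponentᶜ 20 setup) tt) setup≤)))
      (run-seq (run-set (fits 2≤B 20 w (bin mul (reg rN) (reg rN) ⊕ lit 4) bounded₂ (ℕ.≤-trans (ℕ.≤ᵇ⇒≤ (exponent 20 (bin mul (reg rN) (reg rN) ⊕ lit 4)) (exponentᶜ 20 setup) tt) setup≤)))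
      (run-seq (run-set (fits 2≤B 20 w (bin mul (reg rN) (reg rN)) bounded₃ (ℕ.≤-trans (ℕ.≤ᵇ⇒≤ (exponent 20 (bin mul (reg rN) (reg rN))) (exponentᶜ 20 setup) tt) setup≤)))
      (run-set (fits 2≤B 20 w (reg rTB ⊕ bin mul (reg rS) (reg rS)) bounded₄ (ℕ.≤-trans (ℕ.≤ᵇ⇒≤ (exponent 20 (reg rTB ⊕ bin mul (reg rS) (reg rS))) (exponentᶜ 20 setup) tt) setup≤))))))

    Result : Set
    Result = ∃[ t ] Σ[ σ ∈ State ] Σ[ D ∈ LabelledGraph n ]
      Run (B ^ w) (setup ︔ decompose) (input T′) t σ × t ≤ 4096 * (n * n) × Outputs σ D × IsDecompositionTree T′ D

    4096≤^ : 4096 ≤ B ^ 12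
    4096≤^ = ℕ.^-monoˡ-≤ 12 2≤B

    -- 4096 is a power of 2 and thus at most `B ^ 12`, so the time is at most `B ^ 14`. A growth of
    -- `B ^ 20` per unit gives the exponent 34, and the sum with the initial `B ^ 20` gives 21 + 35
    -- = 56.
    all-values : ∀ {t} → 22 + t ≤ 4096 * (n * n) → B ^ 20 + B ^ 20 * t ≤ B ^ 56
    all-values {t} h = suc*≤^ 2≤B {x = B ^ 20} {y = B ^ 20 * t} 20 34 (op≤ 2≤B add (B ^ 20) (B ^ 20 * t)) ℕ.≤-refl (*≤^ 2≤B 20 14 ℕ.≤-refl
      (ℕ.≤-trans (ℕ.m≤n+m t 22) (ℕ.≤-trans h (*≤^ 2≤B 12 2 4096≤^ n²≤^))))

    run-decompose : ∀ {t σ} → Exec decompose σ₁ t σ → 22 + t ≤ 4096 * (n * n) → Run (B ^ w) decompose σ₁ t σ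
    run-decompose x h = lift 2≤B 56 w 16≤^ x refl bounded₅ (all-values h) decompose≤

    run-all : Result
    run-all = from-spec (Spec.runs decompose-spec)
      where
      from-spec : ∃[ t ] ∃[ σ ] Exec decompose σ₁ t σ × Lin 224 2960 (n * n) t × Final σ → Result
      from-spec (t , σ , x , l , D , out , tree) =
        -- 3206 = 22 + 224 + 2960 is rounded up to the power of 2 that `all-values` relies on.
        let total = linear-time 224 2960 22 4096 l (s≤s z≤n) (ℕ.≤ᵇ⇒≤ 3206 4096 tt)
        in 22 + t , σ , D , run-seq run-setup (run-decompose x total) , total , out , tree

abstract
  -- A sum, so that it is at least each of the two exponents; abstract, so that the large numeral is
  -- never computed.
  word : ℕ
  word = exponentᶜ 20 setup + exponentᶜ 56 decompose

  setup≤word : exponentᶜ 20 setup ≤ word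
  setup≤word = ℕ.m≤m+n (exponentᶜ 20 setup) (exponentᶜ 56 decompose)

  decompose≤word : exponentᶜ 56 decompose ≤ word
  decompose≤word = ℕ.m≤n+m (exponentᶜ 56 decompose) (exponentᶜ 20 setup)

proposition10 :
    Σ[ P ∈ Cmd ] Σ[ w ∈ ℕ ] Σ[ c ∈ ℕ ]
      (∀ (n : ℕ) → .{{NonZero n}} → (T : Tournament n) →
        Σ[ t ∈ ℕ ] Σ[ σ ∈ State ] Σ[ D ∈ LabelledGraph n ]
          (Run (suc n ^ w) P (input T) t σ ×
           t ≤ c * (n * n) ×
           Outputs σ D ×
           IsDecompositionTree T D))
proposition10 = (setup ︔ decompose) , word , 4096 , λ where
  zero {{nz}} T → ⊥-elim (≢-nonZero⁻¹ 0 {{nz}} refl)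
  -- The base exceeds the number of vertices by one and so is at least 2 even for a single vertex,
  -- as all power estimates require.
  (suc m) T     → Execution.Words.run-all T (suc (suc m)) (s≤s (s≤s z≤n)) (ℕ.n≤1+n (suc m)) word setup≤word decompose≤word
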